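{- The set $\mathbf{GLP}^\omega_0$ of all $\mathbf{GLP}$-provable variable-free polymodal formulas is $\textsc{PSPACE}$-complete.
   Context: Polymodal formulas are built from propositional variables $x_0,x_1,\ldots$, the constants $\top,\bot$, the connectives $\land,\lor,\lnot,\to$ and unary modalities $\langle n\rangle$ for every natural number $n$ ($[n]\varphi$ abbreviates $\lnot\langle n\rangle\lnot\varphi$). The logic $\mathbf{GLP}$ is axiomatized by: all axioms of classical propositional calculus; $\langle n\rangle(A\lor B)\to(\langle n\rangle A\lor\langle n\rangle B)$; $\lnot\langle n\rangle\lnot\top$; $\langle n\rangle A\to\langle n\rangle(A\land\lnot\langle n\rangle A)$; $\langle n\rangle A\to\langle k\rangle A$ for $k\le n$; $\langle k\rangle A\to\lnot\langle n\rangle\lnot\langle k\rangle A$ for $k<n$; with rules modus ponens and: from $A\to B$ infer $\langle n\rangle A\to\langle n\rangle B$. $L^\omega_0$ is the set of formulas built from $\top,\bot,\land,\lor,\to,\lnot$ and the modalities $\langle n\rangle$, $n\in\omega$ (no variables), and $\mathbf{GLP}^\omega_0$ is the set of $\mathbf{GLP}$-provable formulas in $L^\omega_0$ (viewed as a language of strings; hardness is with respect to polynomial-time many-one reductions). -}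

module Defs where

open import Data.Nat using (ℕ; zero; suc; _+_; _*_; _^_; _≤_)
open import Data.Nat.Binary.Base using (ℕᵇ; 2[1+_]; 1+[2_]) renaming (zero to zeroᵇ; fromℕ to toBin)
open import Data.Fin using (Fin) renaming (zero to fz; suc to fs)
open import Data.Bool using (Bool; true; false; _∧_; _∨_; not)
open import Data.List using (List; []; _∷_; _++_; map; mapMaybe; reverse; length)
open import Data.Maybe using (Maybe; just; nothing)
open import Data.Product using (Σ; ∃; _×_; _,_)
open import Function.Bundles using (_⇔_)
open import Relation.Binary.PropositionalEquality using (_≡_)

data Fm : Set where
  var  : ℕ → Fm
  ⊤ ⊥  : Fm
  _∧'_ _∨'_ _⇒_ : Fm → Fm → Fm
  ¬'_  : Fm → Fm
  ⟨_⟩_ : ℕ → Fm → Fm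

infixr 6 _∧'_
infixr 5 _∨'_
infixr 4 _⇒_
infixr 8 ¬'_
infixr 8 ⟨_⟩_

[_]_ : ℕ → Fm → Fm
[ n ] φ = ¬' ⟨ n ⟩ ¬' φ

evalP : (Fm → Bool) → Fm → Bool
evalP v (var i)   = v (var i)
evalP v ⊤         = true
evalP v ⊥         = false
evalP v (A ∧' B)  = evalP v A ∧ evalP v B
evalP v (A ∨' B)  = evalP v A ∨ evalP v B
evalP v (A ⇒ B)   = not (evalP v A) ∨ evalP v B
evalP v (¬' A)    = not (evalP v A)
evalP v (⟨ n ⟩ A) = v (⟨ n ⟩ A)

Tautology : Fm → Set
Tautology A = (v : Fm → Bool) → evalP v A ≡ true

data GLP⊢_ : Fm → Set where
  taut  : ∀ {A} → Tautology A → GLP⊢ A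
  ax-∨  : ∀ n A B → GLP⊢ (⟨ n ⟩ (A ∨' B) ⇒ (⟨ n ⟩ A ∨' ⟨ n ⟩ B))
  ax-⊤  : ∀ n → GLP⊢ (¬' ⟨ n ⟩ ¬' ⊤)
  ax-L  : ∀ n A → GLP⊢ (⟨ n ⟩ A ⇒ ⟨ n ⟩ (A ∧' ¬' ⟨ n ⟩ A))
  ax-mono : ∀ k n A → k ≤ n → GLP⊢ (⟨ n ⟩ A ⇒ ⟨ k ⟩ A)
  ax-neg  : ∀ k n A → suc k ≤ n → GLP⊢ (⟨ k ⟩ A ⇒ ¬' ⟨ n ⟩ ¬' ⟨ k ⟩ A)
  mp    : ∀ {A B} → GLP⊢ A → GLP⊢ (A ⇒ B) → GLP⊢ B
  nec   : ∀ n {A B} → GLP⊢ (A ⇒ B) → GLP⊢ (⟨ n ⟩ A ⇒ ⟨ n ⟩ B)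

data CFm : Set where
  ⊤ ⊥  : CFm
  _∧'_ _∨'_ _⇒_ : CFm → CFm → CFm
  ¬'_  : CFm → CFm
  ⟨_⟩_ : ℕ → CFm → CFm

ι : CFm → Fm
ι ⊤ = ⊤
ι ⊥ = ⊥
ι (A ∧' B) = ι A ∧' ι B
ι (A ∨' B) = ι A ∨' ι B
ι (A ⇒ B) = ι A ⇒ ι B
ι (¬' A) = ¬' ι A
ι (⟨ n ⟩ A) = ⟨ n ⟩ ι A

Sym : Set
Sym = Fin 10

pattern c⊤ = fz
pattern c⊥ = fs fz
pattern c∧ = fs (fs fz)
pattern c∨ = fs (fs (fs fz))
pattern c⇒ = fs (fs (fs (fs fz)))
pattern c¬ = fs (fs (fs (fs (fs fz))))
pattern c⟨ = fs (fs (fs (fs (fs (fs fz)))))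
pattern c⟩ = fs (fs (fs (fs (fs (fs (fs fz))))))
pattern c1 = fs (fs (fs (fs (fs (fs (fs (fs fz)))))))
pattern c2 = fs (fs (fs (fs (fs (fs (fs (fs (fs fz))))))))

-- bijective base-2 digits (least significant first) of a binary natural
digits : ℕᵇ → List Sym
digits zeroᵇ      = []
digits 2[1+ x ]   = c2 ∷ digits x
digits 1+[2 x ]   = c1 ∷ digits x

enc : CFm → List Sym
enc ⊤ = c⊤ ∷ []
enc ⊥ = c⊥ ∷ []
enc (A ∧' B) = c∧ ∷ enc A ++ enc B
enc (A ∨' B) = c∨ ∷ enc A ++ enc B
enc (A ⇒ B) = c⇒ ∷ enc A ++ enc B
enc (¬' A) = c¬ ∷ enc A
enc (⟨ n ⟩ A) = c⟨ ∷ digits (toBin n) ++ c⟩ ∷ enc A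

GLPω₀ : List Sym → Set
GLPω₀ w = Σ CFm λ A → enc A ≡ w × GLP⊢ ι A

-- Deterministic single-tape Turing machines (bi-infinite tape)

data Move : Set where
  left right stay : Move

record TM (Σ' : ℕ) : Set where
  field
    Q     : ℕ
    Γ     : ℕ
    blank : Fin Γ
    inp   : Fin Σ' → Fin Γ
    start : Fin Q
    halt  : Fin Q → Maybe Bool     -- just b: halting state with answer b
    δ     : Fin Q → Fin Γ → Fin Q × Fin Γ × Move

record Config {Σ' : ℕ} (M : TM Σ') : Set where
  constructor conf
  field
    state : Fin (TM.Q M)
    lft   : List (Fin (TM.Γ M))    -- cells left of the head, nearest first
    cur   : Fin (TM.Γ M)
    rgt   : List (Fin (TM.Γ M))    -- cells right of the head, nearest first

module _ {Σ' : ℕ} (M : TM Σ') where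
  open TM M

  init : List (Fin Σ') → Config M
  init []       = conf start [] blank []
  init (a ∷ as) = conf start [] (inp a) (map inp as)

  move : Fin Q → List (Fin Γ) → Fin Γ → List (Fin Γ) → Move → Config M
  move q []       a rs left  = conf q [] blank (a ∷ rs)
  move q (x ∷ ls) a rs left  = conf q ls x (a ∷ rs)
  move q ls a []       right = conf q (a ∷ ls) blank []
  move q ls a (x ∷ rs) right = conf q (a ∷ ls) x rs
  move q ls a rs       stay  = conf q ls a rs

  stepWith : Maybe Bool → Config M → Config M
  stepWith (just _) c = c
  stepWith nothing (conf q ls a rs) with δ q a
  ... | q' , a' , m = move q' ls a' rs m

  step : Config M → Config M
  step c = stepWith (halt (Config.state c)) c

  run : ℕ → Config M → Config M
  run zero    c = c
  run (suc t) c = run t (step c)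

  outcome : Config M → Maybe Bool
  outcome c = halt (Config.state c)

  -- number of tape cells visited so far
  space : Config M → ℕ
  space (conf _ ls _ rs) = length ls + suc (length rs)

  output : {Σ₂ : ℕ} → (Fin Γ → Maybe (Fin Σ₂)) → Config M → List (Fin Σ₂)
  output dec (conf _ ls a rs) = mapMaybe dec (reverse ls ++ a ∷ rs)

Language : ℕ → Set₁
Language Σ' = List (Fin Σ') → Set

poly : ℕ → ℕ → ℕ → ℕ
poly c k n = c * (suc n) ^ k + c

InPSPACE : {Σ' : ℕ} → Language Σ' → Set
InPSPACE {Σ'} L =
  Σ (TM Σ') λ M → Σ ℕ λ c → Σ ℕ λ k →
    ((w : List (Fin Σ')) → Σ ℕ λ t → Σ Bool λ b →
        outcome M (run M t (init M w)) ≡ just b × ((b ≡ true) ⇔ L w))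
    × ((w : List (Fin Σ')) (t : ℕ) → space M (run M t (init M w)) ≤ poly c k (length w))

PolyTimeComputable : {Σ₁ Σ₂ : ℕ} → (List (Fin Σ₁) → List (Fin Σ₂)) → Set
PolyTimeComputable {Σ₁} {Σ₂} f =
  Σ (TM Σ₁) λ M → Σ (Fin (TM.Γ M) → Maybe (Fin Σ₂)) λ dec → Σ ℕ λ c → Σ ℕ λ k →
    (w : List (Fin Σ₁)) → Σ ℕ λ t → t ≤ poly c k (length w) ×
      Σ Bool λ b → outcome M (run M t (init M w)) ≡ just b
        × output M dec (run M t (init M w)) ≡ f w

_≤ₚ_ : {Σ₁ Σ₂ : ℕ} → Language Σ₁ → Language Σ₂ → Set
_≤ₚ_ {Σ₁} {Σ₂} L₁ L₂ = Σ (List (Fin Σ₁) → List (Fin Σ₂)) λ f →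
  PolyTimeComputable f × ((w : List (Fin Σ₁)) → L₁ w ⇔ L₂ (f w))

PSPACE-hard : {Σ' : ℕ} → Language Σ' → Set₁
PSPACE-hard L = {Σ₁ : ℕ} (L₁ : Language Σ₁) → InPSPACE L₁ → L₁ ≤ₚ L

PSPACE-complete : {Σ' : ℕ} → Language Σ' → Set₁
PSPACE-complete L = InPSPACE L × PSPACE-hard L

{-# OPTIONS --safe #-}

-- Membership.  Give every diamond ⟨n⟩A of a closed formula a truth value, starting with all false, and
-- let an odometer run: take the least k for which some A with ⟨k⟩A false is true, make all such ⟨k⟩A
-- true, keep the levels below k and reset those above.  The run stops, and a formula is provable iff
-- it is true at all visited valuations.  Soundness: every theorem is true along a run that also
-- watches the diamonds of the monotonicity axioms in its derivation, and watching more diamonds does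
-- not change the values of the others.  Completeness: provably, every world agrees with a visited
-- valuation or lies lexicographically above the current one, by Löb's axiom and the persistence of
-- the lower levels.  A valuation is one mark per diamond of the formula, so the odometer runs in
-- place on the input tape, comparing modalities digit by digit.
--
-- Hardness.  Quantified Boolean formulas are translated by means of the worms F v = ⟨2v⟩⟨2v+1⟩F (v+1):
-- the variable v becomes ⟨2v⟩F (v+1), and quantifiers become the modality ⟨2v⟩ relativized to
-- F (v+1), because F v implies ⟨2v⟩(F (v+1) ∧ ± variable v) for both signs, while the earlier
-- variables persist.  Savitch's formula for a given machine is then written by a loop program, which
-- compiles to a polynomial-time machine sweeping its tape.  The i-th modality used is the
-- number 2^i − 1, whose bijective binary notation is a string of i ones.

module Submission where

open import Defs
open import Data.Bool using (Bool; true; false; _∧_; _∨_; not; if_then_else_; T)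
open import Data.Bool.Properties using (∨-assoc; ∨-identityʳ)
open import Data.Empty renaming (⊥ to Empty) using (⊥-elim)
open import Data.Fin using (Fin; toℕ; fromℕ<; combine; remQuot; splitAt; join) renaming (zero to fz; suc to fs)
open import Data.Fin.Properties using (remQuot-combine; splitAt-join; toℕ-injective; toℕ-fromℕ<; toℕ<n; pigeonhole) renaming (_≟_ to _≟ᶠ_)
open import Data.List using (List; []; _∷_; _++_; _∷ʳ_; _ʳ++_; length; map; concatMap; mapMaybe; replicate; allFin)
open import Data.List.Membership.Propositional using (_∈_)
open import Data.List.Membership.Propositional.Properties using (∈-++⁺ˡ; ∈-++⁺ʳ; ∈-++⁻; ∈-allFin; ∈-map⁻; ∈-map⁺)
open import Data.List.Properties using (map-++; ++-assoc; ++-identityʳ; length-map; length-++; map-∘; concatMap-++; concatMap-map; concatMap-cong; ∷-injective; ∷-injectiveˡ; ∷-injectiveʳ)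
open import Data.List.Relation.Unary.All using (All; []; _∷_)
open import Data.List.Relation.Unary.All.Properties using (++⁺)
open import Data.List.Relation.Unary.Any using (here; there)
open import Data.Maybe using (Maybe; just; nothing; maybe′; _>>=_)
open import Data.Maybe.Properties using (just-injective)
open import Data.Nat
open import Data.Nat.Binary.Base using (ℕᵇ; 2[1+_]; 1+[2_]) renaming (zero to zeroᵇ; fromℕ to toBin; toℕ to fromBin)
open import Data.Nat.Binary.Properties using () renaming (toℕ-fromℕ to fromBin-toBin; fromℕ-toℕ to toBin-fromBin)
open import Data.Nat.DivMod using (_mod_; m*n/n≡m; [m+kn]%n≡m%n; +-distrib-/-∣ˡ; m<n⇒m/n≡0; m<n⇒m%n≡m)
open import Data.Nat.Divisibility using (n∣m*n)
open import Data.Nat.Properties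
open import Data.Nat.Tactic.RingSolver using (solve-∀)
open import Data.Product using (Σ; ∃; _×_; _,_; proj₁; proj₂)
open import Data.Sum using (_⊎_; inj₁; inj₂)
open import Data.Unit using (tt) renaming (⊤ to Unit)
open import Data.Vec using (Vec; []; _∷_; lookup; _[_]≔_)
open import Data.Vec.Properties using (lookup∘update; lookup∘update′; tabulate-cong; tabulate∘lookup; lookup∘tabulate)
import Data.List as List
import Data.Vec as Vec
open import Function using (_∘_; case_of_)
open import Function.Bundles using (_⇔_; mk⇔; Equivalence)
open import Relation.Binary.Definitions using (tri<; tri≈; tri>)
open import Relation.Binary.PropositionalEquality hiding ([_])
open import Relation.Nullary using (¬_; yes; no)
open import Relation.Nullary.Decidable using (⌊_⌋)

-- A derivation may pass through arbitrary formulas, even with variables, so soundness cannot be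
-- confined to the diamonds of the formula at hand. Hence a valuation gives a value to every
-- diamond, and the list of items decides only which diamonds can trigger a step. Monotonicity is
-- the one axiom that depends on this list: unless `⟨ k ⟩ A` can trigger, a step at level `n` may
-- set `⟨ n ⟩ A` while `⟨ k ⟩ A` stays false. Soundness therefore works with a longer list than
-- completeness, and `Independence`, which carries visited valuations over to a longer list, joins
-- the two.
--
-- For hardness only the order of the levels matters. The indices `2^i - 1` are chosen because a
-- loop can print a string of ones without arithmetic, and a string of length `i` is short enough.
-- Savitch's two recursive calls are folded into one by quantifying over a pair of blocks required
-- to be one of the two halves, which keeps the formula polynomial. Loops can only range over cells
-- of the tape, so one number `T` serves both as the number of cells of a configuration and as the
-- number of levels of the recursion; it is taken large enough for both.

Val : Set
Val = Fm → Bool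

infix 4 _⊨_
_⊨_ : Val → Fm → Set
u ⊨ A = evalP u A ≡ true

-- Boolean reasoning, and propositional and modal reasoning inside `GLP`

true≢false : ∀ {b : Bool} → b ≡ true → b ≡ false → Empty
true≢false refl ()

¬true→false : ∀ {b} → ¬ b ≡ true → b ≡ false
¬true→false {true}  h = ⊥-elim (h refl)
¬true→false {false} h = refl

bool? : ∀ b → b ≡ true ⊎ b ≡ false
bool? true  = inj₁ refl
bool? false = inj₂ refl

∧-intro : ∀ {a b} → a ≡ true → b ≡ true → a ∧ b ≡ true
∧-intro refl refl = refl

∧-elim : ∀ {a b} → a ∧ b ≡ true → a ≡ true × b ≡ true
∧-elim {true} {true} refl = refl , refl

∨-introˡ : ∀ {a b} → a ≡ true → a ∨ b ≡ true
∨-introˡ refl = refl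

∨-introʳ : ∀ {a b} → b ≡ true → a ∨ b ≡ true
∨-introʳ {true}  refl = refl
∨-introʳ {false} refl = refl

∨-elim : ∀ {a b} → a ∨ b ≡ true → a ≡ true ⊎ b ≡ true
∨-elim {true}  _ = inj₁ refl
∨-elim {false} h = inj₂ h

∨-false : ∀ {a b} → a ∨ b ≡ false → a ≡ false × b ≡ false
∨-false {false} {false} refl = refl , refl

⇒-intro : ∀ {a b} → (a ≡ true → b ≡ true) → not a ∨ b ≡ true
⇒-intro {true}  h = h refl
⇒-intro {false} h = refl

⇒-elim : ∀ {a b} → not a ∨ b ≡ true → a ≡ true → b ≡ true
⇒-elim {true} h refl = h

not-intro : ∀ {a} → ¬ a ≡ true → not a ≡ true
not-intro {true}  h = ⊥-elim (h refl)
not-intro {false} h = refl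

not-elim : ∀ {a} → not a ≡ true → a ≡ false
not-elim {false} _ = refl

not-elim′ : ∀ {a} → not a ≡ true → ¬ a ≡ true
not-elim′ {true} ()
not-elim′ {false} _ ()

-- "X holds at every world whose assignment is consistent with some theorem": this lets
-- propositional reasoning inside GLP be carried out as meta-level reasoning about u.
⊩ : (Val → Set) → Set
⊩ X = Σ Fm λ A → (GLP⊢ A) × (∀ u → u ⊨ A → X u)

⊩-pure : ∀ {X} → (∀ u → X u) → ⊩ X
⊩-pure h = ⊤ , taut (λ _ → refl) , λ u _ → h u

⊩-map : ∀ {X Y : Val → Set} → (∀ u → X u → Y u) → ⊩ X → ⊩ Y
⊩-map f (A , d , h) = A , d , λ u a → f u (h u a)

⊩-both : ∀ {X Y : Val → Set} → ⊩ X → ⊩ Y → ⊩ (λ u → X u × Y u)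
⊩-both (A , d , h) (B , e , k) =
  (A ∧' B) ,
  mp e (mp d (taut {A ⇒ (B ⇒ (A ∧' B))} (λ v → ⇒-intro {evalP v A} (λ a → ⇒-intro {evalP v B} (λ b → ∧-intro a b))))) ,
  λ u ab → h u (proj₁ (∧-elim ab)) , k u (proj₂ (∧-elim ab))

⊩-map₂ : ∀ {X Y Z : Val → Set} → (∀ u → X u → Y u → Z u) → ⊩ X → ⊩ Y → ⊩ Z
⊩-map₂ f x y = ⊩-map (λ u (a , b) → f u a b) (⊩-both x y)

⊩-map₃ : ∀ {X Y Z W : Val → Set} → (∀ u → X u → Y u → Z u → W u) → ⊩ X → ⊩ Y → ⊩ Z → ⊩ W
⊩-map₃ f x y z = ⊩-map (λ u (a , b , c) → f u a b c) (⊩-both x (⊩-both y z))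

⊩-thm : ∀ {A} → GLP⊢ A → ⊩ (_⊨ A)
⊩-thm {A} d = A , d , λ u a → a

⊩-out : ∀ {A} → ⊩ (_⊨ A) → GLP⊢ A
⊩-out {A} (B , d , h) = mp d (taut {B ⇒ A} (λ v → ⇒-intro (h v)))

⊩-all : ∀ {I : Set} {X : I → Val → Set} (is : List I) →
        (∀ i → i ∈ is → ⊩ (X i)) → ⊩ (λ u → ∀ i → i ∈ is → X i u)
⊩-all [] h = ⊩-pure λ u i ()
⊩-all (j ∷ is) h =
  ⊩-map₂ (λ { u x xs .j (here refl) → x ; u x xs i (there m) → xs i m })
         (h j (here refl)) (⊩-all is (λ i m → h i (there m)))

⊩-nec : ∀ n {A B} → ⊩ (λ u → u ⊨ A → u ⊨ B) → ⊩ (λ u → u ⊨ ⟨ n ⟩ A → u ⊨ ⟨ n ⟩ B)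
⊩-nec n {A} {B} h =
  ⊩-map (λ u → ⇒-elim) (⊩-thm (nec n {A} {B} (⊩-out (⊩-map (λ u → ⇒-intro) h))))

⊩-mono : ∀ {k n} A → k ≤ n → ⊩ (λ u → u ⊨ ⟨ n ⟩ A → u ⊨ ⟨ k ⟩ A)
⊩-mono A k≤n = ⊩-map (λ u → ⇒-elim) (⊩-thm (ax-mono _ _ A k≤n))

⊩-or : ∀ n A B → ⊩ (λ u → u ⊨ ⟨ n ⟩ (A ∨' B) → u ⊨ ⟨ n ⟩ A ⊎ u ⊨ ⟨ n ⟩ B)
⊩-or n A B = ⊩-map (λ u h x → ∨-elim (⇒-elim h x)) (⊩-thm (ax-∨ n A B))

⊩-löb : ∀ n A → ⊩ (λ u → u ⊨ ⟨ n ⟩ A → u ⊨ ⟨ n ⟩ (A ∧' ¬' ⟨ n ⟩ A))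
⊩-löb n A = ⊩-map (λ u → ⇒-elim) (⊩-thm (ax-L n A))

⊩-⊥ : ∀ n → ⊩ (λ u → ¬ u ⊨ ⟨ n ⟩ ⊥)
⊩-⊥ n = ⊩-map₂ (λ u f g x → not-elim′ g (f x))
  (⊩-nec n {⊥} {¬' ⊤} (⊩-pure λ u ())) (⊩-thm (ax-⊤ n))

-- Löb's axiom is applied to `B = A ∨ ⟨n⟩A`. A world with `B` but without `⟨n⟩B` cannot satisfy
-- `⟨n⟩A`, since that would give `⟨n⟩B`; so it satisfies `A`.
⊩-trans : ∀ n A → ⊩ (λ u → u ⊨ ⟨ n ⟩ ⟨ n ⟩ A → u ⊨ ⟨ n ⟩ A)
⊩-trans n A = ⊩-map₃ (λ u f g h x → h (g (f x)))
  (⊩-nec n {⟨ n ⟩ A} {B} (⊩-pure λ u → ∨-introʳ {evalP u A}))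
  (⊩-löb n B)
  (⊩-nec n {B ∧' ¬' ⟨ n ⟩ B} {A} (⊩-map keep (⊩-nec n {A} {B} (⊩-pure λ u → ∨-introˡ))))
  where
    B = A ∨' ⟨ n ⟩ A
    keep : ∀ u → (u ⊨ ⟨ n ⟩ A → u ⊨ ⟨ n ⟩ B) → u ⊨ B ∧' ¬' ⟨ n ⟩ B → u ⊨ A
    keep u f x with ∧-elim {evalP u B} x
    ... | b , nb with ∨-elim {evalP u A} b
    ... | inj₁ a  = a
    ... | inj₂ na = ⊥-elim (not-elim′ nb (f na))

-- This is `P → [n]P` with the box unfolded into diamonds.
Persistent : ℕ → Fm → Set
Persistent n P = ⊩ (λ u → u ⊨ P → ¬ u ⊨ ⟨ n ⟩ ¬' P)

persistent-◇ : ∀ {k n} A → k < n → Persistent n (⟨ k ⟩ A)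
persistent-◇ A k<n = ⊩-map (λ u h x → not-elim′ (⇒-elim h x)) (⊩-thm (ax-neg _ _ A k<n))

-- If `⟨k⟩A` held at an `n`-accessible world, then `⟨n⟩⟨k⟩A` would give `⟨k⟩⟨k⟩A` by monotonicity
-- and `⟨k⟩A` by transitivity.
persistent-¬◇ : ∀ {k n} A → k < n → Persistent n (¬' ⟨ k ⟩ A)
persistent-¬◇ {k} {n} A k<n = ⊩-map₃
  (λ u f g h x y → not-elim′ x (h (g (f y))))
  (⊩-nec n {¬' ¬' ⟨ k ⟩ A} {⟨ k ⟩ A} (⊩-pure λ u x → double x))
  (⊩-mono (⟨ k ⟩ A) (<⇒≤ k<n)) (⊩-trans k A)
  where
    double : ∀ {b} → not (not b) ≡ true → b ≡ true
    double {true} _ = refl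

persistent-⊤ : ∀ n → Persistent n ⊤
persistent-⊤ n = ⊩-map (λ u h _ → not-elim′ h) (⊩-thm (ax-⊤ n))

persistent-∧ : ∀ {n P Q} → Persistent n P → Persistent n Q → Persistent n (P ∧' Q)
persistent-∧ {n} {P} {Q} p q = ⊩-map₂
  (λ u (p , q) (f , g) x y → case g (f y) of λ
     { (inj₁ a) → p (proj₁ (∧-elim x)) a ; (inj₂ b) → q (proj₂ (∧-elim {evalP u P} x)) b })
  (⊩-both p q)
  (⊩-both (⊩-nec n {¬' (P ∧' Q)} {¬' P ∨' ¬' Q} (⊩-pure λ u → de-morgan (evalP u P)))
          (⊩-or n (¬' P) (¬' Q)))
  where
    de-morgan : ∀ a {b} → not (a ∧ b) ≡ true → not a ∨ not b ≡ true
    de-morgan true  h = h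
    de-morgan false h = refl

-- Split `A` into `(P ∧ A) ∨ ¬P` under the diamond; persistence excludes the second disjunct.
persistent-into : ∀ {n P} A → Persistent n P → ⊩ (λ u → u ⊨ P → u ⊨ ⟨ n ⟩ A → u ⊨ ⟨ n ⟩ (P ∧' A))
persistent-into {n} {P} A p = ⊩-map₃
  (λ u f g h x y → case g (f y) of λ { (inj₁ a) → a ; (inj₂ b) → ⊥-elim (h x b) })
  (⊩-nec n {A} {(P ∧' A) ∨' ¬' P} (⊩-pure λ u → split (evalP u P)))
  (⊩-or n (P ∧' A) (¬' P)) p
  where
    split : ∀ p {a} → a ≡ true → (p ∧ a) ∨ not p ≡ true
    split true  refl = refl
    split false _    = refl

◇-local : ∀ {n P A E} → Persistent n P → ⊩ (λ u → u ⊨ P → u ⊨ A → u ⊨ E) →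
          ⊩ (λ u → u ⊨ P → u ⊨ ⟨ n ⟩ A → u ⊨ ⟨ n ⟩ E)
◇-local {n} {P} {A} {E} p h = ⊩-map₂ (λ u f g x y → g (f x y))
  (persistent-into A p)
  (⊩-nec n {P ∧' A} {E} (⊩-map (λ u k x → k (proj₁ (∧-elim x)) (proj₂ (∧-elim {evalP u P} x))) h))

-- Löb's axiom supplies an accessible world of `D` from which no further `D` is accessible, and
-- persistence carries `P` into it. This is the form in which the completeness proof uses Löb's
-- axiom.
löb-local : ∀ {n P D E} → Persistent n P →
            ⊩ (λ u → u ⊨ P → u ⊨ D → ¬ u ⊨ ⟨ n ⟩ D → u ⊨ E) →
            ⊩ (λ u → u ⊨ P → u ⊨ ⟨ n ⟩ D → u ⊨ ⟨ n ⟩ E)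
löb-local {n} {P} {D} {E} p h = ⊩-map₂ (λ u f g x y → g x (f y))
  (⊩-löb n D)
  (◇-local {n} {P} {D ∧' ¬' ⟨ n ⟩ D} {E} p
    (⊩-map (λ u k x y → k x (proj₁ (∧-elim y)) (not-elim′ (proj₂ (∧-elim {evalP u D} y)))) h))

-- Items, the odometer step and its runs

Item : Set
Item = ℕ × Fm

new : Val → Item → Bool
new v (n , A) = not (v (⟨ n ⟩ A)) ∧ evalP v A

upd : (k n : ℕ) → Bool → Bool → Bool
upd k n o e with <-cmp n k
... | tri< _ _ _ = o
... | tri≈ _ _ _ = o ∨ e
... | tri> _ _ _ = false

upd< : ∀ {k n} o e → n < k → upd k n o e ≡ o
upd< {k} {n} o e n<k with <-cmp n k
... | tri< _ _ _ = refl
... | tri≈ ¬l _ _ = ⊥-elim (¬l n<k)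
... | tri> ¬l _ _ = ⊥-elim (¬l n<k)

upd≈ : ∀ k o e → upd k k o e ≡ o ∨ e
upd≈ k o e with <-cmp k k
... | tri< _ ¬e _ = ⊥-elim (¬e refl)
... | tri≈ _ _ _ = refl
... | tri> _ ¬e _ = ⊥-elim (¬e refl)

upd> : ∀ {k n} o e → k < n → upd k n o e ≡ false
upd> {k} {n} o e k<n with <-cmp n k
... | tri< _ _ ¬g = ⊥-elim (¬g k<n)
... | tri≈ _ _ ¬g = ⊥-elim (¬g k<n)
... | tri> _ _ _ = refl

-- The step acts on every diamond of the language at once, item or not; the items enter only through
-- `Trigger`.
next : ℕ → Val → Val
next k v (⟨ n ⟩ A) = upd k n (v (⟨ n ⟩ A)) (evalP v A)
next k v F         = v F

Trigger : List Item → Val → ℕ → Set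
Trigger Φ v k = (∃ λ A → (k , A) ∈ Φ × new v (k , A) ≡ true)
              × (∀ n A → (n , A) ∈ Φ → n < k → new v (n , A) ≡ false)

-- The list holds the valuations already left, newest first; the current valuation is kept apart
-- from it.
data Run (Φ : List Item) : List Val → Val → Set where
  origin : Run Φ [] (λ _ → false)
  _▸_   : ∀ {vs v k} → Run Φ vs v → Trigger Φ v k → Run Φ (v ∷ vs) (next k v)

new-elim : ∀ {v n A} → new v (n , A) ≡ true → v (⟨ n ⟩ A) ≡ false × v ⊨ A
new-elim {v} {n} {A} h with ∧-elim {not (v (⟨ n ⟩ A))} h
... | a , b = not-elim a , b

new-false : ∀ {v n A} → new v (n , A) ≡ false → v (⟨ n ⟩ A) ≡ false → evalP v A ≡ false
new-false {v} {n} {A} h e rewrite e = h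

-- Soundness along runs

mono-items : ∀ {A} → GLP⊢ A → List Item
mono-items (taut _) = []
mono-items (ax-∨ n A B) = []
mono-items (ax-⊤ n) = []
mono-items (ax-L n A) = []
mono-items (ax-mono k n A _) = (k , A) ∷ []
mono-items (ax-neg k n A _) = []
mono-items (mp d e) = mono-items d ++ mono-items e
mono-items (nec n d) = mono-items d

module Soundness (Φ : List Item) where

  private
    along : ∀ (I : Val → Set) → I (λ _ → false) →
            (∀ {vs v k} → Run Φ vs v → Trigger Φ v k → I v → I (next k v)) →
            ∀ {vs v} → Run Φ vs v → I v
    along I z s origin  = z
    along I z s (r ▸ t) = s r t (along I z s r)

    or-true : ∀ {a b} → a ∨ b ≡ true → ¬ a ≡ true → b ≡ true
    or-true h na with ∨-elim h
    ... | inj₁ a = ⊥-elim (na a)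
    ... | inj₂ b = b

  -- To transfer n-diamonds along a run it suffices to treat the steps triggered at index n itself.
  transfer : ∀ n A B →
    (∀ {vs v} → Run Φ vs v → v (⟨ n ⟩ A) ≡ false → v ⊨ A → v ⊨ B ⊎ v ⊨ ⟨ n ⟩ B) →
    ∀ {vs v} → Run Φ vs v → v ⊨ ⟨ n ⟩ A → v ⊨ ⟨ n ⟩ B
  transfer n A B h = along (λ v → v ⊨ ⟨ n ⟩ A → v ⊨ ⟨ n ⟩ B) (λ ()) keep
    where
      keep : ∀ {vs v k} → Run Φ vs v → Trigger Φ v k →
             (v ⊨ ⟨ n ⟩ A → v ⊨ ⟨ n ⟩ B) → next k v ⊨ ⟨ n ⟩ A → next k v ⊨ ⟨ n ⟩ B
      keep {vs} {v} {k} r t ih x with <-cmp n k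
      ... | tri< _ _ _ = ih x
      ... | tri> _ _ _ = x
      ... | tri≈ _ _ _ with bool? (v (⟨ n ⟩ A))
      ... | inj₁ o = ∨-introˡ (ih o)
      ... | inj₂ o with h r o (or-true x (λ e → true≢false e o))
      ... | inj₁ b  = ∨-introʳ {v (⟨ n ⟩ B)} b
      ... | inj₂ nb = ∨-introˡ nb

  never-⊥ : ∀ n A → (∀ v → evalP v A ≡ false) → ∀ {vs v} → Run Φ vs v → v (⟨ n ⟩ A) ≡ false
  never-⊥ n A h = along (λ v → v (⟨ n ⟩ A) ≡ false) refl keep
    where
      keep : ∀ {vs v k} → Run Φ vs v → Trigger Φ v k → v (⟨ n ⟩ A) ≡ false → next k v (⟨ n ⟩ A) ≡ false
      keep {v = v} {k} _ _ ih with <-cmp n k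
      ... | tri< _ _ _ = ih
      ... | tri> _ _ _ = refl
      ... | tri≈ _ _ _ rewrite ih = h v

  -- A step below level `n` resets the level-`n` diamond. A step at `n` or above does not touch
  -- `⟨ k ⟩ A`, so if that is true after a step at `n`, it was true before, and the argument
  -- `¬' ⟨ k ⟩ A` was false.
  neg-sound : ∀ {k n} A → k < n → ∀ {vs v} → Run Φ vs v →
              v ⊨ ⟨ k ⟩ A → v (⟨ n ⟩ ¬' ⟨ k ⟩ A) ≡ false
  neg-sound {k} {n} A k<n = along (λ v → v ⊨ ⟨ k ⟩ A → v (⟨ n ⟩ ¬' ⟨ k ⟩ A) ≡ false) (λ _ → refl) keep
    where
      keep : ∀ {vs v l} → Run Φ vs v → Trigger Φ v l →
             (v ⊨ ⟨ k ⟩ A → v (⟨ n ⟩ ¬' ⟨ k ⟩ A) ≡ false) →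
             next l v ⊨ ⟨ k ⟩ A → next l v (⟨ n ⟩ ¬' ⟨ k ⟩ A) ≡ false
      keep {v = v} {l} _ _ ih x with <-cmp n l
      ... | tri> _ _ _ = refl
      ... | tri< n<l _ _ = ih (trans (sym (upd< _ (evalP v A) (<-trans k<n n<l))) x)
      ... | tri≈ _ refl _ with trans (sym (upd< _ (evalP v A) k<n)) x
      ... | y rewrite ih y | y = refl

  -- If a step at level `n` newly sets `⟨ n ⟩ A` while `⟨ k ⟩ A` is false, then `(k , A)` was new as
  -- well, and `n` was not the least triggering level.
  mono-sound : ∀ {k n} A → k ≤ n → (k , A) ∈ Φ → ∀ {vs v} → Run Φ vs v →
               v ⊨ ⟨ n ⟩ A → v ⊨ ⟨ k ⟩ A
  mono-sound {k} {n} A k≤n mem = along (λ v → v ⊨ ⟨ n ⟩ A → v ⊨ ⟨ k ⟩ A) (λ ()) keep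
    where
      keep : ∀ {vs v l} → Run Φ vs v → Trigger Φ v l →
             (v ⊨ ⟨ n ⟩ A → v ⊨ ⟨ k ⟩ A) → next l v ⊨ ⟨ n ⟩ A → next l v ⊨ ⟨ k ⟩ A
      keep {v = v} {l} r (_ , least) ih x with <-cmp n l
      ... | tri> _ _ _ = case x of λ ()
      ... | tri< n<l _ _ = trans (upd< _ (evalP v A) (≤-<-trans k≤n n<l)) (ih x)
      ... | tri≈ _ refl _ with m≤n⇒m<n∨m≡n k≤n
      ... | inj₂ refl = trans (upd≈ k _ _) x
      ... | inj₁ k<n with bool? (v (⟨ k ⟩ A))
      ... | inj₁ o = trans (upd< _ (evalP v A) k<n) o
      ... | inj₂ o with ∨-elim x
      ... | inj₁ y = ⊥-elim (true≢false (ih y) o)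
      ... | inj₂ y = ⊥-elim (true≢false y (new-false {v} {k} {A} (least k A mem k<n) o))

  sound : ∀ {A} (d : GLP⊢ A) → (∀ {i} → i ∈ mono-items d → i ∈ Φ) →
          ∀ {vs v} → Run Φ vs v → v ⊨ A
  sound (taut t) inc {v = v} r = t v
  sound (ax-∨ n A B) inc {v = v} r = ⇒-intro (go r)
    where
      go : ∀ {vs v} → Run Φ vs v → v ⊨ ⟨ n ⟩ (A ∨' B) → v ⊨ ⟨ n ⟩ A ∨' ⟨ n ⟩ B
      go = along (λ v → v ⊨ ⟨ n ⟩ (A ∨' B) → v ⊨ ⟨ n ⟩ A ∨' ⟨ n ⟩ B) (λ ()) keep
        where
          keep : ∀ {vs v k} → Run Φ vs v → Trigger Φ v k →
                 (v ⊨ ⟨ n ⟩ (A ∨' B) → v ⊨ ⟨ n ⟩ A ∨' ⟨ n ⟩ B) →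
                 next k v ⊨ ⟨ n ⟩ (A ∨' B) → next k v ⊨ ⟨ n ⟩ A ∨' ⟨ n ⟩ B
          keep {v = v} {k} r t ih x with <-cmp n k
          ... | tri< _ _ _ = ih x
          ... | tri> _ _ _ = x
          ... | tri≈ _ _ _ with ∨-elim x
          ... | inj₂ y with ∨-elim {evalP v A} y
          ... | inj₁ a = ∨-introˡ (∨-introʳ {v (⟨ n ⟩ A)} a)
          ... | inj₂ b = ∨-introʳ {v (⟨ n ⟩ A) ∨ evalP v A} (∨-introʳ {v (⟨ n ⟩ B)} b)
          keep {v = v} {k} r t ih x | tri≈ _ _ _ | inj₁ y with ∨-elim {v (⟨ n ⟩ A)} (ih y)
          ... | inj₁ a = ∨-introˡ (∨-introˡ a)
          ... | inj₂ b = ∨-introʳ {v (⟨ n ⟩ A) ∨ evalP v A} (∨-introˡ b)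
  sound (ax-⊤ n) inc r = not-intro λ x → true≢false x (never-⊥ n (¬' ⊤) (λ _ → refl) r)
  -- A step that sets `⟨ n ⟩ A` starts from a valuation where `A` is true and `⟨ n ⟩ A` still false,
  -- so it also sets the diamond of the conjunction.
  sound (ax-L n A) inc r = ⇒-intro (transfer n A (A ∧' ¬' ⟨ n ⟩ A)
    (λ {vs} {v} r o a → inj₁ (∧-intro a (cong not o))) r)
  sound (ax-mono k n A k≤n) inc r = ⇒-intro (mono-sound A k≤n (inc (here refl)) r)
  sound (ax-neg k n A k<n) inc r = ⇒-intro λ x → cong not (neg-sound A k<n r x)
  sound (mp d e) inc r = ⇒-elim
    (sound e (λ i → inc (∈-++⁺ʳ (mono-items d) i)) r) (sound d (λ i → inc (∈-++⁺ˡ i)) r)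
  sound (nec n {A} {B} d) inc r = ⇒-intro (transfer n A B
    (λ r o a → inj₁ (⇒-elim (sound d inc r) a)) r)

-- Comparing valuations with those visited earlier

Agree : List Item → Val → Val → Set
Agree Φ u v = ∀ n A → (n , A) ∈ Φ → u (⟨ n ⟩ A) ≡ v (⟨ n ⟩ A)

AgreeBelow : List Item → ℕ → Val → Val → Set
AgreeBelow Φ l u v = ∀ n A → (n , A) ∈ Φ → n < l → u (⟨ n ⟩ A) ≡ v (⟨ n ⟩ A)

Determined : List Item → Fm → Set
Determined Φ A = ∀ u v → Agree Φ u v → evalP u A ≡ evalP v A

Closed : List Item → Set
Closed Φ = ∀ n A → (n , A) ∈ Φ → Determined Φ A

next-below : ∀ Φ {l k} v → l ≤ k → AgreeBelow Φ l v (next k v)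
next-below Φ v l≤k n A m n<l = sym (upd< _ (evalP v A) (<-≤-trans n<l l≤k))

below-next : ∀ Φ {l k} u v → l ≤ k → AgreeBelow Φ l u v → AgreeBelow Φ l u (next k v)
below-next Φ u v l≤k a n A m n<l = trans (a n A m n<l) (next-below Φ v l≤k n A m n<l)

below-next⁻ : ∀ Φ {l k} u v → l ≤ k → AgreeBelow Φ l u (next k v) → AgreeBelow Φ l u v
below-next⁻ Φ u v l≤k a n A m n<l = trans (a n A m n<l) (sym (next-below Φ v l≤k n A m n<l))

next-grows : ∀ {k l} v A → l ≤ k → v ⊨ ⟨ l ⟩ A → next k v ⊨ ⟨ l ⟩ A
next-grows {k} {l} v A l≤k x with m≤n⇒m<n∨m≡n l≤k
... | inj₁ l<k  = trans (upd< _ (evalP v A) l<k) x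
... | inj₂ refl = trans (upd≈ k _ _) (∨-introˡ x)

next-triggered : ∀ {k} v A → new v (k , A) ≡ true → next k v ⊨ ⟨ k ⟩ A
next-triggered {k} v A h = trans (upd≈ k _ _) (∨-introʳ {v (⟨ k ⟩ A)} (proj₂ (new-elim {v} {k} {A} h)))

module Visited (Φ : List Item) where

  -- While the triggers stay at or above k, diamonds of levels up to k are never lost.
  bits-grow : ∀ {vs w k} → Run Φ vs w → ∀ v → v ∈ vs → AgreeBelow Φ k v w →
              ∀ B → (k , B) ∈ Φ → v ⊨ ⟨ k ⟩ B → w ⊨ ⟨ k ⟩ B
  -- A step below `k` turns on some diamond of level `j < k`. By the agreement `v` has it on too,
  -- and then `bits-grow` at level `j` shows that it was on before the step.
  late-trigger : ∀ {vs w j k} → Run Φ vs w → Trigger Φ w j → ∀ v → v ∈ (w ∷ vs) →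
                 AgreeBelow Φ k v (next j w) → k ≤ j

  late-trigger {w = w} {j} {k} r ((χ , mem , h) , _) v v∈ a with k ≤? j
  ... | yes k≤j = k≤j
  ... | no k≰j = ⊥-elim (true≢false (old v∈) (proj₁ (new-elim {w} {j} {χ} h)))
    where
      j<k = ≰⇒> k≰j
      v⊨ : v ⊨ ⟨ j ⟩ χ
      v⊨ = trans (a j χ mem j<k) (next-triggered w χ h)
      old : v ∈ (w ∷ _) → w ⊨ ⟨ j ⟩ χ
      old (here refl) = v⊨
      old (there m) = bits-grow r v m
        (λ n A i n<j → trans (a n A i (<-trans n<j j<k)) (sym (next-below Φ w ≤-refl n A i n<j))) χ mem v⊨

  bits-grow (_▸_ {v = w} {j} r t) v v∈ a B mem x with late-trigger r t v v∈ a
  bits-grow (_▸_ {v = w} {j} r t) .w (here refl) a B mem x | k≤j = next-grows w B k≤j x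
  bits-grow (_▸_ {v = w} {j} r t) v (there m) a B mem x | k≤j =
    next-grows w B k≤j (bits-grow r v m
      (below-next⁻ Φ v w k≤j a) B mem x)

  unset-before : ∀ {k} w B j → k ≤ j → next j w (⟨ k ⟩ B) ≡ false → w (⟨ k ⟩ B) ≡ false
  unset-before w B j k≤j x = ¬true→false λ y → true≢false (next-grows w B k≤j y) x

  -- The step leaving `v` acts at level `k` or higher. Were `B` true at `v`, a step at `k` would
  -- have set `⟨ k ⟩ B`, and a step above `k` would not have been the least possible. Once set, the
  -- diamond would still be on.
  false-before : ∀ {vs w k} → Run Φ vs w → ∀ v → v ∈ vs → AgreeBelow Φ k v w →
                 ∀ B → (k , B) ∈ Φ → w (⟨ k ⟩ B) ≡ false → evalP v B ≡ false
  false-before (_▸_ {v = w} {j} r t) v v∈ a B mem x with late-trigger r t v v∈ a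
  false-before (_▸_ {v = w} {j} r t) v (there m) a B mem x | k≤j =
    false-before r v m (below-next⁻ Φ v w k≤j a) B mem
      (unset-before w B j k≤j x)
  false-before {k = k} (_▸_ {v = w} {j} r (_ , least)) .w (here refl) a B mem x | k≤j
    with m≤n⇒m<n∨m≡n k≤j
  ... | inj₁ k<j  = new-false {w} {k} {B} (least k B mem k<j) (unset-before w B j k≤j x)
  ... | inj₂ refl = proj₂ (∨-false {w (⟨ k ⟩ B)} (trans (sym (upd≈ k _ _)) x))

-- Completeness: `GLP` proves that every world is covered by the run

module Completeness (Φ : List Item) (closed : Closed Φ) where
  open Visited Φ

  private
    lit : Val → Item → Fm
    lit v (n , A) = if v (⟨ n ⟩ A) then ⟨ n ⟩ A else ¬' ⟨ n ⟩ A

    below : ℕ → Val → List Item → Fm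
    below l v [] = ⊤
    below l v ((n , A) ∷ Ψ) with n <? l
    ... | yes _ = lit v (n , A) ∧' below l v Ψ
    ... | no _  = below l v Ψ

    some : ℕ → Val → List Item → Fm
    some l v [] = ⊥
    some l v ((n , A) ∷ Ψ) with n ≟ l | v (⟨ n ⟩ A)
    ... | yes _ | false = A ∨' some l v Ψ
    ... | yes _ | true  = some l v Ψ
    ... | no _  | _     = some l v Ψ

  lit-elim : ∀ v n A u → u ⊨ lit v (n , A) → u (⟨ n ⟩ A) ≡ v (⟨ n ⟩ A)
  lit-elim v n A u x with v (⟨ n ⟩ A)
  ... | true  = x
  ... | false = not-elim x

  lit-intro : ∀ v n A u → u (⟨ n ⟩ A) ≡ v (⟨ n ⟩ A) → u ⊨ lit v (n , A)
  lit-intro v n A u x with v (⟨ n ⟩ A)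
  ... | true  = x
  ... | false = cong not x

  below-elim : ∀ l v Ψ u → u ⊨ below l v Ψ → AgreeBelow Ψ l u v
  below-elim l v ((m , B) ∷ Ψ) u x n A i n<l with m <? l
  below-elim l v ((m , B) ∷ Ψ) u x n A (here refl) n<l | yes _ =
    lit-elim v m B u (proj₁ (∧-elim x))
  below-elim l v ((m , B) ∷ Ψ) u x n A (there i) n<l | yes _ =
    below-elim l v Ψ u (proj₂ (∧-elim {evalP u (lit v (m , B))} x)) n A i n<l
  below-elim l v ((m , B) ∷ Ψ) u x n A (here refl) n<l | no ¬l = ⊥-elim (¬l n<l)
  below-elim l v ((m , B) ∷ Ψ) u x n A (there i) n<l | no ¬l = below-elim l v Ψ u x n A i n<l

  below-intro : ∀ l v Ψ u → AgreeBelow Ψ l u v → u ⊨ below l v Ψ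
  below-intro l v [] u a = refl
  below-intro l v ((m , B) ∷ Ψ) u a with m <? l
  ... | yes m<l = ∧-intro (lit-intro v m B u (a m B (here refl) m<l))
                          (below-intro l v Ψ u λ n A i → a n A (there i))
  ... | no _    = below-intro l v Ψ u λ n A i → a n A (there i)

  below-persistent : ∀ l v Ψ → Persistent l (below l v Ψ)
  below-persistent l v [] = persistent-⊤ l
  below-persistent l v ((m , B) ∷ Ψ) with m <? l
  ... | no _    = below-persistent l v Ψ
  ... | yes m<l = persistent-∧ {l} {lit v (m , B)} head (below-persistent l v Ψ)
    where
      head : Persistent l (lit v (m , B))
      head with v (⟨ m ⟩ B)
      ... | true  = persistent-◇ B m<l
      ... | false = persistent-¬◇ B m<l

  some-elim : ∀ l v Ψ u → u ⊨ some l v Ψ → ∃ λ A → (l , A) ∈ Ψ × v (⟨ l ⟩ A) ≡ false × u ⊨ A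
  some-elim l v ((m , B) ∷ Ψ) u x with m ≟ l | v (⟨ m ⟩ B) in eq
  some-elim l v ((m , B) ∷ Ψ) u x | yes refl | false with ∨-elim {evalP u B} x
  ... | inj₁ b = B , here refl , eq , b
  ... | inj₂ y with some-elim l v Ψ u y
  ... | A , i , e , a = A , there i , e , a
  some-elim l v ((m , B) ∷ Ψ) u x | yes _ | true with some-elim l v Ψ u x
  ... | A , i , e , a = A , there i , e , a
  some-elim l v ((m , B) ∷ Ψ) u x | no _ | _ with some-elim l v Ψ u x
  ... | A , i , e , a = A , there i , e , a

  some-intro : ∀ l v Ψ u A → (l , A) ∈ Ψ → v (⟨ l ⟩ A) ≡ false → u ⊨ A → u ⊨ some l v Ψ
  some-intro l v ((m , B) ∷ Ψ) u A i e a with m ≟ l | v (⟨ m ⟩ B) in eq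
  some-intro l v ((m , B) ∷ Ψ) u .B (here refl) e a | yes _ | false = ∨-introˡ a
  some-intro l v ((m , B) ∷ Ψ) u A (there i) e a | yes _ | false =
    ∨-introʳ {evalP u B} (some-intro l v Ψ u A i e a)
  some-intro l v ((m , B) ∷ Ψ) u .B (here refl) e a | yes _ | true = ⊥-elim (true≢false eq e)
  some-intro l v ((m , B) ∷ Ψ) u A (there i) e a | yes _ | true = some-intro l v Ψ u A i e a
  some-intro l v ((m , B) ∷ Ψ) u .B (here refl) e a | no m≢ | _ = ⊥-elim (m≢ refl)
  some-intro l v ((m , B) ∷ Ψ) u A (there i) e a | no _ | _ = some-intro l v Ψ u A i e a

  -- The lexicographic order of valuations, where the letter at a level is the set of true items of
  -- that level and letters are compared by strict inclusion; `l` is the first level of difference.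
  AboveAt : Val → Val → ℕ → Set
  AboveAt v u l = AgreeBelow Φ l u v
    × (∀ B → (l , B) ∈ Φ → v ⊨ ⟨ l ⟩ B → u ⊨ ⟨ l ⟩ B)
    × (∃ λ A → (l , A) ∈ Φ × v (⟨ l ⟩ A) ≡ false × u ⊨ ⟨ l ⟩ A)

  Above : Val → Val → Set
  Above v u = ∃ (AboveAt v u)

  Covered : List Val → Val → Val → Set
  Covered vs v u = (∃ λ w → w ∈ vs × Agree Φ u w) ⊎ Agree Φ u v ⊎ Above v u

  NothingFrom : Val → ℕ → Set
  NothingFrom v l = ⊩ (λ u → ∀ l′ → l ≤ l′ → ¬ AboveAt v u l′)

  levels-bounded : ∃ λ M → ∀ n A → (n , A) ∈ Φ → n < M
  levels-bounded = go Φ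
    where
      go : ∀ (Ψ : List Item) → ∃ λ M → ∀ n A → (n , A) ∈ Ψ → n < M
      go [] = 0 , λ n A ()
      go ((m , B) ∷ Ψ) with go Ψ
      ... | M , h = suc m ⊔ M , λ { n A (here refl) → m≤m⊔n (suc m) M
                                  ; n A (there i) → ≤-trans (h n A i) (m≤n⊔m (suc m) M) }

  extra-bit? : ∀ l w u → (∃ λ A → (l , A) ∈ Φ × w (⟨ l ⟩ A) ≡ false × u ⊨ ⟨ l ⟩ A)
                       ⊎ (∀ A → (l , A) ∈ Φ → u ⊨ ⟨ l ⟩ A → w ⊨ ⟨ l ⟩ A)
  extra-bit? l w u = scan Φ (λ i → i)
    where
      scan : ∀ Ψ → (∀ {i} → i ∈ Ψ → i ∈ Φ) →
             (∃ λ A → (l , A) ∈ Φ × w (⟨ l ⟩ A) ≡ false × u ⊨ ⟨ l ⟩ A)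
             ⊎ (∀ A → (l , A) ∈ Ψ → u ⊨ ⟨ l ⟩ A → w ⊨ ⟨ l ⟩ A)
      scan [] inc = inj₂ λ A ()
      scan ((n , A) ∷ Ψ) inc with scan Ψ (λ i → inc (there i)) | n ≟ l | bool? (w (⟨ n ⟩ A)) | bool? (u (⟨ n ⟩ A))
      ... | inj₁ x | _ | _ | _ = inj₁ x
      ... | inj₂ f | no n≢l | _ | _ = inj₂ λ { B (here refl) → ⊥-elim (n≢l refl) ; B (there i) → f B i }
      ... | inj₂ f | yes refl | inj₁ y | _ = inj₂ λ { B (here refl) _ → y ; B (there i) → f B i }
      ... | inj₂ f | yes refl | inj₂ y | inj₁ x = inj₁ (A , inc (here refl) , y , x)
      ... | inj₂ f | yes refl | inj₂ y | inj₂ x =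
        inj₂ λ { B (here refl) z → ⊥-elim (true≢false z x) ; B (there i) → f B i }

  same-bit : ∀ {a b : Bool} → (a ≡ true → b ≡ true) → (b ≡ true → a ≡ true) → a ≡ b
  same-bit {true}  {true}  _ _ = refl
  same-bit {true}  {false} f _ = sym (f refl)
  same-bit {false} {true}  _ g = g refl
  same-bit {false} {false} _ _ = refl

  extend-agreement : ∀ l w u → AgreeBelow Φ l u w → (∀ B → (l , B) ∈ Φ → w ⊨ ⟨ l ⟩ B → u ⊨ ⟨ l ⟩ B) →
                     AgreeBelow Φ (suc l) u w ⊎ Above w u
  extend-agreement l w u a up with extra-bit? l w u
  ... | inj₁ x = inj₂ (l , a , up , x)
  ... | inj₂ f = inj₁ λ n A i n≤l → case m≤n⇒m<n∨m≡n (s≤s⁻¹ n≤l) of λ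
          { (inj₁ n<l) → a n A i n<l ; (inj₂ refl) → same-bit (f A i) (up A i) }

  -- Where `w` is zero, `u` has at least its diamonds. So agreement extends level by level, up to
  -- the bound on the levels, unless some level puts `u` above `w`.
  zero-from : ∀ l w u → AgreeBelow Φ l u w → (∀ n A → l ≤ n → w (⟨ n ⟩ A) ≡ false) →
              Agree Φ u w ⊎ Above w u
  zero-from l w u a z with levels-bounded
  ... | M , bound = go M l a (m≤n+m M l) z
    where
      go : ∀ d l → AgreeBelow Φ l u w → M ≤ l + d → (∀ n A → l ≤ n → w (⟨ n ⟩ A) ≡ false) →
           Agree Φ u w ⊎ Above w u
      go zero l a M≤ z = inj₁ λ n A i → a n A i
        (<-≤-trans (bound n A i) (≤-trans M≤ (≤-reflexive (+-identityʳ l))))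
      go (suc d) l a M≤ z with extend-agreement l w u a (λ B _ x → ⊥-elim (true≢false x (z l B ≤-refl)))
      ... | inj₂ x = inj₂ x
      ... | inj₁ a′ = go d (suc l) a′ (≤-trans M≤ (≤-reflexive (+-suc l d))) (λ n A l<n → z n A (<⇒≤ l<n))

  module _ {vs v} (r : Run Φ vs v) (covered : ⊩ (Covered vs v)) where

    -- By Löb there is a ⟨l⟩-accessible world that agrees with v below l, satisfies the
    -- disjunction D of the missing items of level l, but not ⟨l⟩D; it can only be v.
    above-witness : ∀ l E → (∀ u → Agree Φ u v → u ⊨ some l v Φ → u ⊨ E) → NothingFrom v (suc l) →
                    ⊩ (λ u → AboveAt v u l → u ⊨ ⟨ l ⟩ E)
    above-witness l E hE none = ⊩-map₂
      (λ { u f g (a , _ , A , i , e , x) → f (below-intro l v Φ u a) (g (l , A) i refl e x) })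
      (löb-local {l} {below l v Φ} {some l v Φ} {E} (below-persistent l v Φ)
        (⊩-map₃ inner covered none enter))
      enter
      where
        enter : ⊩ (λ u → ∀ i → i ∈ Φ → proj₁ i ≡ l → v (⟨ l ⟩ proj₂ i) ≡ false →
                         u ⊨ ⟨ l ⟩ (proj₂ i) → u ⊨ ⟨ l ⟩ some l v Φ)
        enter = ⊩-all Φ one
          where
            one : ∀ i → i ∈ Φ → ⊩ (λ u → proj₁ i ≡ l → v (⟨ l ⟩ proj₂ i) ≡ false →
                         u ⊨ ⟨ l ⟩ (proj₂ i) → u ⊨ ⟨ l ⟩ some l v Φ)
            one (n , A) i with n ≟ l | bool? (v (⟨ l ⟩ A))
            ... | no n≢l  | _ = ⊩-pure λ u e → ⊥-elim (n≢l e)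
            ... | yes _ | inj₁ t = ⊩-pure λ u _ f → ⊥-elim (true≢false t f)
            ... | yes refl | inj₂ f = ⊩-map (λ u h _ _ → h)
              (⊩-nec l {A} {some l v Φ} (⊩-pure λ u → some-intro l v Φ u A i f))
        inner : ∀ u → Covered vs v u → (∀ l′ → suc l ≤ l′ → ¬ AboveAt v u l′) →
                (∀ i → i ∈ Φ → proj₁ i ≡ l → v (⟨ l ⟩ proj₂ i) ≡ false →
                         u ⊨ ⟨ l ⟩ (proj₂ i) → u ⊨ ⟨ l ⟩ some l v Φ) →
                u ⊨ below l v Φ → u ⊨ some l v Φ → ¬ u ⊨ ⟨ l ⟩ some l v Φ → u ⊨ E
        -- A world matching an earlier valuation `w` would make a missing item true at `w`, although
        -- `v` still lacks its diamond; `false-before` excludes this.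
        inner u (inj₁ (w , w∈ , aw)) _ _ b d _ with some-elim l v Φ u d
        ... | A , i , e , x = ⊥-elim (true≢false
                (trans (sym (closed l A i u w aw)) x)
                (false-before r w w∈ (λ n B j n<l → trans (sym (aw n B j)) (below-elim l v Φ u b n B j n<l)) A i e))
        inner u (inj₂ (inj₁ av)) _ _ b d _ = hE u av d
        -- A first difference below `l` contradicts the agreement below `l`, one at `l` yields the
        -- excluded `⟨l⟩D`, and one above `l` is refuted by assumption.
        inner u (inj₂ (inj₂ (l′ , ab@(_ , _ , A , i , e , x)))) none′ ent b d nd with <-cmp l′ l
        ... | tri< l′<l _ _ = ⊥-elim (true≢false x (trans (below-elim l v Φ u b l′ A i l′<l) e))
        ... | tri≈ _ refl _ = ⊥-elim (nd (ent (l , A) i refl e x))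
        ... | tri> _ _ l<l′ = ⊥-elim (none′ l′ l<l′ ab)

    -- Induction from the top: beyond the highest level of an item there is nothing to refute, and
    -- each level is refuted with all higher ones already excluded.
    nothing-from : ∀ k → (∀ l → k ≤ l → NothingFrom v (suc l) → ⊩ (λ u → ¬ AboveAt v u l)) → NothingFrom v k
    nothing-from k refute with levels-bounded
    ... | M , bound = go (suc M) k ≤-refl (m≤n⇒m≤o+n k (n≤1+n M))
      where
        go : ∀ d l → k ≤ l → M ≤ l + d → NothingFrom v l
        go zero l k≤l M≤l = ⊩-pure λ { u l′ l≤l′ (_ , _ , A , i , _) →
          <⇒≱ (bound l′ A i) (≤-trans M≤l (≤-trans (≤-reflexive (+-identityʳ l)) l≤l′)) }
        go (suc d) l k≤l M≤l = ⊩-map₂ join-levels (refute l k≤l rest) rest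
          where
            rest : NothingFrom v (suc l)
            rest = go d (suc l) (m≤n⇒m≤1+n k≤l) (≤-trans M≤l (≤-reflexive (+-suc l d)))
            join-levels : ∀ u → ¬ AboveAt v u l → (∀ l′ → suc l ≤ l′ → ¬ AboveAt v u l′) →
                      ∀ l′ → l ≤ l′ → ¬ AboveAt v u l′
            join-levels u f g l′ l≤l′ with m≤n⇒m<n∨m≡n l≤l′
            ... | inj₁ l<l′ = g l′ l<l′
            ... | inj₂ refl = f

    -- After the last step no missing item is true at `v`, so `above-witness` applies with `E = ⊥`
    -- at every level, and `⟨l⟩⊥` is refutable.
    final : (∀ n A → (n , A) ∈ Φ → new v (n , A) ≡ false) →
            ⊩ (λ u → ∃ λ w → w ∈ (v ∷ vs) × Agree Φ u w)
    final stop = ⊩-map₂ conclude covered (nothing-from 0 λ l _ rest →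
      ⊩-map₂ (λ u f g a → g (f a)) (above-witness l ⊥ impossible rest) (⊩-⊥ l))
      where
        impossible : ∀ {l} u → Agree Φ u v → u ⊨ some l v Φ → u ⊨ ⊥
        impossible {l} u a d with some-elim l v Φ u d
        ... | A , i , e , x = ⊥-elim (true≢false x
                (trans (closed l A i u v a) (new-false {v} {l} {A} (stop l A i) e)))
        conclude : ∀ u → Covered vs v u → (∀ l → 0 ≤ l → ¬ AboveAt v u l) → ∃ λ w → w ∈ (v ∷ vs) × Agree Φ u w
        conclude u (inj₁ (w , i , a)) _ = w , there i , a
        conclude u (inj₂ (inj₁ a)) _ = v , here refl , a
        conclude u (inj₂ (inj₂ (l , a))) n = ⊥-elim (n l z≤n a)

    module Step {k} (t : Trigger Φ v k) where
      private
        v′ = next k v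

      -- A world above `v` at some `l > k` would satisfy `⟨l⟩χ` for the triggering formula `χ`,
      -- hence `⟨k⟩χ` by monotonicity; but it agrees with `v` below `l`, and `⟨k⟩χ` is false at `v`.
      no-higher : NothingFrom v (suc k)
      no-higher = let (χ , mem , h) = proj₁ t in nothing-from (suc k) λ l k<l rest →
        ⊩-map₃ (λ u f g e a → true≢false (g (f a))
                  (trans (proj₁ a k χ mem k<l) (proj₁ (new-elim {v} {k} {χ} h))))
          (above-witness l χ (λ u a _ → trans (closed k χ mem u v a) (proj₂ (new-elim {v} {k} {χ} h))) rest)
          (⊩-mono χ (<⇒≤ k<l)) (⊩-pure λ _ → refl {x = true})

      -- With the higher levels excluded, the witness of `above-witness` at level `k` is `v` itself,
      -- so a world above `v` at `k` has a diamond for each formula of level `k` true at `v`: it has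
      -- everything the step sets.
      all-set : ⊩ (λ u → AboveAt v u k → ∀ i → i ∈ Φ → proj₁ i ≡ k →
                         v′ ⊨ ⟨ k ⟩ (proj₂ i) → u ⊨ ⟨ k ⟩ (proj₂ i))
      all-set = ⊩-map (λ u f a i m → f i m a) (⊩-all Φ one)
        where
          one : ∀ i → i ∈ Φ → ⊩ (λ u → AboveAt v u k → proj₁ i ≡ k →
                         v′ ⊨ ⟨ k ⟩ (proj₂ i) → u ⊨ ⟨ k ⟩ (proj₂ i))
          one (n , A) i with n ≟ k | bool? (v (⟨ k ⟩ A)) | bool? (evalP v A)
          ... | no n≢k | _ | _ = ⊩-pure λ u _ e → ⊥-elim (n≢k e)
          ... | yes refl | inj₁ o | _ = ⊩-pure λ { u (_ , up , _) _ _ → up A i o }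
          ... | yes refl | inj₂ o | inj₂ e = ⊩-pure λ u _ _ x → ⊥-elim (true≢false
                  (trans (sym (upd≈ k _ _)) x) (trans (cong (_∨ evalP v A) o) e))
          ... | yes refl | inj₂ o | inj₁ e = ⊩-map (λ u f a _ _ → f a)
                  (above-witness k A (λ u a _ → trans (closed k A i u v a) e) no-higher)

      compare-level : ∀ u → AgreeBelow Φ k u v → (∀ i → i ∈ Φ → proj₁ i ≡ k →
                        v′ ⊨ ⟨ k ⟩ (proj₂ i) → u ⊨ ⟨ k ⟩ (proj₂ i)) → Agree Φ u v′ ⊎ Above v′ u
      compare-level u a up with extend-agreement k v′ u (below-next Φ u v ≤-refl a)
                                  (λ B i → up (k , B) i refl)
      ... | inj₂ x = inj₂ x
      ... | inj₁ a′ = zero-from (suc k) v′ u a′ (λ n A k<n → upd> _ (evalP v A) k<n)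

      covered-next : ⊩ (Covered (v ∷ vs) v′)
      covered-next = ⊩-map₃ go covered no-higher all-set
        where
          go : ∀ u → Covered vs v u → (∀ l → suc k ≤ l → ¬ AboveAt v u l) →
               (AboveAt v u k → ∀ i → i ∈ Φ → proj₁ i ≡ k →
                         v′ ⊨ ⟨ k ⟩ (proj₂ i) → u ⊨ ⟨ k ⟩ (proj₂ i)) → Covered (v ∷ vs) v′ u
          go u (inj₁ (w , i , a)) _ _ = inj₁ (w , there i , a)
          go u (inj₂ (inj₁ a)) _ _ = inj₁ (v , here refl , a)
          go u (inj₂ (inj₂ (l , ab@(a , up , A , i , e , x)))) none set with <-cmp l k
          ... | tri> _ _ k<l = ⊥-elim (none l k<l ab)
          ... | tri≈ _ refl _ = inj₂ (compare-level u a (set ab))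
          ... | tri< l<k _ _ = inj₂ (inj₂ (l ,
                  below-next Φ u v (<⇒≤ l<k) a ,
                  (λ B j y → up B j (trans (sym (upd< _ (evalP v B) l<k)) y)) ,
                  A , i , trans (upd< _ (evalP v A) l<k) e , x))

  covered-begin : ⊩ (Covered [] (λ _ → false))
  covered-begin = ⊩-pure λ u → inj₂ (zero-from 0 (λ _ → false) u (λ n A _ ()) (λ _ _ _ → refl))

  covered-run : ∀ {vs v} → Run Φ vs v → ⊩ (Covered vs v)
  covered-run origin = covered-begin
  covered-run (r ▸ t) = Step.covered-next r (covered-run r) t

-- Termination

-- The lower the level, the more significant the digit, since a step erases the levels above its
-- own.
weight : ℕ → ℕ → ℕ → ℕ
weight B M n = B ^ (M ∸ n)

potential : ℕ → ℕ → List Item → Val → ℕ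
potential B M [] v = 0
potential B M ((n , A) ∷ Φ) v = (if v (⟨ n ⟩ A) then weight B M n else 0) + potential B M Φ v

Bounded : ℕ → List Item → Set
Bounded M Φ = ∀ n A → (n , A) ∈ Φ → n < M

item-bound : ∀ Φ → ∃ λ M → Bounded M Φ
item-bound [] = 0 , λ n A ()
item-bound ((m , B) ∷ Ψ) with item-bound Ψ
... | M , h = suc m ⊔ M , λ { n A (here refl) → m≤m⊔n (suc m) M
                            ; n A (there i) → ≤-trans (h n A i) (m≤n⊔m (suc m) M) }

potential-≤ : ∀ B M Φ v → potential (suc B) M Φ v ≤ length Φ * suc B ^ M
potential-≤ B M [] v = z≤n
potential-≤ B M ((n , A) ∷ Φ) v = +-mono-≤ head (potential-≤ B M Φ v)
  where
    head : (if v (⟨ n ⟩ A) then weight (suc B) M n else 0) ≤ suc B ^ M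
    head with v (⟨ n ⟩ A)
    ... | false = z≤n
    ... | true  = ^-monoʳ-≤ (suc B) (m∸n≤m M n)

private
  swap-+ : ∀ a b c d → a + b + (c + d) ≡ a + c + (b + d)
  swap-+ = solve-∀

-- Each item beyond level k loses at most one unit B ^ (M ∸ suc k), each newly set item gains B of them.
potential-step : ∀ B M Φ k v → Bounded M Φ →
  potential (suc B) M Φ v ≤ potential (suc B) M Φ (next k v) + length Φ * suc B ^ (M ∸ suc k)
potential-gain : ∀ B M Φ k v A → Bounded M Φ → (k , A) ∈ Φ → new v (k , A) ≡ true →
  potential (suc B) M Φ v + suc B ^ (M ∸ k) ≤ potential (suc B) M Φ (next k v) + length Φ * suc B ^ (M ∸ suc k)

private
  bit-step : ∀ B M k n o e → (if o then weight (suc B) M n else 0)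
           ≤ (if upd k n o e then weight (suc B) M n else 0) + suc B ^ (M ∸ suc k)
  bit-step B M k n o e with <-cmp n k
  ... | tri< _ _ _ = m≤m+n _ _
  bit-step B M k n true  e | tri≈ _ _ _ = m≤m+n _ _
  bit-step B M k n false e | tri≈ _ _ _ = z≤n
  bit-step B M k n true  e | tri> _ _ k<n = ^-monoʳ-≤ (suc B) (∸-monoʳ-≤ M k<n)
  bit-step B M k n false e | tri> _ _ k<n = z≤n

potential-step B M [] k v b = z≤n
potential-step B M ((n , A) ∷ Φ) k v b = ≤-trans
  (+-mono-≤ (bit-step B M k n (v (⟨ n ⟩ A)) (evalP v A)) (potential-step B M Φ k v (λ m C i → b m C (there i))))
  (≤-reflexive (swap-+ (if next k v (⟨ n ⟩ A) then weight (suc B) M n else 0) _ _ _))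

potential-gain B M ((n , C) ∷ Φ) k v A b (there i) h = ≤-trans
  (≤-trans (≤-reflexive (+-assoc (if v (⟨ n ⟩ C) then weight (suc B) M n else 0) _ _))
    (+-mono-≤ (bit-step B M k n (v (⟨ n ⟩ C)) (evalP v C)) (potential-gain B M Φ k v A (λ m C i → b m C (there i)) i h)))
  (≤-reflexive (swap-+ (if next k v (⟨ n ⟩ C) then weight (suc B) M n else 0) _ _ _))
potential-gain B M ((.k , .A) ∷ Φ) k v A b (here refl) h
  rewrite proj₁ (new-elim {v} {k} {A} h) | upd≈ k false (evalP v A) | proj₂ (new-elim {v} {k} {A} h) = begin
    p + w                 ≡⟨ +-comm p w ⟩
    w + p                 ≤⟨ +-monoʳ-≤ w (potential-step B M Φ k v (λ m C i → b m C (there i))) ⟩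
    w + (p′ + l)          ≡⟨ sym (+-assoc w p′ l) ⟩
    w + p′ + l            ≤⟨ +-monoʳ-≤ (w + p′) (m≤n+m l _) ⟩
    w + p′ + (suc B ^ (M ∸ suc k) + l) ∎
  where
    open ≤-Reasoning
    p = potential (suc B) M Φ v
    p′ = potential (suc B) M Φ (next k v)
    w = suc B ^ (M ∸ k)
    l = length Φ * suc B ^ (M ∸ suc k)

-- With base `suc (length Φ)`, an item gained at level `k` is worth `suc (length Φ)` units `c`,
-- while the items erased above `k` cost at most `length Φ` of them.
potential-< : ∀ M Φ k v → Bounded M Φ → Trigger Φ v k →
              potential (suc (length Φ)) M Φ v < potential (suc (length Φ)) M Φ (next k v)
potential-< M Φ k v b ((A , i , h) , _) = +-cancelʳ-< (length Φ * c) _ _ (begin-strict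
    p + length Φ * c    <⟨ +-monoʳ-< p (m<n+m (length Φ * c) (m^n>0 (suc (length Φ)) (M ∸ suc k))) ⟩
    p + suc (length Φ) * c ≡⟨ cong (λ z → p + suc (length Φ) ^ z) (sym (+-∸-assoc 1 (b k A i))) ⟩
    p + suc (length Φ) ^ (M ∸ k) ≤⟨ potential-gain (length Φ) M Φ k v A b i h ⟩
    p′ + length Φ * c ∎)
  where
    open ≤-Reasoning
    c = suc (length Φ) ^ (M ∸ suc k)
    p = potential (suc (length Φ)) M Φ v
    p′ = potential (suc (length Φ)) M Φ (next k v)

fuel : List Item → Val → ℕ
fuel Φ v = length Φ * suc (length Φ) ^ M ∸ potential (suc (length Φ)) M Φ v
  where M = proj₁ (item-bound Φ)

fuel-< : ∀ Φ k v → Trigger Φ v k → fuel Φ (next k v) < fuel Φ v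
fuel-< Φ k v t = ∸-monoʳ-< (potential-< M Φ k v (proj₂ (item-bound Φ)) t) (potential-≤ (length Φ) M Φ (next k v))
  where M = proj₁ (item-bound Φ)

Stopped : List Item → Val → Set
Stopped Φ v = ∀ n A → (n , A) ∈ Φ → new v (n , A) ≡ false

trigger? : ∀ Φ v → ∃ (Trigger Φ v) ⊎ Stopped Φ v
trigger? [] v = inj₂ λ n A ()
trigger? ((m , B) ∷ Φ) v with trigger? Φ v | bool? (new v (m , B))
... | inj₂ f | inj₂ e = inj₂ λ { n A (here refl) → e ; n A (there i) → f n A i }
... | inj₂ f | inj₁ e = inj₁ (m , (B , here refl , e) ,
        λ { n A (here refl) l → ⊥-elim (n≮n n l) ; n A (there i) l → f n A i })
... | inj₁ (k , (A , i , h) , least) | inj₂ e = inj₁ (k , (A , there i , h) ,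
        λ { n C (here refl) l → e ; n C (there j) l → least n C j l })
... | inj₁ (k , (A , i , h) , least) | inj₁ e with <-cmp m k
... | tri< m<k _ _ = inj₁ (m , (B , here refl , e) ,
        λ { n C (here refl) l → ⊥-elim (n≮n n l) ; n C (there j) l → least n C j (<-trans l m<k) })
... | tri≈ _ refl _ = inj₁ (k , (A , there i , h) ,
        λ { n C (here refl) l → ⊥-elim (n≮n n l) ; n C (there j) l → least n C j l })
... | tri> _ _ k<m = inj₁ (k , (A , there i , h) ,
        λ { n C (here refl) l → ⊥-elim (<-asym l k<m) ; n C (there j) l → least n C j l })

-- Independence of the set of items

data Path (Φ : List Item) : Val → Val → Set where
  ε   : ∀ {v} → Path Φ v v
  _◂_ : ∀ {v k w} → Trigger Φ v k → Path Φ (next k v) w → Path Φ v w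

path-snoc : ∀ {Φ v w k} → Path Φ v w → Trigger Φ w k → Path Φ v (next k w)
path-snoc ε t = t ◂ ε
path-snoc (s ◂ p) t = s ◂ path-snoc p t

path-trans : ∀ {Φ u v w} → Path Φ u v → Path Φ v w → Path Φ u w
path-trans ε q = q
path-trans (s ◂ p) q = s ◂ path-trans p q

run-path : ∀ {Φ vs v} → Run Φ vs v → Path Φ (λ _ → false) v
run-path origin = ε
run-path (r ▸ t) = path-snoc (run-path r) t

-- Take for `z` the valuation left by the last step at level `k` or lower, or the origin. That step
-- zeroed everything above `k`, and the later steps do not touch the levels up to `k`.
reset-visited : ∀ {Φ vs y} → Run Φ vs y → ∀ k → ∃ λ zs → ∃ λ z → Run Φ zs z × Path Φ z y
              × AgreeBelow Φ (suc k) z y × (∀ n A → k < n → z (⟨ n ⟩ A) ≡ false)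
reset-visited origin k = [] , _ , origin , ε , (λ _ _ _ _ → refl) , λ _ _ _ → refl
reset-visited {Φ} (_▸_ {v = y} {j} r t) k with j ≤? k
... | yes j≤k = _ , _ , r ▸ t , ε , (λ _ _ _ _ → refl) , λ n A k<n → upd> _ (evalP y A) (≤-<-trans j≤k k<n)
... | no j≰k with reset-visited r k
... | zs , z , rz , p , a , o = zs , z , rz , path-snoc p t , below-next Φ z y (≰⇒> j≰k) a , o

module Independence (Φ₀ Φ : List Item) (closed : Closed Φ₀) (inc : ∀ {i} → i ∈ Φ₀ → i ∈ Φ) where

  agree-new : ∀ {y x} → Agree Φ₀ y x → ∀ {n A} → (n , A) ∈ Φ₀ → new y (n , A) ≡ new x (n , A)
  agree-new {y} {x} a {n} {A} i = cong₂ (λ b c → not b ∧ c) (a n A i) (closed n A i y x a)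

  agree-next : ∀ {y x} k → Agree Φ₀ y x → Agree Φ₀ (next k y) (next k x)
  agree-next {y} {x} k a n A i = cong₂ (upd k n) (a n A i) (closed n A i y x a)

  -- The longer list may trigger earlier, at some `k′ < k`. No item of `Φ₀` is new at or below `k′`,
  -- so such a step merely erases the bits of `Φ₀` above `k′`. The shorter run is then moved back to
  -- the visited valuation `z` of `reset-visited`, which shows the same bits and from which the path
  -- still leads to `v`. The path grows longer, but the fuel of the longer run decreases.
  simulate : ∀ f {ys y v} → Run Φ₀ ys y → Path Φ₀ y v → ∀ {xs x} → Run Φ xs x → fuel Φ x < f →
             Agree Φ₀ y x → ∃ λ ws → ∃ λ w → Run Φ ws w × Agree Φ₀ v w
  simulate (suc f) r ε {xs} {x} s _ a = xs , x , s , a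
  simulate (suc f) {y = y} r (_◂_ {k = k} t@((χ , i , h) , least) p) {x = x} s x<f a with trigger? Φ x
  ... | inj₂ stop = ⊥-elim (true≢false h (trans (agree-new a i) (stop k χ (inc i))))
  ... | inj₁ (k′ , t′@(_ , least′)) with <-cmp k′ k
  ... | tri> _ _ k<k′ = ⊥-elim (true≢false h (trans (agree-new a i) (least′ k χ (inc i) k<k′)))
  ... | tri≈ _ refl _ = simulate f (r ▸ t) p (s ▸ t′)
          (<-≤-trans (fuel-< Φ k x t′) (s≤s⁻¹ x<f)) (agree-next k a)
  ... | tri< k′<k _ _ with reset-visited r k′
  ... | zs , z , rz , q , az , oz = simulate f rz (path-trans q (t ◂ p)) (s ▸ t′)
          (<-≤-trans (fuel-< Φ k′ x t′) (s≤s⁻¹ x<f)) agree′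
    where
      agree′ : Agree Φ₀ z (next k′ x)
      agree′ n A j with <-cmp n k′
      ... | tri< l _ _ = trans (az n A j (m≤n⇒m≤1+n l)) (a n A j)
      ... | tri> _ _ g = oz n A g
      ... | tri≈ _ refl _ with bool? (x (⟨ n ⟩ A))
      ... | inj₁ o = trans (az n A j ≤-refl) (trans (a n A j) (trans o (sym (∨-introˡ o))))
      ... | inj₂ o = trans (az n A j ≤-refl) (trans (a n A j) (trans o (sym (trans (cong (_∨ evalP x A) o)
              (new-false {x} {n} {A} (trans (sym (agree-new a j)) (least n A j k′<k)) o)))))

-- Provability of closed formulas as truth at all visited valuations

modals : Fm → List Item
modals (var _) = []
modals ⊤ = []
modals ⊥ = []
modals (A ∧' B) = modals A ++ modals B
modals (A ∨' B) = modals A ++ modals B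
modals (A ⇒ B) = modals A ++ modals B
modals (¬' A) = modals A
modals (⟨ n ⟩ A) = (n , A) ∷ modals A

determined : ∀ Φ A → (∀ {i} → i ∈ modals (ι A) → i ∈ Φ) → Determined Φ (ι A)
determined Φ ⊤ inc u v a = refl
determined Φ ⊥ inc u v a = refl
determined Φ (A ∧' B) inc u v a = cong₂ _∧_
  (determined Φ A (λ i → inc (∈-++⁺ˡ i)) u v a) (determined Φ B (λ i → inc (∈-++⁺ʳ (modals (ι A)) i)) u v a)
determined Φ (A ∨' B) inc u v a = cong₂ _∨_
  (determined Φ A (λ i → inc (∈-++⁺ˡ i)) u v a) (determined Φ B (λ i → inc (∈-++⁺ʳ (modals (ι A)) i)) u v a)
determined Φ (A ⇒ B) inc u v a = cong₂ (λ x y → not x ∨ y)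
  (determined Φ A (λ i → inc (∈-++⁺ˡ i)) u v a) (determined Φ B (λ i → inc (∈-++⁺ʳ (modals (ι A)) i)) u v a)
determined Φ (¬' A) inc u v a = cong not (determined Φ A inc u v a)
determined Φ (⟨ n ⟩ A) inc u v a = a n (ι A) (inc (here refl))

modals-closed : ∀ Φ A → (∀ {i} → i ∈ modals (ι A) → i ∈ Φ) → ∀ n B → (n , B) ∈ modals (ι A) → Determined Φ B
modals-closed Φ (A ∧' B) inc n C i with ∈-++⁻ (modals (ι A)) i
... | inj₁ j = modals-closed Φ A (λ i → inc (∈-++⁺ˡ i)) n C j
... | inj₂ j = modals-closed Φ B (λ i → inc (∈-++⁺ʳ (modals (ι A)) i)) n C j
modals-closed Φ (A ∨' B) inc n C i with ∈-++⁻ (modals (ι A)) i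
... | inj₁ j = modals-closed Φ A (λ i → inc (∈-++⁺ˡ i)) n C j
... | inj₂ j = modals-closed Φ B (λ i → inc (∈-++⁺ʳ (modals (ι A)) i)) n C j
modals-closed Φ (A ⇒ B) inc n C i with ∈-++⁻ (modals (ι A)) i
... | inj₁ j = modals-closed Φ A (λ i → inc (∈-++⁺ˡ i)) n C j
... | inj₂ j = modals-closed Φ B (λ i → inc (∈-++⁺ʳ (modals (ι A)) i)) n C j
modals-closed Φ (¬' A) inc n C i = modals-closed Φ A inc n C i
modals-closed Φ (⟨ m ⟩ A) inc n C (here refl) = determined Φ A (λ i → inc (there i))
modals-closed Φ (⟨ m ⟩ A) inc n C (there i) = modals-closed Φ A (λ i → inc (there i)) n C i

items : CFm → List Item
items A = modals (ι A)

items-closed : ∀ A → Closed (items A)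
items-closed A = modals-closed (items A) A (λ i → i)

provable-visited : ∀ A → GLP⊢ ι A → ∀ {vs v} → Run (items A) vs v → v ⊨ ι A
provable-visited A d {vs} {v} r
  with Independence.simulate (items A) Φ (items-closed A) ∈-++⁺ˡ (suc (fuel Φ (λ _ → false)))
         origin (run-path r) origin (n<1+n _) (λ _ _ _ → refl)
  where Φ = items A ++ mono-items d
... | ws , w , s , a = trans (determined (items A) A (λ i → i) v w a)
        (Soundness.sound (items A ++ mono-items d) d (∈-++⁺ʳ (items A)) s)

visited-provable : ∀ A {vs v} → Run (items A) vs v → Stopped (items A) v →
                   (∀ w → w ∈ (v ∷ vs) → w ⊨ ι A) → GLP⊢ ι A
visited-provable A {vs} {v} r stop h = ⊩-out (⊩-map
  (λ { u (w , i , a) → trans (determined (items A) A (λ i → i) u w a) (h w i) })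
  (final r (covered-run r) stop))
  where open Completeness (items A) (items-closed A)

run-to-stop : ∀ Φ → ∃ λ vs → ∃ λ v → Run Φ vs v × Stopped Φ v
run-to-stop Φ = go (suc (fuel Φ (λ _ → false))) origin (n<1+n _)
  where
    go : ∀ f {vs v} → Run Φ vs v → fuel Φ v < f → ∃ λ vs → ∃ λ v → Run Φ vs v × Stopped Φ v
    go (suc f) {vs} {v} r v<f with trigger? Φ v
    ... | inj₂ stop = vs , v , r , stop
    ... | inj₁ (k , t) = go f (r ▸ t) (<-≤-trans (fuel-< Φ k v t) (s≤s⁻¹ v<f))

-- Finite types

-- Only a coding with a left inverse is asked for. Spare codes do no harm, because machines decode a
-- state or symbol before acting on it.
record Finite (A : Set) : Set where
  field
    size : ℕ
    enc′ : A → Fin size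
    dec′ : Fin size → A
    dec-enc : ∀ a → dec′ (enc′ a) ≡ a
open Finite public

fin-Fin : ∀ {n} → Finite (Fin n)
fin-Fin {n} = record { size = n ; enc′ = λ a → a ; dec′ = λ a → a ; dec-enc = λ _ → refl }

fin-⊤ : Finite Unit
fin-⊤ = record { size = 1 ; enc′ = λ _ → fz ; dec′ = λ _ → tt ; dec-enc = λ _ → refl }

fin-Bool : Finite Bool
fin-Bool = record { size = 2 ; enc′ = e ; dec′ = d ; dec-enc = λ { true → refl ; false → refl } }
  where
    e : Bool → Fin 2
    e true  = fz
    e false = fs fz
    d : Fin 2 → Bool
    d fz     = true
    d (fs _) = false

fin-× : ∀ {A B} → Finite A → Finite B → Finite (A × B)
fin-× {A} {B} F G = record { size = size F * size G ; enc′ = e ; dec′ = d ; dec-enc = de }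
  where
    e : A × B → Fin (size F * size G)
    e (a , b) = combine (enc′ F a) (enc′ G b)
    d : Fin (size F * size G) → A × B
    d i = let (j , k) = remQuot {size F} (size G) i in dec′ F j , dec′ G k
    de : ∀ ab → d (e ab) ≡ ab
    de (a , b) = trans (cong (λ jk → dec′ F (proj₁ jk) , dec′ G (proj₂ jk)) (remQuot-combine (enc′ F a) (enc′ G b)))
                       (cong₂ _,_ (dec-enc F a) (dec-enc G b))

fin-⊎ : ∀ {A B} → Finite A → Finite B → Finite (A ⊎ B)
fin-⊎ {A} {B} F G = record { size = size F + size G ; enc′ = e ; dec′ = d ; dec-enc = de }
  where
    e : A ⊎ B → Fin (size F + size G)
    e (inj₁ a) = join (size F) (size G) (inj₁ (enc′ F a))
    e (inj₂ b) = join (size F) (size G) (inj₂ (enc′ G b))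
    back : Fin (size F) ⊎ Fin (size G) → A ⊎ B
    back (inj₁ a) = inj₁ (dec′ F a)
    back (inj₂ b) = inj₂ (dec′ G b)
    d : Fin (size F + size G) → A ⊎ B
    d i = back (splitAt (size F) i)
    de : ∀ ab → d (e ab) ≡ ab
    de (inj₁ a) = trans (cong back (splitAt-join (size F) (size G) (inj₁ (enc′ F a)))) (cong inj₁ (dec-enc F a))
    de (inj₂ b) = trans (cong back (splitAt-join (size F) (size G) (inj₂ (enc′ G b)))) (cong inj₂ (dec-enc G b))

fin-retract : ∀ {A B : Set} (to : A → B) (from : B → A) → (∀ a → from (to a) ≡ a) → Finite B → Finite A
fin-retract to from ft F = record { size = size F ; enc′ = enc′ F ∘ to ; dec′ = from ∘ dec′ F
  ; dec-enc = λ a → trans (cong from (dec-enc F (to a))) (ft a) }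

fin-Maybe : ∀ {A} → Finite A → Finite (Maybe A)
fin-Maybe {A} F = fin-retract to from (λ { (just _) → refl ; nothing → refl }) (fin-⊎ fin-⊤ F)
  where
    to : Maybe A → Unit ⊎ A
    to nothing  = inj₁ tt
    to (just a) = inj₂ a
    from : Unit ⊎ A → Maybe A
    from (inj₁ _) = nothing
    from (inj₂ a) = just a

fin-Vec : ∀ {A} n → Finite A → Finite (Vec A n)
fin-Vec zero F = fin-retract (λ _ → tt) (λ _ → []) (λ { [] → refl }) fin-⊤
fin-Vec (suc n) F = fin-retract (λ { (x ∷ xs) → x , xs }) (λ { (x , xs) → x ∷ xs })
  (λ { (_ ∷ _) → refl }) (fin-× F (fin-Vec n F))

-- Polynomial bounds

PolyBounded : (ℕ → ℕ) → Set
PolyBounded f = ∃ λ c → ∃ λ k → ∀ n → f n ≤ c * suc n ^ k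

pb-const : ∀ c → PolyBounded (λ _ → c)
pb-const c = c , 0 , λ n → ≤-reflexive (sym (*-identityʳ c))

pb-id : PolyBounded (λ n → n)
pb-id = 1 , 1 , λ n → ≤-trans (n≤1+n n) (≤-reflexive (sym (trans (+-identityʳ _) (*-identityʳ (suc n)))))

pb-+ : ∀ {f g} → PolyBounded f → PolyBounded g → PolyBounded (λ n → f n + g n)
pb-+ {f} {g} (c , k , b) (d , l , e) = c + d , k + l , λ n → begin
    f n + g n                                       ≤⟨ +-mono-≤ (b n) (e n) ⟩
    c * suc n ^ k + d * suc n ^ l                   ≤⟨ +-mono-≤ (*-monoʳ-≤ c (^-monoʳ-≤ (suc n) (m≤m+n k l)))
                                                                (*-monoʳ-≤ d (^-monoʳ-≤ (suc n) (m≤n+m l k))) ⟩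
    c * suc n ^ (k + l) + d * suc n ^ (k + l)       ≡⟨ sym (*-distribʳ-+ (suc n ^ (k + l)) c d) ⟩
    (c + d) * suc n ^ (k + l)                       ∎
  where open ≤-Reasoning

pb-* : ∀ {f g} → PolyBounded f → PolyBounded g → PolyBounded (λ n → f n * g n)
pb-* {f} {g} (c , k , b) (d , l , e) = c * d , k + l , λ n → begin
    f n * g n                           ≤⟨ *-mono-≤ (b n) (e n) ⟩
    (c * suc n ^ k) * (d * suc n ^ l)   ≡⟨ rearrange c (suc n ^ k) d (suc n ^ l) ⟩
    (c * d) * (suc n ^ k * suc n ^ l)   ≡⟨ cong (c * d *_) (sym (^-distribˡ-+-* (suc n) k l)) ⟩
    (c * d) * suc n ^ (k + l)           ∎
  where
    open ≤-Reasoning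
    rearrange : ∀ a b c d → (a * b) * (c * d) ≡ (a * c) * (b * d)
    rearrange = solve-∀

pb-poly : ∀ c k → PolyBounded (poly c k)
pb-poly c k = pb-+ (c , k , λ n → ≤-refl) (pb-const c)

-- Sweepers: finite transducers that sweep the tape back and forth, possibly appending
-- one cell at the right end of each round

record Sweeper (Σ′ : ℕ) : Set₁ where
  field
    S X   : Set
    finS  : Finite S
    finX  : Finite X
    R L   : S → X → S × X
    turn  : S → S × Maybe X
    ret   : S → S ⊎ Bool
    s₀    : S
    inpX  : Fin Σ′ → X

  sweepR : S → List X → S × List X
  sweepR s []       = s , []
  sweepR s (x ∷ xs) = let (s′ , x′) = R s x ; (s″ , ys) = sweepR s′ xs in s″ , x′ ∷ ys

  sweepL : S → List X → S × List X
  sweepL s []       = s , []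
  sweepL s (x ∷ xs) = let (s′ , ys) = sweepL s xs ; (s″ , x′) = L s′ x in s″ , x′ ∷ ys

  extend : List X → Maybe X → List X
  extend xs nothing  = xs
  extend xs (just x) = xs ++ x ∷ []

  round : S → List X → S × List X
  round s xs = let (s₁ , ys) = sweepR s xs ; (s₂ , m) = turn s₁ in sweepL s₂ (extend ys m)

  data Rounds : S → List X → S → List X → ℕ → Set where
    ended : ∀ {s xs} → Rounds s xs s xs 0
    fire  : ∀ {s xs s₃ s′ ws t ys n} → round s xs ≡ (s₃ , ws) → ret s₃ ≡ inj₁ s′ →
           Rounds s′ ws t ys n → Rounds s xs t ys (suc n)

  rounds-trans : ∀ {s xs t ys u zs m n} → Rounds s xs t ys m → Rounds t ys u zs n → Rounds s xs u zs (m + n)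
  rounds-trans ended q = q
  rounds-trans (fire e r p) q = fire e r (rounds-trans p q)

  -- `rounds` counts the rounds completed before the halting one, and `wsₕ` is the tape that the
  -- halting round leaves.
  record Halts (w : List (Fin Σ′)) : Set where
    constructor halts
    field
      {sₙ sₕ} : S
      {ysₙ wsₕ} : List X
      rounds  : ℕ
      answer  : Bool
      trace   : Rounds s₀ (map inpX w) sₙ ysₙ rounds
      last    : round sₙ ysₙ ≡ (sₕ , wsₕ)
      stopped : ret sₕ ≡ inj₂ answer

  mid : S → List X → List X
  mid s xs = extend (proj₂ (sweepR s xs)) (proj₂ (turn (proj₁ (sweepR s xs))))

  turned-state : S → List X → S
  turned-state s xs = proj₁ (turn (proj₁ (sweepR s xs)))

  sweepR-length : ∀ s xs → length (proj₂ (sweepR s xs)) ≡ length xs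
  sweepR-length s []       = refl
  sweepR-length s (x ∷ xs) = cong suc (sweepR-length _ xs)

  sweepL-length : ∀ s xs → length (proj₂ (sweepL s xs)) ≡ length xs
  sweepL-length s []       = refl
  sweepL-length s (x ∷ xs) = cong suc (sweepL-length s xs)

  extend-length : ∀ ys m → length (extend ys m) ≤ suc (length ys)
  extend-length ys nothing  = n≤1+n _
  extend-length ys (just x) = ≤-reflexive (trans (length-++ ys) (+-comm (length ys) 1))

-- Turing machines from sweepers

module Machine {Σ′ : ℕ} (W : Sweeper Σ′) where
  open Sweeper W

  -- The square before the cells receives the symbol `home`, where every left sweep stops. `setup`
  -- writes it at the beginning: it steps left of a nonempty input, and uses the starting square
  -- when the input is empty.
  Ctl Sy : Set
  Ctl = S ⊎ (S ⊎ (Bool ⊎ Bool))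
  Sy  = Bool ⊎ X

  pattern goR s   = inj₁ s
  pattern goL s   = inj₂ (inj₁ s)
  pattern setup b = inj₂ (inj₂ (inj₁ b))
  pattern done b  = inj₂ (inj₂ (inj₂ b))
  pattern blank′  = inj₁ false
  pattern home    = inj₁ true
  pattern cell x  = inj₂ x

  abstract
    finCtl : Finite Ctl
    finCtl = fin-⊎ finS (fin-⊎ finS (fin-⊎ fin-Bool fin-Bool))

    finSy : Finite Sy
    finSy = fin-⊎ fin-Bool finX

  returned : S ⊎ Bool → Ctl × Sy × Move
  returned (inj₁ s) = goR s , home , right
  returned (inj₂ b) = done b , home , stay

  turned : S × Maybe X → Ctl × Sy × Move
  turned (s , nothing) = goL s , blank′ , left
  turned (s , just x)  = goL s , cell x , stay

  delta : Ctl → Sy → Ctl × Sy × Move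
  delta (goR s) (cell x) = goR (proj₁ (R s x)) , cell (proj₂ (R s x)) , right
  delta (goR s) (inj₁ _) = turned (turn s)
  delta (goL s) (cell x) = goL (proj₁ (L s x)) , cell (proj₂ (L s x)) , left
  delta (goL s) (inj₁ _) = returned (ret s)
  delta (setup false) (cell x) = setup true , cell x , left
  delta (setup _)     _        = goR s₀ , home , right
  delta (done b) a = done b , a , stay

  halted : Ctl → Maybe Bool
  halted (done b) = just b
  halted _        = nothing

  E : Ctl → Fin (size finCtl)
  E = enc′ finCtl
  e : Sy → Fin (size finSy)
  e = enc′ finSy

  tm : TM Σ′
  tm = record
    { Q = size finCtl ; Γ = size finSy ; blank = e blank′ ; inp = λ a → e (cell (inpX a))
    ; start = E (setup false) ; halt = λ q → halted (dec′ finCtl q)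
    ; δ = λ q a → let (q′ , a′ , m) = delta (dec′ finCtl q) (dec′ finSy a) in E q′ , e a′ , m }

  at : Ctl → List Sy → List Sy → Config tm
  at q ls []       = conf (E q) (map e ls) (e blank′) []
  at q ls (a ∷ rs) = conf (E q) (map e ls) (e a) (map e rs)

  atL : Ctl → Sy → List Sy → List Sy → Config tm
  atL q a ls rs = conf (E q) (map e ls) (e a) (map e rs)

  step-with : ∀ q ls a rs q′ a′ m → halted q ≡ nothing → delta q a ≡ (q′ , a′ , m) →
              step tm (conf (E q) ls (e a) rs) ≡ move tm (E q′) ls (e a′) rs m
  step-with q ls a rs q′ a′ m h d = trans
    (cong (λ z → stepWith tm z c) (trans (cong halted (dec-enc finCtl q)) h))
    (cong (λ D → move tm (E (proj₁ D)) ls (e (proj₁ (proj₂ D))) rs (proj₂ (proj₂ D)))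
      (trans (cong₂ delta (dec-enc finCtl q) (dec-enc finSy a)) d))
    where c = conf (E q) ls (e a) rs

  step-right : ∀ q ls a rs q′ a′ → halted q ≡ nothing → delta q a ≡ (q′ , a′ , right) →
               step tm (conf (E q) (map e ls) (e a) (map e rs)) ≡ at q′ (a′ ∷ ls) rs
  step-right q ls a rs q′ a′ h d = trans (step-with q (map e ls) a (map e rs) q′ a′ right h d) (lemma ls rs)
    where
      lemma : ∀ ls rs → move tm (E q′) (map e ls) (e a′) (map e rs) right ≡ at q′ (a′ ∷ ls) rs
      lemma [] [] = refl
      lemma [] (_ ∷ _) = refl
      lemma (_ ∷ _) [] = refl
      lemma (_ ∷ _) (_ ∷ _) = refl

  step-left : ∀ q l ls a rs q′ a′ → halted q ≡ nothing → delta q a ≡ (q′ , a′ , left) →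
              step tm (conf (E q) (map e (l ∷ ls)) (e a) (map e rs)) ≡ atL q′ l ls (a′ ∷ rs)
  step-left q l ls a rs q′ a′ h d = step-with q (map e (l ∷ ls)) a (map e rs) q′ a′ left h d

  step-stay : ∀ q ls a rs q′ a′ → halted q ≡ nothing → delta q a ≡ (q′ , a′ , stay) →
              step tm (conf (E q) (map e ls) (e a) (map e rs)) ≡ atL q′ a′ ls rs
  step-stay q ls a rs q′ a′ h d = trans (step-with q (map e ls) a (map e rs) q′ a′ stay h d) (lemma ls rs)
    where
      lemma : ∀ ls rs → move tm (E q′) (map e ls) (e a′) (map e rs) stay ≡ atL q′ a′ ls rs
      lemma [] [] = refl
      lemma [] (_ ∷ _) = refl
      lemma (_ ∷ _) [] = refl
      lemma (_ ∷ _) (_ ∷ _) = refl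

  run-+ : ∀ m n c → run tm (m + n) c ≡ run tm n (run tm m c)
  run-+ zero    n c = refl
  run-+ (suc m) n c = run-+ m n (step tm c)

  run-then : ∀ {m n c d f} → run tm m c ≡ d → run tm n d ≡ f → run tm (m + n) c ≡ f
  run-then {m} {n} {c} p q = trans (run-+ m n c) (trans (cong (run tm n) p) q)

  cells : List X → List Sy
  cells = map cell

  sweeping-right : ∀ s xs ls tr → run tm (length xs) (at (goR s) ls (cells xs ++ tr))
                 ≡ at (goR (proj₁ (sweepR s xs))) (cells (proj₂ (sweepR s xs)) ʳ++ ls) tr
  sweeping-right s [] ls tr = refl
  sweeping-right s (x ∷ xs) ls tr = trans
    (cong (run tm (length xs)) (step-right (goR s) ls (cell x) (cells xs ++ tr) _ _ refl refl))
    (sweeping-right (proj₁ (R s x)) xs _ tr)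

  -- the head stands on the last cell of xs, with the left neighbours b ∷ B of xs beyond
  onLast : Ctl → List Sy → Sy → List Sy → List Sy → Config tm
  onLast q [] b B rs = atL q b B rs
  onLast q (c ∷ cs) b B rs = onLast q cs c (b ∷ B) rs

  onLast-++ : ∀ q cs x b B rs → onLast q (cs ++ x ∷ []) b B rs ≡ atL q x (cs ʳ++ (b ∷ B)) rs
  onLast-++ q [] x b B rs = refl
  onLast-++ q (c ∷ cs) x b B rs = onLast-++ q cs x c (b ∷ B) rs

  sweeping-left : ∀ s xs b B rs → run tm (length xs) (onLast (goL s) (cells xs) b B rs)
                ≡ atL (goL (proj₁ (sweepL s xs))) b B (cells (proj₂ (sweepL s xs)) ++ rs)
  sweeping-left s [] b B rs = refl
  sweeping-left s (x ∷ xs) b B rs = subst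
    (λ n → run tm n (onLast (goL s) (cells xs) (cell x) (b ∷ B) rs)
         ≡ atL (goL (proj₁ (sweepL s (x ∷ xs)))) b B (cells (proj₂ (sweepL s (x ∷ xs))) ++ rs))
    (+-comm (length xs) 1)
    (run-then {length xs} {1} (sweeping-left s xs (cell x) (b ∷ B) rs)
      (step-left (goL (proj₁ (sweepL s xs))) b B (cell x) (cells (proj₂ (sweepL s xs)) ++ rs) _ _ refl refl))

  -- A configuration records visited blanks: after a turn that appends nothing, one blank square
  -- stays listed to the right of the cells.
  data Trail : List Sy → Set where
    none : Trail []
    one  : Trail (blank′ ∷ [])

  at-trail : ∀ q ls {tr} → Trail tr → at q ls tr ≡ atL q blank′ ls []
  at-trail q ls none = refl
  at-trail q ls one  = refl

  begins : S → List X → List Sy → Config tm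
  begins s xs tr = at (goR s) (home ∷ []) (cells xs ++ tr)

  turning : ∀ s₁ ys tr → Trail tr → ∃ λ tr′ → Trail tr′ ×
    step tm (at (goR s₁) (cells ys ʳ++ (home ∷ [])) tr)
      ≡ onLast (goL (proj₁ (turn s₁))) (cells (extend ys (proj₂ (turn s₁)))) home [] tr′
  turning s₁ ys tr tr? = go (turn s₁) refl
    where
      blankAt : at (goR s₁) (cells ys ʳ++ (home ∷ [])) tr ≡ atL (goR s₁) blank′ (cells ys ʳ++ (home ∷ [])) []
      blankAt = at-trail (goR s₁) _ tr?
      back : ∀ q cs a b B rs → halted q ≡ nothing → ∀ q′ a′ → delta q a ≡ (q′ , a′ , left) →
             step tm (atL q a (cs ʳ++ (b ∷ B)) rs) ≡ onLast q′ cs b B (a′ ∷ rs)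
      back q [] a b B rs h q′ a′ d = step-left q b B a rs q′ a′ h d
      back q (c ∷ cs) a b B rs h q′ a′ d = back q cs a c (b ∷ B) rs h q′ a′ d
      go : ∀ sm → turn s₁ ≡ sm → ∃ λ tr′ → Trail tr′ ×
        step tm (at (goR s₁) (cells ys ʳ++ (home ∷ [])) tr)
          ≡ onLast (goL (proj₁ sm)) (cells (extend ys (proj₂ sm))) home [] tr′
      go (s₂ , nothing) eq = _ , one , trans (cong (step tm) blankAt)
        (back (goR s₁) (cells ys) blank′ home [] [] refl (goL s₂) blank′ (cong turned eq))
      go (s₂ , just x) eq = _ , none , trans (cong (step tm) blankAt)
        (trans (step-stay (goR s₁) (cells ys ʳ++ (home ∷ [])) blank′ [] (goL s₂) (cell x) refl (cong turned eq))
          (sym (trans (cong (λ z → onLast (goL s₂) z home [] []) (map-++ cell ys (x ∷ [])))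
                      (onLast-++ (goL s₂) (cells ys) (cell x) home [] []))))

  roundCost : S → List X → ℕ
  roundCost s xs = length xs + (1 + length (mid s xs))

  round-run : ∀ s xs tr → Trail tr → ∃ λ tr′ → Trail tr′ ×
    run tm (roundCost s xs) (begins s xs tr)
      ≡ atL (goL (proj₁ (round s xs))) home [] (cells (proj₂ (round s xs)) ++ tr′)
  round-run s xs tr tr? with turning (proj₁ (sweepR s xs)) (proj₂ (sweepR s xs)) tr tr?
  ... | tr′ , tr′? , eq = tr′ , tr′? ,
    run-then {length xs} (sweeping-right s xs (home ∷ []) tr)
      (run-then {1} {length (mid s xs)} eq (sweeping-left (turned-state s xs) (mid s xs) home [] tr′))

  roundCost-≤ : ∀ s xs → roundCost s xs ≤ 2 * length xs + 2
  roundCost-≤ s xs = begin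
    length xs + (1 + length (mid s xs))
      ≤⟨ +-monoʳ-≤ (length xs) (s≤s (extend-length (proj₂ (sweepR s xs)) (proj₂ (turn (proj₁ (sweepR s xs)))))) ⟩
    length xs + (2 + length (proj₂ (sweepR s xs)))
      ≡⟨ cong (λ z → length xs + (2 + z)) (sweepR-length s xs) ⟩
    length xs + (2 + length xs) ≡⟨ arith (length xs) ⟩
    2 * length xs + 2 ∎
    where
      open ≤-Reasoning
      arith : ∀ n → n + (2 + n) ≡ 2 * n + 2
      arith = solve-∀

  round-length : ∀ s xs → length (proj₂ (round s xs)) ≤ suc (length xs)
  round-length s xs = ≤-trans (≤-reflexive (sweepL-length (turned-state s xs) (mid s xs)))
    (≤-trans (extend-length (proj₂ (sweepR s xs)) (proj₂ (turn (proj₁ (sweepR s xs))))) (s≤s (≤-reflexive (sweepR-length s xs))))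

  rounds-run : ∀ {s xs t ys n} → Rounds s xs t ys n → ∀ tr → Trail tr → ∃ λ T → ∃ λ tr′ → Trail tr′ ×
    run tm T (begins s xs tr) ≡ begins t ys tr′ × T ≤ n * (2 * (length xs + n) + 3)
  rounds-run ended tr tr? = 0 , tr , tr? , refl , z≤n
  rounds-run (fire {s} {xs} {n = n} refl re r) tr tr? with round-run s xs tr tr?
  ... | tr₁ , tr₁? , eq₁ with rounds-run r tr₁ tr₁?
  ... | T , tr′ , tr′? , eq , T≤ = roundCost s xs + (1 + T) , tr′ , tr′? ,
        run-then {roundCost s xs} eq₁ (run-then {1} {T}
          (step-right (goL _) [] home (cells (proj₂ (round s xs)) ++ tr₁) _ _ refl (cong returned re)) eq) , bound
    where
      open ≤-Reasoning
      m = length xs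
      arith : ∀ m n → (2 * m + 2) + (1 + n * (2 * (suc m + n) + 3)) ≡ (2 * m + 3) + n * (2 * (m + suc n) + 3)
      arith = solve-∀
      bound : roundCost s xs + (1 + T) ≤ suc n * (2 * (m + suc n) + 3)
      bound = begin
        roundCost s xs + (1 + T)
          ≤⟨ +-mono-≤ (roundCost-≤ s xs) (s≤s (≤-trans T≤ (*-monoʳ-≤ n
               (+-monoˡ-≤ 3 (*-monoʳ-≤ 2 (+-monoˡ-≤ n (round-length s xs))))))) ⟩
        (2 * m + 2) + (1 + n * (2 * (suc m + n) + 3)) ≡⟨ arith m n ⟩
        (2 * m + 3) + n * (2 * (m + suc n) + 3)
          ≤⟨ +-monoˡ-≤ (n * (2 * (m + suc n) + 3)) (+-monoˡ-≤ 3 (*-monoʳ-≤ 2 (m≤m+n m (suc n)))) ⟩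
        suc n * (2 * (m + suc n) + 3) ∎

  rounds-length : ∀ {s xs t ys n} → Rounds s xs t ys n → length ys ≤ length xs + n
  rounds-length ended = m≤m+n _ 0
  rounds-length (fire {s} {xs} {n = n} refl re r) = ≤-trans (rounds-length r)
    (≤-trans (+-monoˡ-≤ n (round-length s xs)) (≤-reflexive (sym (+-suc (length xs) n))))

  map-inp : ∀ w → map e (cells (map inpX w)) ≡ map (TM.inp tm) w
  map-inp []      = refl
  map-inp (a ∷ w) = cong (e (cell (inpX a)) ∷_) (map-inp w)

  setting-up : ∀ w → ∃ λ T → T ≤ 2 × run tm T (init tm w) ≡ begins s₀ (map inpX w) []
  setting-up [] = 1 , s≤s z≤n ,
    step-right (setup false) [] blank′ [] (goR s₀) home refl refl
  setting-up (a ∷ w) = 2 , ≤-refl , trans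
    (cong (λ z → run tm 2 (conf (E (setup false)) [] (e (cell (inpX a))) z)) (sym (map-inp w)))
    (trans (cong (step tm) (step-with (setup false) [] (cell (inpX a)) (map e (cells (map inpX w)))
              (setup true) (cell (inpX a)) left refl refl))
      (trans (step-right (setup true) [] blank′ (cells (map inpX (a ∷ w))) (goR s₀) home refl refl)
        (cong (at (goR s₀) (home ∷ [])) (sym (++-identityʳ (cells (map inpX (a ∷ w))))))))

  halting-run : ∀ w (h : Halts w) → let open Halts h in ∃ λ T → ∃ λ tr → Trail tr ×
    run tm T (init tm w) ≡ atL (done answer) home [] (cells wsₕ ++ tr)
      × T ≤ 2 + (rounds * (2 * (length w + rounds) + 3) + (2 * (length w + rounds) + 3))
  halting-run w (halts {sₙ} {ysₙ = ysₙ} n b trace refl stopped) with setting-up w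
  ... | T₀ , T₀≤ , eq₀ with rounds-run trace [] none
  ... | T₁ , tr₁ , tr₁? , eq₁ , T₁≤ with round-run sₙ ysₙ tr₁ tr₁?
  ... | tr₂ , tr₂? , eq₂ = T₀ + (T₁ + (roundCost sₙ ysₙ + 1)) , tr₂ , tr₂? ,
        run-then {T₀} eq₀ (run-then {T₁} eq₁ (run-then {roundCost sₙ ysₙ} eq₂
          (step-stay (goL _) [] home _ (done b) home refl (cong returned stopped)))) ,
        +-mono-≤ T₀≤ (+-mono-≤
          (subst (λ m → T₁ ≤ n * (2 * (m + n) + 3)) (length-map inpX w) T₁≤)
          (≤-trans (+-monoˡ-≤ 1 (roundCost-≤ sₙ ysₙ))
            (≤-trans (≤-reflexive (+-assoc (2 * length ysₙ) 2 1))
              (+-monoˡ-≤ 3 (*-monoʳ-≤ 2 (subst (λ m → length ysₙ ≤ m + n) (length-map inpX w) (rounds-length trace)))))))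

  outcome-done : ∀ b rs → outcome tm (atL (done b) home [] rs) ≡ just b
  outcome-done b rs = cong halted (dec-enc finCtl (done b))

  done-fixed : ∀ b rs t → run tm t (atL (done b) home [] rs) ≡ atL (done b) home [] rs
  done-fixed b rs zero = refl
  done-fixed b rs (suc t) = trans (cong (run tm t) fixed) (done-fixed b rs t)
    where
      fixed : step tm (atL (done b) home [] rs) ≡ atL (done b) home [] rs
      fixed rewrite dec-enc finCtl (done b) = refl

module _ {Σ′ : ℕ} (M : TM Σ′) where

  move-space : ∀ q ls a rs m → length ls + suc (length rs) ≤ space M (move M q ls a rs m)
  move-space q []       a rs       left  = s≤s (n≤1+n _)
  move-space q (x ∷ ls) a rs       left  = ≤-reflexive (sym (+-suc (length ls) (suc (length rs))))
  move-space q []       a []       right = s≤s z≤n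
  move-space q (x ∷ ls) a []       right = s≤s (≤-trans (n≤1+n _) (≤-reflexive refl))
  move-space q []       a (x ∷ rs) right = ≤-refl
  move-space q (y ∷ ls) a (x ∷ rs) right = ≤-reflexive (cong suc (+-suc (length ls) (suc (length rs))))
  move-space q []       a []       stay  = ≤-refl
  move-space q (_ ∷ _)  a []       stay  = ≤-refl
  move-space q []       a (x ∷ rs) stay  = ≤-refl
  move-space q (_ ∷ _)  a (x ∷ rs) stay  = ≤-refl

  step-space : ∀ c → space M c ≤ space M (step M c)
  step-space (conf q ls a rs) with TM.halt M q
  ... | just _  = ≤-refl
  ... | nothing = move-space (proj₁ (TM.δ M q a)) ls (proj₁ (proj₂ (TM.δ M q a))) rs (proj₂ (proj₂ (TM.δ M q a)))

  run-space : ∀ t c → space M c ≤ space M (run M t c)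
  run-space zero    c = ≤-refl
  run-space (suc t) c = ≤-trans (step-space c) (run-space t (step M c))

module _ {Σ′ : ℕ} (W : Sweeper Σ′) where
  open Sweeper W
  open Machine W

  -- The visited space never decreases, so at all times it is bounded by its value at the halting
  -- configuration: the input cells, `home` and at most one blank.
  sweeper-PSPACE : (∀ s → proj₂ (turn s) ≡ nothing) → (𝓛 : Language Σ′) →
    (∀ w → Σ (Halts w) λ h → (Halts.answer h ≡ true) ⇔ 𝓛 w) → InPSPACE 𝓛
  sweeper-PSPACE no-append 𝓛 decide = tm , 2 , 1 , (λ w → accepts w (decide w)) , λ w t → bound w t (decide w)
    where
      accepts : ∀ w → (Σ (Halts w) λ h → (Halts.answer h ≡ true) ⇔ 𝓛 w) → Σ ℕ λ t → Σ Bool λ b →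
        outcome tm (run tm t (init tm w)) ≡ just b × ((b ≡ true) ⇔ 𝓛 w)
      accepts w (h , iff) with halting-run w h
      ... | T , tr , _ , eq , _ = T , Halts.answer h ,
            trans (cong (outcome tm) eq) (outcome-done (Halts.answer h) (cells (Halts.wsₕ h) ++ tr)) , iff
      round-len : ∀ s xs → length (proj₂ (round s xs)) ≡ length xs
      round-len s xs = trans (sweepL-length (turned-state s xs) (mid s xs))
        (trans (cong (λ m → length (extend (proj₂ (sweepR s xs)) m)) (no-append (proj₁ (sweepR s xs)))) (sweepR-length s xs))
      rounds-len : ∀ {s xs t ys n} → Rounds s xs t ys n → length ys ≡ length xs
      rounds-len ended = refl
      rounds-len (fire {s} {xs} refl re r) = trans (rounds-len r) (round-len s xs)
      bound : ∀ w t → (Σ (Halts w) λ h → (Halts.answer h ≡ true) ⇔ 𝓛 w) → space tm (run tm t (init tm w)) ≤ poly 2 1 (length w)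
      bound w t (h , _) with halting-run w h
      bound w t (halts {sₙ} {ysₙ = ysₙ} n b trace refl stopped , _) | T , tr , tr? , eq , _ = begin
        space tm (run tm t c₀) ≤⟨ run-space tm T (run tm t c₀) ⟩
        space tm (run tm T (run tm t c₀)) ≡⟨ cong (space tm) (trans (sym (run-+ t T c₀)) (cong (λ z → run tm z c₀) (+-comm t T))) ⟩
        space tm (run tm (T + t) c₀) ≡⟨ cong (space tm) (run-then {T} {t} eq (done-fixed b (cells (proj₂ (round sₙ ysₙ)) ++ tr) t)) ⟩
        suc (length (map e (cells (proj₂ (round sₙ ysₙ)) ++ tr))) ≡⟨ cong suc (trans (length-map e (cells (proj₂ (round sₙ ysₙ)) ++ tr))
            (trans (length-++ (cells (proj₂ (round sₙ ysₙ))) {tr}) (cong (_+ length tr) (trans (length-map inj₂ (proj₂ (round sₙ ysₙ)))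
              (trans (round-len sₙ ysₙ) (trans (rounds-len trace) (length-map inpX w))))))) ⟩
        suc (length w + length tr) ≤⟨ s≤s (+-monoʳ-≤ (length w) (small tr?)) ⟩
        suc (length w + 1) ≤⟨ m≤m+n _ (length w + 2) ⟩
        suc (length w + 1) + (length w + 2) ≡⟨ arith (length w) ⟩
        poly 2 1 (length w) ∎
        where
          open ≤-Reasoning
          c₀ = init tm w
          small : ∀ {tr} → Trail tr → length tr ≤ 1
          small none = z≤n
          small one  = ≤-refl
          arith : ∀ n → suc (n + 1) + (n + 2) ≡ 2 * (suc n * 1) + 2
          arith = solve-∀

  -- A round takes time linear in the length of the tape, and the tape grows by at most one cell per
  -- round, so polynomially many rounds take polynomial time.
  sweeper-polytime : ∀ {Σ₂} (dec : X → Maybe (Fin Σ₂)) (f : List (Fin Σ′) → List (Fin Σ₂)) (g : ℕ → ℕ) → PolyBounded g →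
    (∀ w → Σ (Halts w) λ h → Halts.rounds h ≤ g (length w) × mapMaybe dec (Halts.wsₕ h) ≡ f w) → PolyTimeComputable f
  sweeper-polytime {Σ₂} dec f g pb compute with pb-+ (pb-const 2) (pb-+ (pb-* pb (pb-+ (pb-* (pb-const 2) (pb-+ pb-id pb)) (pb-const 3)))
                                                           (pb-+ (pb-* (pb-const 2) (pb-+ pb-id pb)) (pb-const 3)))
  ... | c , k , poly-bound = tm , (λ a → decode (dec′ finSy a)) , c , k , λ w → answer w (compute w)
    where
      decode : Sy → Maybe (Fin Σ₂)
      decode (inj₁ _) = nothing
      decode (cell x) = dec x
      decode-cells : ∀ ws {tr} → Trail tr → mapMaybe (λ a → decode (dec′ finSy a)) (map e (cells ws ++ tr)) ≡ mapMaybe dec ws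
      decode-cells [] none = refl
      decode-cells [] one rewrite dec-enc finSy blank′ = refl
      decode-cells (x ∷ ws) tr? rewrite dec-enc finSy (cell x) with dec x
      ... | nothing = decode-cells ws tr?
      ... | just _  = cong (_ ∷_) (decode-cells ws tr?)
      answer : ∀ w → (Σ (Halts w) λ h → Halts.rounds h ≤ g (length w) × mapMaybe dec (Halts.wsₕ h) ≡ f w) →
        Σ ℕ λ t → t ≤ poly c k (length w) × Σ Bool λ b → outcome tm (run tm t (init tm w)) ≡ just b
          × output tm (λ a → decode (dec′ finSy a)) (run tm t (init tm w)) ≡ f w
      answer w (h , n≤ , out) with halting-run w h
      ... | T , tr , tr? , eq , T≤ = T , ≤-trans T≤ (≤-trans (≤-trans mono (poly-bound (length w))) (m≤m+n _ c)) ,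
            Halts.answer h , trans (cong (outcome tm) eq) (outcome-done (Halts.answer h) (cells (Halts.wsₕ h) ++ tr)) ,
            trans (cong (output tm (λ a → decode (dec′ finSy a))) eq) final
        where
          m = length w
          mono : 2 + (Halts.rounds h * (2 * (m + Halts.rounds h) + 3) + (2 * (m + Halts.rounds h) + 3))
               ≤ 2 + (g m * (2 * (m + g m) + 3) + (2 * (m + g m) + 3))
          mono = +-monoʳ-≤ 2 (+-mono-≤ (*-mono-≤ n≤ inner) inner)
            where inner = +-monoˡ-≤ 3 (*-monoʳ-≤ 2 (+-monoʳ-≤ m n≤))
          final : mapMaybe (λ a → decode (dec′ finSy a)) (e home ∷ map e (cells (Halts.wsₕ h) ++ tr)) ≡ f w
          final rewrite dec-enc finSy home = trans (decode-cells (Halts.wsₕ h) tr?) out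

-- A sweeper deciding provability: cells, states and transitions

module Decider where

  pattern EQ = nothing
  pattern LT = just false
  pattern GT = just true

  Ordr : Set
  Ordr = Maybe Bool

  dsym : Bool → Sym
  dsym false = c1
  dsym true  = c2

  data SymKind : Set where
    opn cls oth : SymKind
    dig : Bool → SymKind

  kindOf : Sym → SymKind
  kindOf c⟨ = opn
  kindOf c⟩ = cls
  kindOf c1 = dig false
  kindOf c2 = dig true
  kindOf _  = oth

  arity : Sym → ℕ
  arity c∧ = 2
  arity c∨ = 2
  arity c⇒ = 2
  arity c¬ = 1
  arity c⟨ = 1
  arity _  = 0

  -- A cell carries its symbol, an evaluation status, and three bits and a flag used by numbers:
  -- s (current truth value of the diamond), r (it is about to become true), p (selected), and the
  -- outcome of comparing the digit with the corresponding digit of the selected number.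
  Ev Flag Cell : Set
  Ev   = Maybe (Maybe Bool)
  Flag = Maybe Ordr
  Cell = Sym × Ev × Bool × Bool × Bool × Flag

  -- A cell is `fresh` until it is evaluated, then `live b` if it is the root of a subformula whose
  -- value `b` still awaits an operator, and `dead` once that value is consumed. Digits and `c⟩`
  -- carry no value and become `dead` at once.
  pattern fresh  = nothing
  pattern dead   = just nothing
  pattern live b = just (just b)
  pattern unseen = nothing
  pattern seen o = just o

  Args : Set
  Args = Maybe (Bool × Maybe Bool)

  pattern A0     = nothing
  pattern A1 a   = just (a , nothing)
  pattern A2 a b = just (a , just b)

  -- In `ev n o a k`, `n` says that digits await their `c⟨`, `o` is the last fresh symbol met, `a`
  -- holds the live values to its right, and `k` tells whether some diamond is due to become true.
  -- `put` looks for the cell that receives the result. A step of the odometer uses `pick` to select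
  -- a due diamond, `coll` to fetch the next digit of its number, `app` to compare that digit with
  -- all numbers, and `fin` to conclude.
  DState : Set
  DState = (Bool × Maybe Sym × Args × Bool) ⊎ (Bool × Maybe Bool) ⊎ Bool ⊎ Fin 5 ⊎ Bool
         ⊎ (Maybe Bool × Maybe Bool) ⊎ (Bool × Bool) ⊎ Ordr

  pattern ev n o a r = inj₁ (n , o , a , r)
  pattern put n b    = inj₂ (inj₁ (n , b))
  pattern back n     = inj₂ (inj₂ (inj₁ n))
  pattern die        = inj₂ (inj₂ (inj₂ (inj₁ fz)))
  pattern acc        = inj₂ (inj₂ (inj₂ (inj₁ (fs fz))))
  pattern rst        = inj₂ (inj₂ (inj₂ (inj₁ (fs (fs fz)))))
  pattern toEv       = inj₂ (inj₂ (inj₂ (inj₁ (fs (fs (fs fz))))))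
  pattern idle       = inj₂ (inj₂ (inj₂ (inj₁ (fs (fs (fs (fs fz)))))))
  pattern pick f     = inj₂ (inj₂ (inj₂ (inj₂ (inj₁ f))))
  pattern coll c d   = inj₂ (inj₂ (inj₂ (inj₂ (inj₂ (inj₁ (c , d))))))
  pattern app d q    = inj₂ (inj₂ (inj₂ (inj₂ (inj₂ (inj₂ (inj₁ (d , q)))))))
  pattern fin o      = inj₂ (inj₂ (inj₂ (inj₂ (inj₂ (inj₂ (inj₂ o))))))

  pushArg : Args → Bool → Args
  pushArg A0       b = A1 b
  pushArg (A1 a)   b = A2 a b
  pushArg (A2 a c) b = A2 a c

  argCount : Args → ℕ
  argCount A0       = 0
  argCount (A1 _)   = 1
  argCount (A2 _ _) = 2

  wants : Maybe Sym → Args → Bool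
  wants nothing  _    = true
  wants (just x) args = argCount args <ᵇ arity x

  kill : Maybe Sym → Bool → Ev
  kill nothing  b = live b
  kill (just _) b = dead

  evR : Bool → Maybe Sym → Args → Bool → Cell → DState × Cell
  evR n o a k (x , fresh , s , r , p , f)  = ev n (just x) a (k ∨ r) , (x , fresh , s , r , p , f)
  evR n o a k (x , dead , s , r , p , f)   = ev n o a (k ∨ r) , (x , dead , s , r , p , f)
  evR n o a k (x , live b , s , r , p , f) with wants o a
  ... | true  = ev n o (pushArg a b) (k ∨ r) , (x , kill o b , s , r , p , f)
  ... | false = ev n o a (k ∨ r) , (x , live b , s , r , p , f)

  result : Bool → Sym → Args → Maybe (Bool × Maybe Bool)
  result true  c1 _        = just (true , nothing)
  result true  c2 _        = just (true , nothing)
  result true  c⟨ (A1 b)   = just (false , just b)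
  result false c⟩ _        = just (true , nothing)
  result false c⊤ _        = just (false , just true)
  result false c⊥ _        = just (false , just false)
  result false c∧ (A2 a b) = just (false , just (a ∧ b))
  result false c∨ (A2 a b) = just (false , just (a ∨ b))
  result false c⇒ (A2 a b) = just (false , just (not a ∨ b))
  result false c¬ (A1 b)   = just (false , just (not b))
  result _     _  _        = nothing

  putOrDie : Maybe (Bool × Maybe Bool) → DState
  putOrDie nothing        = die
  putOrDie (just (n , b)) = put n b

  -- A single true value leads to the next valuation if some diamond is due and to acceptance
  -- otherwise. A false value, or a string that is not one formula, leads to rejection.
  verdict : Bool → Args → Bool → DState
  verdict false (A1 true) true  = rst
  verdict false (A1 true) false = acc
  verdict _     _         _     = die

  digitOrder : Bool → Bool → Ordr
  digitOrder false false = EQ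
  digitOrder false true  = LT
  digitOrder true  false = GT
  digitOrder true  true  = EQ

  -- Within each number only the first unseen digit meets the broadcast digit. If `c⟩` comes first,
  -- the number has fewer digits than the selected one and is therefore smaller.
  appR : SymKind → Bool → Bool → Flag → Bool × Flag
  appR opn     d q     f        = true , f
  appR cls     d true  f        = false , seen LT
  appR cls     d false f        = false , f
  appR (dig a) d true  unseen   = false , seen (digitOrder a d)
  appR (dig a) d q     f        = q , f
  appR oth     d q     f        = q , f

  decR : DState → Cell → DState × Cell
  decR (ev n o a k) c = evR n o a k c
  decR (pick f) (x , e , s , r , p , fl) = pick (f ∨ r) , (x , e , s , r , not f ∧ r , fl)
  decR (app d q) (x , e , s , r , p , fl) =
    let (q′ , fl′) = appR (kindOf x) d q fl in app d q′ , (x , e , s , r , p , fl′)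
  decR q c = q , c

  -- On a left sweep the unseen digit met last before `c⟨` is the first one of the number; it is
  -- handed on only if the diamond is the selected one.
  collL : SymKind → Bool → Flag → Maybe Bool → Maybe Bool → Maybe Bool × Maybe Bool
  collL opn     true  f      c d = nothing , c
  collL opn     false f      c d = nothing , d
  collL cls     p     f      c d = nothing , d
  collL (dig a) p     unseen c d = just a , d
  collL (dig a) p     (seen _) c d = c , d
  collL oth     p     f      c d = c , d

  firstOf : Ordr → Ordr → Ordr
  firstOf EQ       o = o
  firstOf (just b) _ = just b

  -- The odometer step seen from one diamond. Below the selected level the bit `r` is kept, because
  -- a due diamond there must still get its turn.
  updSR : Ordr → Bool → Bool → Bool × Bool
  updSR LT s r = s , r
  updSR EQ s r = s ∨ r , false
  updSR GT s r = false , false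

  -- Digits are stored least significant first, so a left sweep meets the most significant ones
  -- first and the earlier outcome wins. A digit still unseen belongs to a number longer than the
  -- selected one, hence greater.
  finL : SymKind → Ordr → Cell → Ordr × Cell
  finL opn o (x , e , s , r , p , f) = EQ , (x , e , proj₁ (updSR o s r) , proj₂ (updSR o s r) , false , f)
  finL cls o (x , e , s , r , p , unseen)  = EQ , (x , e , s , r , p , unseen)
  finL cls o (x , e , s , r , p , seen o′) = o′ , (x , e , s , r , p , unseen)
  finL (dig a) o (x , e , s , r , p , unseen)  = GT , (x , e , s , r , p , unseen)
  finL (dig a) o (x , e , s , r , p , seen o′) = firstOf o o′ , (x , e , s , r , p , unseen)
  finL oth o c = o , c

  -- The value of a diamond is its stored bit `s`; the value `b` of its argument only decides
  -- whether the diamond is due.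
  putL : Bool → Maybe Bool → Cell → DState × Cell
  putL n b        (x , just e , s , r , p , f) = put n b , (x , just e , s , r , p , f)
  putL n nothing  (x , fresh , s , r , p , f) = back n , (x , dead , false , false , false , f)
  putL n (just b) (x , fresh , s , r , p , f) with kindOf x
  ... | opn = back n , (x , live s , s , not s ∧ b , false , f)
  ... | _   = back n , (x , live b , false , false , false , f)

  decL : DState → Cell → DState × Cell
  decL (put n b) c = putL n b c
  decL rst (x , e , s , r , p , f) = rst , (x , fresh , s , r , p , f)
  decL (coll c d) (x , e , s , r , p , f) =
    let (c′ , d′) = collL (kindOf x) p f c d in coll c′ d′ , (x , e , s , r , p , f)
  decL (fin o) c@(x , _) = let (o′ , c′) = finL (kindOf x) o c in fin o′ , c′
  decL q c = q , c

  decTurn : DState → DState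
  decTurn (ev n nothing a k)  = verdict n a k
  decTurn (ev n (just x) a k) = putOrDie (result n x a)
  decTurn (pick true)  = coll nothing nothing
  decTurn (pick false) = toEv
  decTurn (app d q)    = coll nothing nothing
  decTurn idle         = fin EQ
  decTurn q            = q

  decRet : DState → DState ⊎ Bool
  decRet (back n)          = inj₁ (ev n nothing A0 false)
  decRet acc               = inj₂ true
  decRet rst               = inj₁ (pick false)
  decRet toEv              = inj₁ (ev false nothing A0 false)
  decRet (coll _ (just d)) = inj₁ (app d false)
  decRet (coll _ nothing)  = inj₁ idle
  decRet (fin _)           = inj₁ (pick false)
  decRet _                 = inj₂ false

  rawCell : Sym × Bool × Bool × Bool → Cell
  rawCell (x , s , r , p) = x , fresh , s , r , p , unseen

  decider : Sweeper 10
  decider = record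
    { S = DState ; X = Cell
    ; finS = fin-⊎ (fin-× fin-Bool (fin-× (fin-Maybe fin-Fin) (fin-× (fin-Maybe (fin-× fin-Bool (fin-Maybe fin-Bool))) fin-Bool)))
            (fin-⊎ (fin-× fin-Bool (fin-Maybe fin-Bool)) (fin-⊎ fin-Bool (fin-⊎ fin-Fin (fin-⊎ fin-Bool
            (fin-⊎ (fin-× (fin-Maybe fin-Bool) (fin-Maybe fin-Bool)) (fin-⊎ (fin-× fin-Bool fin-Bool) (fin-Maybe fin-Bool)))))))
    ; finX = fin-× fin-Fin (fin-× (fin-Maybe (fin-Maybe fin-Bool)) (fin-× fin-Bool (fin-× fin-Bool (fin-× fin-Bool (fin-Maybe (fin-Maybe fin-Bool))))))
    ; R = decR ; L = decL ; turn = λ s → decTurn s , nothing ; ret = decRet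
    ; s₀ = ev false nothing A0 false ; inpX = λ x → rawCell (x , false , false , false) }

  open Sweeper decider using (sweepR; sweepL; round; Rounds; ended; fire; rounds-trans; Halts; halts)

  sweepR-++ : ∀ s xs ys → sweepR s (xs ++ ys) ≡
    (proj₁ (sweepR (proj₁ (sweepR s xs)) ys) , proj₂ (sweepR s xs) ++ proj₂ (sweepR (proj₁ (sweepR s xs)) ys))
  sweepR-++ s [] ys = refl
  sweepR-++ s (x ∷ xs) ys rewrite sweepR-++ (proj₁ (decR s x)) xs ys = refl

  sweepL-++ : ∀ s xs ys → sweepL s (xs ++ ys) ≡
    (proj₁ (sweepL (proj₁ (sweepL s ys)) xs) , proj₂ (sweepL (proj₁ (sweepL s ys)) xs) ++ proj₂ (sweepL s ys))
  sweepL-++ s [] ys = refl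
  sweepL-++ s (x ∷ xs) ys rewrite sweepL-++ s xs ys = refl

  R-then : ∀ {s xs s′ xs′ ys s″ ys′} → sweepR s xs ≡ (s′ , xs′) → sweepR s′ ys ≡ (s″ , ys′) →
           sweepR s (xs ++ ys) ≡ (s″ , xs′ ++ ys′)
  R-then {s} {xs} {ys = ys} refl refl = sweepR-++ s xs ys

  L-then : ∀ {s xs s′ xs′ ys s″ ys′} → sweepL s ys ≡ (s′ , ys′) → sweepL s′ xs ≡ (s″ , xs′) →
           sweepL s (xs ++ ys) ≡ (s″ , xs′ ++ ys′)
  L-then {s} {xs} {ys = ys} refl refl = sweepL-++ s xs ys

  cell-cons : ∀ (c : Cell) {q cs} {z : DState × List Cell} → z ≡ (q , cs) → (proj₁ z , c ∷ proj₂ z) ≡ (q , c ∷ cs)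
  cell-cons c refl = refl

  R-cons : ∀ s x xs {s′ x′ s″ xs′} → decR s x ≡ (s′ , x′) → sweepR s′ xs ≡ (s″ , xs′) →
           sweepR s (x ∷ xs) ≡ (s″ , x′ ∷ xs′)
  R-cons s x xs refl refl = refl

  L-cons : ∀ s x xs {s′ x′ s″ xs′} → sweepL s xs ≡ (s′ , xs′) → decL s′ x ≡ (s″ , x′) →
           sweepL s (x ∷ xs) ≡ (s″ , x′ ∷ xs′)
  L-cons s x xs refl refl = refl

  round-of : ∀ {s xs s₁ ys t zs} → sweepR s xs ≡ (s₁ , ys) → sweepL (decTurn s₁) ys ≡ (t , zs) →
             round s xs ≡ (t , zs)
  round-of refl refl = refl

  -- Trees describing the contents of the tape

  data BinOp : Set where
    and or imp : BinOp

  opSym : BinOp → Sym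
  opSym and = c∧
  opSym or  = c∨
  opSym imp = c⇒

  opVal : BinOp → Bool → Bool → Bool
  opVal and a b = a ∧ b
  opVal or  a b = a ∨ b
  opVal imp a b = not a ∨ b

  leafSym : Bool → Sym
  leafSym true  = c⊤
  leafSym false = c⊥

  data Tree : Set where
    leaf : Bool → Tree
    bin  : BinOp → Tree → Tree → Tree
    neg  : Tree → Tree
    dia  : List Bool → (s r p : Bool) → Tree → Tree

  val : Tree → Bool
  val (leaf b) = b
  val (bin o l r) = opVal o (val l) (val r)
  val (neg t) = not (val t)
  val (dia _ s _ _ _) = s

  -- the digits D after comparison with the initial segment E of the selected number
  numCells : Ev → List Bool → List Bool → List Cell
  numCells y [] []          = (c⟩ , y , false , false , false , unseen) ∷ []
  numCells y [] (_ ∷ _)     = (c⟩ , y , false , false , false , seen LT) ∷ []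
  numCells y (a ∷ D) []     = (dsym a , y , false , false , false , unseen) ∷ numCells y D []
  numCells y (a ∷ D) (b ∷ E) = (dsym a , y , false , false , false , seen (digitOrder a b)) ∷ numCells y D E

  node : Sym → Ev → Cell
  node x e = x , e , false , false , false , unseen

  -- `x` is the status of the root cell, `y` that of all other cells, and `E` the part of the
  -- selected number broadcast so far.
  treeCells : Ev → Ev → List Bool → Tree → List Cell
  treeCells x y E (leaf b) = node (leafSym b) x ∷ []
  treeCells x y E (bin o l r) = node (opSym o) x ∷ (treeCells y y E l ++ treeCells y y E r)
  treeCells x y E (neg t) = node c¬ x ∷ treeCells y y E t
  treeCells x y E (dia D s r p t) = (c⟨ , x , s , r , p , unseen) ∷ (numCells y D E ++ treeCells y y E t)

  evaluated : Tree → List Cell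
  evaluated t = treeCells (live (val t)) dead [] t

  -- Evaluation: one symbol per round, from right to left

  anyR : Bool → List Cell → Bool
  anyR k [] = k
  anyR k ((_ , _ , _ , r , _) ∷ cs) = anyR (k ∨ r) cs

  Dead Done : Cell → Set
  Dead (_ , e , _) = e ≡ dead
  Done (_ , e , _) = e ≢ fresh

  numCells-dead : ∀ D E → All Dead (numCells dead D E)
  numCells-dead [] [] = refl ∷ []
  numCells-dead [] (_ ∷ _) = refl ∷ []
  numCells-dead (_ ∷ D) [] = refl ∷ numCells-dead D []
  numCells-dead (_ ∷ D) (_ ∷ E) = refl ∷ numCells-dead D E

  treeCells-dead : ∀ E t → All Dead (treeCells dead dead E t)
  treeCells-dead E (leaf b) = refl ∷ []
  treeCells-dead E (bin o l r) = refl ∷ ++⁺ (treeCells-dead E l) (treeCells-dead E r)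
  treeCells-dead E (neg t) = refl ∷ treeCells-dead E t
  treeCells-dead E (dia D s r p t) = refl ∷ ++⁺ (numCells-dead D E) (treeCells-dead E t)

  ev-dead : ∀ n o a k cs → All Dead cs → sweepR (ev n o a k) cs ≡ (ev n o a (anyR k cs) , cs)
  ev-dead n o a k [] [] = refl
  ev-dead n o a k ((_ , _ , _ , r , _) ∷ cs) (refl ∷ ds) = cell-cons _ (ev-dead n o a (k ∨ r) cs ds)

  treeHead : Ev → Tree → Cell
  treeHead x (leaf b)        = node (leafSym b) x
  treeHead x (bin o _ _)     = node (opSym o) x
  treeHead x (neg _)         = node c¬ x
  treeHead x (dia _ s r p _) = c⟨ , x , s , r , p , unseen

  treeTail : Ev → List Bool → Tree → List Cell
  treeTail y E (leaf b)        = []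
  treeTail y E (bin o l r)     = treeCells y y E l ++ treeCells y y E r
  treeTail y E (neg t)         = treeCells y y E t
  treeTail y E (dia D s r p t) = numCells y D E ++ treeCells y y E t

  head-tail : ∀ x y E t → treeCells x y E t ≡ treeHead x t ∷ treeTail y E t
  head-tail x y E (leaf b) = refl
  head-tail x y E (bin o l r) = refl
  head-tail x y E (neg t) = refl
  head-tail x y E (dia D s r p t) = refl

  tail-dead : ∀ E t → All Dead (treeTail dead E t)
  tail-dead E (leaf b) = []
  tail-dead E (bin o l r) = ++⁺ (treeCells-dead E l) (treeCells-dead E r)
  tail-dead E (neg t) = treeCells-dead E t
  tail-dead E (dia D s r p t) = ++⁺ (numCells-dead D E) (treeCells-dead E t)

  ev-head : ∀ n o a k t → wants o a ≡ true → ∃ λ k′ →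
    decR (ev n o a k) (treeHead (live (val t)) t) ≡ (ev n o (pushArg a (val t)) k′ , treeHead (kill o (val t)) t)
  ev-head n o a k (leaf b) w rewrite w = _ , refl
  ev-head n o a k (bin _ _ _) w rewrite w = _ , refl
  ev-head n o a k (neg _) w rewrite w = _ , refl
  ev-head n o a k (dia _ _ _ _ _) w rewrite w = _ , refl

  ev-take : ∀ n x a k t → wants (just x) a ≡ true → ∃ λ k′ →
    sweepR (ev n (just x) a k) (evaluated t) ≡ (ev n (just x) (pushArg a (val t)) k′ , treeCells dead dead [] t)
  ev-take n x a k t w with ev-head n (just x) a k t w
  ... | k′ , eq rewrite head-tail (live (val t)) dead [] t | head-tail dead dead [] t =
    _ , R-cons (ev n (just x) a k) (treeHead (live (val t)) t) (treeTail dead [] t) eq (ev-dead n (just x) (pushArg a (val t)) k′ (treeTail dead [] t) (tail-dead [] t))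

  ev-skip : ∀ n x a k cs → wants (just x) a ≡ false → All Done cs → ∃ λ k′ →
    sweepR (ev n (just x) a k) cs ≡ (ev n (just x) a k′ , cs)
  ev-skip n x a k [] w _ = _ , refl
  ev-skip n x a k ((y , fresh , _) ∷ cs) w (d ∷ ds) = ⊥-elim (d refl)
  ev-skip n x a k ((y , dead , s , r , p , f) ∷ cs) w (_ ∷ ds) with ev-skip n x a (k ∨ r) cs w ds
  ... | k′ , eq = k′ , cell-cons _ eq
  ev-skip n x a k ((y , live b , s , r , p , f) ∷ cs) w (_ ∷ ds) with ev-skip n x a (k ∨ r) cs w ds
  ... | k′ , eq = k′ , R-cons (ev n (just x) a k) _ cs one eq
    where
      one : evR n (just x) a k (y , live b , s , r , p , f) ≡ (ev n (just x) a (k ∨ r) , (y , live b , s , r , p , f))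
      one rewrite w = refl

  Raw : Set
  Raw = Sym × Bool × Bool × Bool

  ev-raws : ∀ n o k gs → ∃ λ o′ → ∃ λ k′ → sweepR (ev n o A0 k) (map rawCell gs) ≡ (ev n o′ A0 k′ , map rawCell gs)
  ev-raws n o k [] = o , k , refl
  ev-raws n o k ((x , s , r , p) ∷ gs) with ev-raws n (just x) (k ∨ r) gs
  ... | o′ , k′ , eq = o′ , k′ , cell-cons _ eq

  put-done : ∀ n b cs → All Done cs → sweepL (put n b) cs ≡ (put n b , cs)
  put-done n b [] _ = refl
  put-done n b ((x , fresh , _) ∷ cs) (d ∷ ds) = ⊥-elim (d refl)
  put-done n b ((x , just e , s , r , p , f) ∷ cs) (_ ∷ ds) = L-cons (put n b) _ cs (put-done n b cs ds) refl

  L-constant : ∀ q → (∀ c → decL q c ≡ (q , c)) → ∀ cs → sweepL q cs ≡ (q , cs)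
  L-constant q h [] = refl
  L-constant q h (c ∷ cs) = L-cons q c cs (L-constant q h cs) (h c)

  dead-done : ∀ {cs} → All Dead cs → All Done cs
  dead-done [] = []
  dead-done {(_ , _ , _) ∷ _} (refl ∷ ds) = (λ ()) ∷ dead-done ds

  evaluated-done : ∀ t → All Done (evaluated t)
  evaluated-done t rewrite head-tail (live (val t)) dead [] t = first t ∷ dead-done (tail-dead [] t)
    where
      first : ∀ t → Done (treeHead (live (val t)) t)
      first (leaf _) ()
      first (bin _ _ _) ()
      first (neg _) ()
      first (dia _ _ _ _ _) ()

  -- parser state: the digits of a number whose ⟨ is still to come, and the stack of trees
  Stack : Set
  Stack = Maybe (List Bool) × List Tree

  pending : Stack → Bool
  pending (just _  , _) = true
  pending (nothing , _) = false

  trees : List Tree → List Cell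
  trees [] = []
  trees (t ∷ ts) = evaluated t ++ trees ts

  stackCells : Stack → List Cell
  stackCells (just D  , ts) = numCells dead D [] ++ trees ts
  stackCells (nothing , ts) = trees ts

  trees-done : ∀ ts → All Done (trees ts)
  trees-done [] = []
  trees-done (t ∷ ts) = ++⁺ (evaluated-done t) (trees-done ts)

  parseBin : BinOp → List Tree → Maybe Stack
  parseBin o (l ∷ r ∷ ts) = just (nothing , bin o l r ∷ ts)
  parseBin o _            = nothing

  -- A stack parser for Polish notation read from right to left, where an operator finds its
  -- arguments on the stack. It specifies one evaluation round of the machine.
  parse1 : Raw → Stack → Maybe Stack
  parse1 (c1 , _) (just D , ts)       = just (just (false ∷ D) , ts)
  parse1 (c2 , _) (just D , ts)       = just (just (true ∷ D) , ts)
  parse1 (c⟨ , s , _) (just D , t ∷ ts) = just (nothing , dia D s (not s ∧ val t) false t ∷ ts)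
  parse1 (c⟩ , _) (nothing , ts)      = just (just [] , ts)
  parse1 (c⊤ , _) (nothing , ts)      = just (nothing , leaf true ∷ ts)
  parse1 (c⊥ , _) (nothing , ts)      = just (nothing , leaf false ∷ ts)
  parse1 (c∧ , _) (nothing , ts)      = parseBin and ts
  parse1 (c∨ , _) (nothing , ts)      = parseBin or ts
  parse1 (c⇒ , _) (nothing , ts)      = parseBin imp ts
  parse1 (c¬ , _) (nothing , t ∷ ts)  = just (nothing , neg t ∷ ts)
  parse1 _        _                   = nothing

  evs : Stack → DState
  evs ps = ev (pending ps) nothing A0 false

  tape : List Raw → List Cell → List Cell
  tape gs cs = map rawCell gs ++ cs

  -- Everything left of `z` is raw, so the right sweep reaches the evaluated part with `z` as the
  -- last fresh symbol, and the left sweep finds `z` as the first fresh cell to write on.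
  advance : ∀ {n′ b} n gs z {cs cs′ args} x′ → (∀ k → ∃ λ k′ → sweepR (ev n (just (proj₁ z)) A0 k) cs ≡ (ev n (just (proj₁ z)) args k′ , cs′)) →
            result n (proj₁ z) args ≡ just (n′ , b) → All Done cs′ → putL n′ b (rawCell z) ≡ (back n′ , x′) →
            round (ev n nothing A0 false) (tape gs (rawCell z ∷ cs)) ≡ (back n′ , tape gs (x′ ∷ cs′))
  advance {n′} {b} n gs z {cs} {cs′} {args} x′ sw res ds eq with ev-raws n nothing false gs
  ... | o , k , pre with sw (k ∨ proj₁ (proj₂ (proj₂ z)))
  ... | k′ , post = round-of (R-then pre (R-cons (ev n o A0 k) (rawCell z) cs refl post))
    (subst (λ q → sweepL (putOrDie q) (tape gs (rawCell z ∷ cs′)) ≡ (back n′ , tape gs (x′ ∷ cs′))) (sym res)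
      (L-then (L-cons (put n′ b) (rawCell z) cs′ (put-done n′ b cs′ ds) eq) (L-constant (back n′) (λ _ → refl) (map rawCell gs))))

  reject : ∀ n gs z cs → (∀ k → ∃ λ args → ∃ λ k′ → ∃ λ cs′ →
             sweepR (ev n (just (proj₁ z)) A0 k) cs ≡ (ev n (just (proj₁ z)) args k′ , cs′) × result n (proj₁ z) args ≡ nothing) →
           ∃ λ ws → round (ev n nothing A0 false) (tape gs (rawCell z ∷ cs)) ≡ (die , ws)
  reject n gs z cs sw with ev-raws n nothing false gs
  ... | o , k , pre with sw (k ∨ proj₁ (proj₂ (proj₂ z)))
  ... | args , k′ , cs′ , post , res = _ , round-of (R-then pre (R-cons (ev n o A0 k) (rawCell z) cs refl post))
    (subst (λ q → sweepL (putOrDie q) (tape gs (rawCell z ∷ cs′)) ≡ (die , tape gs (rawCell z ∷ cs′))) (sym res)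
      (L-constant die (λ _ → refl) (tape gs (rawCell z ∷ cs′))))

  ev-any : ∀ n x a k cs → All Done cs → ∃ λ a′ → ∃ λ k′ → ∃ λ cs′ →
           sweepR (ev n (just x) a k) cs ≡ (ev n (just x) a′ k′ , cs′)
  ev-any n x a k [] _ = a , k , [] , refl
  ev-any n x a k ((y , fresh , _) ∷ cs) (d ∷ ds) = ⊥-elim (d refl)
  ev-any n x a k ((y , dead , s , r , p , f) ∷ cs) (_ ∷ ds) with ev-any n x a (k ∨ r) cs ds
  ... | a′ , k′ , cs′ , eq = a′ , k′ , _ , cell-cons _ eq
  ev-any n x a k ((y , live b , s , r , p , f) ∷ cs) (_ ∷ ds) with wants (just x) a
  ... | true with ev-any n x (pushArg a b) (k ∨ r) cs ds
  ... | a′ , k′ , cs′ , eq = a′ , k′ , _ , cell-cons _ eq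
  ev-any n x a k ((y , live b , s , r , p , f) ∷ cs) (_ ∷ ds) | false with ev-any n x a (k ∨ r) cs ds
  ... | a′ , k′ , cs′ , eq = a′ , k′ , _ , cell-cons _ eq

  stack-done : ∀ ps → All Done (stackCells ps)
  stack-done (just D , ts)  = ++⁺ (dead-done (numCells-dead D [])) (trees-done ts)
  stack-done (nothing , ts) = trees-done ts

  reject-any : ∀ gs z ps → (∀ args → result (pending ps) (proj₁ z) args ≡ nothing) →
               ∃ λ ws → round (evs ps) (tape gs (rawCell z ∷ stackCells ps)) ≡ (die , ws)
  reject-any gs z ps h = reject (pending ps) gs z (stackCells ps) λ k →
    let (a , k′ , cs′ , eq) = ev-any (pending ps) (proj₁ z) A0 k (stackCells ps) (stack-done ps)
    in a , k′ , cs′ , eq , h a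

  take1 : ∀ n x → wants (just x) A0 ≡ true → (∀ b → wants (just x) (A1 b) ≡ false) → ∀ t ts k → ∃ λ k′ →
          sweepR (ev n (just x) A0 k) (trees (t ∷ ts)) ≡ (ev n (just x) (A1 (val t)) k′ , treeCells dead dead [] t ++ trees ts)
  take1 n x w₀ w₁ t ts k with ev-take n x A0 k t w₀
  ... | k₁ , eq₁ with ev-skip n x (A1 (val t)) k₁ (trees ts) (w₁ (val t)) (trees-done ts)
  ... | k₂ , eq₂ = k₂ , R-then eq₁ eq₂

  take2 : ∀ n x → wants (just x) A0 ≡ true → (∀ b → wants (just x) (A1 b) ≡ true) → (∀ b c → wants (just x) (A2 b c) ≡ false) →
          ∀ l r ts k → ∃ λ k′ → sweepR (ev n (just x) A0 k) (trees (l ∷ r ∷ ts))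
            ≡ (ev n (just x) (A2 (val l) (val r)) k′ , treeCells dead dead [] l ++ (treeCells dead dead [] r ++ trees ts))
  take2 n x w₀ w₁ w₂ l r ts k with ev-take n x A0 k l w₀
  ... | k₁ , eq₁ with ev-take n x (A1 (val l)) k₁ r (w₁ (val l))
  ... | k₂ , eq₂ with ev-skip n x (A2 (val l) (val r)) k₂ (trees ts) (w₂ (val l) (val r)) (trees-done ts)
  ... | k₃ , eq₃ = k₃ , R-then eq₁ (R-then eq₂ eq₃)

  Outcome : List Raw → Raw → Stack → Maybe Stack → Set
  Outcome gs z ps nothing    = ∃ λ ws → round (evs ps) (tape gs (rawCell z ∷ stackCells ps)) ≡ (die , ws)
  Outcome gs z ps (just ps′) = round (evs ps) (tape gs (rawCell z ∷ stackCells ps)) ≡ (back (pending ps′) , tape gs (stackCells ps′))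

  eval-binary : ∀ o gs s ts → Outcome gs (opSym o , s) (nothing , ts) (parseBin o ts)
  eval-binary o gs s [] = reject false gs (opSym o , s) [] (λ k → _ , _ , _ , refl , none o)
    where
      none : ∀ o → result false (opSym o) A0 ≡ nothing
      none and = refl
      none or  = refl
      none imp = refl
  eval-binary o gs s (t ∷ []) = reject false gs (opSym o , s) (trees (t ∷ [])) λ k →
    let (k′ , eq) = ev-take false (opSym o) A0 k t (w₀ o)
    in _ , k′ , _ , R-then eq refl , none o
    where
      w₀ : ∀ o → wants (just (opSym o)) A0 ≡ true
      w₀ and = refl
      w₀ or  = refl
      w₀ imp = refl
      none : ∀ o → result false (opSym o) (A1 (val t)) ≡ nothing
      none and = refl
      none or  = refl
      none imp = refl
  eval-binary o gs s (l ∷ r ∷ ts) = trans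
    (advance {b = just (opVal o (val l) (val r))} false gs (opSym o , s) {cs′ = cs′} (node (opSym o) (live (val (bin o l r))))
      (take2 false (opSym o) (w₀ o) (w₁ o) (w₂ o) l r ts) (some o)
      (++⁺ (dead-done (treeCells-dead [] l)) (++⁺ (dead-done (treeCells-dead [] r)) (trees-done ts))) (written o))
    (cong (λ cs → back false , tape gs (node (opSym o) (live (val (bin o l r))) ∷ cs))
      (sym (++-assoc (treeCells dead dead [] l) (treeCells dead dead [] r) (trees ts))))
    where
      cs′ = treeCells dead dead [] l ++ (treeCells dead dead [] r ++ trees ts)
      w₀ : ∀ o → wants (just (opSym o)) A0 ≡ true
      w₀ and = refl
      w₀ or  = refl
      w₀ imp = refl
      w₁ : ∀ o b → wants (just (opSym o)) (A1 b) ≡ true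
      w₁ and _ = refl
      w₁ or  _ = refl
      w₁ imp _ = refl
      w₂ : ∀ o b c → wants (just (opSym o)) (A2 b c) ≡ false
      w₂ and _ _ = refl
      w₂ or  _ _ = refl
      w₂ imp _ _ = refl
      some : ∀ o → result false (opSym o) (A2 (val l) (val r)) ≡ just (false , just (opVal o (val l) (val r)))
      some and = refl
      some or  = refl
      some imp = refl
      written : ∀ o → putL false (just (opVal o (val l) (val r))) (rawCell (opSym o , s))
              ≡ (back false , node (opSym o) (live (val (bin o l r))))
      written and = refl
      written or  = refl
      written imp = refl

  dead-prefix : ∀ n x D k → sweepR (ev n (just x) A0 k) (numCells dead D []) ≡ (ev n (just x) A0 (anyR k (numCells dead D [])) , numCells dead D [])
  dead-prefix n x D k = ev-dead n (just x) A0 k (numCells dead D []) (numCells-dead D [])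

  skip0 : ∀ n x ps → wants (just x) A0 ≡ false → ∀ k → ∃ λ k′ →
          sweepR (ev n (just x) A0 k) (stackCells ps) ≡ (ev n (just x) A0 k′ , stackCells ps)
  skip0 n x ps w k = ev-skip n x A0 k (stackCells ps) w (stack-done ps)

  eval-round : ∀ gs z ps → Outcome gs z ps (parse1 z ps)
  eval-round gs (c⊤ , s) ps@(just D , ts) = reject-any gs (c⊤ , s) ps (λ _ → refl)
  eval-round gs (c⊥ , s) ps@(just D , ts) = reject-any gs (c⊥ , s) ps (λ _ → refl)
  eval-round gs (c∧ , s) ps@(just D , ts) = reject-any gs (c∧ , s) ps (λ _ → refl)
  eval-round gs (c∨ , s) ps@(just D , ts) = reject-any gs (c∨ , s) ps (λ _ → refl)
  eval-round gs (c⇒ , s) ps@(just D , ts) = reject-any gs (c⇒ , s) ps (λ _ → refl)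
  eval-round gs (c¬ , s) ps@(just D , ts) = reject-any gs (c¬ , s) ps (λ _ → refl)
  eval-round gs (c⟩ , s) ps@(just D , ts) = reject-any gs (c⟩ , s) ps (λ _ → refl)
  eval-round gs (c1 , s) ps@(just D , ts) =
    advance true gs (c1 , s) _ (skip0 true c1 ps refl) refl (stack-done ps) refl
  eval-round gs (c2 , s) ps@(just D , ts) =
    advance true gs (c2 , s) _ (skip0 true c2 ps refl) refl (stack-done ps) refl
  eval-round gs (c⟨ , s) (just D , []) = reject true gs (c⟨ , s) (numCells dead D [] ++ []) λ k →
    _ , _ , _ , R-then (dead-prefix true c⟨ D k) refl , refl
  eval-round gs (c⟨ , s , r , p) (just D , t ∷ ts) = trans
    (advance {b = just (val t)} true gs (c⟨ , s , r , p) {cs′ = numCells dead D [] ++ (treeCells dead dead [] t ++ trees ts)} x′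
      (λ k → let (k′ , eq) = take1 true c⟨ refl (λ _ → refl) t ts (anyR k (numCells dead D [])) in k′ , R-then (dead-prefix true c⟨ D k) eq)
      refl (++⁺ (dead-done (numCells-dead D [])) (++⁺ (dead-done (treeCells-dead [] t)) (trees-done ts))) refl)
    (cong (λ cs → back false , tape gs (x′ ∷ cs)) (sym (++-assoc (numCells dead D []) (treeCells dead dead [] t) (trees ts))))
    where x′ = c⟨ , live s , s , not s ∧ val t , false , unseen
  eval-round gs (c1 , s) ps@(nothing , ts) = reject-any gs (c1 , s) ps (λ _ → refl)
  eval-round gs (c2 , s) ps@(nothing , ts) = reject-any gs (c2 , s) ps (λ _ → refl)
  eval-round gs (c⟨ , s) ps@(nothing , ts) = reject-any gs (c⟨ , s) ps (λ _ → refl)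
  eval-round gs (c⟩ , s) ps@(nothing , ts) =
    advance false gs (c⟩ , s) _ (skip0 false c⟩ ps refl) refl (stack-done ps) refl
  eval-round gs (c⊤ , s) ps@(nothing , ts) =
    advance false gs (c⊤ , s) _ (skip0 false c⊤ ps refl) refl (stack-done ps) refl
  eval-round gs (c⊥ , s) ps@(nothing , ts) =
    advance false gs (c⊥ , s) _ (skip0 false c⊥ ps refl) refl (stack-done ps) refl
  eval-round gs (c∧ , s) (nothing , ts) = eval-binary and gs s ts
  eval-round gs (c∨ , s) (nothing , ts) = eval-binary or gs s ts
  eval-round gs (c⇒ , s) (nothing , ts) = eval-binary imp gs s ts
  eval-round gs (c¬ , s) (nothing , []) = reject false gs (c¬ , s) [] (λ k → _ , _ , _ , refl , refl)
  eval-round gs (c¬ , s) (nothing , t ∷ ts) =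
    advance false gs (c¬ , s) _ (take1 false c¬ refl (λ _ → refl) t ts) refl
      (++⁺ (dead-done (treeCells-dead [] t)) (trees-done ts)) refl

  parse : List Raw → Stack → Maybe Stack
  parse [] ps = just ps
  parse (z ∷ zs) ps with parse zs ps
  ... | nothing  = nothing
  ... | just ps′ = parse1 z ps′

  Dies : DState → List Cell → Set
  Dies q cs = ∃ λ q′ → ∃ λ cs′ → ∃ λ n → ∃ λ ws → Rounds q cs q′ cs′ n × round q′ cs′ ≡ (die , ws)

  dies-after : ∀ {q cs q′ cs′ n} → Rounds q cs q′ cs′ n → Dies q′ cs′ → Dies q cs
  dies-after r (q , cs , n , ws , r′ , eq) = q , cs , _ , ws , rounds-trans r r′ , eq

  Parsed : List Raw → List Raw → Stack → Maybe Stack → Set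
  Parsed gs zs ps nothing    = Dies (evs ps) (tape gs (tape zs (stackCells ps)))
  Parsed gs zs ps (just ps′) = ∃ λ n → Rounds (evs ps) (tape gs (tape zs (stackCells ps))) (evs ps′) (tape gs (stackCells ps′)) n

  parsing : ∀ gs zs ps → Parsed gs zs ps (parse zs ps)
  parsing gs [] ps = 0 , ended
  parsing gs (z ∷ zs) ps with parse zs ps | parsing (gs ++ z ∷ []) zs ps
  ... | nothing | dies = subst (Dies (evs ps)) (regroup (tape zs (stackCells ps))) dies
    where
      regroup : ∀ cs → tape (gs ++ z ∷ []) cs ≡ tape gs (rawCell z ∷ cs)
      regroup cs = trans (cong (_++ cs) (map-++ rawCell gs (z ∷ []))) (++-assoc (map rawCell gs) (rawCell z ∷ []) cs)
  ... | just ps₁ | n , r = finish (parse1 z ps₁) (eval-round gs z ps₁)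
    where
      regroup : ∀ cs → tape (gs ++ z ∷ []) cs ≡ tape gs (rawCell z ∷ cs)
      regroup cs = trans (cong (_++ cs) (map-++ rawCell gs (z ∷ []))) (++-assoc (map rawCell gs) (rawCell z ∷ []) cs)
      r′ : Rounds (evs ps) (tape gs (rawCell z ∷ tape zs (stackCells ps))) (evs ps₁) (tape gs (rawCell z ∷ stackCells ps₁)) n
      r′ = subst₂ (λ a b → Rounds (evs ps) a (evs ps₁) b n) (regroup _) (regroup _) r
      finish : ∀ m → Outcome gs z ps₁ m → Parsed gs (z ∷ zs) ps m
      finish nothing (ws , eq) = dies-after r′ (evs ps₁ , _ , 0 , ws , ended , eq)
      finish (just ps₂) eq = n + 1 , rounds-trans r′ (fire eq refl ended)

  anyT : Tree → Bool
  anyT (leaf _) = false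
  anyT (bin _ l r) = anyT l ∨ anyT r
  anyT (neg t) = anyT t
  anyT (dia _ s r _ t) = r ∨ anyT t

  anyR-++ : ∀ k cs ds → anyR k (cs ++ ds) ≡ anyR (anyR k cs) ds
  anyR-++ k [] ds = refl
  anyR-++ k ((_ , _ , _ , r , _) ∷ cs) ds = anyR-++ (k ∨ r) cs ds

  anyR-num : ∀ k y D E → anyR k (numCells y D E) ≡ k
  anyR-num k y [] [] = ∨-identityʳ k
  anyR-num k y [] (_ ∷ _) = ∨-identityʳ k
  anyR-num k y (_ ∷ D) [] = trans (anyR-num (k ∨ false) y D []) (∨-identityʳ k)
  anyR-num k y (_ ∷ D) (_ ∷ E) = trans (anyR-num (k ∨ false) y D E) (∨-identityʳ k)

  anyR-tree : ∀ k x y E t → anyR k (treeCells x y E t) ≡ k ∨ anyT t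
  anyR-tree k x y E (leaf b) = refl
  anyR-tree k x y E (bin o l r) = trans (anyR-++ (k ∨ false) (treeCells y y E l) (treeCells y y E r))
    (trans (anyR-tree _ y y E r) (trans (cong (_∨ anyT r) (trans (anyR-tree _ y y E l) (cong (_∨ anyT l) (∨-identityʳ k))))
      (∨-assoc k (anyT l) (anyT r))))
  anyR-tree k x y E (neg t) = trans (anyR-tree (k ∨ false) y y E t) (cong (_∨ anyT t) (∨-identityʳ k))
  anyR-tree k x y E (dia D s r p t) = trans (anyR-++ (k ∨ r) (numCells y D E) (treeCells y y E t))
    (trans (anyR-tree _ y y E t) (trans (cong (_∨ anyT t) (anyR-num (k ∨ r) y D E)) (∨-assoc k r (anyT t))))

  count-head : ∀ n a k t → decR (ev n nothing a k) (treeHead (live (val t)) t)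
             ≡ (ev n nothing (pushArg a (val t)) (anyR k (treeHead (live (val t)) t ∷ [])) , treeHead (live (val t)) t)
  count-head n a k (leaf b) = refl
  count-head n a k (bin _ _ _) = refl
  count-head n a k (neg _) = refl
  count-head n a k (dia _ _ _ _ _) = refl

  count-tree : ∀ n a k t → sweepR (ev n nothing a k) (evaluated t)
             ≡ (ev n nothing (pushArg a (val t)) (k ∨ anyT t) , evaluated t)
  count-tree n a k t = trans (cong (sweepR (ev n nothing a k)) ht)
    (trans (R-cons (ev n nothing a k) h tl (count-head n a k t)
        (ev-dead n nothing (pushArg a (val t)) (anyR k (h ∷ [])) tl (tail-dead [] t)))
      (cong₂ (λ b cs → ev n nothing (pushArg a (val t)) b , cs)
        (trans (trans (sym (anyR-++ k (h ∷ []) tl)) (cong (anyR k) (sym ht))) (anyR-tree k _ _ [] t)) (sym ht)))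
    where
      h = treeHead (live (val t)) t
      tl = treeTail dead [] t
      ht = head-tail (live (val t)) dead [] t

  counted : Args → List Tree → Args
  counted a [] = a
  counted a (t ∷ ts) = counted (pushArg a (val t)) ts

  count-trees : ∀ n a k ts → ∃ λ k′ → sweepR (ev n nothing a k) (trees ts) ≡ (ev n nothing (counted a ts) k′ , trees ts)
  count-trees n a k [] = k , refl
  count-trees n a k (t ∷ ts) with count-trees n (pushArg a (val t)) (k ∨ anyT t) ts
  ... | k′ , eq = k′ , R-then (count-tree n a k t) eq

  counted-full : ∀ a b ts → counted (A2 a b) ts ≡ A2 a b
  counted-full a b [] = refl
  counted-full a b (t ∷ ts) = counted-full a b ts

  verdict-round : ∀ n {cs a k cs′} → sweepR (ev n nothing A0 false) cs ≡ (ev n nothing a k , cs′) → verdict n a k ≡ die →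
                  ∃ λ ws → round (ev n nothing A0 false) cs ≡ (die , ws)
  verdict-round n {cs} {a} {k} {cs′} eq v = cs′ , round-of eq
    (subst (λ q → sweepL q cs′ ≡ (die , cs′)) (sym v) (L-constant die (λ _ → refl) cs′))

  data Single : Stack → Set where
    single : ∀ t → Single (nothing , t ∷ [])

  final-single : ∀ ps → Single ps ⊎ (¬ Single ps × ∃ λ ws → round (evs ps) (stackCells ps) ≡ (die , ws))
  final-single (just D , ts) with count-trees true A0 (anyR false (numCells dead D [])) ts
  ... | k′ , eq = inj₂ ((λ ()) , verdict-round true
    (R-then (ev-dead true nothing A0 false (numCells dead D []) (numCells-dead D [])) eq) refl)
  final-single (nothing , []) = inj₂ ((λ ()) , verdict-round false {[]} {A0} {false} refl refl)
  final-single (nothing , t ∷ []) = inj₁ (single t)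
  final-single (nothing , t ∷ u ∷ ts) with count-trees false A0 false (t ∷ u ∷ ts)
  ... | k′ , eq = inj₂ ((λ ()) , verdict-round false (trans eq (cong (λ a → ev false nothing a k′ , trees (t ∷ u ∷ ts))
          (counted-full (val t) (val u) ts))) (two-args (val t) (val u) k′))
    where
      two-args : ∀ a b k → verdict false (A2 a b) k ≡ die
      two-args true  b k = refl
      two-args false b k = refl

  single-sweep : ∀ t → sweepR (ev false nothing A0 false) (trees (t ∷ [])) ≡ (ev false nothing (A1 (val t)) (anyT t) , trees (t ∷ []))
  single-sweep t = R-then (count-tree false A0 false t) refl

  final-false : ∀ t → val t ≡ false → ∃ λ ws → round (ev false nothing A0 false) (trees (t ∷ [])) ≡ (die , ws)
  final-false t e = verdict-round false (single-sweep t) (cong (λ b → verdict false (A1 b) (anyT t)) e)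

  final-accept : ∀ t → val t ≡ true → anyT t ≡ false → ∃ λ ws → round (ev false nothing A0 false) (trees (t ∷ [])) ≡ (acc , ws)
  final-accept t e a = trees (t ∷ []) , round-of (single-sweep t)
    (subst (λ q → sweepL q (trees (t ∷ [])) ≡ (acc , trees (t ∷ []))) (sym (cong₂ (λ b k → verdict false (A1 b) k) e a))
      (L-constant acc (λ _ → refl) (trees (t ∷ []))))

  reset : List Cell → List Cell
  reset = map (λ { (x , e , s , r , p , f) → x , fresh , s , r , p , f })

  rst-sweep : ∀ cs → sweepL rst cs ≡ (rst , reset cs)
  rst-sweep [] = refl
  rst-sweep (c ∷ cs) = L-cons rst c cs (rst-sweep cs) refl

  reset-num : ∀ y D E → reset (numCells y D E) ≡ numCells fresh D E
  reset-num y [] [] = refl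
  reset-num y [] (_ ∷ _) = refl
  reset-num y (_ ∷ D) [] = cong (_ ∷_) (reset-num y D [])
  reset-num y (_ ∷ D) (_ ∷ E) = cong (_ ∷_) (reset-num y D E)

  reset-tree : ∀ x y E t → reset (treeCells x y E t) ≡ treeCells fresh fresh E t
  reset-tree x y E (leaf b) = refl
  reset-tree x y E (bin o l r) = cong (_ ∷_) (trans (map-++ _ (treeCells y y E l) (treeCells y y E r))
    (cong₂ _++_ (reset-tree y y E l) (reset-tree y y E r)))
  reset-tree x y E (neg t) = cong (_ ∷_) (reset-tree y y E t)
  reset-tree x y E (dia D s r p t) = cong (_ ∷_) (trans (map-++ _ (numCells y D E) (treeCells y y E t))
    (cong₂ _++_ (reset-num y D E) (reset-tree y y E t)))

  freshCells : List Bool → Tree → List Cell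
  freshCells = treeCells fresh fresh

  final-reset : ∀ t → val t ≡ true → anyT t ≡ true →
                round (ev false nothing A0 false) (trees (t ∷ [])) ≡ (rst , freshCells [] t)
  final-reset t e a = round-of (single-sweep t)
    (subst (λ q → sweepL q (trees (t ∷ [])) ≡ (rst , freshCells [] t)) (sym (cong₂ (λ b k → verdict false (A1 b) k) e a))
      (trans (rst-sweep (trees (t ∷ []))) (cong (rst ,_)
        (trans (cong reset (++-identityʳ (evaluated t))) (reset-tree _ _ [] t)))))

  -- Updating: select a number, compare all numbers with it digit by digit, and finish

  pickT : Bool → Tree → Tree
  pickT f (leaf b) = leaf b
  pickT f (bin o l r) = bin o (pickT f l) (pickT (f ∨ anyT l) r)
  pickT f (neg t) = neg (pickT f t)
  pickT f (dia D s r p t) = dia D s r (not f ∧ r) (pickT (f ∨ r) t)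

  pick-plain : ∀ f x e fl → decR (pick f) (x , e , false , false , false , fl) ≡ (pick f , (x , e , false , false , false , fl))
  pick-plain true  x e fl = refl
  pick-plain false x e fl = refl

  same-cells : ∀ {b c : Bool} (cs : List Cell) → b ≡ c → _≡_ {A = DState × List Cell} (pick b , cs) (pick c , cs)
  same-cells cs refl = refl

  pick-num : ∀ f y D E → sweepR (pick f) (numCells y D E) ≡ (pick f , numCells y D E)
  pick-num f y [] [] = R-cons (pick f) (c⟩ , y , false , false , false , unseen) [] (pick-plain f c⟩ y unseen) refl
  pick-num f y [] (_ ∷ _) = R-cons (pick f) (c⟩ , y , false , false , false , (seen LT)) [] (pick-plain f c⟩ y (seen LT)) refl
  pick-num f y (a ∷ D) [] = R-cons (pick f) ((dsym a) , y , false , false , false , unseen) (numCells y D []) (pick-plain f (dsym a) y unseen) (pick-num f y D [])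
  pick-num f y (a ∷ D) (b ∷ E) = R-cons (pick f) ((dsym a) , y , false , false , false , (seen (digitOrder a b))) (numCells y D E) (pick-plain f (dsym a) y (seen (digitOrder a b))) (pick-num f y D E)

  pick-tree : ∀ f x y E t → sweepR (pick f) (treeCells x y E t) ≡ (pick (f ∨ anyT t) , treeCells x y E (pickT f t))
  pick-tree f x y E (leaf b) = R-cons (pick f) ((leafSym b) , x , false , false , false , unseen) [] (pick-plain f (leafSym b) x unseen) (same-cells [] (sym (∨-identityʳ f)))
  pick-tree f x y E (bin o l r) = R-cons (pick f) ((opSym o) , x , false , false , false , unseen) (treeCells y y E l ++ treeCells y y E r) (pick-plain f (opSym o) x unseen)
    (trans (R-then (pick-tree f y y E l) (pick-tree (f ∨ anyT l) y y E r))
      (same-cells _ (∨-assoc f (anyT l) (anyT r))))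
  pick-tree f x y E (neg t) = R-cons (pick f) (c¬ , x , false , false , false , unseen) (treeCells y y E t) (pick-plain f c¬ x unseen) (pick-tree f y y E t)
  pick-tree f x y E (dia D s r p t) = R-cons (pick f) (c⟨ , x , s , r , p , unseen) (numCells y D E ++ treeCells y y E t) refl
    (trans (R-then (pick-num (f ∨ r) y D E) (pick-tree (f ∨ r) y y E t))
      (same-cells _ (∨-assoc f r (anyT t))))

  firstUnseen : List Bool → List Bool → Maybe Bool
  firstUnseen [] _ = nothing
  firstUnseen (a ∷ _) [] = just a
  firstUnseen (_ ∷ D) (_ ∷ E) = firstUnseen D E

  collT : List Bool → Maybe Bool → Tree → Maybe Bool
  collT E d (leaf b) = d
  collT E d (bin o l r) = collT E (collT E d r) l
  collT E d (neg t) = collT E d t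
  collT E d (dia D s r true t) = firstUnseen D E
  collT E d (dia D s r false t) = collT E d t

  coll-num : ∀ d y D E → sweepL (coll nothing d) (numCells y D E) ≡ (coll (firstUnseen D E) d , numCells y D E)
  coll-num d y [] [] = refl
  coll-num d y [] (_ ∷ _) = refl
  coll-num d y (a ∷ D) [] = L-cons (coll nothing d) _ (numCells y D []) (coll-num d y D []) (at a)
    where
      at : ∀ a → decL (coll (firstUnseen D []) d) (dsym a , y , false , false , false , unseen)
               ≡ (coll (just a) d , (dsym a , y , false , false , false , unseen))
      at true  = refl
      at false = refl
  coll-num d y (a ∷ D) (b ∷ E) = L-cons (coll nothing d) _ (numCells y D E) (coll-num d y D E) (at a)
    where
      at : ∀ a {o} → decL (coll (firstUnseen D E) d) (dsym a , y , false , false , false , seen o)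
               ≡ (coll (firstUnseen D E) d , (dsym a , y , false , false , false , seen o))
      at true  = refl
      at false = refl

  coll-op : ∀ o c d x → decL (coll c d) (node (opSym o) x) ≡ (coll c d , node (opSym o) x)
  coll-op and c d x = refl
  coll-op or  c d x = refl
  coll-op imp c d x = refl

  coll-tree : ∀ d x y E t → sweepL (coll nothing d) (treeCells x y E t) ≡ (coll nothing (collT E d t) , treeCells x y E t)
  coll-tree d x y E (leaf true) = refl
  coll-tree d x y E (leaf false) = refl
  coll-tree d x y E (bin o l r) = L-cons (coll nothing d) _ (treeCells y y E l ++ treeCells y y E r)
    (L-then (coll-tree d y y E r) (coll-tree (collT E d r) y y E l)) (coll-op o _ _ x)
  coll-tree d x y E (neg t) = L-cons (coll nothing d) _ (treeCells y y E t) (coll-tree d y y E t) refl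
  coll-tree d x y E (dia D s r true t) = L-cons (coll nothing d) _ (numCells y D E ++ treeCells y y E t)
    (L-then (coll-tree d y y E t) (coll-num _ y D E)) refl
  coll-tree d x y E (dia D s r false t) = L-cons (coll nothing d) _ (numCells y D E ++ treeCells y y E t)
    (L-then (coll-tree d y y E t) (coll-num _ y D E)) refl

  app-rest : ∀ d y D → sweepR (app d false) (numCells y D []) ≡ (app d false , numCells y D [])
  app-rest d y [] = refl
  app-rest d y (true ∷ D) = cell-cons _ (app-rest d y D)
  app-rest d y (false ∷ D) = cell-cons _ (app-rest d y D)

  app-num : ∀ d y D E → sweepR (app d true) (numCells y D E) ≡ (app d false , numCells y D (E ∷ʳ d))
  app-num d y [] [] = refl
  app-num d y [] (_ ∷ _) = refl
  app-num d y (true ∷ D) [] = cell-cons _ (app-rest d y D)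
  app-num d y (false ∷ D) [] = cell-cons _ (app-rest d y D)
  app-num d y (true ∷ D) (b ∷ E) = cell-cons _ (app-num d y D E)
  app-num d y (false ∷ D) (b ∷ E) = cell-cons _ (app-num d y D E)

  app-tree : ∀ d x y E t → sweepR (app d false) (treeCells x y E t) ≡ (app d false , treeCells x y (E ∷ʳ d) t)
  app-tree d x y E (leaf true) = refl
  app-tree d x y E (leaf false) = refl
  app-tree d x y E (bin and l r) = cell-cons _ (R-then (app-tree d y y E l) (app-tree d y y E r))
  app-tree d x y E (bin or l r) = cell-cons _ (R-then (app-tree d y y E l) (app-tree d y y E r))
  app-tree d x y E (bin imp l r) = cell-cons _ (R-then (app-tree d y y E l) (app-tree d y y E r))
  app-tree d x y E (neg t) = cell-cons _ (app-tree d y y E t)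
  app-tree d x y E (dia D s r p t) = cell-cons _ (R-then (app-num d y D E) (app-tree d y y E t))

  idle-sweep : ∀ cs → sweepR idle cs ≡ (idle , cs)
  idle-sweep [] = refl
  idle-sweep (c ∷ cs) = cell-cons c (idle-sweep cs)

  -- most significant digits last; a proper prefix is smaller since the numeration is bijective
  compareDigits : List Bool → List Bool → Ordr
  compareDigits [] [] = EQ
  compareDigits [] (_ ∷ _) = LT
  compareDigits (_ ∷ _) [] = GT
  compareDigits (a ∷ D) (b ∷ E) = firstOf (compareDigits D E) (digitOrder a b)

  finT : List Bool → Tree → Tree
  finT E (leaf b) = leaf b
  finT E (bin o l r) = bin o (finT E l) (finT E r)
  finT E (neg t) = neg (finT E t)
  finT E (dia D s r p t) = dia D (proj₁ (updSR (compareDigits D E) s r)) (proj₂ (updSR (compareDigits D E) s r)) false (finT E t)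

  fin-num : ∀ y D E → sweepL (fin EQ) (numCells y D E) ≡ (fin (compareDigits D E) , numCells y D [])
  fin-num y [] [] = refl
  fin-num y [] (_ ∷ _) = refl
  fin-num y (true ∷ D) [] = L-cons (fin EQ) _ (numCells y D []) (fin-num y D []) refl
  fin-num y (false ∷ D) [] = L-cons (fin EQ) _ (numCells y D []) (fin-num y D []) refl
  fin-num y (true ∷ D) (b ∷ E) = L-cons (fin EQ) _ (numCells y D E) (fin-num y D E) refl
  fin-num y (false ∷ D) (b ∷ E) = L-cons (fin EQ) _ (numCells y D E) (fin-num y D E) refl

  fin-tree : ∀ x y E t → sweepL (fin EQ) (treeCells x y E t) ≡ (fin EQ , treeCells x y [] (finT E t))
  fin-tree x y E (leaf true) = refl
  fin-tree x y E (leaf false) = refl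
  fin-tree x y E (bin and l r) = L-cons (fin EQ) _ (treeCells y y E l ++ treeCells y y E r) (L-then (fin-tree y y E r) (fin-tree y y E l)) refl
  fin-tree x y E (bin or l r) = L-cons (fin EQ) _ (treeCells y y E l ++ treeCells y y E r) (L-then (fin-tree y y E r) (fin-tree y y E l)) refl
  fin-tree x y E (bin imp l r) = L-cons (fin EQ) _ (treeCells y y E l ++ treeCells y y E r) (L-then (fin-tree y y E r) (fin-tree y y E l)) refl
  fin-tree x y E (neg t) = L-cons (fin EQ) _ (treeCells y y E t) (fin-tree y y E t) refl
  fin-tree x y E (dia D s r p t) = L-cons (fin EQ) _ (numCells y D E ++ treeCells y y E t)
    (L-then (fin-tree y y E t) (fin-num y D E)) refl

  comparing : Maybe Bool → DState
  comparing (just d) = app d false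
  comparing nothing  = idle

  ret-coll : ∀ m → decRet (coll nothing m) ≡ inj₁ (comparing m)
  ret-coll (just _) = refl
  ret-coll nothing  = refl

  firstUnseen-next : ∀ E d rest → firstUnseen (E ++ d ∷ rest) E ≡ just d
  firstUnseen-next [] d rest = refl
  firstUnseen-next (_ ∷ E) d rest = firstUnseen-next E d rest

  firstUnseen-all : ∀ E → firstUnseen E E ≡ nothing
  firstUnseen-all [] = refl
  firstUnseen-all (_ ∷ E) = firstUnseen-all E

  -- One round per digit of the selected number `D`: `E` has been broadcast, `rest` is still to
  -- come. The hypothesis says that the collecting sweep finds the next digit of `D` after every
  -- broadcast.
  comparison : ∀ D t → (∀ E → collT E nothing t ≡ firstUnseen D E) → ∀ rest E → D ≡ E ++ rest →
    ∃ λ n → Rounds (comparing (firstUnseen D E)) (freshCells E t) (pick false) (freshCells [] (finT D t)) n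
  comparison D t h [] E e rewrite ++-identityʳ E | e | firstUnseen-all E =
    1 , fire (round-of (idle-sweep _) (fin-tree fresh fresh E t)) refl ended
  comparison D t h (d ∷ rest) E e rewrite trans (cong (λ z → firstUnseen z E) e) (firstUnseen-next E d rest)
    with comparison D t h rest (E ∷ʳ d) (trans e (sym (++-assoc E (d ∷ []) rest)))
  ... | n , r = suc n , fire (round-of (app-tree d fresh fresh E t) (coll-tree nothing fresh fresh (E ∷ʳ d) t))
          (trans (ret-coll _) (cong (λ m → inj₁ (comparing m)) (h (E ∷ʳ d)))) r

  update-rounds : ∀ D t → anyT t ≡ true → (∀ E → collT E nothing (pickT false t) ≡ firstUnseen D E) →
    ∃ λ n → Rounds (pick false) (freshCells [] t) (pick false) (freshCells [] (finT D (pickT false t))) n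
  update-rounds D t a h with comparison D (pickT false t) h D [] refl
  ... | n , r = suc n , fire (round-of (trans (pick-tree false fresh fresh [] t) (same-cells _ a))
                                       (coll-tree nothing fresh fresh [] (pickT false t)))
          (trans (ret-coll _) (cong (λ m → inj₁ (comparing m)) (h []))) r

  update-done : ∀ t → anyT t ≡ false →
    Rounds (pick false) (freshCells [] t) (ev false nothing A0 false) (freshCells [] (pickT false t)) 1
  update-done t a = fire (round-of (trans (pick-tree false fresh fresh [] t) (same-cells _ a))
    (L-constant toEv (λ _ → refl) (freshCells [] (pickT false t)))) refl ended

  -- Bijective binary numerals and their order

  bitsOf : ℕᵇ → List Bool
  bitsOf zeroᵇ    = []
  bitsOf 2[1+ x ] = true ∷ bitsOf x
  bitsOf 1+[2 x ] = false ∷ bitsOf x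

  binOf : List Bool → ℕᵇ
  binOf []          = zeroᵇ
  binOf (true ∷ D)  = 2[1+ binOf D ]
  binOf (false ∷ D) = 1+[2 binOf D ]

  bitsOf-binOf : ∀ D → bitsOf (binOf D) ≡ D
  bitsOf-binOf []          = refl
  bitsOf-binOf (true ∷ D)  = cong (true ∷_) (bitsOf-binOf D)
  bitsOf-binOf (false ∷ D) = cong (false ∷_) (bitsOf-binOf D)

  binOf-bitsOf : ∀ x → binOf (bitsOf x) ≡ x
  binOf-bitsOf zeroᵇ    = refl
  binOf-bitsOf 2[1+ x ] = cong 2[1+_] (binOf-bitsOf x)
  binOf-bitsOf 1+[2 x ] = cong 1+[2_] (binOf-bitsOf x)

  digits-bits : ∀ x → digits x ≡ map dsym (bitsOf x)
  digits-bits zeroᵇ    = refl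
  digits-bits 2[1+ x ] = cong (c2 ∷_) (digits-bits x)
  digits-bits 1+[2 x ] = cong (c1 ∷_) (digits-bits x)

  numeral : ℕ → List Bool
  numeral n = bitsOf (toBin n)

  number : List Bool → ℕ
  number D = fromBin (binOf D)

  numeral-number : ∀ D → numeral (number D) ≡ D
  numeral-number D = trans (cong bitsOf (toBin-fromBin (binOf D))) (bitsOf-binOf D)

  number-numeral : ∀ n → number (numeral n) ≡ n
  number-numeral n = trans (cong fromBin (binOf-bitsOf (toBin n))) (fromBin-toBin n)

  data Compared (m n : ℕ) : Ordr → Set where
    less  : m < n → Compared m n LT
    equal : m ≡ n → Compared m n EQ
    more  : n < m → Compared m n GT

  compare-number : ∀ D E → Compared (number D) (number E) (compareDigits D E)
  compare-number [] [] = equal refl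
  compare-number [] (true ∷ E) = less (s≤s z≤n)
  compare-number [] (false ∷ E) = less (s≤s z≤n)
  compare-number (true ∷ D) [] = more (s≤s z≤n)
  compare-number (false ∷ D) [] = more (s≤s z≤n)
  compare-number (a ∷ D) (b ∷ E) with compareDigits D E | compare-number D E
  ... | _ | less h  = less (upper a b h)
    where
      upper : ∀ a b → number D < number E → number (a ∷ D) < number (b ∷ E)
      upper true  true  h = *-monoʳ-< 2 (s≤s h)
      upper true  false h = s≤s (*-monoʳ-≤ 2 h)
      upper false true  h = ≤-trans (s≤s (s≤s (*-monoʳ-≤ 2 (<⇒≤ h)))) (≤-reflexive (sym (*-suc 2 (number E))))
      upper false false h = s≤s (*-monoʳ-< 2 h)
  ... | _ | more h  = more (upper a b h)
    where
      upper : ∀ a b → number E < number D → number (b ∷ E) < number (a ∷ D)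
      upper true  true  h = *-monoʳ-< 2 (s≤s h)
      upper false true  h = s≤s (*-monoʳ-≤ 2 h)
      upper true  false h = ≤-trans (s≤s (s≤s (*-monoʳ-≤ 2 (<⇒≤ h)))) (≤-reflexive (sym (*-suc 2 (number D))))
      upper false false h = s≤s (*-monoʳ-< 2 h)
  ... | _ | equal h = same a b h
    where
      same : ∀ a b → number D ≡ number E → Compared (number (a ∷ D)) (number (b ∷ E)) (digitOrder a b)
      same true  true  h = equal (cong (λ n → 2 * suc n) h)
      same true  false h = more (≤-reflexive (trans (cong (λ n → 2 + 2 * n) (sym h)) (sym (*-suc 2 (number D)))))
      same false true  h = less (≤-reflexive (trans (cong (λ n → 2 + 2 * n) h) (sym (*-suc 2 (number E)))))
      same false false h = equal (cong (λ n → suc (2 * n)) h)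

  compare-numeral : ∀ m n → Compared m n (compareDigits (numeral m) (numeral n))
  compare-numeral m n = subst₂ (λ a b → Compared a b (compareDigits (numeral m) (numeral n)))
    (number-numeral m) (number-numeral n) (compare-number (numeral m) (numeral n))

  -- Trees representing formulas; P relates the bits s and r of a diamond to the diamond

  data Rep (P : ℕ → Fm → Bool → Bool → Set) : CFm → Tree → Set where
    ⊤ʳ : Rep P ⊤ (leaf true)
    ⊥ʳ : Rep P ⊥ (leaf false)
    ∧ʳ : ∀ {A B l r} → Rep P A l → Rep P B r → Rep P (A ∧' B) (bin and l r)
    ∨ʳ : ∀ {A B l r} → Rep P A l → Rep P B r → Rep P (A ∨' B) (bin or l r)
    ⇒ʳ : ∀ {A B l r} → Rep P A l → Rep P B r → Rep P (A ⇒ B) (bin imp l r)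
    ¬ʳ : ∀ {A t} → Rep P A t → Rep P (¬' A) (neg t)
    ◇ʳ : ∀ {n A D s r p t} → D ≡ numeral n → P n (ι A) s r → Rep P A t → Rep P (⟨ n ⟩ A) (dia D s r p t)

  -- A completed step of the odometer guarantees `Bits`; the evaluation that follows recomputes `r`
  -- and restores `Fresh`.
  Bits : Val → ℕ → Fm → Bool → Bool → Set
  Bits v n A s r = s ≡ v (⟨ n ⟩ A)

  Fresh : Val → ℕ → Fm → Bool → Bool → Set
  Fresh v n A s r = s ≡ v (⟨ n ⟩ A) × r ≡ new v (n , A)

  rep-val : ∀ {v A t} → Rep (Bits v) A t → val t ≡ evalP v (ι A)
  rep-val ⊤ʳ = refl
  rep-val ⊥ʳ = refl
  rep-val (∧ʳ a b) = cong₂ _∧_ (rep-val a) (rep-val b)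
  rep-val (∨ʳ a b) = cong₂ _∨_ (rep-val a) (rep-val b)
  rep-val (⇒ʳ a b) = cong₂ (λ x y → not x ∨ y) (rep-val a) (rep-val b)
  rep-val (¬ʳ a) = cong not (rep-val a)
  rep-val (◇ʳ _ e _) = e

  rep-map : ∀ {P Q : ℕ → Fm → Bool → Bool → Set} {A t} → Rep P A t →
            (∀ {n B s r} → P n B s r → Q n B s r) → Rep Q A t
  rep-map ⊤ʳ h = ⊤ʳ
  rep-map ⊥ʳ h = ⊥ʳ
  rep-map (∧ʳ a b) h = ∧ʳ (rep-map a h) (rep-map b h)
  rep-map (∨ʳ a b) h = ∨ʳ (rep-map a h) (rep-map b h)
  rep-map (⇒ʳ a b) h = ⇒ʳ (rep-map a h) (rep-map b h)
  rep-map (¬ʳ a) h = ¬ʳ (rep-map a h)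
  rep-map (◇ʳ e x a) h = ◇ʳ e (h x) (rep-map a h)

  reval : Tree → Tree
  reval (leaf b) = leaf b
  reval (bin o l r) = bin o (reval l) (reval r)
  reval (neg t) = neg (reval t)
  reval (dia D s r p t) = dia D s (not s ∧ val (reval t)) false (reval t)

  rep-reval : ∀ {v A t} → Rep (Bits v) A t → Rep (Fresh v) A (reval t)
  rep-reval ⊤ʳ = ⊤ʳ
  rep-reval ⊥ʳ = ⊥ʳ
  rep-reval (∧ʳ a b) = ∧ʳ (rep-reval a) (rep-reval b)
  rep-reval (∨ʳ a b) = ∨ʳ (rep-reval a) (rep-reval b)
  rep-reval (⇒ʳ a b) = ⇒ʳ (rep-reval a) (rep-reval b)
  rep-reval (¬ʳ a) = ¬ʳ (rep-reval a)
  rep-reval {v} (◇ʳ e x a) = ◇ʳ e (x , cong₂ (λ s b → not s ∧ b) x (rep-val {v} (rep-map (rep-reval {v} a) proj₁))) (rep-reval a)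

  rep-node : ∀ {P A t} → Rep P A t → ∀ n B → (n , B) ∈ items A →
             ∃ λ s → ∃ λ r → P n B s r × (r ≡ true → anyT t ≡ true)
  rep-node (∧ʳ {A} {l = l} a b) n B i with ∈-++⁻ (items A) i
  ... | inj₁ j = let (s , r , x , f) = rep-node a n B j in s , r , x , λ e → ∨-introˡ (f e)
  ... | inj₂ j = let (s , r , x , f) = rep-node b n B j in s , r , x , λ e → ∨-introʳ {anyT l} (f e)
  rep-node (∨ʳ {A} {l = l} a b) n B i with ∈-++⁻ (items A) i
  ... | inj₁ j = let (s , r , x , f) = rep-node a n B j in s , r , x , λ e → ∨-introˡ (f e)
  ... | inj₂ j = let (s , r , x , f) = rep-node b n B j in s , r , x , λ e → ∨-introʳ {anyT l} (f e)
  rep-node (⇒ʳ {A} {l = l} a b) n B i with ∈-++⁻ (items A) i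
  ... | inj₁ j = let (s , r , x , f) = rep-node a n B j in s , r , x , λ e → ∨-introˡ (f e)
  ... | inj₂ j = let (s , r , x , f) = rep-node b n B j in s , r , x , λ e → ∨-introʳ {anyT l} (f e)
  rep-node (¬ʳ a) n B i = rep-node a n B i
  rep-node (◇ʳ e x a) n B (here refl) = _ , _ , x , λ { refl → refl }
  rep-node (◇ʳ {r = r₀} e x a) n B (there i) =
    let (s , r , y , f) = rep-node a n B i in s , r , y , λ e → ∨-introʳ {r₀} (f e)

  rep-update : ∀ {P Q : ℕ → Fm → Bool → Bool → Set} {A t} → ∀ f E → Rep P A t →
    (∀ n B s r → (n , B) ∈ items A → P n B s r →
      let o = compareDigits (numeral n) E in Q n B (proj₁ (updSR o s r)) (proj₂ (updSR o s r))) →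
    Rep Q A (finT E (pickT f t))
  rep-update f E ⊤ʳ h = ⊤ʳ
  rep-update f E ⊥ʳ h = ⊥ʳ
  rep-update f E (∧ʳ {A} a b) h = ∧ʳ (rep-update f E a λ n B s r i → h n B s r (∈-++⁺ˡ i))
                                      (rep-update _ E b λ n B s r i → h n B s r (∈-++⁺ʳ (items A) i))
  rep-update f E (∨ʳ {A} a b) h = ∨ʳ (rep-update f E a λ n B s r i → h n B s r (∈-++⁺ˡ i))
                                      (rep-update _ E b λ n B s r i → h n B s r (∈-++⁺ʳ (items A) i))
  rep-update f E (⇒ʳ {A} a b) h = ⇒ʳ (rep-update f E a λ n B s r i → h n B s r (∈-++⁺ˡ i))
                                      (rep-update _ E b λ n B s r i → h n B s r (∈-++⁺ʳ (items A) i))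
  rep-update f E (¬ʳ a) h = ¬ʳ (rep-update f E a h)
  rep-update f E (◇ʳ {n} {A} refl x a) h = ◇ʳ refl (h n (ι A) _ _ (here refl) x)
    (rep-update _ E a λ n B s r i → h n B s r (there i))

  rep-pick : ∀ {P A t} → ∀ f → Rep P A t → Rep P A (pickT f t)
  rep-pick f ⊤ʳ = ⊤ʳ
  rep-pick f ⊥ʳ = ⊥ʳ
  rep-pick f (∧ʳ a b) = ∧ʳ (rep-pick f a) (rep-pick _ b)
  rep-pick f (∨ʳ a b) = ∨ʳ (rep-pick f a) (rep-pick _ b)
  rep-pick f (⇒ʳ a b) = ⇒ʳ (rep-pick f a) (rep-pick _ b)
  rep-pick f (¬ʳ a) = ¬ʳ (rep-pick f a)
  rep-pick f (◇ʳ e x a) = ◇ʳ e x (rep-pick _ a)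

  cnt : Tree → ℕ
  cnt (leaf _) = 0
  cnt (bin _ l r) = cnt l + cnt r
  cnt (neg t) = cnt t
  cnt (dia _ s r _ t) = (if r then 1 else 0) + cnt t

  upd-cnt : ∀ o s r → (if proj₂ (updSR o s r) then 1 else 0) ≤ (if r then 1 else 0)
  upd-cnt EQ s r = z≤n
  upd-cnt LT s r = ≤-refl
  upd-cnt GT s r = z≤n

  cnt-≤ : ∀ E f t → cnt (finT E (pickT f t)) ≤ cnt t
  cnt-≤ E f (leaf b) = z≤n
  cnt-≤ E f (bin o l r) = +-mono-≤ (cnt-≤ E f l) (cnt-≤ E _ r)
  cnt-≤ E f (neg t) = cnt-≤ E f t
  cnt-≤ E f (dia D s r p t) = +-mono-≤ (upd-cnt (compareDigits D E) s r) (cnt-≤ E _ t)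

  coll-none : ∀ E d f t → f ∨ anyT t ≡ f → collT E d (pickT f t) ≡ d
  coll-none E d f (leaf b) e = refl
  coll-none E d true (bin o l r) e = trans (cong (λ d → collT E d (pickT true l)) (coll-none E d true r refl)) (coll-none E d true l refl)
  coll-none E d false (bin o l r) e with ∨-false {anyT l} e
  ... | el , er rewrite el = trans (cong (λ d → collT E d (pickT false l)) (coll-none E d false r er)) (coll-none E d false l el)
  coll-none E d f (neg t) e = coll-none E d f t e
  coll-none E d true (dia D s r p t) e = coll-none E d true t refl
  coll-none E d false (dia D s false p t) e = coll-none E d false t e

  compareDigits-refl : ∀ D → compareDigits D D ≡ EQ
  compareDigits-refl [] = refl
  compareDigits-refl (true ∷ D) rewrite compareDigits-refl D = refl
  compareDigits-refl (false ∷ D) rewrite compareDigits-refl D = refl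

  -- The leftmost due diamond. The collecting sweep reads its number whatever the default `d`, and
  -- the update at its level clears at least its own bit `r`, so fewer diamonds remain due.
  record Picked (P : ℕ → Fm → Bool → Bool → Set) (A : CFm) (t : Tree) : Set where
    constructor picked
    field
      m        : ℕ
      {B}      : Fm
      {s}      : Bool
      isItem   : (m , B) ∈ items A
      holds    : P m B s true
      selects  : ∀ E d → collT E d (pickT false t) ≡ firstUnseen (numeral m) E
      smaller  : cnt (finT (numeral m) (pickT false t)) < cnt t

  rep-picked : ∀ {P A t} → Rep P A t → anyT t ≡ true → Picked P A t
  pick-bin : ∀ {P A B t l r} o → Rep P A l → Rep P B r → anyT l ∨ anyT r ≡ true →
             (∀ {i} → i ∈ items A → i ∈ items t) → (∀ {i} → i ∈ items B → i ∈ items t) → Picked P t (bin o l r)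
  pick-bin {l = l} {r} o a b e incA incB with anyT l in el
  ... | true = let picked m i h c k = rep-picked a el in
    picked m (incA i) h
      (λ E d → trans (cong (λ d → collT E d (pickT false l)) (trans (cong (λ z → collT E d (pickT z r)) el) (coll-none E d true r refl))) (c E d))
      (+-mono-<-≤ k (cnt-≤ (numeral m) _ r))
  ... | false = let picked m i h c k = rep-picked b e in
    picked m (incB i) h
      (λ E d → trans (coll-none E _ false l el) (trans (cong (λ z → collT E d (pickT z r)) el) (c E d)))
      (+-mono-≤-< (cnt-≤ (numeral m) false l) (subst (λ z → cnt (finT (numeral m) (pickT z r)) < cnt r) (sym el) k))
  rep-picked (∧ʳ {A} a b) e = pick-bin and a b e ∈-++⁺ˡ (∈-++⁺ʳ (items A))
  rep-picked (∨ʳ {A} a b) e = pick-bin or a b e ∈-++⁺ˡ (∈-++⁺ʳ (items A))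
  rep-picked (⇒ʳ {A} a b) e = pick-bin imp a b e ∈-++⁺ˡ (∈-++⁺ʳ (items A))
  rep-picked (¬ʳ a) e = let picked m i h c k = rep-picked a e in picked m i h c k
  rep-picked (◇ʳ {n} {D = D} {s} {true} {t = t} refl x a) e = picked n (here refl) x (λ E d → refl)
    (subst (λ o → (if proj₂ (updSR o s true) then 1 else 0) + cnt (finT (numeral n) (pickT true t)) < suc (cnt t))
      (sym (compareDigits-refl (numeral n))) (s≤s (cnt-≤ (numeral n) true t)))
  rep-picked (◇ʳ {n} {D = D} {s} {false} refl x a) e = let picked m i h c k = rep-picked a e in
    picked m (there i) h c (+-mono-≤-< (upd-cnt (compareDigits D (numeral m)) s false) k)

  no-new : ∀ {P A t} → Rep P A t → (∀ n B s r → (n , B) ∈ items A → P n B s r → r ≡ false) → anyT t ≡ false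
  no-new rep h = ¬true→false λ e → let picked m i x _ _ = rep-picked rep e in case h m _ _ true i x of λ ()

  raw : Tree → List Raw
  raw (leaf b) = (leafSym b , false , false , false) ∷ []
  raw (bin o l r) = (opSym o , false , false , false) ∷ (raw l ++ raw r)
  raw (neg t) = (c¬ , false , false , false) ∷ raw t
  raw (dia D s r p t) = (c⟨ , s , r , p) ∷ (map (λ d → dsym d , false , false , false) D ++ (c⟩ , false , false , false) ∷ raw t)

  raw-num : ∀ D cs → numCells fresh D [] ++ cs ≡ map rawCell (map (λ d → dsym d , false , false , false) D) ++ rawCell (c⟩ , false , false , false) ∷ cs
  raw-num [] cs = refl
  raw-num (_ ∷ D) cs = cong (_ ∷_) (raw-num D cs)

  raw-cells : ∀ t → freshCells [] t ≡ map rawCell (raw t)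
  raw-cells (leaf b) = refl
  raw-cells (bin o l r) = cong (_ ∷_) (trans (cong₂ _++_ (raw-cells l) (raw-cells r)) (sym (map-++ rawCell (raw l) (raw r))))
  raw-cells (neg t) = cong (_ ∷_) (raw-cells t)
  raw-cells (dia D s r p t) = cong (_ ∷_) (trans (raw-num D (freshCells [] t))
    (trans (cong (λ cs → map rawCell (map (λ d → dsym d , false , false , false) D) ++ rawCell (c⟩ , false , false , false) ∷ cs) (raw-cells t))
      (sym (map-++ rawCell (map (λ d → dsym d , false , false , false) D) ((c⟩ , false , false , false) ∷ raw t)))))

  parse-step : ∀ z zs ps {ps′} → parse zs ps ≡ just ps′ → parse (z ∷ zs) ps ≡ parse1 z ps′
  parse-step z zs ps e with parse zs ps | e
  ... | just _ | refl = refl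

  rawDigits : List Bool → List Raw → List Raw
  rawDigits D zs = map (λ d → dsym d , false , false , false) D ++ (c⟩ , false , false , false) ∷ zs

  parse-num : ∀ D zs ps {ts} → parse zs ps ≡ just (nothing , ts) → parse (rawDigits D zs) ps ≡ just (just D , ts)
  parse-num [] zs ps e = parse-step (c⟩ , false , false , false) zs ps e
  parse-num (true ∷ D) zs ps e = parse-step (c2 , false , false , false) (rawDigits D zs) ps (parse-num D zs ps e)
  parse-num (false ∷ D) zs ps e = parse-step (c1 , false , false , false) (rawDigits D zs) ps (parse-num D zs ps e)

  parse-raw : ∀ t zs ps {ts} → parse zs ps ≡ just (nothing , ts) → parse (raw t ++ zs) ps ≡ just (nothing , reval t ∷ ts)
  parse-raw (leaf true) zs ps e = parse-step (c⊤ , false , false , false) zs ps e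
  parse-raw (leaf false) zs ps e = parse-step (c⊥ , false , false , false) zs ps e
  parse-raw (bin o l r) zs ps e = trans (cong (λ xs → parse ((opSym o , false , false , false) ∷ xs) ps) (++-assoc (raw l) (raw r) zs))
    (trans (parse-step (opSym o , false , false , false) (raw l ++ raw r ++ zs) ps (parse-raw l (raw r ++ zs) ps (parse-raw r zs ps e))) (push o))
    where
      push : ∀ o {ts} → parse1 (opSym o , false , false , false) (nothing , reval l ∷ reval r ∷ ts) ≡ just (nothing , bin o (reval l) (reval r) ∷ ts)
      push and = refl
      push or  = refl
      push imp = refl
  parse-raw (neg t) zs ps e = parse-step (c¬ , false , false , false) (raw t ++ zs) ps (parse-raw t zs ps e)
  parse-raw (dia D s r p t) zs ps e = trans
    (cong (λ xs → parse ((c⟨ , s , r , p) ∷ xs) ps) (++-assoc (map (λ d → dsym d , false , false , false) D) ((c⟩ , false , false , false) ∷ raw t) zs))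
    (parse-step (c⟨ , s , r , p) (rawDigits D (raw t ++ zs)) ps (parse-num D (raw t ++ zs) ps (parse-raw t zs ps e)))

  re-evaluate : ∀ t → ∃ λ n → Rounds (ev false nothing A0 false) (freshCells [] t) (ev false nothing A0 false) (trees (reval t ∷ [])) n
  re-evaluate t with parse (raw t) (nothing , []) | parsing [] (raw t) (nothing , [])
      | trans (cong (λ zs → parse zs (nothing , [])) (sym (++-identityʳ (raw t)))) (parse-raw t [] (nothing , []) refl)
  ... | just _ | n , r | refl = n , subst (λ cs → Rounds (ev false nothing A0 false) cs (ev false nothing A0 false) (trees (reval t ∷ [])) n) (trans (++-identityʳ _) (sym (raw-cells t))) r

  -- The decider follows the run of valuations

  record HaltsFrom (q : DState) (cs : List Cell) (Y : Set) : Set where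
    constructor halting
    field
      {q′ qₕ}  : DState
      {cs′ ws} : List Cell
      {n}      : ℕ
      b        : Bool
      trace    : Rounds q cs q′ cs′ n
      last     : round q′ cs′ ≡ (qₕ , ws)
      stopped  : decRet qₕ ≡ inj₂ b
      correct  : (b ≡ true) ⇔ Y

  halts-after : ∀ {q cs q′ cs′ n Y} → Rounds q cs q′ cs′ n → HaltsFrom q′ cs′ Y → HaltsFrom q cs Y
  halts-after r (halting b r′ e h y) = halting b (rounds-trans r r′) e h y

  halts-reject : ∀ {q cs Y} → ¬ Y → Dies q cs → HaltsFrom q cs Y
  halts-reject ¬y (q′ , cs′ , n , ws , r , e) = halting false r e refl (mk⇔ (λ ()) (λ y → ⊥-elim (¬y y)))

  module _ (A : CFm) where

    -- before and after the items at the trigger level k have been processed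
    Early Late : Val → ℕ → ℕ → Fm → Bool → Bool → Set
    Early v k n B s r = n ≤ k → Fresh v n B s r
    Late  v k n B s r = s ≡ next k v (⟨ n ⟩ B) × r ≡ false

    -- The machine does not search for the least triggering level: it selects whichever due diamond
    -- is leftmost. An update at a level above `k` leaves all levels up to `k` intact, and its
    -- effect is wiped out when level `k` itself is selected. The number of due diamonds bounds the
    -- number of updates.
    updating : ∀ v k → Trigger (items A) v k → ∀ f t → cnt t < f → Rep (Early v k) A t →
      ∃ λ t′ → ∃ λ n → Rounds (pick false) (freshCells [] t) (ev false nothing A0 false) (freshCells [] t′) n × Rep (Bits (next k v)) A t′
    updating v k tr@((χ , mem , h) , least) (suc f) t t<f rep with bool? (anyT t)
    ... | inj₂ none with rep-node rep k χ mem
    ...   | s , r , early , some = ⊥-elim (true≢false (some (trans (proj₂ (early ≤-refl)) h)) none)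
    updating v k tr@((χ , mem , h) , least) (suc f) t t<f rep | inj₁ some with rep-picked rep some
    ... | picked m {B₀} {s₀} i holds selects smaller with update-rounds (numeral m) t some (λ E → selects E nothing) | <-cmp m k
    ...   | n , rounds | tri< m<k _ _ = ⊥-elim (true≢false (sym (proj₂ (holds (<⇒≤ m<k)))) (least m B₀ i m<k))
    ...   | n , rounds | tri> _ _ k<m with updating v k tr f (finT (numeral m) (pickT false t)) (<-≤-trans smaller (s≤s⁻¹ t<f))
              (rep-update false (numeral m) rep λ n B s r i early n≤k → keep n s r (≤-<-trans n≤k k<m) (early n≤k))
      where
        keep : ∀ n {B} s r → n < m → Fresh v n B s r →
               let o = compareDigits (numeral n) (numeral m) in Fresh v n B (proj₁ (updSR o s r)) (proj₂ (updSR o s r))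
        keep n s r n<m x with compareDigits (numeral n) (numeral m) | compare-numeral n m
        ... | _ | less _  = x
        ... | _ | equal e = ⊥-elim (<-irrefl e n<m)
        ... | _ | more g  = ⊥-elim (<-asym n<m g)
    ...     | t′ , n′ , rounds′ , rep′ = t′ , n + n′ , rounds-trans rounds rounds′ , rep′
    updating v k tr@((χ , mem , h) , least) (suc f) t t<f rep | inj₁ some | picked m i holds selects smaller | n , rounds | tri≈ _ refl _ =
      pickT false t₂ , n + 1 , rounds-trans rounds (update-done t₂ (no-new late (λ _ _ _ _ _ → proj₂))) , rep-pick false (rep-map late proj₁)
      where
        t₂ = finT (numeral m) (pickT false t)
        set : ∀ n B s r → (n , B) ∈ items A → Early v m n B s r →
              let o = compareDigits (numeral n) (numeral m) in Late v m n B (proj₁ (updSR o s r)) (proj₂ (updSR o s r))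
        set n B s r i early with compareDigits (numeral n) (numeral m) | compare-numeral n m
        ... | _ | less l = trans (proj₁ (early (<⇒≤ l))) (sym (upd< _ (evalP v B) l)) , trans (proj₂ (early (<⇒≤ l))) (least n B i l)
        ... | _ | more g = sym (upd> _ (evalP v B) g) , refl
        ... | _ | equal refl with early ≤-refl
        ...   | refl , refl = trans (absorb (v (⟨ n ⟩ B)) (evalP v B)) (sym (upd≈ n _ _)) , refl
          where
            absorb : ∀ a b → a ∨ (not a ∧ b) ≡ a ∨ b
            absorb true  b = refl
            absorb false b = refl
        late : Rep (Late v m) A t₂
        late = rep-update false (numeral m) rep set

    -- Each verdict examines one visited valuation. A false value refutes provability by soundness;
    -- a true value with nothing due means that the run has stopped, and the truths collected on the
    -- way give provability by completeness.
    deciding : ∀ f {vs v} t → Run (items A) vs v → fuel (items A) v < f → (∀ w → w ∈ vs → w ⊨ ι A) →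
               Rep (Fresh v) A t → HaltsFrom (ev false nothing A0 false) (trees (t ∷ [])) (GLP⊢ ι A)
    deciding (suc f) {vs} {v} t run v<f seen-true rep with bool? (val t) | bool? (anyT t)
    ... | inj₂ isF | _ = halts-reject (λ d → true≢false (provable-visited A d run) (trans (sym (rep-val (rep-map rep proj₁))) isF))
          (_ , _ , 0 , _ , ended , proj₂ (final-false t isF))
    ... | inj₁ isT | inj₂ none = halting true ended (proj₂ (final-accept t isT none)) refl
          (mk⇔ (λ _ → visited-provable A run stopped all-true) (λ _ → refl))
      where
        stopped : Stopped (items A) v
        stopped n B i with rep-node rep n B i
        ... | s , r , (_ , e) , g = trans (sym e) (¬true→false λ x → true≢false (g x) none)
        all-true : ∀ w → w ∈ (v ∷ vs) → w ⊨ ι A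
        all-true w (here refl) = trans (sym (rep-val (rep-map rep proj₁))) isT
        all-true w (there i) = seen-true w i
    ... | inj₁ isT | inj₁ some with trigger? (items A) v
    ...   | inj₂ stop with rep-picked rep some
    ...     | picked m i holds _ _ = ⊥-elim (true≢false (sym (proj₂ holds)) (stop m _ i))
    deciding (suc f) {vs} {v} t run v<f seen-true rep | inj₁ isT | inj₁ some | inj₁ (k , tr)
      with updating v k tr (suc (cnt t)) t (n<1+n _) (rep-map rep (λ x _ → x))
    ... | t′ , n , rounds , rep′ with re-evaluate t′
    ... | n′ , rounds′ = halts-after (fire (final-reset t isT some) refl (rounds-trans rounds rounds′))
          (deciding f (reval t′) (run ▸ tr) (<-≤-trans (fuel-< (items A) k v tr) (s≤s⁻¹ v<f))
            (λ { w (here refl) → trans (sym (rep-val (rep-map rep proj₁))) isT ; w (there i) → seen-true w i })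
            (rep-reval rep′))

  zeroVal : Val
  zeroVal _ = false

  data AllRep : List CFm → List Tree → Set where
    []  : AllRep [] []
    _∷_ : ∀ {A As t ts} → Rep (Fresh zeroVal) A t → AllRep As ts → AllRep (A ∷ As) (t ∷ ts)

  -- The stack represents the consumed suffix of the input: the codes of its formulas in order, in
  -- `inNum` preceded by `c⟩` and the digits read so far.
  data Reads : List Sym → Stack → Set where
    plain : ∀ {As ts w} → AllRep As ts → w ≡ concatMap enc As → Reads w (nothing , ts)
    inNum : ∀ {As ts w} D → AllRep As ts → w ≡ map dsym D ++ c⟩ ∷ concatMap enc As → Reads w (just D , ts)

  input : Sym → Raw
  input x = x , false , false , false

  reads-binary : ∀ {w ts ps} o → Reads w (nothing , ts) → parseBin o ts ≡ just ps → Reads (opSym o ∷ w) ps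
  reads-binary {ts = l ∷ r ∷ ts} and (plain {A ∷ B ∷ As} (a ∷ b ∷ as) refl) refl = plain (∧ʳ a b ∷ as) (cong (c∧ ∷_) (sym (++-assoc (enc A) (enc B) _)))
  reads-binary {ts = l ∷ r ∷ ts} or  (plain {A ∷ B ∷ As} (a ∷ b ∷ as) refl) refl = plain (∨ʳ a b ∷ as) (cong (c∨ ∷_) (sym (++-assoc (enc A) (enc B) _)))
  reads-binary {ts = l ∷ r ∷ ts} imp (plain {A ∷ B ∷ As} (a ∷ b ∷ as) refl) refl = plain (⇒ʳ a b ∷ as) (cong (c⇒ ∷_) (sym (++-assoc (enc A) (enc B) _)))

  reads1 : ∀ x {w} ps {ps′} → Reads w ps → parse1 (input x) ps ≡ just ps′ → Reads (x ∷ w) ps′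
  reads1 c⊤ (nothing , ts) (plain as e) refl = plain (⊤ʳ ∷ as) (cong (c⊤ ∷_) e)
  reads1 c⊥ (nothing , ts) (plain as e) refl = plain (⊥ʳ ∷ as) (cong (c⊥ ∷_) e)
  reads1 c∧ (nothing , ts) r e = reads-binary and r e
  reads1 c∨ (nothing , ts) r e = reads-binary or r e
  reads1 c⇒ (nothing , ts) r e = reads-binary imp r e
  reads1 c¬ (nothing , t ∷ ts) (plain (a ∷ as) e) refl = plain (¬ʳ a ∷ as) (cong (c¬ ∷_) e)
  reads1 c⟨ (just D , t ∷ ts) (inNum {A ∷ As} .D (a ∷ as) refl) refl =
    plain (◇ʳ {n = number D} (sym (numeral-number D)) (refl , rep-val {zeroVal} (rep-map a proj₁)) a ∷ as) (cong (c⟨ ∷_) (trans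
      (cong (λ E → map dsym E ++ c⟩ ∷ (enc A ++ concatMap enc As)) (sym (numeral-number D)))
      (trans (cong (λ z → z ++ c⟩ ∷ (enc A ++ concatMap enc As)) (sym (digits-bits (toBin (number D)))))
        (sym (++-assoc (digits (toBin (number D))) (c⟩ ∷ enc A) (concatMap enc As))))))
  reads1 c⟩ (nothing , ts) (plain as e) refl = inNum [] as (cong (c⟩ ∷_) e)
  reads1 c1 (just D , ts) (inNum .D as e) refl = inNum (false ∷ D) as (cong (c1 ∷_) e)
  reads1 c2 (just D , ts) (inNum .D as e) refl = inNum (true ∷ D) as (cong (c2 ∷_) e)

  reads : ∀ w {ps} → parse (map input w) (nothing , []) ≡ just ps → Reads w ps
  reads [] refl = plain {[]} [] refl
  reads (x ∷ w) e with parse (map input w) (nothing , []) in eq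
  ... | just ps = reads1 x ps (reads w eq) e

  blankTree : CFm → Tree
  blankTree ⊤ = leaf true
  blankTree ⊥ = leaf false
  blankTree (A ∧' B) = bin and (blankTree A) (blankTree B)
  blankTree (A ∨' B) = bin or (blankTree A) (blankTree B)
  blankTree (A ⇒ B) = bin imp (blankTree A) (blankTree B)
  blankTree (¬' A) = neg (blankTree A)
  blankTree (⟨ n ⟩ A) = dia (numeral n) false false false (blankTree A)

  raw-blank : ∀ A → raw (blankTree A) ≡ map input (enc A)
  raw-blank ⊤ = refl
  raw-blank ⊥ = refl
  raw-blank (A ∧' B) = cong (_ ∷_) (trans (cong₂ _++_ (raw-blank A) (raw-blank B)) (sym (map-++ input (enc A) (enc B))))
  raw-blank (A ∨' B) = cong (_ ∷_) (trans (cong₂ _++_ (raw-blank A) (raw-blank B)) (sym (map-++ input (enc A) (enc B))))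
  raw-blank (A ⇒ B) = cong (_ ∷_) (trans (cong₂ _++_ (raw-blank A) (raw-blank B)) (sym (map-++ input (enc A) (enc B))))
  raw-blank (¬' A) = cong (_ ∷_) (raw-blank A)
  raw-blank (⟨ n ⟩ A) = cong (_ ∷_) (trans (cong₂ (λ a b → a ++ input c⟩ ∷ b)
      (trans (map-∘ (numeral n)) (cong (map input) (sym (digits-bits (toBin n))))) (raw-blank A))
    (sym (map-++ input (digits (toBin n)) (c⟩ ∷ enc A))))

  rep-blank : ∀ A → Rep (Bits zeroVal) A (blankTree A)
  rep-blank ⊤ = ⊤ʳ
  rep-blank ⊥ = ⊥ʳ
  rep-blank (A ∧' B) = ∧ʳ (rep-blank A) (rep-blank B)
  rep-blank (A ∨' B) = ∨ʳ (rep-blank A) (rep-blank B)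
  rep-blank (A ⇒ B) = ⇒ʳ (rep-blank A) (rep-blank B)
  rep-blank (¬' A) = ¬ʳ (rep-blank A)
  rep-blank (⟨ n ⟩ A) = ◇ʳ refl refl (rep-blank A)

  rep-unique : ∀ {P A B t} → Rep P A t → Rep P B t → A ≡ B
  rep-unique ⊤ʳ ⊤ʳ = refl
  rep-unique ⊥ʳ ⊥ʳ = refl
  rep-unique (∧ʳ a b) (∧ʳ c d) = cong₂ _∧'_ (rep-unique a c) (rep-unique b d)
  rep-unique (∨ʳ a b) (∨ʳ c d) = cong₂ _∨'_ (rep-unique a c) (rep-unique b d)
  rep-unique (⇒ʳ a b) (⇒ʳ c d) = cong₂ _⇒_ (rep-unique a c) (rep-unique b d)
  rep-unique (¬ʳ a) (¬ʳ c) = cong ¬'_ (rep-unique a c)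
  rep-unique (◇ʳ {n} e _ a) (◇ʳ {m} e′ _ c) = cong₂ ⟨_⟩_
    (trans (sym (number-numeral n)) (trans (cong number (trans (sym e) e′)) (number-numeral m))) (rep-unique a c)

  parse-code : ∀ A → parse (map input (enc A)) (nothing , []) ≡ just (nothing , reval (blankTree A) ∷ [])
  parse-code A = trans (cong (λ zs → parse zs (nothing , []))
    (sym (trans (++-identityʳ (raw (blankTree A))) (raw-blank A)))) (parse-raw (blankTree A) [] (nothing , []) refl)

  same-stack : ∀ {w} A {m} → enc A ≡ w → parse (map input w) (nothing , []) ≡ m → just (nothing , reval (blankTree A) ∷ []) ≡ m
  same-stack A refl eq = trans (sym (parse-code A)) eq

  tree-eq : ∀ {t u : Tree} {m n : Maybe (List Bool)} → _≡_ {A = Maybe Stack} (just (m , t ∷ [])) (just (n , u ∷ [])) → t ≡ u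
  tree-eq refl = refl

  -- The parser returns one tree for the common code, and a tree represents only one formula,
  -- because a bijective numeral determines its number.
  enc-injective : ∀ {A B} → enc A ≡ enc B → A ≡ B
  enc-injective {A} {B} e = rep-unique (rep-reval {zeroVal} (rep-blank A))
    (subst (Rep (Fresh zeroVal) B) (tree-eq (same-stack B (sym e) (parse-code A))) (rep-reval {zeroVal} (rep-blank B)))

  decides : ∀ w → HaltsFrom (ev false nothing A0 false) (map rawCell (map input w)) (GLPω₀ w)
  decides w with parse (map input w) (nothing , []) in eq | parsing [] (map input w) (nothing , [])
  ... | nothing | dies = halts-reject (λ (A , e , _) → case same-stack A e eq of λ ())
          (subst (Dies (ev false nothing A0 false)) (++-identityʳ _) dies)
  ... | just ps | n , rounds with final-single ps
  ...   | inj₂ (¬single , ws , e) = halts-after (subst (λ cs → Rounds (ev false nothing A0 false) cs (evs ps) (stackCells ps) n) (++-identityʳ _) rounds)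
            (halts-reject (λ (A , e , _) → ¬single (subst Single (case same-stack A e eq of λ { refl → refl }) (single (reval (blankTree A)))))
              (_ , _ , 0 , ws , ended , e))
  ...   | inj₁ (single t) with reads w eq
  ...     | plain {A ∷ []} (a ∷ []) we with deciding A (suc (fuel (items A) zeroVal)) t origin (n<1+n _) (λ _ ()) a
  ...       | halting b r e h iff = halts-after (subst (λ cs → Rounds (ev false nothing A0 false) cs (ev false nothing A0 false) (trees (t ∷ [])) n) (++-identityʳ _) rounds)
              (halting b r e h (mk⇔
                (λ bt → A , trans (sym (++-identityʳ (enc A))) (sym we) , Equivalence.to iff bt)
                (λ (B , eB , d) → Equivalence.from iff (subst (λ C → GLP⊢ ι C)
                  (rep-unique (subst (Rep (Fresh zeroVal) B) (tree-eq (same-stack B eB eq)) (rep-reval {zeroVal} (rep-blank B))) a) d))))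

  GLPω₀∈PSPACE : InPSPACE GLPω₀
  GLPω₀∈PSPACE = sweeper-PSPACE decider (λ _ → refl) GLPω₀ λ w → answer w (decides w)
    where
      answer : ∀ w → HaltsFrom (ev false nothing A0 false) (map rawCell (map input w)) (GLPω₀ w) →
               Σ (Halts w) λ h → (Halts.answer h ≡ true) ⇔ GLPω₀ w
      answer w (halting {q′} {cs′ = cs′} {n = n} b r e h iff) =
        halts n b (subst (λ zs → Rounds (ev false nothing A0 false) zs q′ cs′ n) (sym (map-∘ w)) r) e h , iff

open Decider using (GLPω₀∈PSPACE; enc-injective)

-- Loop programs over marked tape cells

cat : ∀ {A : Set} → ℕ → ℕ → (ℕ → List A) → List A
cat p zero    f = []
cat p (suc n) f = f p ++ cat (suc p) n f

nth : ∀ {A : Set} → List A → ℕ → Maybe A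
nth []       _       = nothing
nth (x ∷ xs) zero    = just x
nth (x ∷ xs) (suc i) = nth xs i

≡ᵇ-refl : ∀ n → (n ≡ᵇ n) ≡ true
≡ᵇ-refl zero    = refl
≡ᵇ-refl (suc n) = ≡ᵇ-refl n

≡ᵇ-false : ∀ {m n} → m ≢ n → (m ≡ᵇ n) ≡ false
≡ᵇ-false {zero}  {zero}  h = ⊥-elim (h refl)
≡ᵇ-false {zero}  {suc n} h = refl
≡ᵇ-false {suc m} {zero}  h = refl
≡ᵇ-false {suc m} {suc n} h = ≡ᵇ-false (h ∘ cong suc)

<ᵇ-true : ∀ {m n} → m < n → (m <ᵇ n) ≡ true
<ᵇ-true {zero}  {suc n} _ = refl
<ᵇ-true {suc m} {suc n} (s≤s h) = <ᵇ-true h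

<ᵇ-false : ∀ {m n} → n ≤ m → (m <ᵇ n) ≡ false
<ᵇ-false {m}     {zero}  _ = refl
<ᵇ-false {suc m} {suc n} (s≤s h) = <ᵇ-false h

module Loops (Kd : Set) (finKd : Finite Kd) (K : ℕ) where

  -- Loop counters are pointers to cells. A cell carries one mark bit for each of the `K` counters,
  -- so the values need no storage in the finite control.
  Env Mark MCell : Set
  Env   = Fin K → ℕ
  Mark  = Vec Bool K
  MCell = Kd × Mark

  finMCell : Finite MCell
  finMCell = fin-× finKd (fin-Vec K fin-Bool)

  upd-env : Env → Fin K → ℕ → Env
  upd-env ρ x p y = if ⌊ y ≟ᶠ x ⌋ then p else ρ y

  upd-same : ∀ ρ x p → upd-env ρ x p x ≡ p
  upd-same ρ x p with x ≟ᶠ x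
  ... | yes _ = refl
  ... | no ne = ⊥-elim (ne refl)

  upd-other : ∀ ρ x p y → y ≢ x → upd-env ρ x p y ≡ ρ y
  upd-other ρ x p y ne with y ≟ᶠ x
  ... | yes e = ⊥-elim (ne e)
  ... | no _  = refl

  mark-set : ∀ (f : Fin K → Bool) (g : Fin K → Bool) x b → g x ≡ b → (∀ y → y ≢ x → g y ≡ f y) →
             Vec.tabulate f [ x ]≔ b ≡ Vec.tabulate g
  mark-set f g x b gx go = trans (sym (tabulate∘lookup _)) (tabulate-cong at)
    where
      at : ∀ y → lookup (Vec.tabulate f [ x ]≔ b) y ≡ g y
      at y with y ≟ᶠ x
      ... | yes refl = trans (lookup∘update x (Vec.tabulate f) b) (sym gx)
      ... | no ne = trans (lookup∘update′ ne (Vec.tabulate f) b) (trans (lookup∘tabulate f y) (sym (go y ne)))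

  none : Mark
  none = Vec.tabulate (λ _ → false)

  marks : Env → ℕ → Mark
  marks ρ i = Vec.tabulate (λ x → i ≡ᵇ ρ x)

  data Test : Set where
    lt nx : Fin K → Fin K → Test
    kd    : Fin K → (Kd → Bool) → Test
    frs lst : Fin K → Test

  module Over (reg : Kd → Bool) where

    -- Loops range over the cells selected by `reg`, while programs may emit only other cells; the
    -- range of a loop is therefore fixed while it runs.
    region : List Kd → List Kd
    region [] = []
    region (k ∷ ks) = if reg k then k ∷ region ks else region ks

    -- the i-th region cell carries mark x iff ρ x = i; a slot is off when ρ x is the region's length
    render : Env → ℕ → List Kd → List MCell
    render ρ i [] = []
    render ρ i (k ∷ ks) = if reg k then (k , marks ρ i) ∷ render ρ (suc i) ks else (k , none) ∷ render ρ i ks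

    size-of : List Kd → ℕ
    size-of ks = length (region ks)

    region-++ : ∀ ks ls → region (ks ++ ls) ≡ region ks ++ region ls
    region-++ [] ls = refl
    region-++ (k ∷ ks) ls with reg k
    ... | true  = cong (k ∷_) (region-++ ks ls)
    ... | false = region-++ ks ls

    render-cong : ∀ ρ σ i ks → (∀ x j → i ≤ j → j < i + size-of ks → (j ≡ᵇ ρ x) ≡ (j ≡ᵇ σ x)) → render ρ i ks ≡ render σ i ks
    render-cong ρ σ i [] h = refl
    render-cong ρ σ i (k ∷ ks) h with reg k
    ... | false = cong ((k , none) ∷_) (render-cong ρ σ i ks h)
    ... | true  = cong₂ _∷_ (cong (k ,_) (tabulate-cong λ x → h x i ≤-refl (≤-trans (s≤s (m≤m+n i _)) (≤-reflexive (sym (+-suc i _))))))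
                    (render-cong ρ σ (suc i) ks λ x j l u → h x j (<⇒≤ l) (<-≤-trans u (≤-reflexive (sym (+-suc i _)))))

    render-snoc : ∀ ρ i ks c → reg c ≡ false → render ρ i (ks ++ c ∷ []) ≡ render ρ i ks ++ (c , none) ∷ []
    render-snoc ρ i [] c e rewrite e = refl
    render-snoc ρ i (k ∷ ks) c e with reg k
    ... | true  = cong (_ ∷_) (render-snoc ρ (suc i) ks c e)
    ... | false = cong (_ ∷_) (render-snoc ρ i ks c e)

    sweepA : ∀ {Q : Set} → (Q → MCell → Q × MCell) → Q → List MCell → Q × List MCell
    sweepA r q [] = q , []
    sweepA r q (c ∷ cs) = let (q′ , c′) = r q c ; (q″ , cs′) = sweepA r q′ cs in q″ , c′ ∷ cs′

    Carry : Set
    Carry = Maybe Bool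
    pattern seek   = nothing
    pattern carry  = just false
    pattern placed = just true

    -- `seek` looks for the mark, `carry` has lifted it and waits for the next cell of the region.
    -- Starting in `carry` puts the mark on the first cell; ending in `carry` means that the range
    -- is exhausted.
    advR : Fin K → Carry → MCell → Carry × MCell
    advR x seek   (k , v) = if lookup v x then (carry , k , v [ x ]≔ false) else (seek , k , v)
    advR x carry  (k , v) = if reg k then (placed , k , v [ x ]≔ true) else (carry , k , v)
    advR x placed c       = placed , c

    adv-placed : ∀ x cs → sweepA (advR x) placed cs ≡ (placed , cs)
    adv-placed x [] = refl
    adv-placed x (c ∷ cs) = cong (λ z → proj₁ z , c ∷ proj₂ z) (adv-placed x cs)

    outcomeC : ℕ → Carry
    outcomeC zero    = carry
    outcomeC (suc _) = placed

    private
      Swept : Set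
      Swept = Carry × List MCell

      pair-cons : ∀ {c c′ : MCell} {q q′ : Carry} {cs cs′ : List MCell} → c ≡ c′ → _≡_ {A = Swept} (q , cs) (q′ , cs′) →
                  _≡_ {A = Swept} (q , c ∷ cs) (q′ , c′ ∷ cs′)
      pair-cons refl refl = refl

      pair : ∀ {q q′ : Carry} {cs cs′ : List MCell} → q ≡ q′ → cs ≡ cs′ → _≡_ {A = Swept} (q , cs) (q′ , cs′)
      pair refl refl = refl

    adv-carry : ∀ ρ x i ks → (∀ j → i ≤ j → j < i + size-of ks → j ≢ ρ x) →
                sweepA (advR x) carry (render ρ i ks) ≡ (outcomeC (size-of ks) , render (upd-env ρ x i) i ks)
    adv-carry ρ x i [] h = refl
    adv-carry ρ x i (k ∷ ks) h with reg k in eq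
    ... | false rewrite eq = pair-cons refl (adv-carry ρ x i ks h)
    ... | true rewrite eq = trans (cong (λ z → proj₁ z , (k , marks ρ i [ x ]≔ true) ∷ proj₂ z) (adv-placed x (render ρ (suc i) ks)))
          (pair-cons (cong (k ,_) (mark-set _ _ x true (trans (cong (i ≡ᵇ_) (upd-same ρ x i)) (≡ᵇ-refl i))
                (λ y ne → cong (i ≡ᵇ_) (upd-other ρ x i y ne))))
            (pair refl (render-cong ρ (upd-env ρ x i) (suc i) ks same)))
      where
        same : ∀ y j → suc i ≤ j → j < suc i + size-of ks → (j ≡ᵇ ρ y) ≡ (j ≡ᵇ upd-env ρ x i y)
        same y j l u with y ≟ᶠ x
        ... | no _ = refl
        ... | yes refl = trans (≡ᵇ-false (h j (<⇒≤ l) (<-≤-trans u (≤-reflexive (sym (+-suc i _)))))) (sym (≡ᵇ-false (λ e → <-irrefl (sym e) l)))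

    adv-seek : ∀ ρ x p i ks n → ρ x ≡ p → i ≤ p → suc p + n ≡ i + size-of ks →
               sweepA (advR x) seek (render ρ i ks) ≡ (outcomeC n , render (upd-env ρ x (suc p)) i ks)
    adv-seek ρ x p i [] n e i≤p s = ⊥-elim (<⇒≱ (≤-trans (m≤m+n (suc p) n) (≤-trans (≤-reflexive s) (≤-reflexive (+-identityʳ i)))) i≤p)
    adv-seek ρ x p i (k ∷ ks) n e i≤p s with reg k in eq
    ... | false rewrite lookup∘tabulate {n = K} (λ _ → false) x =
      cong (λ z → proj₁ z , (k , none) ∷ proj₂ z) (adv-seek ρ x p i ks n e i≤p s)
    ... | true rewrite lookup∘tabulate (λ y → i ≡ᵇ ρ y) x with i ≟ p
    ...   | no i≢p rewrite ≡ᵇ-false (λ q → i≢p (trans q e)) = trans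
            (cong (λ z → proj₁ z , (k , marks ρ i) ∷ proj₂ z) (adv-seek ρ x p (suc i) ks n e (≤∧≢⇒< i≤p i≢p) (trans s (+-suc i _))))
            (pair-cons (cong (k ,_) (tabulate-cong same)) refl)
      where
        same : ∀ y → (i ≡ᵇ ρ y) ≡ (i ≡ᵇ upd-env ρ x (suc p) y)
        same y with y ≟ᶠ x
        ... | no _ = refl
        ... | yes refl = trans (≡ᵇ-false (λ q → i≢p (trans q e))) (sym (≡ᵇ-false (λ q → <-irrefl q (s≤s i≤p))))
    ...   | yes refl rewrite trans (cong (i ≡ᵇ_) e) (≡ᵇ-refl i) = trans
            (cong (λ z → proj₁ z , (k , marks ρ i [ x ]≔ false) ∷ proj₂ z)
              (adv-carry ρ x (suc i) ks (λ j l u q → <-irrefl (sym (trans q e)) l)))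
            (pair-cons (cong (k ,_) (mark-set _ _ x false (trans (cong (i ≡ᵇ_) (upd-same ρ x (suc i))) (≡ᵇ-false {i} {suc i} (λ q → <-irrefl q ≤-refl)))
                (λ y ne → cong (i ≡ᵇ_) (upd-other ρ x (suc i) y ne))))
              (pair (cong outcomeC (sym (+-cancelˡ-≡ (suc i) n _ (trans s (+-suc i _))))) refl))

    TSt : Set
    TSt = Fin 4
    pattern t0 = fz
    pattern t1 = fs fz
    pattern tY = fs (fs fz)
    pattern tN = fs (fs (fs fz))

    testR : Test → TSt → MCell → TSt
    testR (lt x y) t0 (k , v) = if lookup v y then tN else if lookup v x then t1 else t0
    testR (lt x y) t1 (k , v) = if lookup v y then tY else t1
    testR (nx x y) t0 (k , v) = if lookup v x then t1 else t0
    testR (nx x y) t1 (k , v) = if reg k then (if lookup v y then tY else tN) else t1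
    testR (kd x p) t0 (k , v) = if lookup v x then (if p k then tY else tN) else t0
    testR (lst x)  t0 (k , v) = if lookup v x then t1 else t0
    testR (lst x)  t1 (k , v) = if reg k then tN else t1
    testR (frs x)  t0 (k , v) = if reg k then (if lookup v x then tY else tN) else t0
    testR _        q  _       = q

    -- For `lst` success is the absence of a further region cell, which is known only at the end of
    -- the sweep; hence the accepting intermediate state.
    accept : Test → TSt → Bool
    accept (lst _) t1 = true
    accept _       tY = true
    accept _       _  = false

    testing : Test → TSt → List MCell → TSt
    testing t q [] = q
    testing t q (c ∷ cs) = testing t (testR t q c) cs

    -- The bounds by `length rs` reflect that a slot that is off leaves no mark on the tape, so that
    -- a sweep cannot recognize it.
    holds : Test → List Kd → Env → Bool
    holds (lt x y) rs ρ = (ρ x <ᵇ ρ y) ∧ (ρ y <ᵇ length rs)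
    holds (nx x y) rs ρ = (ρ y ≡ᵇ suc (ρ x)) ∧ (ρ y <ᵇ length rs)
    holds (kd x p) rs ρ = maybe′ p false (nth rs (ρ x))
    holds (lst x)  rs ρ = suc (ρ x) ≡ᵇ length rs
    holds (frs x)  rs ρ = (ρ x ≡ᵇ 0) ∧ (ρ x <ᵇ length rs)

    stay-Y : ∀ t cs → testing t tY cs ≡ tY
    stay-Y t [] = refl
    stay-Y t@(lt _ _) (c ∷ cs) = stay-Y t cs
    stay-Y t@(nx _ _) (c ∷ cs) = stay-Y t cs
    stay-Y t@(kd _ _) (c ∷ cs) = stay-Y t cs
    stay-Y t@(lst _) (c ∷ cs) = stay-Y t cs
    stay-Y t@(frs _) (c ∷ cs) = stay-Y t cs

    stay-N : ∀ t cs → testing t tN cs ≡ tN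
    stay-N t [] = refl
    stay-N t@(lt _ _) (c ∷ cs) = stay-N t cs
    stay-N t@(nx _ _) (c ∷ cs) = stay-N t cs
    stay-N t@(kd _ _) (c ∷ cs) = stay-N t cs
    stay-N t@(lst _) (c ∷ cs) = stay-N t cs
    stay-N t@(frs _) (c ∷ cs) = stay-N t cs

    private
      ∧-false : ∀ b → b ∧ false ≡ false
      ∧-false true  = refl
      ∧-false false = refl

      look : ∀ ρ i x → lookup (marks ρ i) x ≡ (i ≡ᵇ ρ x)
      look ρ i x = lookup∘tabulate (λ y → i ≡ᵇ ρ y) x

      look-none : ∀ x → lookup none x ≡ false
      look-none x = lookup∘tabulate {n = K} (λ _ → false) x

      end≤ : ∀ {i p} → i ≤ p → (p <ᵇ i + 0) ≡ false
      end≤ {i} h = <ᵇ-false (≤-trans (≤-reflexive (+-identityʳ i)) h)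

    lt-t1 : ∀ ρ x y i ks → i ≤ ρ y → accept (lt x y) (testing (lt x y) t1 (render ρ i ks)) ≡ (ρ y <ᵇ i + size-of ks)
    lt-t1 ρ x y i [] h = sym (end≤ h)
    lt-t1 ρ x y i (k ∷ ks) h with reg k
    ... | false rewrite look-none y = lt-t1 ρ x y i ks h
    ... | true rewrite look ρ i y | +-suc i (size-of ks) with i ≟ ρ y
    ...   | yes e rewrite sym e | ≡ᵇ-refl i | stay-Y (lt x y) (render ρ (suc i) ks) = sym (<ᵇ-true (s≤s (m≤m+n i _)))
    ...   | no ne rewrite ≡ᵇ-false ne = lt-t1 ρ x y (suc i) ks (≤∧≢⇒< h ne)

    lt-t0 : ∀ ρ x y i ks → i ≤ ρ x → i ≤ ρ y →
            accept (lt x y) (testing (lt x y) t0 (render ρ i ks)) ≡ (ρ x <ᵇ ρ y) ∧ (ρ y <ᵇ i + size-of ks)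
    lt-t0 ρ x y i [] hx hy rewrite end≤ hy = sym (∧-false _)
    lt-t0 ρ x y i (k ∷ ks) hx hy with reg k
    ... | false rewrite look-none y | look-none x = lt-t0 ρ x y i ks hx hy
    ... | true rewrite look ρ i y | look ρ i x | +-suc i (size-of ks) with i ≟ ρ y
    ...   | yes e rewrite trans (cong (i ≡ᵇ_) (sym e)) (≡ᵇ-refl i) | stay-N (lt x y) (render ρ (suc i) ks)
            | <ᵇ-false {ρ x} {ρ y} (≤-trans (≤-reflexive (sym e)) hx) = refl
    ...   | no ne rewrite ≡ᵇ-false ne with i ≟ ρ x
    ...     | yes e rewrite trans (cong (i ≡ᵇ_) (sym e)) (≡ᵇ-refl i)
              | <ᵇ-true {ρ x} {ρ y} (≤-<-trans (≤-reflexive (sym e)) (≤∧≢⇒< hy ne)) = lt-t1 ρ x y (suc i) ks (≤∧≢⇒< hy ne)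
    ...     | no nx′ rewrite ≡ᵇ-false nx′ = lt-t0 ρ x y (suc i) ks (≤∧≢⇒< hx nx′) (≤∧≢⇒< hy ne)

    nx-t1 : ∀ ρ x y i ks → accept (nx x y) (testing (nx x y) t1 (render ρ i ks)) ≡ (ρ y ≡ᵇ i) ∧ (ρ y <ᵇ i + size-of ks)
    nx-t1 ρ x y i [] with ρ y ≟ i
    ... | yes e rewrite end≤ (≤-reflexive (sym e)) = sym (∧-false _)
    ... | no ne rewrite ≡ᵇ-false ne = refl
    nx-t1 ρ x y i (k ∷ ks) with reg k in eq
    ... | false rewrite eq = nx-t1 ρ x y i ks
    ... | true rewrite eq | look ρ i y with i ≟ ρ y
    ...   | yes e rewrite sym e | ≡ᵇ-refl i | stay-Y (nx x y) (render ρ (suc i) ks) =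
            sym (<ᵇ-true (≤-trans (s≤s (m≤m+n i (size-of ks))) (≤-reflexive (sym (+-suc i _)))))
    ...   | no ne rewrite ≡ᵇ-false ne | ≡ᵇ-false (λ q → ne (sym q)) | stay-N (nx x y) (render ρ (suc i) ks) = refl

    nx-t0 : ∀ ρ x y i ks → i ≤ ρ x →
            accept (nx x y) (testing (nx x y) t0 (render ρ i ks)) ≡ (ρ y ≡ᵇ suc (ρ x)) ∧ (ρ y <ᵇ i + size-of ks)
    nx-t0 ρ x y i [] hx with ρ y ≟ suc (ρ x)
    ... | yes e rewrite end≤ {i} {ρ y} (≤-trans hx (≤-trans (n≤1+n _) (≤-reflexive (sym e)))) = sym (∧-false _)
    ... | no ne rewrite ≡ᵇ-false ne = refl
    nx-t0 ρ x y i (k ∷ ks) hx with reg k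
    ... | false rewrite look-none x = nx-t0 ρ x y i ks hx
    ... | true rewrite look ρ i x | +-suc i (size-of ks) with i ≟ ρ x
    ...   | yes e rewrite sym e | ≡ᵇ-refl i = nx-t1 ρ x y (suc i) ks
    ...   | no ne rewrite ≡ᵇ-false ne = nx-t0 ρ x y (suc i) ks (≤∧≢⇒< hx ne)

    lst-t1 : ∀ ρ x i ks → accept (lst x) (testing (lst x) t1 (render ρ i ks)) ≡ (0 ≡ᵇ size-of ks)
    lst-t1 ρ x i [] = refl
    lst-t1 ρ x i (k ∷ ks) with reg k in eq
    ... | false rewrite eq = lst-t1 ρ x i ks
    ... | true rewrite eq | stay-N (lst x) (render ρ (suc i) ks) = refl

    lst-t0 : ∀ ρ x i d ks → ρ x ≡ i + d → accept (lst x) (testing (lst x) t0 (render ρ i ks)) ≡ (suc d ≡ᵇ size-of ks)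
    lst-t0 ρ x i d [] e = refl
    lst-t0 ρ x i d (k ∷ ks) e with reg k
    ... | false rewrite look-none x = lst-t0 ρ x i d ks e
    lst-t0 ρ x i zero (k ∷ ks) e | true rewrite look ρ i x | trans e (+-identityʳ i) | ≡ᵇ-refl i = lst-t1 ρ x (suc i) ks
    lst-t0 ρ x i (suc d) (k ∷ ks) e | true rewrite look ρ i x
      | ≡ᵇ-false (λ q → m≢1+m+n i (trans q (trans e (+-suc i d)))) = lst-t0 ρ x (suc i) d ks (trans e (+-suc i d))

    kd-t0 : ∀ ρ x p i d ks → ρ x ≡ i + d → accept (kd x p) (testing (kd x p) t0 (render ρ i ks)) ≡ maybe′ p false (nth (region ks) d)
    kd-t0 ρ x p i d [] e = refl
    kd-t0 ρ x p i d (k ∷ ks) e with reg k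
    ... | false rewrite look-none x = kd-t0 ρ x p i d ks e
    kd-t0 ρ x p i zero (k ∷ ks) e | true rewrite look ρ i x | trans e (+-identityʳ i) | ≡ᵇ-refl i with p k
    ... | true rewrite stay-Y (kd x p) (render ρ (suc i) ks) = refl
    ... | false rewrite stay-N (kd x p) (render ρ (suc i) ks) = refl
    kd-t0 ρ x p i (suc d) (k ∷ ks) e | true rewrite look ρ i x
      | ≡ᵇ-false (λ q → m≢1+m+n i (trans q (trans e (+-suc i d)))) = kd-t0 ρ x p (suc i) d ks (trans e (+-suc i d))

    frs-t0 : ∀ ρ x ks → accept (frs x) (testing (frs x) t0 (render ρ 0 ks)) ≡ (ρ x ≡ᵇ 0) ∧ (ρ x <ᵇ size-of ks)
    frs-t0 ρ x [] = sym (∧-false _)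
    frs-t0 ρ x (k ∷ ks) with reg k in eq
    ... | false rewrite eq = frs-t0 ρ x ks
    ... | true rewrite eq | look ρ 0 x with ρ x
    ...   | zero  rewrite stay-Y (frs x) (render ρ 1 ks) = refl
    ...   | suc _ rewrite stay-N (frs x) (render ρ 1 ks) = refl

    test-correct : ∀ t ρ ks → accept t (testing t t0 (render ρ 0 ks)) ≡ holds t (region ks) ρ
    test-correct (lt x y) ρ ks = lt-t0 ρ x y 0 ks z≤n z≤n
    test-correct (nx x y) ρ ks = nx-t0 ρ x y 0 ks z≤n
    test-correct (kd x p) ρ ks = kd-t0 ρ x p 0 (ρ x) ks refl
    test-correct (lst x)  ρ ks = lst-t0 ρ x 0 (ρ x) ks refl
    test-correct (frs x)  ρ ks = frs-t0 ρ x ks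

-- A sweeper whose left sweeps only rewind
record Rewinder (Σ′ : ℕ) (X : Set) : Set₁ where
  field
    S    : Set
    finS : Finite S
    finX : Finite X
    R    : S → X → S × X
    turn : S → S × Maybe X
    ret  : S → S ⊎ Bool
    s₀   : S
    inpX : Fin Σ′ → X

  sweeper : Sweeper Σ′
  sweeper = record { S = S ; X = X ; finS = finS ; finX = finX ; R = R ; L = λ s x → s , x
                   ; turn = turn ; ret = ret ; s₀ = s₀ ; inpX = inpX }

-- Loop programs, their denotation and their execution

module Programs (Kd : Set) (finKd : Finite Kd) (K : ℕ) (reg : Kd → Bool) where
  open Loops Kd finKd K
  open Over reg

  infixr 5 _>>_

  -- The index bounds the slots in use: the body of a loop over slot `x` may loop only over smaller
  -- slots, so nested loops never disturb each other's marks.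
  data G : ℕ → Set where
    skip : ∀ {m} → G m
    emit : ∀ {m} (c : Kd) → reg c ≡ false → G m
    _>>_ : ∀ {m} → G m → G m → G m
    for  : ∀ {m} (x : Fin K) → toℕ x < m → G (toℕ x) → G m
    ifT  : ∀ {m} → Test → G m → G m → G m

  ⟦_⟧ : ∀ {m} → G m → List Kd → Env → List Kd
  ⟦ skip ⟧      rs ρ = []
  ⟦ emit c _ ⟧  rs ρ = c ∷ []
  ⟦ g >> h ⟧    rs ρ = ⟦ g ⟧ rs ρ ++ ⟦ h ⟧ rs ρ
  ⟦ for x _ g ⟧ rs ρ = cat 0 (length rs) (λ i → ⟦ g ⟧ rs (upd-env ρ x i))
  ⟦ ifT t g h ⟧ rs ρ = if holds t rs ρ then ⟦ g ⟧ rs ρ else ⟦ h ⟧ rs ρ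

  seqN : ∀ {m} → ℕ → ℕ → (ℕ → G m) → G m
  seqN p zero    h = skip
  seqN p (suc n) h = h p >> seqN (suc p) n h

  seqL : ∀ {m} {B : Set} → List B → (B → G m) → G m
  seqL [] h = skip
  seqL (b ∷ bs) h = h b >> seqL bs h

  ⟦seqN⟧ : ∀ {m} p n (h : ℕ → G m) rs ρ → ⟦ seqN p n h ⟧ rs ρ ≡ cat p n (λ w → ⟦ h w ⟧ rs ρ)
  ⟦seqN⟧ p zero h rs ρ = refl
  ⟦seqN⟧ p (suc n) h rs ρ = cong (⟦ h p ⟧ rs ρ ++_) (⟦seqN⟧ (suc p) n h rs ρ)

  ⟦seqL⟧ : ∀ {m} {B : Set} (bs : List B) (h : B → G m) rs ρ → ⟦ seqL bs h ⟧ rs ρ ≡ concatMap (λ b → ⟦ h b ⟧ rs ρ) bs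
  ⟦seqL⟧ [] h rs ρ = refl
  ⟦seqL⟧ (b ∷ bs) h rs ρ = cong (⟦ h b ⟧ rs ρ ++_) (⟦seqL⟧ bs h rs ρ)

  cost : ∀ {m} → G m → ℕ → ℕ
  cost skip        N = 1
  cost (emit _ _)  N = 1
  cost (g >> h)    N = cost g N + cost h N
  cost (for _ _ g) N = 1 + N * (cost g N + 1)
  cost (ifT _ g h) N = 1 + (cost g N + cost h N)

  pb-cost : ∀ {m} (g : G m) {N : ℕ → ℕ} → PolyBounded N → PolyBounded (λ n → cost g (N n))
  pb-cost skip        pb = pb-const 1
  pb-cost (emit _ _)  pb = pb-const 1
  pb-cost (g >> h)    pb = pb-+ (pb-cost g pb) (pb-cost h pb)
  pb-cost (for _ _ g) pb = pb-+ (pb-const 1) (pb-* pb (pb-+ (pb-cost g pb) (pb-const 1)))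
  pb-cost (ifT _ g h) pb = pb-+ (pb-const 1) (pb-+ (pb-cost g pb) (pb-cost h pb))

  PC : ∀ {m} → G m → Set
  PC skip        = Unit
  PC (emit _ _)  = Unit
  PC (g >> h)    = PC g ⊎ PC h
  PC (for _ _ g) = Carry ⊎ PC g
  PC (ifT _ g h) = TSt ⊎ PC g ⊎ PC h

  finPC : ∀ {m} (g : G m) → Finite (PC g)
  finPC skip        = fin-⊤
  finPC (emit _ _)  = fin-⊤
  finPC (g >> h)    = fin-⊎ (finPC g) (finPC h)
  finPC (for _ _ g) = fin-⊎ (fin-Maybe fin-Bool) (finPC g)
  finPC (ifT _ g h) = fin-⊎ fin-Fin (fin-⊎ (finPC g) (finPC h))

  start : ∀ {m} (g : G m) → PC g
  start skip        = tt
  start (emit _ _)  = tt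
  start (g >> h)    = inj₁ (start g)
  start (for _ _ g) = inj₁ carry
  start (ifT _ g h) = inj₁ t0

  stepG : ∀ {m} (g : G m) → PC g → MCell → PC g × MCell
  stepG skip       q c = q , c
  stepG (emit _ _) q c = q , c
  stepG (g >> h) (inj₁ q) c = let (q′ , c′) = stepG g q c in inj₁ q′ , c′
  stepG (g >> h) (inj₂ q) c = let (q′ , c′) = stepG h q c in inj₂ q′ , c′
  stepG (for x _ g) (inj₁ q) c = let (q′ , c′) = advR x q c in inj₁ q′ , c′
  stepG (for x _ g) (inj₂ q) c = let (q′ , c′) = stepG g q c in inj₂ q′ , c′
  stepG (ifT t g h) (inj₁ q) c = inj₁ (testR t q c) , c
  stepG (ifT t g h) (inj₂ (inj₁ q)) c = let (q′ , c′) = stepG g q c in inj₂ (inj₁ q′) , c′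
  stepG (ifT t g h) (inj₂ (inj₂ q)) c = let (q′ , c′) = stepG h q c in inj₂ (inj₂ q′) , c′

  next-pc : ∀ {P Q : Set} → (P → Q) → Q → Maybe P × Maybe MCell → Q × Maybe MCell
  next-pc j k (just p  , a) = j p , a
  next-pc j k (nothing , a) = k , a

  embed : ∀ {P Q : Set} → (P → Q) → Maybe Q → Maybe P × Maybe MCell → Maybe Q × Maybe MCell
  embed j k (just p  , a) = just (j p) , a
  embed j k (nothing , a) = k , a

  after-adv : ∀ {P : Set} → P → Carry → Maybe P
  after-adv p placed = just p
  after-adv p _      = nothing

  turnG : ∀ {m} (g : G m) → PC g → Maybe (PC g) × Maybe MCell
  turnG skip       q = nothing , nothing
  turnG (emit c _) q = nothing , just (c , none)
  turnG (g >> h) (inj₁ q) = embed inj₁ (just (inj₂ (start h))) (turnG g q)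
  turnG (g >> h) (inj₂ q) = embed inj₂ nothing (turnG h q)
  turnG (for x _ g) (inj₁ q) = after-adv (inj₂ (start g)) q , nothing
  turnG (for x _ g) (inj₂ q) = embed inj₂ (just (inj₁ seek)) (turnG g q)
  turnG (ifT t g h) (inj₁ q) = just (inj₂ (if accept t q then inj₁ (start g) else inj₂ (start h))) , nothing
  turnG (ifT t g h) (inj₂ (inj₁ q)) = embed (inj₂ ∘ inj₁) nothing (turnG g q)
  turnG (ifT t g h) (inj₂ (inj₂ q)) = embed (inj₂ ∘ inj₂) nothing (turnG h q)

  module Execution {Σ′} (W : Rewinder Σ′ MCell) where
    open Rewinder W
    open Sweeper sweeper using (Rounds; ended; fire; rounds-trans; round; sweepR; sweepL; extend)

    -- The states of `g` form a part of the states of one fixed machine, and control passes to `k`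
    -- when `g` ends. Execution can thus be proved by recursion on subprograms without changing the
    -- machine.
    record Embedded {m} (g : G m) (k : S) : Set where
      field
        at      : PC g → S
        at-R    : ∀ q c → R (at q) c ≡ (at (proj₁ (stepG g q c)) , proj₂ (stepG g q c))
        at-turn : ∀ q → turn (at q) ≡ next-pc at k (turnG g q)
        at-ret  : ∀ q → ret (at q) ≡ inj₁ (at q)
        k-ret   : ret k ≡ inj₁ k
    open Embedded

    rewind : ∀ s xs → sweepL s xs ≡ (s , xs)
    rewind s [] = refl
    rewind s (x ∷ xs) rewrite rewind s xs = refl

    sweep-as : ∀ {Q : Set} (r : Q → MCell → Q × MCell) (j : Q → S) → (∀ q c → R (j q) c ≡ (j (proj₁ (r q c)) , proj₂ (r q c))) →
               ∀ q cs → sweepR (j q) cs ≡ (j (proj₁ (sweepA r q cs)) , proj₂ (sweepA r q cs))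
    sweep-as r j h q [] = refl
    sweep-as r j h q (c ∷ cs) rewrite h q c | sweep-as r j h (proj₁ (r q c)) cs = refl

    one-round : ∀ {s cs s₁ cs₁ s₂ a} → sweepR s cs ≡ (s₁ , cs₁) → turn s₁ ≡ (s₂ , a) → ret s₂ ≡ inj₁ s₂ →
                Rounds s cs s₂ (extend cs₁ a) 1
    one-round {s} {cs} {s₁} {cs₁} {s₂} {a} e t r = fire round-eq r ended
      where
        round-eq : round s cs ≡ (s₂ , extend cs₁ a)
        round-eq rewrite e | t = rewind s₂ (extend cs₁ a)

    private
      compose-next : ∀ {P Q : Set} (j : P → Q) (at : Q → S) (k : S) (m : Maybe Q) z →
        next-pc at k (embed j m z) ≡ next-pc (at ∘ j) (maybe′ at k m) z
      compose-next j at k m (just p , a) = refl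
      compose-next j at k (just q) (nothing , a) = refl
      compose-next j at k nothing (nothing , a) = refl

    sub-left : ∀ {m} {g h : G m} {k} → (e : Embedded (g >> h) k) → Embedded g (at e (inj₂ (start h)))
    sub-left {g = g} {h} e = record { at = at e ∘ inj₁ ; at-R = λ q c → at-R e (inj₁ q) c
      ; at-turn = λ q → trans (at-turn e (inj₁ q)) (compose-next inj₁ (at e) _ (just (inj₂ (start h))) (turnG g q))
      ; at-ret = λ q → at-ret e (inj₁ q) ; k-ret = at-ret e (inj₂ (start h)) }

    sub-right : ∀ {m} {g h : G m} {k} → Embedded (g >> h) k → Embedded h k
    sub-right {h = h} e = record { at = at e ∘ inj₂ ; at-R = λ q c → at-R e (inj₂ q) c
      ; at-turn = λ q → trans (at-turn e (inj₂ q)) (compose-next inj₂ (at e) _ nothing (turnG h q))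
      ; at-ret = λ q → at-ret e (inj₂ q) ; k-ret = k-ret e }

    sub-body : ∀ {m x l} {g : G (toℕ x)} {k} → (e : Embedded (for {m} x l g) k) → Embedded g (at e (inj₁ seek))
    sub-body {g = g} e = record { at = at e ∘ inj₂ ; at-R = λ q c → at-R e (inj₂ q) c
      ; at-turn = λ q → trans (at-turn e (inj₂ q)) (compose-next inj₂ (at e) _ (just (inj₁ seek)) (turnG g q))
      ; at-ret = λ q → at-ret e (inj₂ q) ; k-ret = at-ret e (inj₁ seek) }

    sub-then : ∀ {m t} {g h : G m} {k} → Embedded (ifT t g h) k → Embedded g k
    sub-then {g = g} e = record { at = at e ∘ inj₂ ∘ inj₁ ; at-R = λ q c → at-R e (inj₂ (inj₁ q)) c
      ; at-turn = λ q → trans (at-turn e (inj₂ (inj₁ q))) (compose-next (inj₂ ∘ inj₁) (at e) _ nothing (turnG g q))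
      ; at-ret = λ q → at-ret e (inj₂ (inj₁ q)) ; k-ret = k-ret e }

    sub-else : ∀ {m t} {g h : G m} {k} → Embedded (ifT t g h) k → Embedded h k
    sub-else {h = h} e = record { at = at e ∘ inj₂ ∘ inj₂ ; at-R = λ q c → at-R e (inj₂ (inj₂ q)) c
      ; at-turn = λ q → trans (at-turn e (inj₂ (inj₂ q))) (compose-next (inj₂ ∘ inj₂) (at e) _ nothing (turnG h q))
      ; at-ret = λ q → at-ret e (inj₂ (inj₂ q)) ; k-ret = k-ret e }

    -- The slots at the program's disposal point just past the region and show no mark.
    Off : ℕ → Env → List Kd → Set
    Off m ρ ks = ∀ x → toℕ x < m → ρ x ≡ size-of ks

    Executes : ∀ {m} → G m → S → S → Env → List Kd → Set
    Executes g s k ρ ks = ∃ λ ls → ls ≡ ⟦ g ⟧ (region ks) ρ × region (ks ++ ls) ≡ region ks × ∃ λ j →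
      Rounds s (render ρ 0 ks) k (render ρ 0 (ks ++ ls)) j × j ≤ cost g (size-of ks)

    idle-sweep : ∀ {m} (g : G m) q → (∀ q c → stepG g q c ≡ (q , c)) → ∀ cs → sweepA (stepG g) q cs ≡ (q , cs)
    idle-sweep g q h [] = refl
    idle-sweep g q h (c ∷ cs) rewrite h q c | idle-sweep g q h cs = refl

    test-sweep : ∀ {m} t (g h : G m) q cs → sweepA (stepG (ifT t g h)) (inj₁ q) cs ≡ (inj₁ (testing t q cs) , cs)
    test-sweep t g h q [] = refl
    test-sweep t g h q (c ∷ cs) rewrite test-sweep t g h (testR t q c) cs = refl

    adv-sweep : ∀ {m} x l (g : G (toℕ x)) q cs → sweepA (stepG (for {m} x l g)) (inj₁ q) cs
              ≡ (inj₁ (proj₁ (sweepA (advR x) q cs)) , proj₂ (sweepA (advR x) q cs))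
    adv-sweep x l g q [] = refl
    adv-sweep {m} x l g q (c ∷ cs) rewrite adv-sweep {m} x l g (proj₁ (advR x q c)) cs = refl

    round-of : ∀ {m} {g : G m} {k} (e : Embedded g k) {q cs q′ cs′ z} → sweepA (stepG g) q cs ≡ (q′ , cs′) →
               turnG g q′ ≡ z → let (s , a) = next-pc (at e) k z in Rounds (at e q) cs s (extend cs′ a) 1
    round-of {g = g} {k} e {q} {cs} {q′} {cs′} {z} sw refl = one-round
      (trans (sweep-as (stepG g) (at e) (at-R e) q cs) (cong (λ y → at e (proj₁ y) , proj₂ y) sw))
      (at-turn e q′) (returns (turnG g q′))
      where
        returns : ∀ z → ret (proj₁ (next-pc (at e) k z)) ≡ inj₁ (proj₁ (next-pc (at e) k z))
        returns (just p , a)  = at-ret e p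
        returns (nothing , a) = k-ret e

    execute : ∀ {m} (g : G m) {k} (e : Embedded g k) ρ ks → Off m ρ ks → Executes g (at e (start g)) k ρ ks
    -- The loop from its pass at position `p` on, with `n` passes to follow. The tape grows
    -- meanwhile, but its region, and with it the range, stays the same.
    iterate : ∀ {m} x l (g : G (toℕ x)) {k} (e : Embedded (for {m} x l g) k) ρ n p ks → Off m ρ ks → p + suc n ≡ size-of ks →
      ∃ λ ls → ls ≡ cat p (suc n) (λ i → ⟦ g ⟧ (region ks) (upd-env ρ x i)) × region (ks ++ ls) ≡ region ks × ∃ λ j →
      Rounds (at e (inj₂ (start g))) (render (upd-env ρ x p) 0 ks) k (render ρ 0 (ks ++ ls)) j × j ≤ suc n * (cost g (size-of ks) + 1)

    execute {m} skip {k} e ρ ks off = [] , refl , cong region (++-identityʳ ks) , 1 ,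
      subst (λ z → Rounds (at e tt) (render ρ 0 ks) k (render ρ 0 z) 1) (sym (++-identityʳ ks)) (round-of e (idle-sweep {m} skip tt (λ _ _ → refl) (render ρ 0 ks)) refl) , ≤-refl
    execute {m} (emit c ok) {k} e ρ ks off = c ∷ [] , refl , trans (region-++ ks (c ∷ [])) (trans (cong (region ks ++_) (empty ok)) (++-identityʳ _)) , 1 ,
      subst (λ z → Rounds (at e tt) (render ρ 0 ks) k z 1) (sym (render-snoc ρ 0 ks c ok)) (round-of e (idle-sweep {m} (emit c ok) tt (λ _ _ → refl) (render ρ 0 ks)) refl) , ≤-refl
      where
        empty : ∀ {c} → reg c ≡ false → region (c ∷ []) ≡ []
        empty h rewrite h = refl
    execute (g >> h) {k} e ρ ks off with execute g (sub-left e) ρ ks off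
    ... | ls , refl , rg , j , r , b with execute h (sub-right e) ρ (ks ++ ls) (λ x l → trans (off x l) (cong length (sym rg)))
    ...   | ls′ , refl , rg′ , j′ , r′ , b′ = ls ++ ls′ , cong (λ z → ls ++ ⟦ h ⟧ z ρ) rg ,
            trans (cong region (sym (++-assoc ks ls ls′))) (trans rg′ rg) , j + j′ ,
            subst (λ z → Rounds _ _ k (render ρ 0 z) (j + j′)) (++-assoc ks ls ls′) (rounds-trans r r′) ,
            +-mono-≤ b (subst (λ z → j′ ≤ cost h (length z)) rg b′)
    execute (ifT t g h) {k} e ρ ks off = branch (holds t (region ks) ρ) (test-correct t ρ ks)
      where
        first : ∀ b → accept t (testing t t0 (render ρ 0 ks)) ≡ b →
                Rounds (at e (inj₁ t0)) (render ρ 0 ks) (at e (inj₂ (if b then inj₁ (start g) else inj₂ (start h)))) (render ρ 0 ks) 1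
        first b eq = subst (λ b → Rounds (at e (inj₁ t0)) (render ρ 0 ks) (at e (inj₂ (if b then inj₁ (start g) else inj₂ (start h)))) (render ρ 0 ks) 1)
          eq (round-of e (test-sweep t g h t0 (render ρ 0 ks)) refl)
        branch : ∀ b → accept t (testing t t0 (render ρ 0 ks)) ≡ b → ∃ λ ls → ls ≡ (if b then ⟦ g ⟧ (region ks) ρ else ⟦ h ⟧ (region ks) ρ)
          × region (ks ++ ls) ≡ region ks × ∃ λ j → Rounds (at e (inj₁ t0)) (render ρ 0 ks) k (render ρ 0 (ks ++ ls)) j
          × j ≤ 1 + (cost g (size-of ks) + cost h (size-of ks))
        branch true eq with execute g (sub-then e) ρ ks off
        ... | ls , d , rg , j , r , b = ls , d , rg , suc j , rounds-trans (first true eq) r , s≤s (≤-trans b (m≤m+n _ _))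
        branch false eq with execute h (sub-else e) ρ ks off
        ... | ls , d , rg , j , r , b = ls , d , rg , suc j , rounds-trans (first false eq) r , s≤s (≤-trans b (m≤n+m _ _))
    execute (for {m} x l g) {k} e ρ ks off = enter (size-of ks) refl
      where
        place : sweepA (stepG (for {m} x l g)) (inj₁ carry) (render ρ 0 ks) ≡ (inj₁ (outcomeC (size-of ks)) , render (upd-env ρ x 0) 0 ks)
        place = trans (adv-sweep {m} x l g carry (render ρ 0 ks)) (cong (λ z → inj₁ (proj₁ z) , proj₂ z)
          (adv-carry ρ x 0 ks (λ j _ u q → <-irrefl (trans q (off x l)) u)))
        enter : ∀ N → size-of ks ≡ N → ∃ λ ls → ls ≡ cat 0 N (λ i → ⟦ g ⟧ (region ks) (upd-env ρ x i))
          × region (ks ++ ls) ≡ region ks × ∃ λ j → Rounds (at e (inj₁ carry)) (render ρ 0 ks) k (render ρ 0 (ks ++ ls)) j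
          × j ≤ 1 + N * (cost g N + 1)
        enter zero eq = [] , refl , cong region (++-identityʳ ks) , 1 ,
          subst (λ z → Rounds _ _ k z 1) (trans (render-cong (upd-env ρ x 0) ρ 0 ks (λ y j _ u → ⊥-elim (n≮0 (subst (j <_) eq u)))) (cong (render ρ 0) (sym (++-identityʳ ks))))
            (round-of e {z = nothing , nothing} place (cong (λ N → after-adv (inj₂ (start g)) (outcomeC N) , nothing) eq)) , s≤s z≤n
        enter (suc n) eq with iterate x l g e ρ n 0 ks off (sym eq)
        ... | ls , d , rg , j , r , b = ls , d , rg , suc j ,
              rounds-trans (round-of e {z = just (inj₂ (start g)) , nothing} place (cong (λ N → after-adv (inj₂ (start g)) (outcomeC N) , nothing) eq)) r ,
              s≤s (subst (λ N → j ≤ suc n * (cost g N + 1)) eq b)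

    iterate {m} x l g {k} e ρ n p ks off eq with execute g (sub-body e) (upd-env ρ x p) ks
        (λ y y<x → trans (upd-other ρ x p y (λ { refl → <-irrefl refl y<x })) (off y (<-trans y<x l)))
    ... | ls , dl , rg , j , r , b = continue n eq
      where
        ρ′ = upd-env ρ x p
        ks′ = ks ++ ls
        size′ : size-of ks′ ≡ size-of ks
        size′ = cong length rg
        render-upd : ∀ q → render (upd-env ρ′ x q) 0 ks′ ≡ render (upd-env ρ x q) 0 ks′
        render-upd q = render-cong (upd-env ρ′ x q) (upd-env ρ x q) 0 ks′ λ y j _ _ → cong (j ≡ᵇ_) (twice y)
          where
            twice : ∀ y → upd-env ρ′ x q y ≡ upd-env ρ x q y
            twice y with y ≟ᶠ x
            ... | yes _ = refl
            ... | no _  = refl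
        advance : ∀ n → p + suc n ≡ size-of ks → sweepA (stepG (for {m} x l g)) (inj₁ seek) (render ρ′ 0 ks′)
                ≡ (inj₁ (outcomeC n) , render (upd-env ρ x (suc p)) 0 ks′)
        advance n eq = trans (adv-sweep {m} x l g seek (render ρ′ 0 ks′)) (trans (cong (λ z → inj₁ (proj₁ z) , proj₂ z)
          (adv-seek ρ′ x p 0 ks′ n (upd-same ρ x p) z≤n (trans (sym (+-suc p n)) (trans eq (sym size′)))))
          (cong (λ z → inj₁ (outcomeC n) , z) (render-upd (suc p))))
        continue : ∀ n → p + suc n ≡ size-of ks → ∃ λ ls → ls ≡ cat p (suc n) (λ i → ⟦ g ⟧ (region ks) (upd-env ρ x i)) × region (ks ++ ls) ≡ region ks × ∃ λ j →
          Rounds (at e (inj₂ (start g))) (render (upd-env ρ x p) 0 ks) k (render ρ 0 (ks ++ ls)) j × j ≤ suc n * (cost g (size-of ks) + 1)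
        continue zero eq = ls , trans dl (sym (++-identityʳ _)) , rg , j + 1 ,
          rounds-trans r (subst (λ z → Rounds (at e (inj₁ seek)) (render ρ′ 0 ks′) k z 1)
            (render-cong (upd-env ρ x (suc p)) ρ 0 ks′ off-again)
            (round-of e {z = nothing , nothing} (advance zero eq) refl)) ,
          ≤-trans (+-monoˡ-≤ 1 b) (≤-reflexive (sym (+-identityʳ _)))
          where
            -- After the last pass the counter has advanced to the size of the region, which is
            -- precisely its off value.
            off-again : ∀ y i → 0 ≤ i → i < 0 + size-of ks′ → (i ≡ᵇ upd-env ρ x (suc p) y) ≡ (i ≡ᵇ ρ y)
            off-again y i _ u with y ≟ᶠ x
            ... | no _ = refl
            ... | yes refl = cong (i ≡ᵇ_) (trans (trans (sym (+-comm p 1)) eq) (sym (off x l)))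
        continue (suc n) eq with iterate x l g e ρ n (suc p) ks′ (λ y h → trans (off y h) (sym size′)) (trans (sym (+-suc p (suc n))) (trans eq (sym size′)))
        ... | ls′ , dl′ , rg′ , j′ , r′ , b′ = ls ++ ls′ ,
              cong₂ _++_ dl (trans dl′ (cong (λ rs → cat (suc p) (suc n) (λ i → ⟦ g ⟧ rs (upd-env ρ x i))) rg)) ,
              trans (cong region (sym (++-assoc ks ls ls′))) (trans rg′ rg) , (j + 1) + j′ ,
              subst (λ z → Rounds _ _ k (render ρ 0 z) ((j + 1) + j′)) (++-assoc ks ls ls′)
                (rounds-trans (rounds-trans r (round-of e {z = just (inj₂ (start g)) , nothing} (advance (suc n) eq) refl)) r′) ,
              +-mono-≤ (+-monoˡ-≤ 1 b) (subst (λ N → j′ ≤ suc n * (cost g N + 1)) size′ b′)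

-- Two loop programs in succession

module TwoPhase {Σ₁ Σ₂ : ℕ} (Kd : Set) (finKd : Finite Kd) (K : ℕ) (reg₁ reg₂ : Kd → Bool)
                (inK : Fin Σ₁ → Kd) (outK : Kd → Maybe (Fin Σ₂)) where
  open Loops Kd finKd K
  module O₁ = Over reg₁
  module O₂ = Over reg₂
  module P₁ = Programs Kd finKd K reg₁
  module P₂ = Programs Kd finKd K reg₂

  off : ℕ → Env
  off n _ = n

  plain : List Kd → List MCell
  plain = map (_, none)

  render-off : ∀ (reg : Kd → Bool) n i ks → i + Over.size-of reg ks ≤ n → Over.render reg (off n) i ks ≡ plain ks
  render-off reg n i [] h = refl
  render-off reg n i (k ∷ ks) h with reg k
  ... | false = cong ((k , none) ∷_) (render-off reg n i ks h)
  ... | true  = cong₂ _∷_ (cong (k ,_) (tabulate-cong λ _ → ≡ᵇ-false (λ e → <-irrefl e (≤-trans (s≤s (m≤m+n i _)) (≤-trans (≤-reflexive (sym (+-suc i _))) h)))))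
                  (render-off reg n (suc i) ks (≤-trans (≤-reflexive (sym (+-suc i _))) h))

  module _ {m₁ m₂ : ℕ} (g₁ : P₁.G m₁) (g₂ : P₂.G m₂) where

    -- The first program loops over the input and creates the cells that the second one loops over;
    -- this is how loops of polynomial length arise from an input of length `n`.
    first second : List (Fin Σ₁) → List Kd
    first w  = map inK w ++ P₁.⟦ g₁ ⟧ (O₁.region (map inK w)) (off (O₁.size-of (map inK w)))
    second w = P₂.⟦ g₂ ⟧ (O₂.region (first w)) (off (O₂.size-of (first w)))

    S : Set
    S = P₁.PC g₁ ⊎ P₂.PC g₂ ⊎ Bool

    pattern finishing = inj₂ (inj₂ false)
    pattern finished  = inj₂ (inj₂ true)

    R : S → MCell → S × MCell
    R (inj₁ q)        c = let (q′ , c′) = P₁.stepG g₁ q c in inj₁ q′ , c′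
    R (inj₂ (inj₁ q)) c = let (q′ , c′) = P₂.stepG g₂ q c in inj₂ (inj₁ q′) , c′
    R (inj₂ (inj₂ b)) c = inj₂ (inj₂ b) , c

    turn : S → S × Maybe MCell
    turn (inj₁ q)        = P₁.next-pc inj₁ (inj₂ (inj₁ (P₂.start g₂))) (P₁.turnG g₁ q)
    turn (inj₂ (inj₁ q)) = P₂.next-pc (inj₂ ∘ inj₁) finishing (P₂.turnG g₂ q)
    turn (inj₂ (inj₂ b)) = finished , nothing

    ret : S → S ⊎ Bool
    ret finished = inj₂ true
    ret s        = inj₁ s

    rewinder : Rewinder Σ₁ MCell
    rewinder = record { S = S ; finS = fin-⊎ (P₁.finPC g₁) (fin-⊎ (P₂.finPC g₂) fin-Bool) ; finX = finMCell
      ; R = R ; turn = turn ; ret = ret ; s₀ = inj₁ (P₁.start g₁) ; inpX = λ a → inK a , none }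

    open Sweeper (Rewinder.sweeper rewinder) using (Rounds; rounds-trans; round; sweepR; Halts; halts)
    module E₁ = P₁.Execution rewinder
    module E₂ = P₂.Execution rewinder

    embedded₁ : E₁.Embedded g₁ (inj₂ (inj₁ (P₂.start g₂)))
    embedded₁ = record { at = inj₁ ; at-R = λ _ _ → refl ; at-turn = λ _ → refl ; at-ret = λ _ → refl ; k-ret = refl }

    embedded₂ : E₂.Embedded g₂ finishing
    embedded₂ = record { at = inj₂ ∘ inj₁ ; at-R = λ _ _ → refl ; at-turn = λ _ → refl ; at-ret = λ _ → refl ; k-ret = refl }

    last-sweep : ∀ cs → sweepR finishing cs ≡ (finishing , cs)
    last-sweep [] = refl
    last-sweep (c ∷ cs) rewrite last-sweep cs = refl

    computes : ∀ w → Σ (Halts w) λ h → Halts.rounds h ≤ P₁.cost g₁ (O₁.size-of (map inK w)) + P₂.cost g₂ (O₂.size-of (first w))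
                   × Halts.wsₕ h ≡ plain (first w ++ second w)
    computes w with E₁.execute g₁ embedded₁ (off (O₁.size-of (map inK w))) (map inK w) (λ _ _ → refl)
    ... | ls₁ , refl , rg₁ , j₁ , r₁ , b₁ with E₂.execute g₂ embedded₂ (off (O₂.size-of (first w))) (first w) (λ _ _ → refl)
    ... | ls₂ , refl , rg₂ , j₂ , r₂ , b₂ = halts (j₁ + j₂) true trace final refl , +-mono-≤ b₁ b₂ , refl
      where
        begin₁ : O₁.render (off (O₁.size-of (map inK w))) 0 (map inK w) ≡ map (λ a → inK a , none) w
        begin₁ = trans (render-off reg₁ _ 0 (map inK w) ≤-refl) (sym (map-∘ w))
        middle : O₁.render (off (O₁.size-of (map inK w))) 0 (first w) ≡ O₂.render (off (O₂.size-of (first w))) 0 (first w)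
        middle = trans (render-off reg₁ _ 0 (first w) (≤-reflexive (cong length rg₁))) (sym (render-off reg₂ _ 0 (first w) ≤-refl))
        end : O₂.render (off (O₂.size-of (first w))) 0 (first w ++ second w) ≡ plain (first w ++ second w)
        end = render-off reg₂ _ 0 (first w ++ second w) (≤-reflexive (cong length rg₂))
        trace : Rounds (inj₁ (P₁.start g₁)) (map (λ a → inK a , none) w) finishing (plain (first w ++ second w)) (j₁ + j₂)
        trace = rounds-trans
          (subst₂ (λ a b → Rounds (inj₁ (P₁.start g₁)) a (inj₂ (inj₁ (P₂.start g₂))) b j₁) begin₁ middle r₁)
          (subst (λ b → Rounds (inj₂ (inj₁ (P₂.start g₂))) (O₂.render (off (O₂.size-of (first w))) 0 (first w)) finishing b j₂) end r₂)
        final : round finishing (plain (first w ++ second w)) ≡ (finished , plain (first w ++ second w))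
        final rewrite last-sweep (plain (first w ++ second w)) = E₁.rewind finished (plain (first w ++ second w))

    mapMaybe-plain : ∀ ks → mapMaybe (λ c → outK (proj₁ c)) (plain ks) ≡ mapMaybe outK ks
    mapMaybe-plain [] = refl
    mapMaybe-plain (k ∷ ks) with outK k
    ... | nothing = mapMaybe-plain ks
    ... | just _  = cong (_ ∷_) (mapMaybe-plain ks)

    two-phase-polytime : (f : List (Fin Σ₁) → List (Fin Σ₂)) → (∀ w → mapMaybe outK (first w ++ second w) ≡ f w) →
      (n₁ n₂ : ℕ → ℕ) → (∀ w → O₁.size-of (map inK w) ≡ n₁ (length w)) → (∀ w → O₂.size-of (first w) ≡ n₂ (length w)) →
      PolyBounded n₁ → PolyBounded n₂ → PolyTimeComputable f
    two-phase-polytime f ok n₁ n₂ e₁ e₂ pb₁ pb₂ = sweeper-polytime (Rewinder.sweeper rewinder) (λ c → outK (proj₁ c)) f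
      (λ n → P₁.cost g₁ (n₁ n) + P₂.cost g₂ (n₂ n)) (pb-+ (P₁.pb-cost g₁ pb₁) (P₂.pb-cost g₂ pb₂)) λ w →
      let (h , b , out) = computes w in h ,
        subst₂ (λ a b → Halts.rounds h ≤ P₁.cost g₁ a + P₂.cost g₂ b) (e₁ w) (e₂ w) b ,
        trans (cong (mapMaybe (λ c → outK (proj₁ c))) out) (trans (mapMaybe-plain (first w ++ second w)) (ok w))

-- Quantified Boolean formulas in GLP

level : ℕ → ℕ
level zero    = 0
level (suc i) = suc (2 * level i)

level-< : ∀ i → level i < level (suc i)
level-< i = s≤s (m≤m+n (level i) (level i + 0))

level-mono : ∀ {i j} → i < j → level i < level j
level-mono {i} {suc j} (s≤s i≤j) with m≤n⇒m<n∨m≡n i≤j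
... | inj₁ i<j  = <-trans (level-mono i<j) (level-< j)
... | inj₂ refl = level-< i

worm : ℕ → ℕ → CFm
worm v zero    = ⊤
worm v (suc n) = ⟨ level (v + v) ⟩ ⟨ level (suc (v + v)) ⟩ worm (suc v) n

-- At a stopped valuation a watched diamond with a true argument is true, otherwise it would be new;
-- the worm becomes true from the inside out.
worm-true : ∀ {Φ u} → Stopped Φ u → ∀ v n → (∀ {i} → i ∈ items (worm v n) → i ∈ Φ) → u ⊨ ι (worm v n)
worm-true stop v zero inc = refl
worm-true {Φ} {u} stop v (suc n) inc = grow _ _ (inc (here refl)) (grow _ _ (inc (there (here refl)))
  (worm-true stop (suc v) n (λ i → inc (there (there i)))))
  where
    grow : ∀ m A → (m , A) ∈ Φ → u ⊨ A → u ⊨ ⟨ m ⟩ A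
    grow m A i a with bool? (u (⟨ m ⟩ A))
    ... | inj₁ x = x
    ... | inj₂ x = ⊥-elim (true≢false a (new-false {u} {m} {A} (stop m A i) x))

-- The last valuation of a run makes the worm true, so its negation is not provable. This keeps the
-- premise `F 0` of the translated formulas from being vacuous.
worm-consistent : ∀ v n → ¬ GLP⊢ ι (¬' worm v n)
worm-consistent v n d with run-to-stop (items (¬' worm v n))
... | vs , u , r , stop = not-elim′ (provable-visited (¬' worm v n) d r) (worm-true stop v n (λ i → i))

data Bf : Set where
  tt′ ff′ : Bf
  vr      : ℕ → Bf
  _∧ᵇ′_ _∨ᵇ′_ _⇒ᵇ′_ : Bf → Bf → Bf
  ¬ᵇ′_    : Bf → Bf

evalB : (ℕ → Bool) → Bf → Bool
evalB ρ tt′ = true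
evalB ρ ff′ = false
evalB ρ (vr i) = ρ i
evalB ρ (a ∧ᵇ′ b) = evalB ρ a ∧ evalB ρ b
evalB ρ (a ∨ᵇ′ b) = evalB ρ a ∨ evalB ρ b
evalB ρ (a ⇒ᵇ′ b) = not (evalB ρ a) ∨ evalB ρ b
evalB ρ (¬ᵇ′ a) = not (evalB ρ a)

Below : ℕ → Bf → Set
Below v tt′ = Unit
Below v ff′ = Unit
Below v (vr i) = i < v
Below v (a ∧ᵇ′ b) = Below v a × Below v b
Below v (a ∨ᵇ′ b) = Below v a × Below v b
Below v (a ⇒ᵇ′ b) = Below v a × Below v b
Below v (¬ᵇ′ a) = Below v a

evalB-cong : ∀ {ρ σ} v a → Below v a → (∀ i → i < v → ρ i ≡ σ i) → evalB ρ a ≡ evalB σ a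
evalB-cong v tt′ s h = refl
evalB-cong v ff′ s h = refl
evalB-cong v (vr i) s h = h i s
evalB-cong v (a ∧ᵇ′ b) (s , t) h = cong₂ _∧_ (evalB-cong v a s h) (evalB-cong v b t h)
evalB-cong v (a ∨ᵇ′ b) (s , t) h = cong₂ _∨_ (evalB-cong v a s h) (evalB-cong v b t h)
evalB-cong v (a ⇒ᵇ′ b) (s , t) h = cong₂ (λ x y → not x ∨ y) (evalB-cong v a s h) (evalB-cong v b t h)
evalB-cong v (¬ᵇ′ a) s h = cong not (evalB-cong v a s h)

-- Implications may stand between the quantifiers, so the formula needs no prenex form: each level
-- of Savitch's recursion puts its condition right where its variables have been bound.
data It : Set where
  allI exI : It
  impI     : Bf → It

quantifiers : List It → ℕ
quantifiers [] = 0
quantifiers (allI ∷ its) = suc (quantifiers its)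
quantifiers (exI ∷ its) = suc (quantifiers its)
quantifiers (impI _ ∷ its) = quantifiers its

Scoped : ℕ → List It → Bf → Set
Scoped v [] l = Below v l
Scoped v (allI ∷ its) l = Scoped (suc v) its l
Scoped v (exI ∷ its) l = Scoped (suc v) its l
Scoped v (impI a ∷ its) l = Below v a × Scoped v its l

set : (ℕ → Bool) → ℕ → Bool → ℕ → Bool
set ρ v b i = if i ≡ᵇ v then b else ρ i

set-same : ∀ ρ v b → set ρ v b v ≡ b
set-same ρ v b with v ≡ᵇ v in e
... | true  = refl
... | false = ⊥-elim (subst T e (≡⇒≡ᵇ v v refl))

set-below : ∀ ρ v b i → i < v → set ρ v b i ≡ ρ i
set-below ρ v b i i<v with i ≡ᵇ v in e
... | false = refl
... | true  = ⊥-elim (<-irrefl (≡ᵇ⇒≡ i v (subst T (sym e) tt)) i<v)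

qval : ℕ → List It → Bf → (ℕ → Bool) → Bool
qval v [] l ρ = evalB ρ l
qval v (allI ∷ its) l ρ = qval (suc v) its l (set ρ v false) ∧ qval (suc v) its l (set ρ v true)
qval v (exI ∷ its) l ρ = qval (suc v) its l (set ρ v false) ∨ qval (suc v) its l (set ρ v true)
qval v (impI a ∷ its) l ρ = not (evalB ρ a) ∨ qval v its l ρ

module QBF (N : ℕ) where

  F : ℕ → CFm
  F v = worm v (N ∸ v)

  xv : ℕ → CFm
  xv v = ⟨ level (v + v) ⟩ F (suc v)

  trB : Bf → CFm
  trB tt′ = ⊤
  trB ff′ = ⊥
  trB (vr i) = xv i
  trB (a ∧ᵇ′ b) = trB a ∧' trB b
  trB (a ∨ᵇ′ b) = trB a ∨' trB b
  trB (a ⇒ᵇ′ b) = trB a ⇒ trB b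
  trB (¬ᵇ′ a) = ¬' trB a

  tr : ℕ → List It → Bf → CFm
  tr v [] l = trB l
  tr v (allI ∷ its) l = ¬' ⟨ level (v + v) ⟩ ¬' (F (suc v) ⇒ tr (suc v) its l)
  tr v (exI ∷ its) l = ⟨ level (v + v) ⟩ (F (suc v) ∧' tr (suc v) its l)
  tr v (impI a ∷ its) l = trB a ⇒ tr v its l

  F-unfold : ∀ {v} → v < N → F v ≡ ⟨ level (v + v) ⟩ ⟨ level (suc (v + v)) ⟩ F (suc v)
  F-unfold {v} v<N = cong (worm v) (+-∸-assoc 1 v<N)

  literal : Bool → CFm → CFm
  literal true  A = A
  literal false A = ¬' A

  literal-val : ∀ b A u → u ⊨ ι (literal b A) → evalP u (ι A) ≡ b
  literal-val true  A u h = h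
  literal-val false A u h = not-elim h

  val-literal : ∀ b A u → evalP u (ι A) ≡ b → u ⊨ ι (literal b A)
  val-literal true  A u h = h
  val-literal false A u h = cong not h

  -- Let `m < m′` be the two levels. For the false literal, `⟨m⟩⟨m′⟩A` gives `⟨m⟩A` and Löb's axiom
  -- adds `¬⟨m⟩A`. For the true literal, `⟨m′⟩A` gives `⟨m⟩A`, which persists into the
  -- `m′`-accessible world of `A`; monotonicity and transitivity bring the conjunction under a
  -- single `⟨m⟩`.
  split : ∀ {v} → v < N → ∀ b → ⊩ (λ u → u ⊨ ι (F v) → u ⊨ ⟨ level (v + v) ⟩ (ι (F (suc v)) ∧' ι (literal b (xv v))))
  split {v} v<N b rewrite F-unfold v<N = go b
    where
      m = level (v + v)
      m′ = level (suc (v + v))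
      A = ι (F (suc v))
      m<m′ : m < m′
      m<m′ = level-< (v + v)
      go : ∀ b → ⊩ (λ u → u ⊨ ⟨ m ⟩ ⟨ m′ ⟩ A → u ⊨ ⟨ m ⟩ (A ∧' ι (literal b (xv v))))
      go false = ⊩-map₃ (λ u f g h x → h (g (f x)))
        (⊩-nec m {⟨ m′ ⟩ A} {⟨ m ⟩ A} (⊩-mono A (<⇒≤ m<m′))) (⊩-trans m A) (⊩-löb m A)
      go true = ⊩-map₂ (λ u f g x → g (f x)) (⊩-nec m {⟨ m′ ⟩ A} {⟨ m ⟩ (A ∧' ⟨ m ⟩ A)} inner) (⊩-trans m (A ∧' ⟨ m ⟩ A))
        where
          into : ⊩ (λ u → u ⊨ ⟨ m ⟩ A → u ⊨ ⟨ m′ ⟩ A → u ⊨ ⟨ m′ ⟩ (⟨ m ⟩ A ∧' A))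
          into = persistent-into {m′} {⟨ m ⟩ A} A (persistent-◇ A m<m′)
          commute : ⊩ (λ u → u ⊨ ⟨ m′ ⟩ (⟨ m ⟩ A ∧' A) → u ⊨ ⟨ m′ ⟩ (A ∧' ⟨ m ⟩ A))
          commute = ⊩-nec m′ {⟨ m ⟩ A ∧' A} {A ∧' ⟨ m ⟩ A} (⊩-pure λ u x → ∧-intro (proj₂ (∧-elim {u (⟨ m ⟩ A)} x)) (proj₁ (∧-elim x)))
          inner : ⊩ (λ u → u ⊨ ⟨ m′ ⟩ A → u ⊨ ⟨ m ⟩ (A ∧' ⟨ m ⟩ A))
          inner = ⊩-map₂ (λ u (f , g) (h , k) x → k (h (g (f x) x)))
            (⊩-both (⊩-mono A (<⇒≤ m<m′)) into) (⊩-both commute (⊩-mono (A ∧' ⟨ m ⟩ A) (<⇒≤ m<m′)))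

  assigned : (ℕ → Bool) → ℕ → Fm
  assigned ρ zero    = ⊤
  assigned ρ (suc v) = ι (literal (ρ v) (xv v)) ∧' assigned ρ v

  Assigned : (ℕ → Bool) → ℕ → Val → Set
  Assigned ρ v u = ∀ i → i < v → evalP u (ι (xv i)) ≡ ρ i

  assigned-elim : ∀ ρ v u → u ⊨ assigned ρ v → Assigned ρ v u
  assigned-elim ρ (suc v) u h i i≤v with ∧-elim {evalP u (ι (literal (ρ v) (xv v)))} h | m≤n⇒m<n∨m≡n (s≤s⁻¹ i≤v)
  ... | a , b | inj₁ i<v  = assigned-elim ρ v u b i i<v
  ... | a , b | inj₂ refl = literal-val (ρ v) (xv v) u a

  assigned-intro : ∀ ρ v u → Assigned ρ v u → u ⊨ assigned ρ v
  assigned-intro ρ zero u h = refl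
  assigned-intro ρ (suc v) u h = ∧-intro (val-literal (ρ v) (xv v) u (h v ≤-refl)) (assigned-intro ρ v u λ i l → h i (m≤n⇒m≤1+n l))

  assigned-persistent : ∀ ρ v w → v ≤ w → Persistent (level (w + w)) (assigned ρ v)
  assigned-persistent ρ zero w _ = persistent-⊤ _
  assigned-persistent ρ (suc v) w v<w = persistent-∧ {level (w + w)} {ι (literal (ρ v) (xv v))} (one (ρ v)) (assigned-persistent ρ v w (<⇒≤ v<w))
    where
      one : ∀ b → Persistent (level (w + w)) (ι (literal b (xv v)))
      one true  = persistent-◇ (ι (F (suc v))) (level-mono (+-mono-< v<w v<w))
      one false = persistent-¬◇ (ι (F (suc v))) (level-mono (+-mono-< v<w v<w))

  trB-val : ∀ ρ v u a → Below v a → Assigned ρ v u → evalP u (ι (trB a)) ≡ evalB ρ a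
  trB-val ρ v u tt′ s h = refl
  trB-val ρ v u ff′ s h = refl
  trB-val ρ v u (vr i) s h = h i s
  trB-val ρ v u (a ∧ᵇ′ b) (s , t) h = cong₂ _∧_ (trB-val ρ v u a s h) (trB-val ρ v u b t h)
  trB-val ρ v u (a ∨ᵇ′ b) (s , t) h = cong₂ _∨_ (trB-val ρ v u a s h) (trB-val ρ v u b t h)
  trB-val ρ v u (a ⇒ᵇ′ b) (s , t) h = cong₂ (λ x y → not x ∨ y) (trB-val ρ v u a s h) (trB-val ρ v u b t h)
  trB-val ρ v u (¬ᵇ′ a) s h = cong not (trB-val ρ v u a s h)

  -- The truth value is settled by provability from the assignment and the worm, so the induction
  -- over quantifiers runs inside `GLP` and needs no model.
  Decided : ℕ → (ℕ → Bool) → CFm → Bool → Set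
  Decided v ρ A b = ⊩ (λ u → Assigned ρ v u → u ⊨ ι (F v) → evalP u (ι A) ≡ b)

  -- Every value of the variable v is realized at an accessible world, and no others exist.
  module Quantifier {v} (v<N : v < N) (ρ : ℕ → Bool) (B : CFm) {c : Bool → Bool}
                    (dec : ∀ b → Decided (suc v) (set ρ v b) B (c b)) where
    private
      m = level (v + v)

    extend-assigned : ∀ b u → Assigned ρ v u → evalP u (ι (xv v)) ≡ b → Assigned (set ρ v b) (suc v) u
    extend-assigned b u h e i i≤v with m≤n⇒m<n∨m≡n (s≤s⁻¹ i≤v)
    ... | inj₁ i<v  = trans (h i i<v) (sym (set-below ρ v b i i<v))
    ... | inj₂ refl = trans e (sym (set-same ρ v b))

    everywhere : ∀ E → (∀ b u → evalP u (ι B) ≡ c b → u ⊨ ι (F (suc v)) → u ⊨ E → Empty) →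
                 ⊩ (λ u → Assigned ρ v u → (u ⊨ ⟨ m ⟩ (ι (F (suc v)) ∧' E)) → Empty)
    everywhere E h = ⊩-map₂ (λ u f g a x → g (f (assigned-intro ρ v u a) x))
      (◇-local {m} {assigned ρ v} {ι (F (suc v)) ∧' E} {⊥} (assigned-persistent ρ v v ≤-refl)
        (⊩-map₂ (λ u d₀ d₁ a x → ⊥-elim (absurd u d₀ d₁ (assigned-elim ρ v u a) (∧-elim {evalP u (ι (F (suc v)))} x)))
          (dec false) (dec true)))
      (⊩-⊥ m)
      where
        absurd : ∀ u → (Assigned (set ρ v false) (suc v) u → u ⊨ ι (F (suc v)) → evalP u (ι B) ≡ c false) →
                 (Assigned (set ρ v true) (suc v) u → u ⊨ ι (F (suc v)) → evalP u (ι B) ≡ c true) →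
                 Assigned ρ v u → u ⊨ ι (F (suc v)) × u ⊨ E → Empty
        absurd u d₀ d₁ a (f , e) with bool? (evalP u (ι (xv v)))
        ... | inj₁ t = h true u (d₁ (extend-assigned true u a t) f) f e
        ... | inj₂ t = h false u (d₀ (extend-assigned false u a t) f) f e

    somewhere : ∀ b E → (∀ u → evalP u (ι B) ≡ c b → u ⊨ ι (F (suc v)) → u ⊨ E) →
                ⊩ (λ u → Assigned ρ v u → u ⊨ ι (F v) → u ⊨ ⟨ m ⟩ E)
    somewhere b E h = ⊩-map₂ (λ u f g a x → f (assigned-intro ρ v u a) (g x))
      (◇-local {m} {assigned ρ v} {ι (F (suc v)) ∧' ι (literal b (xv v))} {E} (assigned-persistent ρ v v ≤-refl)
        (⊩-map (λ u d a x → let (f , l) = ∧-elim {evalP u (ι (F (suc v)))} x in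
            h u (d (extend-assigned b u (assigned-elim ρ v u a) (literal-val b (xv v) u l)) f) f) (dec b)))
      (split v<N b)

  decided : ∀ its l v ρ → v + quantifiers its ≡ N → Scoped v its l → Decided v ρ (tr v its l) (qval v its l ρ)
  decided [] l v ρ e s = ⊩-pure λ u a _ → trB-val ρ v u l s a
  decided (impI a ∷ its) l v ρ e (s , t) = ⊩-map (λ u f h x → cong₂ (λ p q → not p ∨ q) (trB-val ρ v u a s h) (f h x))
    (decided its l v ρ e t)
  decided (allI ∷ its) l v ρ e s = finish (c false) (c true) refl refl
    where
      c : Bool → Bool
      c b = qval (suc v) its l (set ρ v b)
      v<N : v < N
      v<N = ≤-trans (m≤m+n (suc v) (quantifiers its)) (≤-reflexive (trans (sym (+-suc v _)) e))
      B = tr (suc v) its l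
      open Quantifier v<N ρ B {c} (λ b → decided its l (suc v) (set ρ v b) (trans (sym (+-suc v _)) e) s)
      G = F (suc v) ⇒ B
      refuted : ∀ b → c b ≡ false → ⊩ (λ u → Assigned ρ v u → u ⊨ ι (F v) → not (u (⟨ level (v + v) ⟩ ¬' ι G)) ≡ false)
      refuted b cb = ⊩-map (λ u f a x → cong not (f a x)) (somewhere b (¬' ι G)
        λ u e f → cong not (trans (cong (λ z → not z ∨ evalP u (ι B)) f) (trans e cb)))
      finish : ∀ x y → c false ≡ x → c true ≡ y → Decided v ρ (tr v (allI ∷ its) l) (x ∧ y)
      finish false y e₀ e₁ = refuted false e₀
      finish true false e₀ e₁ = refuted true e₁
      finish true true e₀ e₁ = ⊩-map₂ (λ u f g a x → not-intro (λ z → f a (g z)))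
        (everywhere (¬' ι B) λ { false u e _ n → not-elim′ n (trans e e₀) ; true u e _ n → not-elim′ n (trans e e₁) })
        (⊩-nec (level (v + v)) {¬' ι G} {ι (F (suc v)) ∧' ¬' ι B} (⊩-pure λ u → unfold (evalP u (ι (F (suc v))))))
        where
          unfold : ∀ p {q} → not (not p ∨ q) ≡ true → p ∧ not q ≡ true
          unfold true h = h
  decided (exI ∷ its) l v ρ e s = finish (c false) (c true) refl refl
    where
      c : Bool → Bool
      c b = qval (suc v) its l (set ρ v b)
      v<N : v < N
      v<N = ≤-trans (m≤m+n (suc v) (quantifiers its)) (≤-reflexive (trans (sym (+-suc v _)) e))
      B = tr (suc v) its l
      open Quantifier v<N ρ B {c} (λ b → decided its l (suc v) (set ρ v b) (trans (sym (+-suc v _)) e) s)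
      realized : ∀ b → c b ≡ true → Decided v ρ (tr v (exI ∷ its) l) true
      realized b cb = somewhere b (ι (F (suc v)) ∧' ι B) λ u e f → ∧-intro f (trans e cb)
      finish : ∀ x y → c false ≡ x → c true ≡ y → Decided v ρ (tr v (exI ∷ its) l) (x ∨ y)
      finish true y e₀ e₁ = realized false e₀
      finish false true e₀ e₁ = realized true e₁
      finish false false e₀ e₁ = ⊩-map (λ u f a x → ¬true→false (f a))
        (everywhere (ι B) λ { false u e _ n → true≢false n (trans e e₀) ; true u e _ n → true≢false n (trans e e₁) })

  -- `GLP` decides the translation under `F 0`. If the value were false while the implication is
  -- provable, `GLP` would refute `F 0`, which is consistent.
  qbf-correct : ∀ its l ρ → quantifiers its ≡ N → Scoped 0 its l →
    (qval 0 its l ρ ≡ true → GLP⊢ ι (F 0 ⇒ tr 0 its l)) × (GLP⊢ ι (F 0 ⇒ tr 0 its l) → qval 0 its l ρ ≡ true)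
  qbf-correct its l ρ e s =
    (λ q → ⊩-out (⊩-map (λ u f → ⇒-intro λ x → trans (f (λ i ()) x) q) d)) ,
    λ p → case bool? (qval 0 its l ρ) of λ
      { (inj₁ q) → q
      ; (inj₂ q) → ⊥-elim (worm-consistent 0 N (⊩-out (⊩-map₂ (λ u f g → not-intro λ x →
          true≢false (⇒-elim g x) (trans (f (λ i ()) x) q)) d (⊩-thm p)))) }
    where d = decided its l 0 ρ e s

-- Codes of worms and quantifier prefixes

cat-split : ∀ {A : Set} p m n (f : ℕ → List A) → cat p (m + n) f ≡ cat p m f ++ cat (p + m) n f
cat-split p zero n f = cong (λ q → cat q n f) (sym (+-identityʳ p))
cat-split p (suc m) n f = trans (cong (f p ++_) (trans (cat-split (suc p) m n f)
  (cong (λ q → cat (suc p) m f ++ cat q n f) (sym (+-suc p m))))) (sym (++-assoc (f p) _ _))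

cat-cong : ∀ {A : Set} p n {f h : ℕ → List A} → (∀ w → p ≤ w → w < p + n → f w ≡ h w) → cat p n f ≡ cat p n h
cat-cong p zero e = refl
cat-cong p (suc n) e = cong₂ _++_ (e p ≤-refl (≤-trans (s≤s (m≤m+n p n)) (≤-reflexive (sym (+-suc p n)))))
  (cat-cong (suc p) n λ w l u → e w (<⇒≤ l) (<-≤-trans u (≤-reflexive (sym (+-suc p n)))))

cat-shift : ∀ {A : Set} c p n (f : ℕ → List A) → cat p n (λ w → f (c + w)) ≡ cat (c + p) n f
cat-shift c p zero f = refl
cat-shift c p (suc n) f = cong (f (c + p) ++_) (trans (cat-shift c (suc p) n f) (cong (λ q → cat q n f) (+-suc c p)))

cat-blocks : ∀ {A : Set} p n W (f : ℕ → List A) → cat p n (λ x → cat (x * W) W f) ≡ cat (p * W) (n * W) f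
cat-blocks p zero W f = refl
cat-blocks p (suc n) W f = trans (cong (cat (p * W) W f ++_) (trans (cat-blocks (suc p) n W f)
  (cong (λ q → cat q (n * W) f) (+-comm W (p * W))))) (sym (cat-split (p * W) W (n * W) f))

-- In row-major order, the rest of the current row followed by all later rows is one interval.
cat-tail : ∀ {A : Set} W X x y (f : ℕ → List A) → y ≤ W → x < X →
  cat (x * W + y) (W ∸ y) f ++ cat (suc x) (X ∸ suc x) (λ x′ → cat (x′ * W) W f)
    ≡ cat (x * W + y) (X * W ∸ (x * W + y)) f
cat-tail W X x y f y≤W x<X = trans (cong (cat (x * W + y) (W ∸ y) f ++_) (cat-blocks (suc x) (X ∸ suc x) W f))
  (trans (cong (λ q → cat (x * W + y) (W ∸ y) f ++ cat q ((X ∸ suc x) * W) f) start)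
    (trans (sym (cat-split (x * W + y) (W ∸ y) ((X ∸ suc x) * W) f)) (cong (λ n → cat (x * W + y) n f) count)))
  where
    start : suc x * W ≡ x * W + y + (W ∸ y)
    start = trans (+-comm W (x * W)) (sym (trans (+-assoc (x * W) y (W ∸ y)) (cong (x * W +_) (m+[n∸m]≡n y≤W))))
    total : (x * W + y) + ((W ∸ y) + (X ∸ suc x) * W) ≡ X * W
    total = trans (sym (+-assoc (x * W + y) (W ∸ y) _)) (trans (cong (_+ (X ∸ suc x) * W) (sym start))
      (trans (sym (*-distribʳ-+ W (suc x) (X ∸ suc x))) (cong (_* W) (m+[n∸m]≡n x<X))))
    count : (W ∸ y) + (X ∸ suc x) * W ≡ X * W ∸ (x * W + y)
    count = sym (trans (cong (_∸ (x * W + y)) (sym total)) (m+n∸m≡n (x * W + y) _))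

replicate-++ : ∀ {A : Set} m n {a : A} → replicate m a ++ replicate n a ≡ replicate (m + n) a
replicate-++ zero n = refl
replicate-++ (suc m) n = cong (_ ∷_) (replicate-++ m n)

cat-replicate : ∀ {A : Set} p n m (a : A) → cat p n (λ _ → replicate m a) ≡ replicate (n * m) a
cat-replicate p zero m a = refl
cat-replicate p (suc n) m a = trans (cong (replicate m a ++_) (cat-replicate (suc p) n m a)) (replicate-++ m (n * m))

cat-empty : ∀ {A : Set} p n → cat {A} p n (λ _ → []) ≡ []
cat-empty p zero = refl
cat-empty p (suc n) = cat-empty (suc p) n

-- A loop always runs over the whole range; a part of it is obtained by a test inside the body. This
-- lemma and the next two compute the outcome of such tests.
cat-below : ∀ {A : Set} n d (f : ℕ → List A) → d ≤ n → cat 0 n (λ w → if w <ᵇ d then f w else []) ≡ cat 0 d f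
cat-below n d f d≤n = trans (cong (λ k → cat 0 k h) (sym (m+[n∸m]≡n d≤n))) (trans (cat-split 0 d (n ∸ d) h)
  (trans (cong₂ _++_ (cat-cong 0 d λ w _ u → cong (λ b → if b then f w else []) (<ᵇ-true u))
    (trans (cat-cong d (n ∸ d) λ w l _ → cong (λ b → if b then f w else []) (<ᵇ-false l)) (cat-empty d (n ∸ d)))) (++-identityʳ _)))
  where h = λ w → if w <ᵇ d then f w else []

cat-above : ∀ {A : Set} n i (f : ℕ → List A) → i < n → cat 0 n (λ w → if i <ᵇ w then f w else []) ≡ cat (suc i) (n ∸ suc i) f
cat-above n i f i<n = trans (cong (λ k → cat 0 k h) (sym (m+[n∸m]≡n i<n))) (trans (cat-split 0 (suc i) (n ∸ suc i) h)
  (cong₂ _++_ (trans (cat-cong 0 (suc i) λ w _ u → cong (λ b → if b then f w else []) (<ᵇ-false (s≤s⁻¹ u))) (cat-empty 0 (suc i)))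
    (cat-cong (suc i) (n ∸ suc i) λ w l _ → cong (λ b → if b then f w else []) (<ᵇ-true l))))
  where h = λ w → if i <ᵇ w then f w else []

cat-pick : ∀ {A : Set} n i (f : ℕ → List A) → i < n → cat 0 n (λ w → if w ≡ᵇ i then f w else []) ≡ f i
cat-pick n i f i<n = trans (cong (λ k → cat 0 k h) (sym (m+[n∸m]≡n i<n))) (trans (cat-split 0 (suc i) (n ∸ suc i) h)
  (trans (cong₂ _++_ (trans (cong (λ k → cat 0 k h) (+-comm 1 i)) (trans (cat-split 0 i 1 h) (cong₂ _++_
      (trans (cat-cong 0 i λ w _ u → cong (λ b → if b then f w else []) (≡ᵇ-false (λ e → <-irrefl e u))) (cat-empty 0 i))
      (trans (++-identityʳ _) (cong (λ b → if b then f i else []) (≡ᵇ-refl i))))))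
    (trans (cat-cong (suc i) (n ∸ suc i) λ w l _ → cong (λ b → if b then f w else []) (≡ᵇ-false (λ e → <-irrefl (sym e) l))) (cat-empty (suc i) (n ∸ suc i))))
    (++-identityʳ _)))
  where h = λ w → if w ≡ᵇ i then f w else []

cat-last : ∀ {A : Set} p n (f h : ℕ → List A) →
  cat p (suc n) (λ d → f d ++ (if suc d ≡ᵇ p + suc n then h d else [])) ≡ cat p (suc n) f ++ h (p + n)
cat-last p zero f h rewrite +-comm p 1 | +-identityʳ p | ≡ᵇ-refl p = trans (++-identityʳ _) (cong (_++ h p) (sym (++-identityʳ (f p))))
cat-last p (suc n) f h = trans (cong₂ _++_
    (trans (cong (f p ++_) (cong (λ b → if b then h p else []) (≡ᵇ-false (λ e → m≢1+m+n p (suc-injective (trans e (trans (+-suc p (suc n)) (cong suc (+-suc p n)))))))))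
      (++-identityʳ (f p)))
    (trans (cat-cong (suc p) (suc n) λ w _ _ → cong (λ q → f w ++ (if suc w ≡ᵇ q then h w else [])) (+-suc p (suc n))) (trans (cat-last (suc p) n f h) (cong (λ q → cat (suc p) (suc n) f ++ h q) (sym (+-suc p n))))))
  (sym (++-assoc (f p) (cat (suc p) (suc n) f) (h (p + suc n))))

concatMap-cat : ∀ {A B : Set} p n (k : A → List B) (f : ℕ → List A) → concatMap k (cat p n f) ≡ cat p n (λ w → concatMap k (f w))
concatMap-cat p zero k f = refl
concatMap-cat p (suc n) k f = trans (concatMap-++ k (f p) (cat (suc p) n f)) (cong (concatMap k (f p) ++_) (concatMap-cat (suc p) n k f))

map-cat : ∀ {A B : Set} p n (k : A → B) (f : ℕ → List A) → map k (cat p n f) ≡ cat p n (λ w → map k (f w))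
map-cat p zero k f = refl
map-cat p (suc n) k f = trans (map-++ k (f p) (cat (suc p) n f)) (cong (map k (f p) ++_) (map-cat (suc p) n k f))

ones : ℕ → List Sym
ones n = replicate n c1

level-digits : ∀ i → digits (toBin (level i)) ≡ ones i
level-digits i = trans (cong (λ n → digits (toBin n)) (level-bin i)) (trans (cong digits (toBin-fromBin (onesBin i))) (digits-ones i))
  where
    onesBin : ℕ → ℕᵇ
    onesBin zero    = zeroᵇ
    onesBin (suc i) = 1+[2 onesBin i ]
    level-bin : ∀ i → level i ≡ fromBin (onesBin i)
    level-bin zero    = refl
    level-bin (suc i) = cong (λ n → suc (2 * n)) (level-bin i)
    digits-ones : ∀ i → digits (onesBin i) ≡ ones i
    digits-ones zero    = refl
    digits-ones (suc i) = cong (c1 ∷_) (digits-ones i)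

sMod : ℕ → List Sym
sMod n = c⟨ ∷ (ones n ++ c⟩ ∷ [])

sPair : ℕ → List Sym
sPair v = sMod (v + v) ++ sMod (suc (v + v))

enc-◇ : ∀ n A → enc (⟨ level n ⟩ A) ≡ sMod n ++ enc A
enc-◇ n A = cong (c⟨ ∷_) (trans (cong (_++ c⟩ ∷ enc A) (level-digits n)) (sym (++-assoc (ones n) (c⟩ ∷ []) (enc A))))

enc-worm : ∀ v n → enc (worm v n) ≡ cat v n sPair ++ c⊤ ∷ []
enc-worm v zero = refl
enc-worm v (suc n) = trans (enc-◇ (v + v) (⟨ level (suc (v + v)) ⟩ worm (suc v) n)) (trans (cong (sMod (v + v) ++_) (trans (enc-◇ (suc (v + v)) (worm (suc v) n)) (cong (sMod (suc (v + v)) ++_) (enc-worm (suc v) n))))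
  (trans (sym (++-assoc (sMod (v + v)) (sMod (suc (v + v))) _)) (sym (++-assoc (sPair v) (cat (suc v) n sPair) (c⊤ ∷ [])))))

module Codes (N : ℕ) where
  open QBF N

  sWorm sAll sEx : ℕ → List Sym
  sWorm v = cat v (N ∸ v) sPair ++ c⊤ ∷ []
  sAll v  = c¬ ∷ (sMod (v + v) ++ c¬ ∷ c⇒ ∷ sWorm (suc v))
  sEx v   = sMod (v + v) ++ c∧ ∷ sWorm (suc v)

  enc-xv : ∀ v → enc (xv v) ≡ sMod (v + v) ++ sWorm (suc v)
  enc-xv v = trans (enc-◇ (v + v) (F (suc v))) (cong (sMod (v + v) ++_) (enc-worm (suc v) (N ∸ suc v)))

  enc-all : ∀ v its l → enc (tr v (allI ∷ its) l) ≡ sAll v ++ enc (tr (suc v) its l)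
  enc-all v its l = cong (c¬ ∷_) (trans (enc-◇ (v + v) (¬' (F (suc v) ⇒ tr (suc v) its l))) (trans
    (cong (λ z → sMod (v + v) ++ c¬ ∷ c⇒ ∷ z ++ enc (tr (suc v) its l)) (enc-worm (suc v) (N ∸ suc v)))
    (sym (++-assoc (sMod (v + v)) (c¬ ∷ c⇒ ∷ sWorm (suc v)) (enc (tr (suc v) its l))))))

  enc-ex : ∀ v its l → enc (tr v (exI ∷ its) l) ≡ sEx v ++ enc (tr (suc v) its l)
  enc-ex v its l = trans (enc-◇ (v + v) (F (suc v) ∧' tr (suc v) its l)) (trans
    (cong (λ z → sMod (v + v) ++ c∧ ∷ z ++ enc (tr (suc v) its l)) (enc-worm (suc v) (N ∸ suc v)))
    (sym (++-assoc (sMod (v + v)) (c∧ ∷ sWorm (suc v)) (enc (tr (suc v) its l)))))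

  enc-alls : ∀ n v its l → enc (tr v (replicate n allI ++ its) l) ≡ cat v n sAll ++ enc (tr (v + n) its l)
  enc-alls zero v its l = cong (λ w → enc (tr w its l)) (sym (+-identityʳ v))
  enc-alls (suc n) v its l = trans (enc-all v (replicate n allI ++ its) l) (trans (cong (sAll v ++_) (trans (enc-alls n (suc v) its l)
    (cong (λ w → cat (suc v) n sAll ++ enc (tr w its l)) (sym (+-suc v n))))) (sym (++-assoc (sAll v) _ _)))

  enc-exs : ∀ n v its l → enc (tr v (replicate n exI ++ its) l) ≡ cat v n sEx ++ enc (tr (v + n) its l)
  enc-exs zero v its l = cong (λ w → enc (tr w its l)) (sym (+-identityʳ v))
  enc-exs (suc n) v its l = trans (enc-ex v (replicate n exI ++ its) l) (trans (cong (sEx v ++_) (trans (enc-exs n (suc v) its l)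
    (cong (λ w → cat (suc v) n sEx ++ enc (tr w its l)) (sym (+-suc v n))))) (sym (++-assoc (sEx v) _ _)))

  conj : List Bf → Bf
  conj [] = tt′
  conj (a ∷ as) = a ∧ᵇ′ conj as

  enc-conj : ∀ as → enc (trB (conj as)) ≡ concatMap (λ a → c∧ ∷ enc (trB a)) as ++ c⊤ ∷ []
  enc-conj [] = refl
  enc-conj (a ∷ as) = cong (c∧ ∷_) (trans (cong (enc (trB a) ++_) (enc-conj as)) (sym (++-assoc (enc (trB a)) _ _)))

-- Addressing: block D, cell i, bit b

module Layout (T g : ℕ) where

  blockSize : ℕ
  blockSize = T * g

  num : ℕ → ℕ → ℕ → ℕ
  num D i b = D * blockSize + (i * g + b)

  -- `T` levels of three blocks each: the two ends of a computation, bound universally, and its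
  -- midpoint, bound existentially.
  N : ℕ
  N = T * (3 * blockSize)

  open QBF N public
  open Codes N public

  cell-end : ∀ i b → i < T → b < g → i * g + suc b ≤ blockSize
  cell-end i b i<T b<g = ≤-trans (+-monoʳ-≤ (i * g) b<g) (≤-trans (≤-reflexive (+-comm (i * g) g)) (*-monoˡ-≤ g i<T))

  private
    W = blockSize
    cellRow : ∀ (f : ℕ → List Sym) D w → cat 0 g (λ b′ → f (num D w b′)) ≡ cat (w * g) g (λ e → f (D * W + e))
    cellRow f D w = trans (cat-shift (w * g) 0 g (λ e → f (D * W + e))) (cong (λ q → cat q g (λ e → f (D * W + e))) (+-identityʳ (w * g)))
    block : ∀ (f : ℕ → List Sym) D → cat 0 T (λ w → cat 0 g (λ b′ → f (num D w b′))) ≡ cat 0 W (λ e → f (D * W + e))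
    block f D = trans (cat-cong 0 T (λ w _ _ → cellRow f D w)) (cat-blocks 0 T g (λ e → f (D * W + e)))
    regroup : ∀ u r e → (u * 3 + r) * W + e ≡ u * (3 * W) + (r * W + e)
    regroup u r e = arith u r W e
      where
        arith : ∀ u r W e → (u * 3 + r) * W + e ≡ u * (3 * W) + (r * W + e)
        arith = solve-∀
    blockAt : ∀ u r → cat 0 T (λ w → cat 0 g (λ b′ → sPair (num (u * 3 + r) w b′))) ≡ cat (r * W) W (λ e → sPair (u * (3 * W) + e))
    blockAt u r = trans (block sPair (u * 3 + r)) (trans (cat-cong 0 W (λ e _ _ → cong sPair (regroup u r e)))
      (trans (cat-shift (r * W) 0 W (λ e → sPair (u * (3 * W) + e))) (cong (λ q → cat q W (λ e → sPair (u * (3 * W) + e))) (+-identityʳ (r * W)))))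
    levelAt : ∀ u → cat 0 3 (λ r′ → cat 0 T (λ w → cat 0 g (λ b′ → sPair (num (u * 3 + r′) w b′)))) ≡ cat (u * (3 * W)) (3 * W) sPair
    levelAt u = trans (cat-cong 0 3 (λ r′ _ _ → blockAt u r′)) (trans (cat-blocks 0 3 W (λ e → sPair (u * (3 * W) + e)))
      (trans (cat-shift (u * (3 * W)) 0 (3 * W) sPair) (cong (λ q → cat q (3 * W) sPair) (+-identityʳ _))))
  -- the four nested tails that make up the worm after variable (3d + r, i, b)
  worm-tails : ∀ d r i b → d < T → r < 3 → i < T → b < g →
    cat (suc b) (g ∸ suc b) (λ b′ → sPair (num (d * 3 + r) i b′))
    ++ (cat (suc i) (T ∸ suc i) (λ w → cat 0 g (λ b′ → sPair (num (d * 3 + r) w b′)))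
    ++ (cat (suc r) (3 ∸ suc r) (λ r′ → cat 0 T (λ w → cat 0 g (λ b′ → sPair (num (d * 3 + r′) w b′))))
    ++ cat (suc d) (T ∸ suc d) (λ u → cat 0 3 (λ r′ → cat 0 T (λ w → cat 0 g (λ b′ → sPair (num (u * 3 + r′) w b′)))))))
    ≡ cat (suc (num (d * 3 + r) i b)) (N ∸ suc (num (d * 3 + r) i b)) sPair
  worm-tails d r i b d<T r<3 i<T b<g = trans (cong (c₁ ++_) (sym (++-assoc c₂ c₃ c₄)))
    (trans (sym (++-assoc c₁ (c₂ ++ c₃) c₄)) (trans (cong (_++ c₄) (sym (++-assoc c₁ c₂ c₃)))
    (trans (cong (λ z → (z ++ c₃) ++ c₄) inner) (trans (cong (_++ c₄) middle) outer))))
    where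
      c₁ = cat (suc b) (g ∸ suc b) (λ b′ → sPair (num (d * 3 + r) i b′))
      c₂ = cat (suc i) (T ∸ suc i) (λ w → cat 0 g (λ b′ → sPair (num (d * 3 + r) w b′)))
      c₃ = cat (suc r) (3 ∸ suc r) (λ r′ → cat 0 T (λ w → cat 0 g (λ b′ → sPair (num (d * 3 + r′) w b′))))
      c₄ = cat (suc d) (T ∸ suc d) (λ u → cat 0 3 (λ r′ → cat 0 T (λ w → cat 0 g (λ b′ → sPair (num (u * 3 + r′) w b′)))))
      in-block in-level : ℕ → List Sym
      in-block e = sPair ((d * 3 + r) * W + e)
      in-level e = sPair (d * (3 * W) + e)
      y₁ = i * g + suc b
      y₂ = r * W + y₁
      y₁≤ : y₁ ≤ W
      y₁≤ = cell-end i b i<T b<g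
      y₂≤ : y₂ ≤ 3 * W
      y₂≤ = ≤-trans (+-monoʳ-≤ (r * W) y₁≤) (≤-trans (≤-reflexive (+-comm (r * W) W)) (*-monoˡ-≤ W r<3))
      inner : c₁ ++ c₂ ≡ cat y₁ (W ∸ y₁) in-block
      inner = trans (cong₂ _++_ (cat-shift (i * g) (suc b) (g ∸ suc b) in-block) (cat-cong (suc i) (T ∸ suc i) (λ w _ _ → cellRow sPair (d * 3 + r) w)))
        (cat-tail g T i (suc b) in-block b<g i<T)
      middle : cat y₁ (W ∸ y₁) in-block ++ c₃ ≡ cat y₂ (3 * W ∸ y₂) in-level
      middle = trans (cong₂ _++_
          (trans (cat-cong y₁ (W ∸ y₁) (λ e _ _ → cong sPair (regroup d r e))) (cat-shift (r * W) y₁ (W ∸ y₁) in-level))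
          (cat-cong (suc r) (3 ∸ suc r) (λ r′ _ _ → blockAt d r′)))
        (cat-tail W 3 r y₁ in-level y₁≤ r<3)
      outer : cat y₂ (3 * W ∸ y₂) in-level ++ c₄ ≡ cat (suc (num (d * 3 + r) i b)) (N ∸ suc (num (d * 3 + r) i b)) sPair
      outer = trans (cong₂ _++_ (cat-shift (d * (3 * W)) y₂ (3 * W ∸ y₂) sPair) (cat-cong (suc d) (T ∸ suc d) (λ u _ _ → levelAt u)))
        (trans (cat-tail (3 * W) T d y₂ sPair y₂≤ d<T) (cong (λ q → cat q (N ∸ q) sPair) address))
        where
          address : d * (3 * W) + y₂ ≡ suc (num (d * 3 + r) i b)
          address = trans (sym (regroup d r y₁)) (trans (cong ((d * 3 + r) * W +_) (+-suc (i * g) b)) (+-suc ((d * 3 + r) * W) (i * g + b)))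

  whole-worm : cat 0 T (λ u → cat 0 3 (λ r′ → cat 0 T (λ w → cat 0 g (λ b′ → sPair (num (u * 3 + r′) w b′))))) ≡ cat 0 N sPair
  whole-worm = trans (cat-cong 0 T (λ u _ _ → levelAt u)) (cat-blocks 0 T (3 * W) sPair)

  block-cat : ∀ (f : ℕ → List Sym) D → cat 0 T (λ w → cat 0 g (λ b′ → f (num D w b′))) ≡ cat (D * W) W f
  block-cat f D = trans (block f D) (trans (cat-shift (D * W) 0 W f) (cong (λ q → cat q W f) (+-identityʳ (D * W))))

-- Local tables and Savitch's formula

data Pos : Set where
  pF pM pL : Pos

-- neighbouring cells that exist at a first, middle or last position
data Off : Pos → Set where
  here        : ∀ {p} → Off p
  nextF       : Off pF
  nextM prevM : Off pM
  prevL       : Off pL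

-- A bit is constant, a test of an input symbol, or a copy of a bit of the same or an adjacent cell.
-- This is enough to express the initial block, the accepting block, equality and a machine step.
data Src (A : Set) (g : ℕ) (p : Pos) : Set where
  cst : Bool → Src A g p
  kis : Off p → A → Src A g p
  cpy : Off p → Fin g → Src A g p

Table : Set → ℕ → Set
Table A g = (p : Pos) → Fin g → Src A g p

data Dir : Set where
  stayD nextD prevD : Dir

dirOf : ∀ {p} → Off p → Dir
dirOf here  = stayD
dirOf nextF = nextD
dirOf nextM = nextD
dirOf prevM = prevD
dirOf prevL = prevD

shift : Dir → ℕ → ℕ
shift stayD i = i
shift nextD i = suc i
shift prevD i = pred i

data PosIs (T i : ℕ) : Pos → Set where
  isF : i ≡ 0 → PosIs T i pF
  isL : i ≢ 0 → suc i ≡ T → PosIs T i pL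
  isM : i ≢ 0 → suc i ≢ T → PosIs T i pM

data Valid (T i : ℕ) : Dir → Set where
  stays : Valid T i stayD
  goes  : suc i < T → Valid T i nextD
  comes : ∀ {p} → i ≡ suc p → Valid T i prevD

nonzero : ∀ {i} → i ≢ 0 → i ≡ suc (pred i)
nonzero {zero}  h = ⊥-elim (h refl)
nonzero {suc i} h = refl

valid : ∀ {T i p} → PosIs T i p → i < T → 2 ≤ T → (o : Off p) → Valid T i (dirOf o)
valid _ _ _ here = stays
valid (isF refl) _ 2≤T nextF = goes 2≤T
valid (isM _ ne) i<T _ nextM = goes (≤∧≢⇒< i<T ne)
valid (isM nz _) _ _ prevM = comes (nonzero nz)
valid (isL nz _) _ _ prevL = comes (nonzero nz)

shift-< : ∀ {T i δ} → i < T → Valid T i δ → shift δ i < T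
shift-< i<T stays = i<T
shift-< i<T (goes h) = h
shift-< i<T (comes refl) = <-trans ≤-refl i<T

posOf : ℕ → ℕ → Pos
posOf T i = if i ≡ᵇ 0 then pF else if suc i ≡ᵇ T then pL else pM

posOf-is : ∀ T i → PosIs T i (posOf T i)
posOf-is T zero = isF refl
posOf-is T (suc i) with suc (suc i) ≟ T
... | yes e rewrite trans (cong (_≡ᵇ T) e) (≡ᵇ-refl T) = isL (λ ()) e
... | no ne rewrite ≡ᵇ-false ne = isM (λ ()) ne

-- Bits are numbered in Fin g; kindB j a says that input position j carries the symbol a.
module Formula (A : Set) (g T : ℕ) (kindB : ℕ → A → Bool) where
  open Layout T g public

  eqF : ∀ {p} (D D′ i : ℕ) (b : Fin g) → Src A g p → Bf
  eqF D D′ i b (cst true)  = vr (num D i (toℕ b))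
  eqF D D′ i b (cst false) = ¬ᵇ′ vr (num D i (toℕ b))
  eqF D D′ i b (kis o a)   = if kindB (shift (dirOf o) i) a then vr (num D i (toℕ b)) else ¬ᵇ′ vr (num D i (toℕ b))
  eqF D D′ i b (cpy o b′)  = (vr (num D i (toℕ b)) ⇒ᵇ′ vr s) ∧ᵇ′ (vr s ⇒ᵇ′ vr (num D i (toℕ b)))
    where s = num D′ (shift (dirOf o) i) (toℕ b′)

  rowF : Table A g → ℕ → ℕ → ℕ → List Bf
  rowF tb D D′ i = map (λ b → eqF D D′ i b (tb (posOf T i) b)) (allFin g)

  tabF : Table A g → ℕ → ℕ → Bf
  tabF tb D D′ = conj (cat 0 T (rowF tb D D′))

  -- If both bits are set in cell 0 of the old block, the table determines the new block; `nothing`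
  -- instead of a table forbids any successor.
  Clause : Set
  Clause = Fin g × Fin g × Maybe (Table A g)

  bodyF : ℕ → Maybe (Table A g) → Bf
  bodyF d nothing   = ff′
  bodyF d (just tb) = tabF tb (d * 3 + 1) (d * 3 + 0)

  clauseF : ℕ → Clause → Bf
  clauseF d (b₁ , b₂ , body) = (vr (num (d * 3 + 0) 0 (toℕ b₁)) ∧ᵇ′ vr (num (d * 3 + 0) 0 (toℕ b₂))) ⇒ᵇ′ bodyF d body

  leafF : List Clause → ℕ → Bf
  leafF cls d = conj (map (clauseF d) cls)

  module _ (initT accT eqT : Table A g) where

    -- The condition on the universal pair of a level: at the outermost level an initial and an
    -- accepting block, at every other level one of the two halves into which the midpoint divides
    -- the preceding pair.
    levelF : ℕ → Bf
    levelF zero    = tabF initT 0 0 ∧ᵇ′ tabF accT 1 1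
    levelF (suc d) = (tabF eqT (suc d * 3 + 0) (d * 3 + 0) ∧ᵇ′ tabF eqT (suc d * 3 + 1) (d * 3 + 2))
                  ∨ᵇ′ (tabF eqT (suc d * 3 + 0) (d * 3 + 2) ∧ᵇ′ tabF eqT (suc d * 3 + 1) (d * 3 + 1))

    levelIts : ℕ → List It
    levelIts d = replicate blockSize allI ++ (replicate blockSize allI ++ (impI (levelF d) ∷ replicate blockSize exI))

    formula : List Clause → CFm
    formula cls = F 0 ⇒ tr 0 (cat 0 T levelIts) (leafF cls (pred T))

≤! : ∀ {m n} {_ : T (m ≤ᵇ n)} → m ≤ n
≤! {m} {n} {h} = ≤ᵇ⇒≤ m n h

-- Loop programs printing the formula

module Emitters (A : Set) (Kd : Set) (finKd : Finite Kd) (k : ℕ) (reg : Kd → Bool) (out : Sym → Kd) (out-off : ∀ s → reg (out s) ≡ false)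
                (isSym : A → Kd → Bool) (g : ℕ) where
  K : ℕ
  K = 8 + k
  open Loops Kd finKd K
  open Over reg
  open Programs Kd finKd K reg

  -- From the outside in: `s7` runs over levels, `s6` finds the preceding level, `s5` runs over
  -- cells, `s4` finds an adjacent cell, `s3` and `s2` run through the remainder of a worm, `s1` and
  -- `s0` print numerals.
  s0 s1 s2 s3 s4 s5 s6 s7 : Fin K
  s0 = fz
  s1 = fs fz
  s2 = fs (fs fz)
  s3 = fs (fs (fs fz))
  s4 = fs (fs (fs (fs fz)))
  s5 = fs (fs (fs (fs (fs fz))))
  s6 = fs (fs (fs (fs (fs (fs fz)))))
  s7 = fs (fs (fs (fs (fs (fs (fs fz))))))

  put′ : ∀ {m} → Sym → G m
  put′ c = emit (out c) (out-off c)

  reps : ∀ {m} → ℕ → G m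
  reps n = seqN 0 n (λ _ → put′ c1)

  -- Prints twice the variable's number, plus `e`. Each earlier level contributes `6 * g` ones per
  -- cell, twice three blocks; each earlier block of the level `2 * g` per cell; each earlier cell
  -- `2 * g`.
  unaryG : ∀ {m} → 2 ≤ m → (d i : Fin K) (r b e : ℕ) → G m
  unaryG l d i r b e =
    for s1 l (ifT (lt s1 d) (for s0 ≤! (reps (6 * g))) skip)
    >> for s0 (≤-trans ≤! l) (reps (r * (2 * g)))
    >> for s0 (≤-trans ≤! l) (ifT (lt s0 i) (reps (2 * g)) skip)
    >> reps (b + b + e)

  modG : ∀ {m} → 2 ≤ m → (d i : Fin K) (r b e : ℕ) → G m
  modG l d i r b e = put′ c⟨ >> unaryG l d i r b e >> put′ c⟩

  pairG : ∀ {m} → 2 ≤ m → (d i : Fin K) (r b : ℕ) → G m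
  pairG l d i r b = modG l d i r b 0 >> modG l d i r b 1

  cellG : ∀ {m} → 2 ≤ m → (d i : Fin K) (r b n : ℕ) → G m
  cellG l d i r b n = seqN b n (pairG l d i r)

  blocksG : ∀ {m} → 3 ≤ m → (d : Fin K) (r n : ℕ) → G m
  blocksG l d r n = seqN r n (λ r′ → for s2 l (cellG ≤! d s2 r′ 0 g))

  wormG : ∀ {m} → 4 ≤ m → (d i : Fin K) (r b : ℕ) → G m
  wormG l d i r b =
    (cellG (≤-trans ≤! l) d i r (suc b) (g ∸ suc b)
    >> for s2 (≤-trans ≤! l) (ifT (lt i s2) (cellG ≤! d s2 r 0 g) skip)
    >> blocksG (≤-trans ≤! l) d (suc r) (3 ∸ suc r)
    >> for s3 l (ifT (lt d s3) (blocksG ≤! s3 0 3) skip))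
    >> put′ c⊤

  varG : ∀ {m} → 4 ≤ m → (d i : Fin K) (r b : ℕ) → G m
  varG l d i r b = modG (≤-trans ≤! l) d i r b 0 >> wormG l d i r b

  allG exG : ∀ {m} → 4 ≤ m → (d i : Fin K) (r b : ℕ) → G m
  allG l d i r b = put′ c¬ >> modG (≤-trans ≤! l) d i r b 0 >> put′ c¬ >> put′ c⇒ >> wormG l d i r b
  exG  l d i r b = modG (≤-trans ≤! l) d i r b 0 >> put′ c∧ >> wormG l d i r b

  -- Programs cannot add one to a counter, so the adjacent cell is found by a loop over all cells
  -- with a test for adjacency.
  withDir : Dir → Fin K → (∀ {m} → 4 ≤ m → Fin K → G m) → ∀ {m} → 5 ≤ m → G m
  withDir stayD i f l = f (≤-trans ≤! l) i
  withDir nextD i f l = for s4 l (ifT (nx i s4) (f ≤! s4) skip)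
  withDir prevD i f l = for s4 l (ifT (nx s4 i) (f ≤! s4) skip)

  eqG : ∀ {m p} → 5 ≤ m → (d d′ i : Fin K) (r r′ : ℕ) (b : Fin g) → Src A g p → G m
  eqG l d d′ i r r′ b (cst true)  = varG (≤-trans ≤! l) d i r (toℕ b)
  eqG l d d′ i r r′ b (cst false) = put′ c¬ >> varG (≤-trans ≤! l) d i r (toℕ b)
  eqG l d d′ i r r′ b (kis o a)   = withDir (dirOf o) i
    (λ l j → ifT (kd j (isSym a)) (varG l d i r (toℕ b)) (put′ c¬ >> varG l d i r (toℕ b))) l
  eqG l d d′ i r r′ b (cpy o b′)  = withDir (dirOf o) i
    (λ l j → put′ c∧ >> (put′ c⇒ >> varG l d i r (toℕ b) >> varG l d′ j r′ (toℕ b′))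
                     >> (put′ c⇒ >> varG l d′ j r′ (toℕ b′) >> varG l d i r (toℕ b))) l

  rowG : Table A g → (d d′ : Fin K) (r r′ : ℕ) → Pos → G 5
  rowG tb d d′ r r′ p = seqL (allFin g) (λ b → put′ c∧ >> eqG ≤! d d′ s5 r r′ b (tb p b))

  tabG : ∀ {m} → 6 ≤ m → Table A g → (d d′ : Fin K) (r r′ : ℕ) → G m
  tabG l tb d d′ r r′ = for s5 l (ifT (frs s5) (rowG tb d d′ r r′ pF)
    (ifT (lst s5) (rowG tb d d′ r r′ pL) (rowG tb d d′ r r′ pM))) >> put′ c⊤

  bodyG : ∀ {m} → 6 ≤ m → Maybe (Table A g) → G m
  bodyG l nothing   = put′ c⊥
  bodyG l (just tb) = tabG l tb s7 s7 1 0

  leafG : ∀ {m} → 6 ≤ m → List (Fin g × Fin g × Maybe (Table A g)) → G m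
  leafG l cls = seqL cls (λ (b₁ , b₂ , body) → put′ c∧ >> (put′ c⇒ >> for s5 l (ifT (frs s5)
      (put′ c∧ >> varG ≤! s7 s5 0 (toℕ b₁) >> varG ≤! s7 s5 0 (toℕ b₂)) skip) >> bodyG l body))
    >> put′ c⊤

  levelG : ∀ {m} → 7 ≤ m → (initT accT eqT : Table A g) → G m
  levelG l initT accT eqT = ifT (frs s7) (put′ c∧ >> tabG l₁ initT s7 s7 0 0 >> tabG l₁ accT s7 s7 1 1)
    (for s6 l (ifT (nx s6 s7)
      (put′ c∨ >> (put′ c∧ >> tabG ≤! eqT s7 s6 0 0 >> tabG ≤! eqT s7 s6 1 2)
               >> (put′ c∧ >> tabG ≤! eqT s7 s6 0 2 >> tabG ≤! eqT s7 s6 1 1)) skip))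
    where l₁ = ≤-trans ≤! l

  quantG : ∀ {m} → 6 ≤ m → (∀ {m} → 4 ≤ m → (d i : Fin K) (r b : ℕ) → G m) → ℕ → G m
  quantG l q r = for s5 l (seqN 0 g (q ≤! s7 s5 r))

  mainG : (initT accT eqT : Table A g) → List (Fin g × Fin g × Maybe (Table A g)) → G 8
  mainG initT accT eqT cls = put′ c⇒ >> (for s3 ≤! (blocksG ≤! s3 0 3) >> put′ c⊤)
    >> for s7 ≤! ((quantG ≤! allG 0 >> (quantG ≤! allG 1 >> ((put′ c⇒ >> levelG ≤! initT accT eqT) >> quantG ≤! exG 2)))
        -- The leaf refers to the blocks of the last level through `s7`, so it is printed in the
        -- last pass of the loop, while the mark is still there.
        >> ifT (lst s7) (leafG ≤! cls) skip)

  module Emission (rs : List Kd) (2≤T : 2 ≤ length rs) where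
    T′ : ℕ
    T′ = length rs

    kindB : ℕ → A → Bool
    kindB j a = maybe′ (isSym a) false (nth rs j)

    open Formula A g T′ kindB

    record Emits {m} (h : G m) (ρ : Env) (s : List Sym) : Set where
      constructor emits
      field denotes : ⟦ h ⟧ rs ρ ≡ map out s
    open Emits

    e-skip : ∀ {m ρ} → Emits (skip {m}) ρ []
    e-skip = emits refl

    e-put₁ : ∀ {m ρ} c → Emits (put′ {m} c) ρ (c ∷ [])
    e-put₁ c = emits refl

    e-cast : ∀ {m} {h : G m} {ρ s t} → s ≡ t → Emits h ρ s → Emits h ρ t
    e-cast refl e = e

    e-seq : ∀ {m} (h h′ : G m) {ρ s t} → Emits h ρ s → Emits h′ ρ t → Emits (h >> h′) ρ (s ++ t)
    e-seq h h′ {s = s} {t} (emits e) (emits e′) = emits (trans (cong₂ _++_ e e′) (sym (map-++ out s t)))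

    e-put : ∀ {m} c (h : G m) {ρ s} → Emits h ρ s → Emits (put′ c >> h) ρ (c ∷ s)
    e-put c h (emits e) = emits (cong (out c ∷_) e)

    e-seqN : ∀ {m} p n (h : ℕ → G m) {ρ f} → (∀ w → p ≤ w → w < p + n → Emits (h w) ρ (f w)) → Emits (seqN p n h) ρ (cat p n f)
    e-seqN p zero h e = e-skip
    e-seqN p (suc n) h {ρ} {f} e = e-seq (h p) (seqN (suc p) n h) (e p ≤-refl (≤-trans (s≤s (m≤m+n p n)) (≤-reflexive (sym (+-suc p n)))))
      (e-seqN (suc p) n h λ w l u → e w (<⇒≤ l) (<-≤-trans u (≤-reflexive (sym (+-suc p n)))))

    e-seqL : ∀ {m} {B : Set} (bs : List B) (h : B → G m) {ρ f} → (∀ b → Emits (h b) ρ (f b)) → Emits (seqL bs h) ρ (concatMap f bs)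
    e-seqL [] h e = e-skip
    e-seqL (b ∷ bs) h e = e-seq (h b) (seqL bs h) (e b) (e-seqL bs h e)

    e-for : ∀ {m} x l (h : G (toℕ x)) {ρ f} → (∀ w → w < T′ → Emits h (upd-env ρ x w) (f w)) → Emits (for {m} x l h) ρ (cat 0 T′ f)
    e-for x l h {ρ} {f} e = emits (trans (cat-cong 0 T′ λ w _ u → denotes (e w u)) (sym (map-cat 0 T′ out f)))

    e-if : ∀ {m} t (h h′ : G m) {ρ s s′} b → holds t rs ρ ≡ b → (b ≡ true → Emits h ρ s) → (b ≡ false → Emits h′ ρ s′) →
           Emits (ifT t h h′) ρ (if b then s else s′)
    e-if t h h′ {ρ} true  e y n = emits (trans (cong (λ b → if b then ⟦ h ⟧ rs ρ else ⟦ h′ ⟧ rs ρ) e) (denotes (y refl)))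
    e-if t h h′ {ρ} false e y n = emits (trans (cong (λ b → if b then ⟦ h ⟧ rs ρ else ⟦ h′ ⟧ rs ρ) e) (denotes (n refl)))

    -- slot x holds v and is not clobbered by loops over slots below n
    record At (n : ℕ) (ρ : Env) (x : Fin K) (v : ℕ) : Set where
      constructor is
      field
        high  : n ≤ toℕ x
        value : ρ x ≡ v
        small : v < T′
    open At

    keep : ∀ {n ρ x v} y w → toℕ y < n → At n ρ x v → At n (upd-env ρ y w) x v
    keep {ρ = ρ} {x} y w y<n (is h e s) = is h (trans (upd-other ρ y w x (λ { refl → <-irrefl refl (<-≤-trans y<n h) })) e) s

    lower : ∀ {n n′ ρ x v} → n′ ≤ n → At n ρ x v → At n′ ρ x v
    lower l (is h e s) = is (≤-trans l h) e s

    here-at : ∀ ρ x w → w < T′ → At (toℕ x) (upd-env ρ x w) x w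
    here-at ρ x w s = is ≤-refl (upd-same ρ x w) s

    at-≢ : ∀ {ρ x v y} → At (suc (toℕ y)) ρ x v → x ≢ y
    at-≢ (is h _ _) refl = <-irrefl refl h

    e-above : ∀ {m} x l i (h : G (toℕ x)) {ρ vi f} → At (suc (toℕ x)) ρ i vi → (∀ w → w < T′ → Emits h (upd-env ρ x w) (f w)) →
              Emits (for {m} x l (ifT (lt i x) h skip)) ρ (cat (suc vi) (T′ ∸ suc vi) f)
    e-above x l i h {ρ} {vi} {f} a e = e-cast (cat-above T′ vi f (small a))
      (e-for x l (ifT (lt i x) h skip) λ w w<T → e-if (lt i x) h skip (vi <ᵇ w)
        (test w w<T) (λ _ → e w w<T) (λ _ → e-skip))
      where
        test : ∀ w → w < T′ → holds (lt i x) rs (upd-env ρ x w) ≡ (vi <ᵇ w)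
        test w w<T rewrite upd-same ρ x w | upd-other ρ x w i (at-≢ a) | value a | <ᵇ-true w<T with vi <ᵇ w
        ... | true  = refl
        ... | false = refl

    e-under : ∀ {m} x l i (h : G (toℕ x)) {ρ vi f} → At (suc (toℕ x)) ρ i vi → (∀ w → w < T′ → Emits h (upd-env ρ x w) (f w)) →
              Emits (for {m} x l (ifT (lt x i) h skip)) ρ (cat 0 vi f)
    e-under x l i h {ρ} {vi} {f} a e = e-cast (cat-below T′ vi f (<⇒≤ (small a)))
      (e-for x l (ifT (lt x i) h skip) λ w w<T → e-if (lt x i) h skip (w <ᵇ vi)
        (test w) (λ _ → e w w<T) (λ _ → e-skip))
      where
        test : ∀ w → holds (lt x i) rs (upd-env ρ x w) ≡ (w <ᵇ vi)
        test w rewrite upd-same ρ x w | upd-other ρ x w i (at-≢ a) | value a | <ᵇ-true (small a) with w <ᵇ vi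
        ... | true  = refl
        ... | false = refl

    ≡ᵇ-sym : ∀ m n → (m ≡ᵇ n) ≡ (n ≡ᵇ m)
    ≡ᵇ-sym zero zero = refl
    ≡ᵇ-sym zero (suc n) = refl
    ≡ᵇ-sym (suc m) zero = refl
    ≡ᵇ-sym (suc m) (suc n) = ≡ᵇ-sym m n

    e-next : ∀ {m} x l i (h : G (toℕ x)) {ρ vi f} → At (suc (toℕ x)) ρ i vi → suc vi < T′ → (∀ w → w < T′ → w ≡ suc vi → Emits h (upd-env ρ x w) (f w)) →
             Emits (for {m} x l (ifT (nx i x) h skip)) ρ (f (suc vi))
    e-next x l i h {ρ} {vi} {f} a lim e = e-cast (cat-pick T′ (suc vi) f lim)
      (e-for x l (ifT (nx i x) h skip) λ w w<T → e-if (nx i x) h skip (w ≡ᵇ suc vi)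
        (test w w<T) (λ t → e w w<T (≡ᵇ⇒≡ w (suc vi) (subst T (sym t) tt))) (λ _ → e-skip))
      where
        test : ∀ w → w < T′ → holds (nx i x) rs (upd-env ρ x w) ≡ (w ≡ᵇ suc vi)
        test w w<T rewrite upd-same ρ x w | upd-other ρ x w i (at-≢ a) | value a | <ᵇ-true w<T with w ≡ᵇ suc vi
        ... | true  = refl
        ... | false = refl

    e-prev : ∀ {m} x l i (h : G (toℕ x)) {ρ p f} → At (suc (toℕ x)) ρ i (suc p) → (∀ w → w < T′ → w ≡ p → Emits h (upd-env ρ x w) (f w)) →
             Emits (for {m} x l (ifT (nx x i) h skip)) ρ (f p)
    e-prev x l i h {ρ} {p} {f} a e = e-cast (cat-pick T′ p f (<-trans ≤-refl (small a)))
      (e-for x l (ifT (nx x i) h skip) λ w w<T → e-if (nx x i) h skip (w ≡ᵇ p)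
        (test w) (λ t → e w w<T (≡ᵇ⇒≡ w p (subst T (sym t) tt))) (λ _ → e-skip))
      where
        test : ∀ w → holds (nx x i) rs (upd-env ρ x w) ≡ (w ≡ᵇ p)
        test w rewrite upd-same ρ x w | upd-other ρ x w i (at-≢ a) | value a | <ᵇ-true (small a) | ≡ᵇ-sym p w with w ≡ᵇ p
        ... | true  = refl
        ... | false = refl

    e-reps : ∀ {m} n {ρ} → Emits (reps {m} n) ρ (ones n)
    e-reps {m} n = e-cast (trans (cat-replicate 0 n 1 c1) (cong ones (*-identityʳ n)))
      (e-seqN 0 n (λ _ → put′ {m} c1) (λ _ _ _ → e-put₁ c1))

    ones-++ : ∀ m n → ones m ++ ones n ≡ ones (m + n)
    ones-++ m n = replicate-++ m n

    e-unary : ∀ {m} l d i r b e {ρ vd vi} → At 2 ρ d vd → At 2 ρ i vi →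
              Emits (unaryG {m} l d i r b e) ρ (ones (num (vd * 3 + r) vi b + num (vd * 3 + r) vi b + e))
    e-unary {m} l d i r b e {ρ} {vd} {vi} ad ai = e-cast total
      (e-seq _ _ (e-under s1 l d (for s0 ≤! (reps (6 * g))) ad λ w _ → e-for s0 ≤! (reps (6 * g)) λ _ _ → e-reps (6 * g))
        (e-seq _ _ (e-for s0 _ (reps (r * (2 * g))) (λ _ _ → e-reps (r * (2 * g))))
          (e-seq _ _ (e-under s0 _ i (reps (2 * g)) (lower ≤! ai) (λ w _ → e-reps (2 * g)))
            (e-reps (b + b + e)))))
      where
        arith : ∀ vd T g r vi b e → vd * (T * (6 * g)) + (T * (r * (2 * g)) + (vi * (2 * g) + (b + b + e)))
              ≡ (vd * 3 + r) * (T * g) + (vi * g + b) + ((vd * 3 + r) * (T * g) + (vi * g + b)) + e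
        arith = solve-∀
        total : cat 0 vd (λ _ → cat 0 T′ (λ _ → ones (6 * g))) ++ (cat 0 T′ (λ _ → ones (r * (2 * g))) ++ (cat 0 vi (λ _ → ones (2 * g)) ++ ones (b + b + e)))
              ≡ ones (num (vd * 3 + r) vi b + num (vd * 3 + r) vi b + e)
        total = trans (cong₂ _++_ (trans (cat-cong 0 vd (λ _ _ _ → cat-replicate 0 T′ (6 * g) c1)) (cat-replicate 0 vd (T′ * (6 * g)) c1))
            (trans (cong₂ _++_ (cat-replicate 0 T′ (r * (2 * g)) c1) (trans (cong (_++ ones (b + b + e)) (cat-replicate 0 vi (2 * g) c1)) (ones-++ (vi * (2 * g)) (b + b + e))))
              (ones-++ (T′ * (r * (2 * g))) _)))
          (trans (ones-++ (vd * (T′ * (6 * g))) _) (cong ones (arith vd T′ g r vi b e)))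

    e-mod : ∀ {m} l d i r b e {ρ vd vi} → At 2 ρ d vd → At 2 ρ i vi →
            Emits (modG {m} l d i r b e) ρ (sMod (num (vd * 3 + r) vi b + num (vd * 3 + r) vi b + e))
    e-mod {m} l d i r b e ad ai = e-put c⟨ (unaryG l d i r b e >> put′ c⟩) (e-seq (unaryG {m} l d i r b e) (put′ c⟩) (e-unary l d i r b e ad ai) (e-put₁ c⟩))

    e-mod0 : ∀ {m} l d i r b {ρ vd vi} → At 2 ρ d vd → At 2 ρ i vi →
             Emits (modG {m} l d i r b 0) ρ (sMod (num (vd * 3 + r) vi b + num (vd * 3 + r) vi b))
    e-mod0 {m} l d i r b ad ai = e-cast (cong sMod (+-identityʳ _)) (e-mod {m} l d i r b 0 ad ai)

    e-pair : ∀ {m} l d i r b {ρ vd vi} → At 2 ρ d vd → At 2 ρ i vi → Emits (pairG {m} l d i r b) ρ (sPair (num (vd * 3 + r) vi b))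
    e-pair {m} l d i r b ad ai = e-seq (modG {m} l d i r b 0) (modG l d i r b 1) (e-mod0 {m} l d i r b ad ai)
      (e-cast (cong sMod (+-comm _ 1)) (e-mod {m} l d i r b 1 ad ai))

    e-cell : ∀ {m} l d i r b n {ρ vd vi} → At 2 ρ d vd → At 2 ρ i vi →
             Emits (cellG {m} l d i r b n) ρ (cat b n (λ b′ → sPair (num (vd * 3 + r) vi b′)))
    e-cell {m} l d i r b n ad ai = e-seqN b n (pairG {m} l d i r) (λ b′ _ _ → e-pair {m} l d i r b′ ad ai)

    e-blocks : ∀ {m} l d r n {ρ vd} → At 3 ρ d vd →
               Emits (blocksG {m} l d r n) ρ (cat r n (λ r′ → cat 0 T′ (λ w → cat 0 g (λ b′ → sPair (num (vd * 3 + r′) w b′)))))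
    e-blocks l d r n {ρ} ad = e-seqN r n _ λ r′ _ _ → e-for s2 l (cellG ≤! d s2 r′ 0 g) λ w w<T →
      e-cell ≤! d s2 r′ 0 g (lower ≤! (keep s2 w ≤! ad)) (here-at ρ s2 w w<T)

    e-worm : ∀ {m} l d i r b {ρ vd vi} → r < 3 → b < g → At 4 ρ d vd → At 4 ρ i vi →
             Emits (wormG {m} l d i r b) ρ (sWorm (suc (num (vd * 3 + r) vi b)))
    e-worm {m} l d i r b {ρ} {vd} {vi} r<3 b<g ad ai = e-seq _ (put′ c⊤)
      (e-cast (worm-tails vd r vi b (small ad) r<3 (small ai) b<g)
        (e-seq _ _ (e-cell _ d i r (suc b) (g ∸ suc b) (lower ≤! ad) (lower ≤! ai))
          (e-seq _ _ (e-above s2 _ i (cellG ≤! d s2 r 0 g) (lower ≤! ai) λ w w<T →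
              e-cell ≤! d s2 r 0 g (lower ≤! (keep s2 w ≤! ad)) (here-at ρ s2 w w<T))
            (e-seq _ _ (e-blocks _ d (suc r) (3 ∸ suc r) (lower ≤! ad))
              (e-above s3 l d (blocksG ≤! s3 0 3) ad λ u u<T → e-blocks ≤! s3 0 3 (here-at ρ s3 u u<T))))))
      (e-put₁ c⊤)

    enc-bit : ∀ v → sMod (v + v) ++ sWorm (suc v) ≡ enc (trB (vr v))
    enc-bit v = sym (enc-xv v)

    e-var : ∀ {m} l d i r b {ρ vd vi} → r < 3 → b < g → At 4 ρ d vd → At 4 ρ i vi →
            Emits (varG {m} l d i r b) ρ (enc (trB (vr (num (vd * 3 + r) vi b))))
    e-var {m} l d i r b {vd = vd} {vi} r<3 b<g ad ai = e-cast (enc-bit (num (vd * 3 + r) vi b))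
      (e-seq _ _ (e-mod0 {m} _ d i r b (lower ≤! ad) (lower ≤! ai)) (e-worm l d i r b r<3 b<g ad ai))

    e-all : ∀ {m} l d i r b {ρ vd vi} → r < 3 → b < g → At 4 ρ d vd → At 4 ρ i vi →
            Emits (allG {m} l d i r b) ρ (sAll (num (vd * 3 + r) vi b))
    e-all {m} l d i r b r<3 b<g ad ai = e-put c¬ _ (e-seq _ _ (e-mod0 {m} _ d i r b (lower ≤! ad) (lower ≤! ai))
      (e-put c¬ _ (e-put c⇒ _ (e-worm l d i r b r<3 b<g ad ai))))

    e-ex : ∀ {m} l d i r b {ρ vd vi} → r < 3 → b < g → At 4 ρ d vd → At 4 ρ i vi →
           Emits (exG {m} l d i r b) ρ (sEx (num (vd * 3 + r) vi b))
    e-ex {m} l d i r b r<3 b<g ad ai = e-seq _ _ (e-mod0 {m} _ d i r b (lower ≤! ad) (lower ≤! ai))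
      (e-put c∧ _ (e-worm l d i r b r<3 b<g ad ai))

    e-then : ∀ {m} t (h h′ : G m) {ρ s} → holds t rs ρ ≡ true → Emits h ρ s → Emits (ifT t h h′) ρ s
    e-then t h h′ {s = s} e y = e-if t h h′ {s′ = s} true e (λ _ → y) (λ ())

    e-else : ∀ {m} t (h h′ : G m) {ρ s} → holds t rs ρ ≡ false → Emits h′ ρ s → Emits (ifT t h h′) ρ s
    e-else t h h′ {s = s} e n = e-if t h h′ {s = s} false e (λ ()) (λ _ → n)

    e-dir : ∀ {m} δ i (f : ∀ {m} → 4 ≤ m → Fin K → G m) (l : 5 ≤ m) {ρ vi s} → At 5 ρ i vi → Valid T′ vi δ →
      (∀ {m′} (l′ : 4 ≤ m′) ρ′ j → (∀ {x v} → At 5 ρ x v → At 4 ρ′ x v) → At 4 ρ′ j (shift δ vi) → Emits (f l′ j) ρ′ s) →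
      Emits (withDir δ i f l) ρ s
    e-dir stayD i f l {ρ} ai _ e = e _ ρ i (lower ≤!) (lower ≤! ai)
    e-dir nextD i f l {ρ} {s = s} ai (goes lim) e = e-next s4 l i (f ≤! s4) {f = λ _ → s} ai lim λ { w w<T refl →
      e ≤! (upd-env ρ s4 w) s4 (λ a → lower ≤! (keep s4 w ≤! a)) (here-at ρ s4 w w<T) }
    e-dir prevD i f l {ρ} {s = s} ai (comes refl) e = e-prev s4 l i (f ≤! s4) {f = λ _ → s} ai λ { w w<T refl →
      e ≤! (upd-env ρ s4 w) s4 (λ a → lower ≤! (keep s4 w ≤! a)) (here-at ρ s4 w w<T) }

    enc-if : ∀ b x y → (if b then enc (trB x) else enc (trB y)) ≡ enc (trB (if b then x else y))
    enc-if true  x y = refl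
    enc-if false x y = refl

    e-eq : ∀ {m p} (l : 5 ≤ m) d d′ i r r′ b (src : Src A g p) {ρ vd vd′ vi} → r < 3 → r′ < 3 →
           At 5 ρ d vd → At 5 ρ d′ vd′ → At 5 ρ i vi → PosIs T′ vi p →
           Emits (eqG l d d′ i r r′ b src) ρ (enc (trB (eqF (vd * 3 + r) (vd′ * 3 + r′) vi b src)))
    e-eq l d d′ i r r′ b (cst true) r<3 _ ad _ ai _ = e-var _ d i r (toℕ b) r<3 (toℕ<n b) (lower ≤! ad) (lower ≤! ai)
    e-eq l d d′ i r r′ b (cst false) r<3 _ ad _ ai _ = e-put c¬ _ (e-var _ d i r (toℕ b) r<3 (toℕ<n b) (lower ≤! ad) (lower ≤! ai))
    e-eq l d d′ i r r′ b (kis o a) {vi = vi} r<3 _ ad _ ai at = e-dir (dirOf o) i _ l ai (valid at (small ai) 2≤T o)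
      λ l′ ρ′ j keeps aj → e-cast (enc-if (kindB (shift (dirOf o) vi) a) _ _)
        (e-if (kd j (isSym a)) (varG l′ d i r (toℕ b)) (put′ c¬ >> varG l′ d i r (toℕ b)) (kindB (shift (dirOf o) vi) a)
          (cong (λ q → maybe′ (isSym a) false (nth rs q)) (value aj))
          (λ _ → e-var l′ d i r (toℕ b) r<3 (toℕ<n b) (keeps ad) (keeps ai))
          (λ _ → e-put c¬ _ (e-var l′ d i r (toℕ b) r<3 (toℕ<n b) (keeps ad) (keeps ai))))
    e-eq l d d′ i r r′ b (cpy o b′) r<3 r′<3 ad ad′ ai at = e-dir (dirOf o) i _ l ai (valid at (small ai) 2≤T o)
      λ l′ ρ′ j keeps aj → let t = e-var l′ d i r (toℕ b) r<3 (toℕ<n b) (keeps ad) (keeps ai)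
                               s = e-var l′ d′ j r′ (toℕ b′) r′<3 (toℕ<n b′) (keeps ad′) aj in
        e-put c∧ _ (e-seq _ _ (e-put c⇒ _ (e-seq _ _ t s)) (e-put c⇒ _ (e-seq _ _ s t)))

    frs-test : ∀ {ρ x v} n → At n ρ x v → holds (frs x) rs ρ ≡ (v ≡ᵇ 0)
    frs-test {v = v} n (is _ refl s) rewrite <ᵇ-true s with v ≡ᵇ 0
    ... | true  = refl
    ... | false = refl

    lst-test : ∀ {ρ x v} n → At n ρ x v → holds (lst x) rs ρ ≡ (suc v ≡ᵇ T′)
    lst-test n (is _ refl s) = refl

    e-tab : ∀ {m} (l : 6 ≤ m) tb d d′ r r′ {ρ vd vd′} → r < 3 → r′ < 3 → At 6 ρ d vd → At 6 ρ d′ vd′ →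
            Emits (tabG l tb d d′ r r′) ρ (enc (trB (tabF tb (vd * 3 + r) (vd′ * 3 + r′))))
    e-tab l tb d d′ r r′ {ρ} {vd} {vd′} r<3 r′<3 ad ad′ = e-cast (sym code)
      (e-seq _ _ (e-for s5 l _ λ i i<T → choose i i<T (posOf T′ i) (posOf-is T′ i)) (e-put₁ c⊤))
      where
        D = vd * 3 + r
        D′ = vd′ * 3 + r′
        conjunct : Bf → List Sym
        conjunct a = c∧ ∷ enc (trB a)
        row : (p : Pos) → ℕ → List Sym
        row p i = concatMap (λ b → conjunct (eqF D D′ i b (tb p b))) (allFin g)
        code : enc (trB (tabF tb D D′)) ≡ cat 0 T′ (λ i → row (posOf T′ i) i) ++ c⊤ ∷ []
        code = trans (enc-conj (cat 0 T′ (rowF tb D D′))) (cong (_++ c⊤ ∷ []) (trans (concatMap-cat 0 T′ conjunct (rowF tb D D′))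
          (cat-cong 0 T′ λ i _ _ → concatMap-map conjunct _ (allFin g))))
        emit-row : ∀ i → i < T′ → ∀ p → PosIs T′ i p → Emits (rowG tb d d′ r r′ p) (upd-env ρ s5 i) (row p i)
        emit-row i i<T p at = e-seqL (allFin g) _ λ b → e-put c∧ _
          (e-eq ≤! d d′ s5 r r′ b (tb p b) r<3 r′<3 (lower ≤! (keep s5 i ≤! ad)) (lower ≤! (keep s5 i ≤! ad′)) (here-at ρ s5 i i<T) at)
        choose : ∀ i → i < T′ → ∀ p → PosIs T′ i p → Emits (ifT (frs s5) (rowG tb d d′ r r′ pF)
          (ifT (lst s5) (rowG tb d d′ r r′ pL) (rowG tb d d′ r r′ pM))) (upd-env ρ s5 i) (row p i)
        choose i i<T .pF at@(isF refl) = e-then (frs s5) _ _ (frs-test 5 (here-at ρ s5 i i<T)) (emit-row i i<T pF at)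
        choose i i<T .pL at@(isL nz e) = e-else (frs s5) _ _ (trans (frs-test 5 (here-at ρ s5 i i<T)) (≡ᵇ-false nz))
          (e-then (lst s5) _ _ (trans (lst-test 5 (here-at ρ s5 i i<T)) (trans (cong (_≡ᵇ T′) e) (≡ᵇ-refl T′))) (emit-row i i<T pL at))
        choose i i<T .pM at@(isM nz ne) = e-else (frs s5) _ _ (trans (frs-test 5 (here-at ρ s5 i i<T)) (≡ᵇ-false nz))
          (e-else (lst s5) _ _ (trans (lst-test 5 (here-at ρ s5 i i<T)) (≡ᵇ-false ne)) (emit-row i i<T pM at))

    0<T : 0 < T′
    0<T = <-trans (s≤s z≤n) 2≤T

    e-body : ∀ {m} (l : 6 ≤ m) body {ρ vd} → At 7 ρ s7 vd → Emits (bodyG l body) ρ (enc (trB (bodyF vd body)))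
    e-body l nothing a = e-put₁ c⊥
    e-body l (just tb) a = e-tab l tb s7 s7 1 0 ≤! ≤! (lower ≤! a) (lower ≤! a)

    e-leaf : ∀ {m} (l : 6 ≤ m) cls {ρ vd} → At 7 ρ s7 vd → Emits (leafG l cls) ρ (enc (trB (leafF cls vd)))
    e-leaf l cls {ρ} {vd} a = e-cast (sym (trans (enc-conj (map (clauseF vd) cls)) (cong (_++ c⊤ ∷ []) (concatMap-map _ (clauseF vd) cls))))
      (e-seq _ _ (e-seqL cls _ λ (b₁ , b₂ , body) → e-put c∧ _ (e-put c⇒ _ (e-seq _ _ (first b₁ b₂) (e-body l body a)))) (e-put₁ c⊤))
      where
        X : ℕ → Fin g → ℕ
        X i b = num (vd * 3 + 0) i (toℕ b)
        first : ∀ b₁ b₂ → Emits (for s5 l (ifT (frs s5) (put′ c∧ >> varG ≤! s7 s5 0 (toℕ b₁) >> varG ≤! s7 s5 0 (toℕ b₂)) skip)) ρ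
                          (enc (trB (vr (X 0 b₁) ∧ᵇ′ vr (X 0 b₂))))
        first b₁ b₂ = e-cast (cat-pick T′ 0 (λ i → enc (trB (vr (X i b₁) ∧ᵇ′ vr (X i b₂)))) 0<T)
          (e-for s5 l _ λ i i<T → e-if (frs s5) _ skip (i ≡ᵇ 0) (frs-test 5 (here-at ρ s5 i i<T))
            (λ _ → e-put c∧ _ (e-seq _ _ (e-var ≤! s7 s5 0 (toℕ b₁) ≤! (toℕ<n b₁) (lower ≤! (keep s5 i ≤! a)) (lower ≤! (here-at ρ s5 i i<T)))
                                         (e-var ≤! s7 s5 0 (toℕ b₂) ≤! (toℕ<n b₂) (lower ≤! (keep s5 i ≤! a)) (lower ≤! (here-at ρ s5 i i<T)))))
            (λ _ → e-skip))

    e-quant : ∀ {m} (l : 6 ≤ m) (q : ∀ {m} → 4 ≤ m → (d i : Fin K) (r b : ℕ) → G m) (sQ : ℕ → List Sym) →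
      (∀ {m} (l : 4 ≤ m) d i r b {ρ vd vi} → r < 3 → b < g → At 4 ρ d vd → At 4 ρ i vi → Emits (q l d i r b) ρ (sQ (num (vd * 3 + r) vi b))) →
      ∀ r {ρ vd} → r < 3 → At 7 ρ s7 vd → Emits (quantG l q r) ρ (cat ((vd * 3 + r) * blockSize) blockSize sQ)
    e-quant l q sQ e r {ρ} {vd} r<3 a = e-cast (block-cat sQ (vd * 3 + r)) (e-for s5 l _ λ i i<T → e-seqN 0 g _ λ b _ b<g →
      e ≤! s7 s5 r b r<3 b<g (lower ≤! (keep s5 i ≤! a)) (lower ≤! (here-at ρ s5 i i<T)))

    module _ (initT accT eqT : Table A g) where

      e-level : ∀ {m} (l : 7 ≤ m) {ρ vd} → At 7 ρ s7 vd → Emits (levelG l initT accT eqT) ρ (enc (trB (levelF initT accT eqT vd)))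
      e-level l {ρ} {zero} a = e-then (frs s7) _ _ (frs-test 7 a) (e-put c∧ _ (e-seq _ _
        (e-tab _ initT s7 s7 0 0 ≤! ≤! (lower ≤! a) (lower ≤! a)) (e-tab _ accT s7 s7 1 1 ≤! ≤! (lower ≤! a) (lower ≤! a))))
      e-level l {ρ} {suc d} a = e-else (frs s7) _ _ (frs-test 7 a) (e-prev s6 l s7 _ {f = λ _ → enc (trB (levelF initT accT eqT (suc d)))} a
        λ { w w<T refl → let a₇ = lower {n′ = 6} ≤! (keep s6 w ≤! a) ; a₆ = here-at ρ s6 w w<T in
          e-put c∨ _ (e-seq _ _
            (e-put c∧ _ (e-seq _ _ (e-tab ≤! eqT s7 s6 0 0 ≤! ≤! a₇ a₆) (e-tab ≤! eqT s7 s6 1 2 ≤! ≤! a₇ a₆)))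
            (e-put c∧ _ (e-seq _ _ (e-tab ≤! eqT s7 s6 0 2 ≤! ≤! a₇ a₆) (e-tab ≤! eqT s7 s6 1 1 ≤! ≤! a₇ a₆)))) })

      levelS : ℕ → List Sym
      levelS d = cat ((d * 3 + 0) * blockSize) blockSize sAll ++ (cat ((d * 3 + 1) * blockSize) blockSize sAll
        ++ ((c⇒ ∷ enc (trB (levelF initT accT eqT d))) ++ cat ((d * 3 + 2) * blockSize) blockSize sEx))

      enc-levels : ∀ p n l → enc (tr (p * (3 * blockSize)) (cat p n (levelIts initT accT eqT)) l) ≡ cat p n levelS ++ enc (trB l)
      enc-levels p zero l = refl
      enc-levels p (suc n) l = trans (cong (λ its → enc (tr v its l)) flatten)
        (trans (enc-alls W v _ l) (trans (cong₂ (λ q z → cat q W sAll ++ z) (v₀ p W) (trans (enc-alls W (v + W) _ l)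
          (cong₂ (λ q z → cat q W sAll ++ z) (v₁ p W) (cong (λ z → c⇒ ∷ enc (trB (levelF initT accT eqT p)) ++ z)
            (trans (enc-exs W (v + W + W) _ l) (cong₂ (λ q z → cat q W sEx ++ z) (v₂ p W)
              (trans (cong (λ q → enc (tr q rest l)) (v₃ p W)) (enc-levels (suc p) n l)))))))) regroup))
        where
          W = blockSize
          v = p * (3 * W)
          rest = cat (suc p) n (levelIts initT accT eqT)
          I = impI (levelF initT accT eqT p)
          flatten : levelIts initT accT eqT p ++ rest ≡ replicate W allI ++ (replicate W allI ++ (I ∷ (replicate W exI ++ rest)))
          flatten = trans (++-assoc (replicate W allI) _ rest) (cong (replicate W allI ++_) (++-assoc (replicate W allI) _ rest))
          v₀ : ∀ p W → p * (3 * W) ≡ (p * 3 + 0) * W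
          v₀ = solve-∀
          v₁ : ∀ p W → p * (3 * W) + W ≡ (p * 3 + 1) * W
          v₁ = solve-∀
          v₂ : ∀ p W → p * (3 * W) + W + W ≡ (p * 3 + 2) * W
          v₂ = solve-∀
          v₃ : ∀ p W → p * (3 * W) + W + W + W ≡ suc p * (3 * W)
          v₃ = solve-∀
          b₀ = cat ((p * 3 + 0) * W) W sAll
          b₁ = cat ((p * 3 + 1) * W) W sAll
          i = enc (trB (levelF initT accT eqT p))
          b₂ = cat ((p * 3 + 2) * W) W sEx
          z = cat (suc p) n levelS ++ enc (trB l)
          regroup : b₀ ++ (b₁ ++ (c⇒ ∷ (i ++ (b₂ ++ z)))) ≡ (levelS p ++ cat (suc p) n levelS) ++ enc (trB l)
          regroup = sym (trans (++-assoc (levelS p) (cat (suc p) n levelS) (enc (trB l)))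
            (trans (++-assoc b₀ _ z) (cong (b₀ ++_) (trans (++-assoc b₁ _ z) (cong (λ y → b₁ ++ (c⇒ ∷ y)) (++-assoc i b₂ z))))))

      e-main : ∀ cls ρ → Emits (mainG initT accT eqT cls) ρ (enc (formula initT accT eqT cls))
      e-main cls ρ = e-cast code (e-put c⇒ _ (e-seq _ _
        (e-seq _ _ (e-for s3 ≤! _ λ u u<T → e-blocks ≤! s3 0 3 (here-at ρ s3 u u<T)) (e-put₁ c⊤))
        (e-for s7 ≤! _ λ d d<T → let a = here-at ρ s7 d d<T in e-seq _ _
          (e-seq _ _ (e-quant ≤! allG sAll e-all 0 ≤! a) (e-seq _ _ (e-quant ≤! allG sAll e-all 1 ≤! a)
            (e-seq _ _ (e-put c⇒ _ (e-level ≤! a)) (e-quant ≤! exG sEx e-ex 2 ≤! a))))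
          (e-if (lst s7) _ skip (suc d ≡ᵇ T′) (lst-test 7 a) (λ _ → e-leaf ≤! cls a) (λ _ → e-skip)))))
        where
          leafS : ℕ → List Sym
          leafS d = enc (trB (leafF cls d))
          last-level : ∀ n (f h : ℕ → List Sym) → 0 < n → cat 0 n (λ d → f d ++ (if suc d ≡ᵇ n then h d else [])) ≡ cat 0 n f ++ h (pred n)
          last-level (suc t) f h _ = cat-last 0 t f h
          code : c⇒ ∷ ((cat 0 T′ (λ u → cat 0 3 (λ r′ → cat 0 T′ (λ w → cat 0 g (λ b′ → sPair (num (u * 3 + r′) w b′))))) ++ c⊤ ∷ [])
                   ++ cat 0 T′ (λ d → levelS d ++ (if suc d ≡ᵇ T′ then leafS d else [])))
               ≡ enc (formula initT accT eqT cls)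
          code = cong (c⇒ ∷_) (cong₂ _++_ (trans (cong (_++ c⊤ ∷ []) whole-worm) (sym (enc-worm 0 N)))
            (trans (last-level T′ levelS leafS 0<T) (sym (enc-levels 0 T′ (leafF cls (pred T′))))))

-- Blocks of equal quantifiers

AgreeTo : ℕ → (ℕ → Bool) → (ℕ → Bool) → Set
AgreeTo v ρ σ = ∀ x → x < v → ρ x ≡ σ x

set-agree : ∀ {v ρ σ} b → AgreeTo v ρ σ → AgreeTo (suc v) (set ρ v b) (set σ v b)
set-agree {v} {ρ} {σ} b a x x≤v with m≤n⇒m<n∨m≡n (s≤s⁻¹ x≤v)
... | inj₁ x<v  = trans (set-below ρ v b x x<v) (trans (a x x<v) (sym (set-below σ v b x x<v)))
... | inj₂ refl = trans (set-same ρ v b) (sym (set-same σ v b))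

qval-cong : ∀ its l {v ρ σ} → Scoped v its l → AgreeTo v ρ σ → qval v its l ρ ≡ qval v its l σ
qval-cong [] l s a = evalB-cong _ l s a
qval-cong (allI ∷ its) l s a = cong₂ _∧_ (qval-cong its l s (set-agree false a)) (qval-cong its l s (set-agree true a))
qval-cong (exI ∷ its) l s a = cong₂ _∨_ (qval-cong its l s (set-agree false a)) (qval-cong its l s (set-agree true a))
qval-cong (impI b ∷ its) l (s , t) a = cong₂ (λ p q → not p ∨ q) (evalB-cong _ b s a) (qval-cong its l t a)

set-extends : ∀ {v ρ σ} → AgreeTo v ρ σ → AgreeTo (suc v) (set ρ v (σ v)) σ
set-extends {v} {ρ} {σ} a x x≤v with m≤n⇒m<n∨m≡n (s≤s⁻¹ x≤v)
... | inj₁ x<v  = trans (set-below ρ v (σ v) x x<v) (a x x<v)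
... | inj₂ refl = set-same ρ v (σ v)

agree-trans : ∀ {v ρ σ τ} → AgreeTo v ρ σ → AgreeTo v σ τ → AgreeTo v ρ τ
agree-trans a b x h = trans (a x h) (b x h)

scoped-replicate : ∀ q → (q ≡ allI ⊎ q ≡ exI) → ∀ n v its l → Scoped (v + n) its l → Scoped v (replicate n q ++ its) l
scoped-replicate q h zero v its l s = subst (λ w → Scoped w its l) (+-identityʳ v) s
scoped-replicate q (inj₁ refl) (suc n) v its l s = scoped-replicate q (inj₁ refl) n (suc v) its l (subst (λ w → Scoped w its l) (+-suc v n) s)
scoped-replicate q (inj₂ refl) (suc n) v its l s = scoped-replicate q (inj₂ refl) n (suc v) its l (subst (λ w → Scoped w its l) (+-suc v n) s)

quantifiers-++ : ∀ is js → quantifiers (is ++ js) ≡ quantifiers is + quantifiers js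
quantifiers-++ [] js = refl
quantifiers-++ (allI ∷ is) js = cong suc (quantifiers-++ is js)
quantifiers-++ (exI ∷ is) js = cong suc (quantifiers-++ is js)
quantifiers-++ (impI _ ∷ is) js = quantifiers-++ is js

-- Each universal variable is instantiated with the value that `σ` gives it; in the end the
-- assignment agrees with `σ` on all variables in scope.
all-elim : ∀ n v its l ρ → Scoped (v + n) its l → qval v (replicate n allI ++ its) l ρ ≡ true →
           ∀ σ → AgreeTo v ρ σ → qval (v + n) its l σ ≡ true
all-elim zero v its l ρ s q σ a rewrite +-identityʳ v = trans (sym (qval-cong its l s a)) q
all-elim (suc n) v its l ρ s q σ a = subst (λ w → qval w its l σ ≡ true) (sym (+-suc v n))
  (all-elim n (suc v) its l (set ρ v (σ v)) (subst (λ w → Scoped w its l) (+-suc v n) s) (pickBit (σ v)) σ (set-extends a))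
  where
    pickBit : ∀ b → qval (suc v) (replicate n allI ++ its) l (set ρ v b) ≡ true
    pickBit true  = proj₂ (∧-elim {qval (suc v) (replicate n allI ++ its) l (set ρ v false)} q)
    pickBit false = proj₁ (∧-elim q)

all-intro : ∀ n v its l ρ → Scoped (v + n) its l → (∀ σ → AgreeTo v ρ σ → qval (v + n) its l σ ≡ true) →
            qval v (replicate n allI ++ its) l ρ ≡ true
all-intro zero v its l ρ s h = subst (λ w → qval w its l ρ ≡ true) (+-identityʳ v) (h ρ λ _ _ → refl)
all-intro (suc n) v its l ρ s h = ∧-intro (bit false) (bit true)
  where
    bit : ∀ b → qval (suc v) (replicate n allI ++ its) l (set ρ v b) ≡ true
    bit b = all-intro n (suc v) its l (set ρ v b) (subst (λ w → Scoped w its l) (+-suc v n) s) λ σ a →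
      subst (λ w → qval w its l σ ≡ true) (+-suc v n) (h σ λ x x<v → trans (sym (set-below ρ v b x x<v)) (a x (m≤n⇒m≤1+n x<v)))

ex-elim : ∀ n v its l ρ → qval v (replicate n exI ++ its) l ρ ≡ true →
          ∃ λ σ → AgreeTo v ρ σ × qval (v + n) its l σ ≡ true
ex-elim zero v its l ρ q = ρ , (λ _ _ → refl) , subst (λ w → qval w its l ρ ≡ true) (sym (+-identityʳ v)) q
ex-elim (suc n) v its l ρ q = case ∨-elim {qval (suc v) (replicate n exI ++ its) l (set ρ v false)} q of λ
    { (inj₁ h) → go false h ; (inj₂ h) → go true h }
  where
    go : ∀ b → qval (suc v) (replicate n exI ++ its) l (set ρ v b) ≡ true → ∃ λ σ → AgreeTo v ρ σ × qval (v + suc n) its l σ ≡ true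
    go b h with ex-elim n (suc v) its l (set ρ v b) h
    ... | σ , a , q′ = σ , (λ x x<v → trans (sym (set-below ρ v b x x<v)) (a x (m≤n⇒m≤1+n x<v))) ,
          subst (λ w → qval w its l σ ≡ true) (sym (+-suc v n)) q′

ex-intro : ∀ n v its l ρ → Scoped (v + n) its l → ∀ σ → AgreeTo v ρ σ → qval (v + n) its l σ ≡ true →
           qval v (replicate n exI ++ its) l ρ ≡ true
ex-intro zero v its l ρ s σ a q rewrite +-identityʳ v = trans (qval-cong its l s a) q
ex-intro (suc n) v its l ρ s σ a q = pickBit (σ v) (ex-intro n (suc v) its l (set ρ v (σ v))
    (subst (λ w → Scoped w its l) (+-suc v n) s) σ (set-extends a) (subst (λ w → qval w its l σ ≡ true) (+-suc v n) q))
  where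
    pickBit : ∀ b → qval (suc v) (replicate n exI ++ its) l (set ρ v b) ≡ true → qval v (replicate (suc n) exI ++ its) l ρ ≡ true
    pickBit true  h = ∨-introʳ {qval (suc v) (replicate n exI ++ its) l (set ρ v false)} h
    pickBit false h = ∨-introˡ h

-- The formula expresses iterated application of the clause relation (Savitch)

module Savitch (A : Set) (g T : ℕ) {{_ : NonZero g}} (2≤T : 2 ≤ T) (kindB : ℕ → A → Bool)
               (initT accT eqT : Table A g) (cls : List (Fin g × Fin g × Maybe (Table A g))) where
  open Formula A g T kindB

  private
    W = blockSize

  Block : Set
  Block = ℕ → Fin g → Bool

  infix 4 _≈_
  _≈_ : Block → Block → Set
  X ≈ Y = ∀ i → i < T → ∀ b → X i b ≡ Y i b

  ≈-sym : ∀ {X Y} → X ≈ Y → Y ≈ X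
  ≈-sym e i l b = sym (e i l b)

  ≈-trans : ∀ {X Y Z} → X ≈ Y → Y ≈ Z → X ≈ Z
  ≈-trans e f i l b = trans (e i l b) (f i l b)

  ≈-refl : ∀ {X} → X ≈ X
  ≈-refl i l b = refl

  vec : (ℕ → Bool) → ℕ → Block
  vec ρ D i b = ρ (num D i (toℕ b))

  srcV : ∀ {p} → Block → ℕ → Src A g p → Bool
  srcV X i (cst c)    = c
  srcV X i (kis o a)  = kindB (shift (dirOf o) i) a
  srcV X i (cpy o b′) = X (shift (dirOf o) i) b′

  apply : Table A g → Block → Block
  apply tb X i b = srcV X i (tb (posOf T i) b)

  position : ∀ i → i < T → (o : Off (posOf T i)) → shift (dirOf o) i < T
  position i i<T o = shift-< i<T (valid (posOf-is T i) i<T 2≤T o)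

  apply-cong : ∀ tb {X X′} → X ≈ X′ → apply tb X ≈ apply tb X′
  apply-cong tb e i i<T b with tb (posOf T i) b
  ... | cst _ = refl
  ... | kis _ _ = refl
  ... | cpy o b′ = e _ (position i i<T o) b′

  num-bound : ∀ {n D i} (b : Fin g) → D < n → i < T → num D i (toℕ b) < n * W
  num-bound {n} {D} {i} b D<n i<T = ≤-trans (≤-trans (≤-reflexive (trans (sym (+-suc (D * W) _)) (cong (D * W +_) (sym (+-suc (i * g) (toℕ b))))))
    (≤-trans (+-monoʳ-≤ (D * W) (cell-end i (toℕ b) i<T (toℕ<n b))) (≤-reflexive (+-comm (D * W) W)))) (*-monoˡ-≤ W D<n)

  vec-agree : ∀ {n ρ σ D} → AgreeTo (n * W) ρ σ → D < n → vec ρ D ≈ vec σ D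
  vec-agree {D = D} a D<n i i<T b = a _ (num-bound {D = D} b D<n i<T)

  -- Writes `X` into block `D` over `ρ`; quotient and remainder by `g` recover the cell and the bit
  -- from an address.
  fill : (ℕ → Bool) → ℕ → Block → ℕ → Bool
  fill ρ D X x = if x <ᵇ D * W then ρ x else X ((x ∸ D * W) / g) ((x ∸ D * W) mod g)

  fill-agree : ∀ ρ D X → AgreeTo (D * W) ρ (fill ρ D X)
  fill-agree ρ D X x h rewrite <ᵇ-true h = refl

  fill-vec : ∀ ρ D X → vec (fill ρ D X) D ≈ X
  fill-vec ρ D X i i<T b rewrite <ᵇ-false (m≤m+n (D * W) (i * g + toℕ b)) | m+n∸m≡n (D * W) (i * g + toℕ b) = cong₂ X quotient remainder
    where
      quotient : (i * g + toℕ b) / g ≡ i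
      quotient = trans (+-distrib-/-∣ˡ (toℕ b) (n∣m*n i)) (trans (cong₂ _+_ (m*n/n≡m i g) (m<n⇒m/n≡0 (toℕ<n b))) (+-identityʳ i))
      remainder : (i * g + toℕ b) mod g ≡ b
      remainder = toℕ-injective (trans (toℕ-fromℕ< _) (trans (cong (_% g) (+-comm (i * g) (toℕ b)))
        (trans ([m+kn]%n≡m%n (toℕ b) i g) (m<n⇒m%n≡m (toℕ<n b)))))

  conj-++-elim : ∀ ρ as bs → evalB ρ (conj (as ++ bs)) ≡ true → evalB ρ (conj as) ≡ true × evalB ρ (conj bs) ≡ true
  conj-++-elim ρ [] bs h = refl , h
  conj-++-elim ρ (a ∷ as) bs h with ∧-elim {evalB ρ a} h
  ... | x , y with conj-++-elim ρ as bs y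
  ... | u , v = ∧-intro x u , v

  conj-++-intro : ∀ ρ as bs → evalB ρ (conj as) ≡ true → evalB ρ (conj bs) ≡ true → evalB ρ (conj (as ++ bs)) ≡ true
  conj-++-intro ρ [] bs h k = k
  conj-++-intro ρ (a ∷ as) bs h k with ∧-elim {evalB ρ a} h
  ... | x , y = ∧-intro x (conj-++-intro ρ as bs y k)

  conj-cat-elim : ∀ ρ p n f → evalB ρ (conj (cat p n f)) ≡ true → ∀ w → p ≤ w → w < p + n → evalB ρ (conj (f w)) ≡ true
  conj-cat-elim ρ p zero f h w l u = ⊥-elim (<⇒≱ u (≤-trans (≤-reflexive (+-identityʳ p)) l))
  conj-cat-elim ρ p (suc n) f h w l u with conj-++-elim ρ (f p) (cat (suc p) n f) h | m≤n⇒m<n∨m≡n l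
  ... | x , y | inj₁ p<w  = conj-cat-elim ρ (suc p) n f y w p<w (<-≤-trans u (≤-reflexive (+-suc p n)))
  ... | x , y | inj₂ refl = x

  conj-cat-intro : ∀ ρ p n f → (∀ w → p ≤ w → w < p + n → evalB ρ (conj (f w)) ≡ true) → evalB ρ (conj (cat p n f)) ≡ true
  conj-cat-intro ρ p zero f h = refl
  conj-cat-intro ρ p (suc n) f h = conj-++-intro ρ (f p) (cat (suc p) n f) (h p ≤-refl (≤-trans (s≤s (m≤m+n p n)) (≤-reflexive (sym (+-suc p n)))))
    (conj-cat-intro ρ (suc p) n f λ w l u → h w (<⇒≤ l) (<-≤-trans u (≤-reflexive (sym (+-suc p n)))))

  conj-map-elim : ∀ {B : Set} ρ (f : B → Bf) bs → evalB ρ (conj (map f bs)) ≡ true → ∀ b → b ∈ bs → evalB ρ (f b) ≡ true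
  conj-map-elim ρ f (c ∷ bs) h b m with ∧-elim {evalB ρ (f c)} h
  conj-map-elim ρ f (c ∷ bs) h .c (here refl) | x , y = x
  conj-map-elim ρ f (c ∷ bs) h b (there m) | x , y = conj-map-elim ρ f bs y b m

  conj-map-intro : ∀ {B : Set} ρ (f : B → Bf) bs → (∀ b → b ∈ bs → evalB ρ (f b) ≡ true) → evalB ρ (conj (map f bs)) ≡ true
  conj-map-intro ρ f [] h = refl
  conj-map-intro ρ f (c ∷ bs) h = ∧-intro (h c (here refl)) (conj-map-intro ρ f bs λ b m → h b (there m))

  iff-elim : ∀ {x y} → (not x ∨ y) ∧ (not y ∨ x) ≡ true → x ≡ y
  iff-elim {true}  {true}  _ = refl
  iff-elim {false} {false} _ = refl

  iff-intro : ∀ {x y} → x ≡ y → (not x ∨ y) ∧ (not y ∨ x) ≡ true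
  iff-intro {true}  refl = refl
  iff-intro {false} refl = refl

  eq-elim : ∀ ρ {p} D D′ i b (s : Src A g p) → evalB ρ (eqF D D′ i b s) ≡ true → vec ρ D i b ≡ srcV (vec ρ D′) i s
  eq-elim ρ D D′ i b (cst true) h = h
  eq-elim ρ D D′ i b (cst false) h = not-elim h
  eq-elim ρ D D′ i b (kis o a) h with kindB (shift (dirOf o) i) a
  ... | true  = h
  ... | false = not-elim h
  eq-elim ρ D D′ i b (cpy o b′) h = iff-elim h

  eq-intro : ∀ ρ {p} D D′ i b (s : Src A g p) → vec ρ D i b ≡ srcV (vec ρ D′) i s → evalB ρ (eqF D D′ i b s) ≡ true
  eq-intro ρ D D′ i b (cst true) h = h
  eq-intro ρ D D′ i b (cst false) h = cong not h
  eq-intro ρ D D′ i b (kis o a) h with kindB (shift (dirOf o) i) a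
  ... | true  = h
  ... | false = cong not h
  eq-intro ρ D D′ i b (cpy o b′) h = iff-intro h

  tab-elim : ∀ ρ tb D D′ → evalB ρ (tabF tb D D′) ≡ true → vec ρ D ≈ apply tb (vec ρ D′)
  tab-elim ρ tb D D′ h i i<T b = eq-elim ρ D D′ i b (tb (posOf T i) b)
    (conj-map-elim ρ _ (allFin g) (conj-cat-elim ρ 0 T (rowF tb D D′) h i z≤n i<T) b (∈-allFin b))

  tab-intro : ∀ ρ tb D D′ → vec ρ D ≈ apply tb (vec ρ D′) → evalB ρ (tabF tb D D′) ≡ true
  tab-intro ρ tb D D′ h = conj-cat-intro ρ 0 T (rowF tb D D′) λ i _ i<T →
    conj-map-intro ρ _ (allFin g) λ b _ → eq-intro ρ D D′ i b (tb (posOf T i) b) (h i i<T b)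

  below-conj : ∀ v as → (∀ a → a ∈ as → Below v a) → Below v (conj as)
  below-conj v [] h = _
  below-conj v (a ∷ as) h = h a (here refl) , below-conj v as λ b m → h b (there m)

  in-cat : ∀ {B : Set} p n (f : ℕ → List B) {x} → x ∈ cat p n f → ∃ λ w → p ≤ w × w < p + n × x ∈ f w
  in-cat p (suc n) f m with ∈-++⁻ (f p) m
  ... | inj₁ h = p , ≤-refl , ≤-trans (s≤s (m≤m+n p n)) (≤-reflexive (sym (+-suc p n))) , h
  ... | inj₂ h = let (w , l , u , k) = in-cat (suc p) n f h in w , <⇒≤ l , <-≤-trans u (≤-reflexive (sym (+-suc p n))) , k

  below-tab : ∀ {n} tb D D′ → D < n → D′ < n → Below (n * W) (tabF tb D D′)
  below-tab {n} tb D D′ l l′ = below-conj (n * W) _ λ a m → case in-cat 0 T (rowF tb D D′) m of λ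
    { (i , _ , i<T , k) → case ∈-map⁻ _ k of λ { (b , _ , refl) → below-eq i i<T b (tb (posOf T i) b) } }
    where
      below-eq : ∀ i → i < T → ∀ b (s : Src A g (posOf T i)) → Below (n * W) (eqF D D′ i b s)
      below-eq i i<T b (cst true) = num-bound {D = D} b l i<T
      below-eq i i<T b (cst false) = num-bound {D = D} b l i<T
      below-eq i i<T b (kis o a) with kindB (shift (dirOf o) i) a
      ... | true  = num-bound {D = D} b l i<T
      ... | false = num-bound {D = D} b l i<T
      below-eq i i<T b (cpy o b′) = let t = num-bound {D = D} b l i<T ; s = num-bound {D = D′} b′ l′ (position i i<T o) in (t , s) , (s , t)

  0<T : 0 < T
  0<T = <-trans (s≤s z≤n) 2≤T

  below-leaf : ∀ d → Below ((d * 3 + 2) * W) (leafF cls d)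
  below-leaf d = below-conj ((d * 3 + 2) * W) (map (clauseF d) cls) λ a m → case ∈-map⁻ (clauseF d) m of λ { (cl , _ , refl) → below-clause cl }
    where
      r₀ : d * 3 + 0 < d * 3 + 2
      r₀ = +-monoʳ-< (d * 3) (s≤s z≤n)
      r₁ : d * 3 + 1 < d * 3 + 2
      r₁ = +-monoʳ-< (d * 3) (s≤s (s≤s z≤n))
      below-body : ∀ body → Below ((d * 3 + 2) * W) (bodyF d body)
      below-body nothing = _
      below-body (just tb) = below-tab tb (d * 3 + 1) (d * 3 + 0) r₁ r₀
      below-clause : ∀ cl → Below ((d * 3 + 2) * W) (clauseF d cl)
      below-clause (b₁ , b₂ , body) = (num-bound {D = d * 3 + 0} b₁ r₀ 0<T , num-bound {D = d * 3 + 0} b₂ r₀ 0<T) , below-body body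

  levelB : ℕ → Bf
  levelB = levelF initT accT eqT

  below-level : ∀ d → Below ((d * 3 + 2) * W) (levelB d)
  below-level zero = below-tab {2} initT 0 0 (s≤s z≤n) (s≤s z≤n) , below-tab {2} accT 1 1 ≤-refl ≤-refl
  below-level (suc d) = (below-tab eqT _ _ (cur 0 ≤!) (old 0 ≤!) , below-tab eqT _ _ (cur 1 ≤!) (old 2 ≤!))
                      , (below-tab eqT _ _ (cur 0 ≤!) (old 2 ≤!) , below-tab eqT _ _ (cur 1 ≤!) (old 1 ≤!))
    where
      cur : ∀ r → r < 2 → suc d * 3 + r < suc d * 3 + 2
      cur r h = +-monoʳ-< (suc d * 3) h
      old : ∀ r → r < 3 → d * 3 + r < suc d * 3 + 2
      old r h = ≤-trans (+-monoʳ-< (d * 3) h) (≤-trans (≤-reflexive (+-comm (d * 3) 3)) (m≤m+n (suc d * 3) 2))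

  below-mono : ∀ {v w} a → v ≤ w → Below v a → Below w a
  below-mono tt′ l s = _
  below-mono ff′ l s = _
  below-mono (vr i) l s = ≤-trans s l
  below-mono (a ∧ᵇ′ b) l (s , t) = below-mono a l s , below-mono b l t
  below-mono (a ∨ᵇ′ b) l (s , t) = below-mono a l s , below-mono b l t
  below-mono (a ⇒ᵇ′ b) l (s , t) = below-mono a l s , below-mono b l t
  below-mono (¬ᵇ′ a) l s = below-mono a l s

  levels : ℕ → ℕ → List It
  levels p n = cat p n (levelIts initT accT eqT)

  leaf : Bf
  leaf = leafF cls (pred T)

  off₁ : ∀ p → p * (3 * W) + W ≡ (p * 3 + 1) * W
  off₁ p = arith p W
    where
      arith : ∀ p W → p * (3 * W) + W ≡ (p * 3 + 1) * W
      arith = solve-∀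
  off₀ : ∀ p → p * (3 * W) ≡ (p * 3 + 0) * W
  off₀ p = arith p W
    where
      arith : ∀ p W → p * (3 * W) ≡ (p * 3 + 0) * W
      arith = solve-∀
  off₂ : ∀ p → p * (3 * W) + W + W ≡ (p * 3 + 2) * W
  off₂ p = arith p W
    where
      arith : ∀ p W → p * (3 * W) + W + W ≡ (p * 3 + 2) * W
      arith = solve-∀
  off₃ : ∀ p → p * (3 * W) + W + W + W ≡ suc p * (3 * W)
  off₃ p = arith p W
    where
      arith : ∀ p W → p * (3 * W) + W + W + W ≡ suc p * (3 * W)
      arith = solve-∀

  tail₂ tail₁ tail₀ : ℕ → ℕ → List It
  tail₂ p n = replicate W exI ++ levels (suc p) n
  tail₁ p n = impI (levelB p) ∷ tail₂ p n
  tail₀ p n = replicate W allI ++ tail₁ p n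

  levels-suc : ∀ p n → levels p (suc n) ≡ replicate W allI ++ tail₀ p n
  levels-suc p n = trans (++-assoc (replicate W allI) _ (levels (suc p) n)) (cong (replicate W allI ++_) (++-assoc (replicate W allI) _ (levels (suc p) n)))

  scoped-levels : ∀ p n → p + n ≡ T → Scoped (p * (3 * W)) (levels p n) leaf
  scoped₂ : ∀ p n → p + suc n ≡ T → Scoped (p * (3 * W) + W + W) (tail₂ p n) leaf
  scoped₁ : ∀ p n → p + suc n ≡ T → Scoped (p * (3 * W) + W + W) (tail₁ p n) leaf
  scoped₀ : ∀ p n → p + suc n ≡ T → Scoped (p * (3 * W) + W) (tail₀ p n) leaf
  scoped-levels p zero e = below-mono leaf (≤-trans (*-monoˡ-≤ W bound) (≤-reflexive (sym (trans (off₀ p) (cong (_* W) (+-identityʳ (p * 3))))))) (below-leaf (pred T))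
    where
      bound : pred T * 3 + 2 ≤ p * 3
      bound = ≤-trans (≤-trans (+-monoʳ-≤ (pred T * 3) (s≤s (s≤s z≤n))) (≤-reflexive (+-comm (pred T * 3) 3)))
        (≤-reflexive (cong (_* 3) (trans (suc-pred T {{>-nonZero 0<T}}) (trans (sym e) (+-identityʳ p)))))
  scoped-levels p (suc n) e = subst (λ its → Scoped (p * (3 * W)) its leaf) (sym (levels-suc p n))
    (scoped-replicate allI (inj₁ refl) W (p * (3 * W)) (tail₀ p n) leaf (scoped₀ p n e))
  scoped₂ p n e = scoped-replicate exI (inj₂ refl) W _ (levels (suc p) n) leaf
    (subst (λ v → Scoped v (levels (suc p) n) leaf) (sym (off₃ p)) (scoped-levels (suc p) n (trans (sym (+-suc p n)) e)))
  scoped₁ p n e = subst (λ v → Below v (levelB p)) (sym (off₂ p)) (below-level p) , scoped₂ p n e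
  scoped₀ p n e = scoped-replicate allI (inj₁ refl) W _ (tail₁ p n) leaf (scoped₁ p n e)

  count-levels : ∀ p n → quantifiers (levels p n) ≡ n * (3 * W)
  count-levels p zero = refl
  count-levels p (suc n) = trans (cong quantifiers (levels-suc p n)) (trans (quantifiers-++ (replicate W allI) (tail₀ p n))
    (trans (cong₂ _+_ (count W) (trans (quantifiers-++ (replicate W allI) (tail₁ p n)) (cong₂ _+_ (count W)
      (trans (quantifiers-++ (replicate W exI) (levels (suc p) n)) (cong₂ _+_ (count′ W) (count-levels (suc p) n))))))
      (arith W (n * (3 * W)))))
    where
      count : ∀ n → quantifiers (replicate n allI) ≡ n
      count zero = refl
      count (suc n) = cong suc (count n)
      count′ : ∀ n → quantifiers (replicate n exI) ≡ n
      count′ zero = refl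
      count′ (suc n) = cong suc (count′ n)
      arith : ∀ W k → W + (W + (W + k)) ≡ 3 * W + k
      arith = solve-∀

  Fires : Block → Block → Maybe (Table A g) → Set
  Fires X Y nothing   = Empty
  Fires X Y (just tb) = Y ≈ apply tb X

  Step : Block → Block → Set
  Step X Y = ∀ b₁ b₂ body → (b₁ , b₂ , body) ∈ cls → X 0 b₁ ≡ true → X 0 b₂ ≡ true → Fires X Y body

  step-cong : ∀ {X X′ Y Y′} → X ≈ X′ → Y ≈ Y′ → Step X Y → Step X′ Y′
  step-cong {X} {X′} {Y} {Y′} eX eY s b₁ b₂ body m h₁ h₂ = transport body (s b₁ b₂ body m (trans (eX 0 0<T b₁) h₁) (trans (eX 0 0<T b₂) h₂))
    where
      transport : ∀ body → Fires X Y body → Fires X′ Y′ body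
      transport (just tb) f = ≈-trans (≈-sym eY) (≈-trans f (apply-cong tb eX))

  leaf-elim : ∀ ρ d → evalB ρ (leafF cls d) ≡ true → Step (vec ρ (d * 3 + 0)) (vec ρ (d * 3 + 1))
  leaf-elim ρ d h b₁ b₂ body m h₁ h₂ = fires body (⇒-elim (conj-map-elim ρ (clauseF d) cls h _ m) (∧-intro h₁ h₂))
    where
      fires : ∀ body → evalB ρ (bodyF d body) ≡ true → Fires (vec ρ (d * 3 + 0)) (vec ρ (d * 3 + 1)) body
      fires (just tb) h = tab-elim ρ tb (d * 3 + 1) (d * 3 + 0) h

  leaf-intro : ∀ ρ d → Step (vec ρ (d * 3 + 0)) (vec ρ (d * 3 + 1)) → evalB ρ (leafF cls d) ≡ true
  leaf-intro ρ d s = conj-map-intro ρ (clauseF d) cls λ (b₁ , b₂ , body) m →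
    ⇒-intro λ h → let (h₁ , h₂) = ∧-elim h in fires body (s b₁ b₂ body m h₁ h₂)
    where
      fires : ∀ body → Fires (vec ρ (d * 3 + 0)) (vec ρ (d * 3 + 1)) body → evalB ρ (bodyF d body) ≡ true
      fires (just tb) h = tab-intro ρ tb (d * 3 + 1) (d * 3 + 0) h

  -- Exactly `2 ^ n` steps, with midpoints ranging over all blocks of bits, whether or not they code
  -- a configuration.
  Reach : ℕ → Block → Block → Set
  Reach zero    X Y = Step X Y
  Reach (suc n) X Y = ∃ λ Z → Reach n X Z × Reach n Z Y

  reach-cong : ∀ n {X X′ Y Y′} → X ≈ X′ → Y ≈ Y′ → Reach n X Y → Reach n X′ Y′
  reach-cong zero eX eY r = step-cong eX eY r
  reach-cong (suc n) eX eY (Z , r , r′) = Z , reach-cong n eX ≈-refl r , reach-cong n ≈-refl eY r′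

  -- The meaning of `levelF` for a pair of blocks, the three blocks of the preceding level being
  -- read off `ρ`.
  Cond : ℕ → (ℕ → Bool) → Block → Block → Set
  Cond zero    ρ X Y = X ≈ apply initT X × Y ≈ apply accT Y
  Cond (suc d) ρ X Y = (X ≈ vec ρ (d * 3 + 0) × Y ≈ vec ρ (d * 3 + 2)) ⊎ (X ≈ vec ρ (d * 3 + 2) × Y ≈ vec ρ (d * 3 + 1))

  module _ (eqT-copies : ∀ X → apply eqT X ≈ X) where

    cond-agree : ∀ p {ρ σ X Y} → AgreeTo (p * (3 * W)) ρ σ → Cond p ρ X Y → Cond p σ X Y
    cond-agree zero a c = c
    cond-agree (suc d) {ρ} {σ} a c = both c
      where
        same : ∀ r → r < 3 → vec ρ (d * 3 + r) ≈ vec σ (d * 3 + r)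
        same r h = vec-agree {n = suc d * 3} (λ x l → a x (<-≤-trans l (≤-reflexive (*-assoc (suc d) 3 W))))
          (≤-trans (+-monoʳ-< (d * 3) h) (≤-reflexive (+-comm (d * 3) 3)))
        both : _ → _
        both (inj₁ (e , f)) = inj₁ (≈-trans e (same 0 ≤!) , ≈-trans f (same 2 ≤!))
        both (inj₂ (e , f)) = inj₂ (≈-trans e (same 2 ≤!) , ≈-trans f (same 1 ≤!))

    level-elim : ∀ p ρ → evalB ρ (levelB p) ≡ true → Cond p ρ (vec ρ (p * 3 + 0)) (vec ρ (p * 3 + 1))
    level-elim zero ρ h = let (x , y) = ∧-elim h in tab-elim ρ initT 0 0 x , tab-elim ρ accT 1 1 y
    level-elim (suc d) ρ h with ∨-elim h
    ... | inj₁ k = let (x , y) = ∧-elim k in inj₁ (≈-trans (tab-elim ρ eqT (suc d * 3 + 0) (d * 3 + 0) x) (eqT-copies _) ,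
                                                   ≈-trans (tab-elim ρ eqT (suc d * 3 + 1) (d * 3 + 2) y) (eqT-copies _))
    ... | inj₂ k = let (x , y) = ∧-elim k in inj₂ (≈-trans (tab-elim ρ eqT (suc d * 3 + 0) (d * 3 + 2) x) (eqT-copies _) ,
                                                   ≈-trans (tab-elim ρ eqT (suc d * 3 + 1) (d * 3 + 1) y) (eqT-copies _))

    level-intro : ∀ p ρ → Cond p ρ (vec ρ (p * 3 + 0)) (vec ρ (p * 3 + 1)) → evalB ρ (levelB p) ≡ true
    level-intro zero ρ (x , y) = ∧-intro (tab-intro ρ initT 0 0 x) (tab-intro ρ accT 1 1 y)
    level-intro (suc d) ρ (inj₁ (x , y)) = ∨-introˡ (∧-intro
      (tab-intro ρ eqT (suc d * 3 + 0) (d * 3 + 0) (≈-trans x (≈-sym (eqT-copies _)))) (tab-intro ρ eqT (suc d * 3 + 1) (d * 3 + 2) (≈-trans y (≈-sym (eqT-copies _)))))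
    level-intro (suc d) ρ (inj₂ (x , y)) = ∨-introʳ {evalB ρ (tabF eqT (suc d * 3 + 0) (d * 3 + 0)) ∧ evalB ρ (tabF eqT (suc d * 3 + 1) (d * 3 + 2))} (∧-intro
      (tab-intro ρ eqT (suc d * 3 + 0) (d * 3 + 2) (≈-trans x (≈-sym (eqT-copies _)))) (tab-intro ρ eqT (suc d * 3 + 1) (d * 3 + 1) (≈-trans y (≈-sym (eqT-copies _)))))

    cond-cong : ∀ p {ρ X X′ Y Y′} → X ≈ X′ → Y ≈ Y′ → Cond p ρ X Y → Cond p ρ X′ Y′
    cond-cong zero eX eY (x , y) = ≈-trans (≈-sym eX) (≈-trans x (apply-cong initT eX)) , ≈-trans (≈-sym eY) (≈-trans y (apply-cong accT eY))
    cond-cong (suc d) eX eY (inj₁ (x , y)) = inj₁ (≈-trans (≈-sym eX) x , ≈-trans (≈-sym eY) y)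
    cond-cong (suc d) eX eY (inj₂ (x , y)) = inj₂ (≈-trans (≈-sym eX) x , ≈-trans (≈-sym eY) y)

    private
      r<2 : ∀ d {r} → r < 2 → d * 3 + r < d * 3 + 2
      r<2 d h = +-monoʳ-< (d * 3) h
      to : ∀ {v w ρ σ} → v ≡ w → AgreeTo v ρ σ → AgreeTo w ρ σ
      to refl a = a

    -- Instantiate the universal blocks with `X` and `Y`. The condition then holds, and the
    -- existential block yields a midpoint; both halves satisfy the condition of the next level, so
    -- the induction hypothesis applies to each of them.
    savitch-elim : ∀ n p ρ → p + suc n ≡ T → qval (p * (3 * W)) (levels p (suc n)) leaf ρ ≡ true →
                   ∀ X Y → Cond p ρ X Y → Reach n X Y
    savitch-elim n p ρ e q X Y c = answer n e (ex-elim W _ (levels (suc p) n) leaf ρ₂ q₂)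
      where
        ρ₁ = fill ρ (p * 3 + 0) X
        ρ₂ = fill ρ₁ (p * 3 + 1) Y
        a₁ : AgreeTo (p * (3 * W)) ρ ρ₁
        a₁ = to (sym (off₀ p)) (fill-agree ρ (p * 3 + 0) X)
        a₂ : AgreeTo (p * (3 * W) + W) ρ₁ ρ₂
        a₂ = to (sym (off₁ p)) (fill-agree ρ₁ (p * 3 + 1) Y)
        X≈ : X ≈ vec ρ₂ (p * 3 + 0)
        X≈ = ≈-trans (≈-sym (fill-vec ρ (p * 3 + 0) X)) (vec-agree (fill-agree ρ₁ (p * 3 + 1) Y) (+-monoʳ-< (p * 3) ≤-refl))
        Y≈ : Y ≈ vec ρ₂ (p * 3 + 1)
        Y≈ = ≈-sym (fill-vec ρ₁ (p * 3 + 1) Y)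
        q₀ = all-elim W (p * (3 * W)) (tail₀ p n) leaf ρ (scoped₀ p n e) (subst (λ its → qval (p * (3 * W)) its leaf ρ ≡ true) (levels-suc p n) q) ρ₁ a₁
        q₁ = all-elim W (p * (3 * W) + W) (tail₁ p n) leaf ρ₁ (scoped₁ p n e) q₀ ρ₂ a₂
        q₂ : qval (p * (3 * W) + W + W) (tail₂ p n) leaf ρ₂ ≡ true
        q₂ = ⇒-elim q₁ (level-intro p ρ₂ (cond-cong p X≈ Y≈ (cond-agree p (agree-trans a₁ (λ x l → a₂ x (<-≤-trans l (m≤m+n _ W)))) c)))
        answer : ∀ n → p + suc n ≡ T → (∃ λ σ → AgreeTo (p * (3 * W) + W + W) ρ₂ σ × qval (p * (3 * W) + W + W + W) (levels (suc p) n) leaf σ ≡ true) → Reach n X Y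
        answer zero e (σ , a , h) = step-cong (≈-trans (≈-sym (vec-agree (to (off₂ p) a) (r<2 p ≤!))) (≈-sym X≈))
                                              (≈-trans (≈-sym (vec-agree (to (off₂ p) a) (r<2 p ≤!))) (≈-sym Y≈))
          (leaf-elim σ p (subst (λ d → evalB σ (leafF cls d) ≡ true) (trans (cong pred (sym e)) (cong pred (+-comm p 1))) h))
        answer (suc m) e (σ , a , h) = vec σ (p * 3 + 2) ,
            IH X (vec σ (p * 3 + 2)) (inj₁ (≈-trans X≈ (vec-agree (to (off₂ p) a) (r<2 p ≤!)) , ≈-refl)) ,
            IH (vec σ (p * 3 + 2)) Y (inj₂ (≈-refl , ≈-trans Y≈ (vec-agree (to (off₂ p) a) (r<2 p ≤!))))
          where IH = savitch-elim m (suc p) σ (trans (sym (+-suc p (suc m))) e) (subst (λ v → qval v (levels (suc p) (suc m)) leaf σ ≡ true) (off₃ p) h)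

    savitch-intro : ∀ n p ρ → p + suc n ≡ T → (∀ X Y → Cond p ρ X Y → Reach n X Y) →
                    qval (p * (3 * W)) (levels p (suc n)) leaf ρ ≡ true
    savitch-intro n p ρ e h = subst (λ its → qval (p * (3 * W)) its leaf ρ ≡ true) (sym (levels-suc p n))
      (all-intro W _ (tail₀ p n) leaf ρ (scoped₀ p n e) λ ρ₁ a₁ → all-intro W _ (tail₁ p n) leaf ρ₁ (scoped₁ p n e) λ ρ₂ a₂ → ⇒-intro λ l →
        let c = cond-agree p {ρ₂} {ρ} (λ x lt → sym (trans (a₁ x lt) (a₂ x (<-≤-trans lt (m≤m+n _ W))))) (level-elim p ρ₂ l)
        in answer n e ρ₂ (h (vec ρ₂ (p * 3 + 0)) (vec ρ₂ (p * 3 + 1)) c))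
      where
        answer : ∀ n → (e : p + suc n ≡ T) → ∀ ρ₂ → Reach n (vec ρ₂ (p * 3 + 0)) (vec ρ₂ (p * 3 + 1)) → qval (p * (3 * W) + W + W) (tail₂ p n) leaf ρ₂ ≡ true
        answer zero e ρ₂ s = ex-intro W _ [] leaf ρ₂ (subst (λ v → Scoped v [] leaf) (sym (off₃ p)) (scoped-levels (suc p) 0 (trans (sym (+-suc p 0)) e))) ρ₂ (λ _ _ → refl)
          (subst (λ d → evalB ρ₂ (leafF cls d) ≡ true) (sym (trans (cong pred (sym e)) (cong pred (+-comm p 1)))) (leaf-intro ρ₂ p s))
        answer (suc m) e ρ₂ (Z , r , r′) = ex-intro W _ (levels (suc p) (suc m)) leaf ρ₂
            (subst (λ v → Scoped v (levels (suc p) (suc m)) leaf) (sym (off₃ p)) (scoped-levels (suc p) (suc m) e′)) ρ₃ (to (sym (off₂ p)) a₃)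
            (subst (λ v → qval v (levels (suc p) (suc m)) leaf ρ₃ ≡ true) (sym (off₃ p)) (savitch-intro m (suc p) ρ₃ e′ pairs))
          where
            e′ = trans (sym (+-suc p (suc m))) e
            ρ₃ = fill ρ₂ (p * 3 + 2) Z
            a₃ : AgreeTo ((p * 3 + 2) * W) ρ₂ ρ₃
            a₃ = fill-agree ρ₂ (p * 3 + 2) Z
            pairs : ∀ X Y → Cond (suc p) ρ₃ X Y → Reach m X Y
            pairs X Y (inj₁ (x , y)) = reach-cong m (≈-sym (≈-trans x (≈-sym (vec-agree a₃ (r<2 p ≤!))))) (≈-sym (≈-trans y (fill-vec ρ₂ (p * 3 + 2) Z))) r
            pairs X Y (inj₂ (x , y)) = reach-cong m (≈-sym (≈-trans x (fill-vec ρ₂ (p * 3 + 2) Z))) (≈-sym (≈-trans y (≈-sym (vec-agree a₃ (r<2 p ≤!))))) r′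

    formula-correct : (GLP⊢ ι (formula initT accT eqT cls)) ⇔
      (∀ X Y → X ≈ apply initT X → Y ≈ apply accT Y → Reach (pred T) X Y)
    formula-correct = mk⇔
      (λ d X Y x y → savitch-elim (pred T) 0 ρ₀ T≡ (subst (λ n → qval 0 (levels 0 n) leaf ρ₀ ≡ true) (sym T≡) (proj₂ correct d)) X Y (x , y))
      (λ h → proj₁ correct (subst (λ n → qval 0 (levels 0 n) leaf ρ₀ ≡ true) T≡ (savitch-intro (pred T) 0 ρ₀ T≡ λ { X Y (x , y) → h X Y x y })))
      where
        -- The prefix binds every variable, so the evaluation may start from any assignment.
        ρ₀ : ℕ → Bool
        ρ₀ _ = false
        T≡ : suc (pred T) ≡ T
        T≡ = suc-pred T {{>-nonZero 0<T}}
        correct = qbf-correct (levels 0 T) leaf ρ₀ (count-levels 0 T) (scoped-levels 0 T refl)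

-- Halting times of machines with bounded space

module Halting {Σ₁ : ℕ} (M : TM Σ₁) where
  open TM M

  run-add : ∀ m n c → run M (m + n) c ≡ run M n (run M m c)
  run-add zero    n c = refl
  run-add (suc m) n c = run-add m n (step M c)

  step-halted : ∀ {b} c → outcome M c ≡ just b → step M c ≡ c
  step-halted c h rewrite h = refl

  run-halted : ∀ {b} t c → outcome M c ≡ just b → run M t c ≡ c
  run-halted zero c h = refl
  run-halted (suc t) c h = trans (cong (run M t) (step-halted c h)) (run-halted t c h)

  outcome-later : ∀ {b s t} c → s ≤ t → outcome M (run M s c) ≡ just b → outcome M (run M t c) ≡ just b
  outcome-later {b} {s} {t} c s≤t h = trans (cong (outcome M) (trans (cong (λ n → run M n c) (sym (m+[n∸m]≡n s≤t)))
    (trans (run-add s (t ∸ s) c) (run-halted (t ∸ s) (run M s c) h)))) h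

  outcome-unique : ∀ {a b} s t c → outcome M (run M s c) ≡ just a → outcome M (run M t c) ≡ just b → a ≡ b
  outcome-unique s t c h k with ≤-total s t
  ... | inj₁ l = just-injective (trans (sym (outcome-later c l h)) k)
  ... | inj₂ l = just-injective (trans (sym h) (outcome-later c l k))

  -- configurations as lists of tokens, the head token carrying the state

  finTok : Finite (Fin Γ ⊎ (Fin Q × Fin Γ))
  finTok = fin-⊎ fin-Fin (fin-× fin-Fin fin-Fin)

  -- One more than the number of codes: digits then run from 1 upwards and are never 0, so lists of
  -- different lengths also receive different numbers.
  radix : ℕ
  radix = suc (size finTok)

  tokens : Config M → List (Fin Γ ⊎ (Fin Q × Fin Γ))
  tokens (conf q ls a rs) = map inj₁ ls ++ inj₂ (q , a) ∷ map inj₁ rs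

  inj₁-injective : ∀ (rs rs′ : List (Fin Γ)) → map (inj₁ {B = Fin Q × Fin Γ}) rs ≡ map inj₁ rs′ → rs ≡ rs′
  inj₁-injective [] [] e = refl
  inj₁-injective (x ∷ rs) (y ∷ rs′) e with ∷-injective e
  ... | refl , e′ = cong (x ∷_) (inj₁-injective rs rs′ e′)

  tokens-injective : ∀ c d → tokens c ≡ tokens d → c ≡ d
  tokens-injective (conf q ls a rs) (conf q′ ls′ a′ rs′) = split ls ls′
    where
      split : ∀ ls ls′ → tokens (conf q ls a rs) ≡ tokens (conf q′ ls′ a′ rs′) → conf {M = M} q ls a rs ≡ conf q′ ls′ a′ rs′
      split [] [] e with inj₂-head (∷-injectiveˡ e)
        where
          inj₂-head : inj₂ {A = Fin Γ} (q , a) ≡ inj₂ (q′ , a′) → (q , a) ≡ (q′ , a′)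
          inj₂-head refl = refl
      ... | h = cong₂ (λ qa rs → conf (proj₁ qa) [] (proj₂ qa) rs) h (inj₁-injective rs rs′ (∷-injectiveʳ e))
      split (x ∷ ls) (y ∷ ls′) e with ∷-injective e
      ... | refl , e′ = cong (λ c → conf (Config.state c) (x ∷ Config.lft c) (Config.cur c) (Config.rgt c)) (split ls ls′ e′)
      split [] (y ∷ ls′) e with ∷-injectiveˡ e
      ... | ()
      split (x ∷ ls) [] e with ∷-injectiveˡ e
      ... | ()

  number′ : List (Fin Γ ⊎ (Fin Q × Fin Γ)) → ℕ
  number′ [] = 0
  number′ (x ∷ xs) = suc (toℕ (enc′ finTok x)) + number′ xs * radix

  number-injective : ∀ xs ys → number′ xs ≡ number′ ys → xs ≡ ys
  number-injective [] [] e = refl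
  number-injective (x ∷ xs) (y ∷ ys) e = cong₂ _∷_
    (trans (sym (dec-enc finTok x)) (trans (cong (dec′ finTok) (toℕ-injective (suc-injective low))) (dec-enc finTok y)))
    (number-injective xs ys (*-cancelʳ-≡ (number′ xs) (number′ ys) radix (+-cancelˡ-≡ (suc (toℕ (enc′ finTok x))) _ _
      (trans e (cong (_+ number′ ys * radix) (sym low))))))
    where
      digit : ∀ x n → (suc (toℕ (enc′ finTok x)) + n * radix) % radix ≡ suc (toℕ (enc′ finTok x))
      digit x n = trans ([m+kn]%n≡m%n (suc (toℕ (enc′ finTok x))) n radix) (m<n⇒m%n≡m (s≤s (toℕ<n (enc′ finTok x))))
      low : suc (toℕ (enc′ finTok x)) ≡ suc (toℕ (enc′ finTok y))
      low = trans (sym (digit x (number′ xs))) (trans (cong (_% radix) e) (digit y (number′ ys)))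

  number-< : ∀ xs → number′ xs < radix ^ length xs
  number-< [] = s≤s z≤n
  number-< (x ∷ xs) = ≤-trans (+-monoˡ-≤ (number′ xs * radix) (s≤s (toℕ<n (enc′ finTok x))))
    (≤-trans (*-monoˡ-≤ radix (number-< xs)) (≤-reflexive (*-comm _ radix)))

  n<2^n : ∀ n → n < 2 ^ n
  n<2^n zero = s≤s z≤n
  n<2^n (suc n) = ≤-trans (+-mono-≤ (s≤s z≤n) (n<2^n n)) (≤-trans (+-monoˡ-≤ (2 ^ n) (m^n>0 2 n)) (≤-reflexive (cong (2 ^ n +_) (sym (+-identityʳ _)))))

  module _ (P : ℕ) (c₀ : Config M) (bounded : ∀ t → space M (run M t c₀) ≤ P) where

    -- A power of two, as Savitch's recursion doubles the number of steps. It is at least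
    -- `radix ^ P`, which exceeds the code of every reachable configuration.
    count : ℕ
    count = 2 ^ (radix * P)

    code : ℕ → ℕ
    code t = number′ (tokens (run M t c₀))

    code-< : ∀ t → code t < count
    code-< t = <-≤-trans (number-< (tokens (run M t c₀))) (begin
        radix ^ length (tokens (run M t c₀)) ≤⟨ ^-monoʳ-≤ radix (≤-trans (≤-reflexive (lengths (run M t c₀))) (bounded t)) ⟩
        radix ^ P                            ≤⟨ ^-monoˡ-≤ P (<⇒≤ (n<2^n radix)) ⟩
        (2 ^ radix) ^ P                      ≡⟨ ^-*-assoc 2 radix P ⟩
        2 ^ (radix * P) ∎)
      where
        open ≤-Reasoning
        lengths : ∀ c → length (tokens c) ≡ space M c
        lengths (conf q ls a rs) = trans (length-++ (map inj₁ ls)) (cong₂ (λ m n → m + suc n) (length-map inj₁ ls) (length-map inj₁ rs))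

    -- A repeated configuration is never left, so a halting run halts before any repetition.
    halts-early : ∀ {b} t → outcome M (run M t c₀) ≡ just b → outcome M (run M count c₀) ≡ just b
    halts-early {b} t h with pigeonhole (n<1+n count) (λ i → fromℕ< (code-< (toℕ i)))
    ... | i , j , i<j , e = search (suc t) t (n<1+n t) h
      where
        same : run M (toℕ i) c₀ ≡ run M (toℕ j) c₀
        same = tokens-injective _ _ (number-injective _ _ (trans (sym (toℕ-fromℕ< (code-< (toℕ i)))) (trans (cong toℕ e) (toℕ-fromℕ< (code-< (toℕ j))))))
        search : ∀ f t → t < f → outcome M (run M t c₀) ≡ just b → outcome M (run M count c₀) ≡ just b
        search (suc f) t t<f h with t ≤? count
        ... | yes t≤ = outcome-later c₀ t≤ h
        ... | no t≰ = search f (toℕ i + (t ∸ toℕ j)) (<-≤-trans shorter (s≤s⁻¹ t<f))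
              (trans (cong (outcome M) (trans (run-add (toℕ i) (t ∸ toℕ j) c₀) (trans (cong (run M (t ∸ toℕ j)) same)
                (trans (sym (run-add (toℕ j) (t ∸ toℕ j) c₀)) (cong (λ n → run M n c₀) (m+[n∸m]≡n j≤t)))))) h)
          where
            j≤t : toℕ j ≤ t
            j≤t = ≤-trans (s≤s⁻¹ (toℕ<n j)) (<⇒≤ (≰⇒> t≰))
            shorter : toℕ i + (t ∸ toℕ j) < t
            shorter = <-≤-trans (+-monoˡ-< (t ∸ toℕ j) i<j) (≤-reflexive (m+[n∸m]≡n j≤t))

-- Configurations as blocks of bits: cell 0 holds the state and the scanned symbol, cell i holds
-- the i-th symbols to the left and to the right of the head. `nothing` is an accepting sink.

module Blocks {Σ₁ : ℕ} (M : TM Σ₁) where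
  open TM M

  Bit : Set
  Bit = Maybe (Fin Q) ⊎ (Fin Γ ⊎ (Fin Γ ⊎ Fin Γ))

  pattern qb q = inj₁ (just q)
  pattern qA   = inj₁ nothing
  pattern cb a = inj₂ (inj₁ a)
  pattern lb a = inj₂ (inj₂ (inj₁ a))
  pattern rb a = inj₂ (inj₂ (inj₂ a))

  abstract
    finBit : Finite Bit
    finBit = fin-⊎ (fin-Maybe fin-Fin) (fin-⊎ fin-Fin (fin-⊎ fin-Fin fin-Fin))

  g : ℕ
  g = size finBit

  bit : Bit → Fin g
  bit = enc′ finBit

  name : Fin g → Bit
  name = dec′ finBit

  instance
    g-nonzero : NonZero g
    g-nonzero = >-nonZero (≤-<-trans z≤n (toℕ<n (bit qA)))

  eqb : ∀ {n} → Fin n → Fin n → Bool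
  eqb x y = ⌊ x ≟ᶠ y ⌋

  eqb-true : ∀ {n} {x y : Fin n} → eqb x y ≡ true → x ≡ y
  eqb-true {x = x} {y} h with x ≟ᶠ y
  ... | yes e = e

  eqb-refl : ∀ {n} (x : Fin n) → eqb x x ≡ true
  eqb-refl x with x ≟ᶠ x
  ... | yes _ = refl
  ... | no ne = ⊥-elim (ne refl)

  cell : List (Fin Γ) → ℕ → Fin Γ
  cell []       _       = blank
  cell (x ∷ xs) zero    = x
  cell (x ∷ xs) (suc i) = cell xs i

  rest : List (Fin Γ) → List (Fin Γ)
  rest []       = []
  rest (x ∷ xs) = xs

  cell-rest : ∀ xs i → cell (rest xs) i ≡ cell xs (suc i)
  cell-rest [] i = refl
  cell-rest (x ∷ xs) i = refl

  cell-beyond : ∀ xs i → length xs ≤ i → cell xs i ≡ blank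
  cell-beyond [] i h = refl
  cell-beyond (x ∷ xs) (suc i) (s≤s h) = cell-beyond xs i h

  bitOf : Maybe (Config M) → ℕ → Bit → Bool
  bitOf nothing i qA = i ≡ᵇ 0
  bitOf nothing i _  = false
  bitOf (just (conf q ls a rs)) i (qb q′) = (i ≡ᵇ 0) ∧ eqb q q′
  bitOf (just (conf q ls a rs)) i qA      = false
  bitOf (just (conf q ls a rs)) i (cb a′) = (i ≡ᵇ 0) ∧ eqb a a′
  bitOf (just (conf q ls a rs)) i (lb a′) = eqb (cell ls i) a′
  bitOf (just (conf q ls a rs)) i (rb a′) = eqb (cell rs i) a′

  block : Maybe (Config M) → ℕ → Fin g → Bool
  block s i b = bitOf s i (name b)

  block-bit : ∀ s i x → block s i (bit x) ≡ bitOf s i x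
  block-bit s i x = cong (bitOf s i) (dec-enc finBit x)

  Source : Pos → Set
  Source = Src (Fin Γ) g

  eqB : ∀ p → Fin g → Source p
  eqB p b = cpy here b

  accB : ∀ p → Bit → Source p
  accB pF qA = cst true
  accB _  _  = cst false

  initB : ∀ p → Bit → Source p
  initB pF (qb q) = cst (eqb start q)
  initB pF (cb a) = kis here a
  initB p  (lb a) = cst (eqb blank a)
  initB pF (rb a) = kis nextF a
  initB pM (rb a) = kis nextM a
  -- The block has more cells than the input has symbols, so only blanks lie beyond the last cell.
  initB pL (rb a) = cst (eqb blank a)
  initB _  _      = cst false

  -- The head stays at cell 0 and the tape moves under it: one half shifts towards cell 0 and
  -- supplies the scanned symbol, the other shifts away and receives the written symbol `a`. Every
  -- new bit therefore depends on an adjacent cell at most.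
  stepB : Fin Q → Fin Γ → Move → ∀ p → Bit → Source p
  stepB q a mv    pF (qb q′) = cst (eqb q q′)
  stepB q a left  pF (cb a′) = cpy here (bit (lb a′))
  stepB q a right pF (cb a′) = cpy here (bit (rb a′))
  stepB q a stay  pF (cb a′) = cst (eqb a a′)
  stepB q a left  pF (lb a′) = cpy nextF (bit (lb a′))
  stepB q a left  pM (lb a′) = cpy nextM (bit (lb a′))
  stepB q a left  pL (lb a′) = cst (eqb blank a′)
  stepB q a right pF (lb a′) = cst (eqb a a′)
  stepB q a right pM (lb a′) = cpy prevM (bit (lb a′))
  stepB q a right pL (lb a′) = cpy prevL (bit (lb a′))
  stepB q a stay  p  (lb a′) = cpy here (bit (lb a′))
  stepB q a right pF (rb a′) = cpy nextF (bit (rb a′))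
  stepB q a right pM (rb a′) = cpy nextM (bit (rb a′))
  stepB q a right pL (rb a′) = cst (eqb blank a′)
  stepB q a left  pF (rb a′) = cst (eqb a a′)
  stepB q a left  pM (rb a′) = cpy prevM (bit (rb a′))
  stepB q a left  pL (rb a′) = cpy prevL (bit (rb a′))
  stepB q a stay  p  (rb a′) = cpy here (bit (rb a′))
  stepB _ _ _     _  _       = cst false

  table : (∀ p → Bit → Source p) → Table (Fin Γ) g
  table f p b = f p (name b)

  Clauses : Set
  Clauses = List (Fin g × Fin g × Maybe (Table (Fin Γ) g))

  actT : Fin Q → Fin Γ → Table (Fin Γ) g
  actT q a = table (let (q′ , a′ , mv) = δ q a in stepB q′ a′ mv)

  -- Accepting states enter the sink, which repeats forever, so acceptance before step `2 ^ n` is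
  -- visible at step `2 ^ n`. Rejecting states have no successor. Where the state alone decides, its
  -- bit fills both places of the clause.
  clausesAt : Fin Q → Maybe Bool → Clauses
  clausesAt q (just true)  = (bit (qb q) , bit (qb q) , just (table accB)) ∷ []
  clausesAt q (just false) = (bit (qb q) , bit (qb q) , nothing) ∷ []
  clausesAt q nothing      = map (λ a → bit (qb q) , bit (cb a) , just (actT q a)) (allFin Γ)

  clauses : Clauses
  clauses = (bit qA , bit qA , just (table accB)) ∷ concatMap (λ q → clausesAt q (halt q)) (allFin Q)

  ∈-concat⁺ : ∀ {A B : Set} (f : A → List B) xs {x b} → x ∈ xs → b ∈ f x → b ∈ concatMap f xs
  ∈-concat⁺ f (y ∷ xs) (here refl) m = ∈-++⁺ˡ m
  ∈-concat⁺ f (y ∷ xs) (there i) m = ∈-++⁺ʳ (f y) (∈-concat⁺ f xs i m)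

  ∈-concat⁻ : ∀ {A B : Set} (f : A → List B) xs {b} → b ∈ concatMap f xs → ∃ λ x → b ∈ f x
  ∈-concat⁻ f (y ∷ xs) m with ∈-++⁻ (f y) m
  ... | inj₁ h = y , h
  ... | inj₂ h = ∈-concat⁻ f xs h

  nextAt : Maybe Bool → Config M → Maybe (Maybe (Config M))
  nextAt (just true)  c = just nothing
  nextAt (just false) c = nothing
  nextAt nothing      c = just (just (step M c))

  -- The outer `nothing` means that the machine has rejected and there is no successor, the inner
  -- one is the accepting sink.
  successor : Maybe (Config M) → Maybe (Maybe (Config M))
  successor nothing  = just nothing
  successor (just c) = nextAt (outcome M c) c

  after : ℕ → Maybe (Config M) → Maybe (Maybe (Config M))
  after zero    s = just s
  after (suc n) s = successor s >>= after n

  after-+ : ∀ m n s → after (m + n) s ≡ (after m s >>= after n)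
  after-+ zero n s = refl
  after-+ (suc m) n s with successor s
  ... | nothing = refl
  ... | just s′ = after-+ m n s′

  after-sink : ∀ n → after n nothing ≡ just nothing
  after-sink zero = refl
  after-sink (suc n) = after-sink n

  after-run : ∀ n c {c′} → after n (just c) ≡ just (just c′) → c′ ≡ run M n c
  after-run zero c refl = refl
  after-run (suc n) c {c′} e = go (outcome M c) e
    where
      go : ∀ o → (nextAt o c >>= after n) ≡ just (just c′) → c′ ≡ run M n (step M c)
      go (just true) e = case trans (sym e) (after-sink n) of λ ()
      go nothing e = after-run n (step M c) e

  after-accept⁻ : ∀ n c → after n (just c) ≡ just nothing → ∃ λ t → outcome M (run M t c) ≡ just true
  after-accept⁻ (suc n) c e = go (outcome M c) refl e
    where
      go : ∀ o → outcome M c ≡ o → (nextAt o c >>= after n) ≡ just nothing → ∃ λ t → outcome M (run M t c) ≡ just true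
      go (just true) h e = 0 , h
      go nothing h e = let (t , k) = after-accept⁻ n (step M c) e in suc t , k

  after-accept⁺ : ∀ n t c → t < n → outcome M (run M t c) ≡ just true → after n (just c) ≡ just nothing
  after-accept⁺ (suc n) t c t<n k = go (outcome M c) refl t t<n k
    where
      go : ∀ o → outcome M c ≡ o → ∀ t → t < suc n → outcome M (run M t c) ≡ just true → (nextAt o c >>= after n) ≡ just nothing
      go (just true) h t t<n k = after-sink n
      go (just false) h t t<n k = case trans (sym k) (trans (cong (outcome M) (Halting.run-halted M t c h)) h) of λ ()
      go nothing h zero t<n k = case trans (sym h) k of λ ()
      go nothing h (suc t) t<n k = after-accept⁺ n t (step M c) (s≤s⁻¹ t<n) k

  step-move : ∀ q ls a rs → halt q ≡ nothing → step M (conf q ls a rs) ≡ (let (q′ , a′ , mv) = δ q a in move M q′ ls a′ rs mv)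
  step-move q ls a rs h rewrite h = refl

  move-left : ∀ q ls a rs → move M q ls a rs left ≡ conf q (rest ls) (cell ls 0) (a ∷ rs)
  move-left q [] a rs = refl
  move-left q (x ∷ ls) a rs = refl

  move-right : ∀ q ls a rs → move M q ls a rs right ≡ conf q (a ∷ ls) (cell rs 0) (rest rs)
  move-right q [] a [] = refl
  move-right q (_ ∷ _) a [] = refl
  move-right q [] a (_ ∷ _) = refl
  move-right q (_ ∷ _) a (_ ∷ _) = refl

  move-stay : ∀ q ls a rs → move M q ls a rs stay ≡ conf q ls a rs
  move-stay q [] a [] = refl
  move-stay q (_ ∷ _) a [] = refl
  move-stay q [] a (_ ∷ _) = refl
  move-stay q (_ ∷ _) a (_ ∷ _) = refl

  module Simulation (T : ℕ) (2≤T : 2 ≤ T) (kindB : ℕ → Fin Γ → Bool) where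
    open Savitch (Fin Γ) g T 2≤T kindB (table initB) (table accB) eqB clauses public

    Fits : Maybe (Config M) → Set
    Fits nothing = Unit
    Fits (just (conf q ls a rs)) = length ls ≤ T × length rs ≤ T

    at-zero : ∀ {i} x → i ≡ 0 → (i ≡ᵇ 0) ∧ x ≡ x
    at-zero x refl = refl

    off-zero : ∀ {i} x → i ≢ 0 → (i ≡ᵇ 0) ∧ x ≡ false
    off-zero {zero}  x h = ⊥-elim (h refl)
    off-zero {suc i} x h = refl

    accept-block : ∀ X → apply (table accB) X ≈ block nothing
    accept-block X i i<T b = go (posOf T i) (posOf-is T i) (name b)
      where
        go : ∀ p → PosIs T i p → ∀ x → srcV X i (accB p x) ≡ bitOf nothing i x
        go .pF (isF refl) (qb _) = refl
        go .pF (isF refl) qA = refl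
        go .pF (isF refl) (cb _) = refl
        go .pF (isF refl) (lb _) = refl
        go .pF (isF refl) (rb _) = refl
        go .pL (isL nz _) (qb _) = refl
        go .pL (isL nz _) qA = sym (≡ᵇ-false nz)
        go .pL (isL nz _) (cb _) = refl
        go .pL (isL nz _) (lb _) = refl
        go .pL (isL nz _) (rb _) = refl
        go .pM (isM nz _) (qb _) = refl
        go .pM (isM nz _) qA = sym (≡ᵇ-false nz)
        go .pM (isM nz _) (cb _) = refl
        go .pM (isM nz _) (lb _) = refl
        go .pM (isM nz _) (rb _) = refl

    move-block : ∀ q₀ a₀ ls rs q a mv → length ls ≤ T → length rs ≤ T →
                 apply (table (stepB q a mv)) (block (just (conf q₀ ls a₀ rs))) ≈ block (just (move M q ls a rs mv))
    move-block q₀ a₀ ls rs q a mv hl hr i i<T b = trans (go mv (posOf T i) (posOf-is T i) (name b)) (moved mv (name b))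
      where
        target : Move → Config M
        target left  = conf q (rest ls) (cell ls 0) (a ∷ rs)
        target right = conf q (a ∷ ls) (cell rs 0) (rest rs)
        target stay  = conf q ls a rs
        moved : ∀ mv x → bitOf (just (target mv)) i x ≡ bitOf (just (move M q ls a rs mv)) i x
        moved left  x = cong (λ c → bitOf (just c) i x) (sym (move-left q ls a rs))
        moved right x = cong (λ c → bitOf (just c) i x) (sym (move-right q ls a rs))
        moved stay  x = cong (λ c → bitOf (just c) i x) (sym (move-stay q ls a rs))
        s = just (conf q₀ ls a₀ rs)
        left-of : ∀ j x → block s j (bit (lb x)) ≡ eqb (cell ls j) x
        left-of j x = block-bit s j (lb x)
        right-of : ∀ j x → block s j (bit (rb x)) ≡ eqb (cell rs j) x
        right-of j x = block-bit s j (rb x)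
        -- The symbol shifted into the last cell comes from outside the block; it is blank because
        -- the half of the tape fits into `T` cells.
        beyond : ∀ xs x → length xs ≤ T → suc i ≡ T → eqb blank x ≡ eqb (cell (rest xs) i) x
        beyond xs x h e = cong (λ y → eqb y x) (sym (trans (cell-rest xs i) (cell-beyond xs (suc i) (≤-trans h (≤-reflexive (sym e))))))
        ahead : ∀ xs x → eqb (cell xs (suc i)) x ≡ eqb (cell (rest xs) i) x
        ahead xs x = cong (λ y → eqb y x) (sym (cell-rest xs i))
        behind : ∀ xs x → i ≢ 0 → eqb (cell xs (pred i)) x ≡ eqb (cell (a ∷ xs) i) x
        behind xs x nz = cong (λ j → eqb (cell (a ∷ xs) j) x) (sym (nonzero nz))
        front : ∀ xs x → i ≡ 0 → eqb a x ≡ eqb (cell (a ∷ xs) i) x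
        front xs x refl = refl
        scanned : ∀ xs x → i ≡ 0 → eqb (cell xs i) x ≡ (i ≡ᵇ 0) ∧ eqb (cell xs 0) x
        scanned xs x refl = refl
        go : ∀ mv p → PosIs T i p → ∀ x → srcV (block s) i (stepB q a mv p x) ≡ bitOf (just (target mv)) i x
        go left  .pF (isF z) (qb x) = sym (at-zero (eqb q x) z)
        go right .pF (isF z) (qb x) = sym (at-zero (eqb q x) z)
        go stay  .pF (isF z) (qb x) = sym (at-zero (eqb q x) z)
        go left  .pF (isF z) qA = refl
        go right .pF (isF z) qA = refl
        go stay  .pF (isF z) qA = refl
        go left  .pF (isF z) (cb x) = trans (left-of i x) (scanned ls x z)
        go right .pF (isF z) (cb x) = trans (right-of i x) (scanned rs x z)
        go stay  .pF (isF z) (cb x) = sym (at-zero (eqb a x) z)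
        go left  .pF (isF z) (lb x) = trans (left-of (suc i) x) (ahead ls x)
        go right .pF (isF z) (lb x) = front ls x z
        go stay  .pF (isF z) (lb x) = left-of i x
        go left  .pF (isF z) (rb x) = front rs x z
        go right .pF (isF z) (rb x) = trans (right-of (suc i) x) (ahead rs x)
        go stay  .pF (isF z) (rb x) = right-of i x
        go left  .pM (isM nz _) (qb x) = sym (off-zero (eqb q x) nz)
        go right .pM (isM nz _) (qb x) = sym (off-zero (eqb q x) nz)
        go stay  .pM (isM nz _) (qb x) = sym (off-zero (eqb q x) nz)
        go left  .pM (isM nz _) qA = refl
        go right .pM (isM nz _) qA = refl
        go stay  .pM (isM nz _) qA = refl
        go left  .pM (isM nz _) (cb x) = sym (off-zero (eqb (cell ls 0) x) nz)
        go right .pM (isM nz _) (cb x) = sym (off-zero (eqb (cell rs 0) x) nz)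
        go stay  .pM (isM nz _) (cb x) = sym (off-zero (eqb a x) nz)
        go left  .pM (isM nz _) (lb x) = trans (left-of (suc i) x) (ahead ls x)
        go right .pM (isM nz _) (lb x) = trans (left-of (pred i) x) (behind ls x nz)
        go stay  .pM (isM nz _) (lb x) = left-of i x
        go left  .pM (isM nz _) (rb x) = trans (right-of (pred i) x) (behind rs x nz)
        go right .pM (isM nz _) (rb x) = trans (right-of (suc i) x) (ahead rs x)
        go stay  .pM (isM nz _) (rb x) = right-of i x
        go left  .pL (isL nz e) (qb x) = sym (off-zero (eqb q x) nz)
        go right .pL (isL nz e) (qb x) = sym (off-zero (eqb q x) nz)
        go stay  .pL (isL nz e) (qb x) = sym (off-zero (eqb q x) nz)
        go left  .pL (isL nz e) qA = refl
        go right .pL (isL nz e) qA = refl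
        go stay  .pL (isL nz e) qA = refl
        go left  .pL (isL nz e) (cb x) = sym (off-zero (eqb (cell ls 0) x) nz)
        go right .pL (isL nz e) (cb x) = sym (off-zero (eqb (cell rs 0) x) nz)
        go stay  .pL (isL nz e) (cb x) = sym (off-zero (eqb a x) nz)
        go left  .pL (isL nz e) (lb x) = beyond ls x hl e
        go right .pL (isL nz e) (lb x) = trans (left-of (pred i) x) (behind ls x nz)
        go stay  .pL (isL nz e) (lb x) = left-of i x
        go left  .pL (isL nz e) (rb x) = trans (right-of (pred i) x) (behind rs x nz)
        go right .pL (isL nz e) (rb x) = beyond rs x hr e
        go stay  .pL (isL nz e) (rb x) = right-of i x

    step-elim : ∀ s {Y} → Fits s → Step (block s) Y → ∃ λ s′ → successor s ≡ just s′ × Y ≈ block s′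
    step-elim nothing {Y} _ st = nothing , refl , ≈-trans (st (bit qA) (bit qA) (just (table accB)) (here refl) sink sink) (accept-block (block nothing))
      where
        sink : block nothing 0 (bit qA) ≡ true
        sink = block-bit nothing 0 qA
    step-elim (just c@(conf q ls a rs)) {Y} (hl , hr) st = go (halt q) refl
      where
        state : block (just c) 0 (bit (qb q)) ≡ true
        state = trans (block-bit (just c) 0 (qb q)) (eqb-refl q)
        symbol : block (just c) 0 (bit (cb a)) ≡ true
        symbol = trans (block-bit (just c) 0 (cb a)) (eqb-refl a)
        member : ∀ h {cl} → halt q ≡ h → cl ∈ clausesAt q h → cl ∈ clauses
        member h e m = there (∈-concat⁺ (λ q → clausesAt q (halt q)) (allFin Q) (∈-allFin q) (subst (λ h → _ ∈ clausesAt q h) (sym e) m))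
        go : ∀ h → halt q ≡ h → ∃ λ s′ → nextAt (halt q) c ≡ just s′ × Y ≈ block s′
        go (just true) e = nothing , cong (λ h → nextAt h c) e ,
          ≈-trans (st _ _ (just (table accB)) (member (just true) e (here refl)) state state) (accept-block (block (just c)))
        go (just false) e = ⊥-elim (st _ _ nothing (member (just false) e (here refl)) state state)
        go nothing e = just (step M c) , cong (λ h → nextAt h c) e ,
          ≈-trans (st _ _ (just (actT q a)) (member nothing e (∈-map⁺′ a)) state symbol)
            (≈-trans (move-block q a ls rs _ _ _ hl hr) (λ i _ b → cong (λ d → block (just d) i b) (sym (step-move q ls a rs e))))
          where
            ∈-map⁺′ : ∀ a → (bit (qb q) , bit (cb a) , just (actT q a)) ∈ map (λ a → bit (qb q) , bit (cb a) , just (actT q a)) (allFin Γ)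
            ∈-map⁺′ a = ∈-map⁺ (λ a → bit (qb q) , bit (cb a) , just (actT q a)) (∈-allFin a)

    state-of : ∀ s q → block s 0 (bit (qb q)) ≡ true → ∃ λ ls → ∃ λ a → ∃ λ rs → s ≡ just (conf q ls a rs)
    state-of nothing q h = case trans (sym (block-bit nothing 0 (qb q))) h of λ ()
    state-of (just c@(conf q′ ls a rs)) q h with eqb-true {x = q′} {q} (trans (sym (block-bit (just c) 0 (qb q))) h)
    ... | refl = ls , a , rs , refl

    step-intro : ∀ s {s′} → Fits s → successor s ≡ just s′ → Step (block s) (block s′)
    step-intro nothing fits refl .(bit qA) .(bit qA) .(just (table accB)) (here refl) h₁ h₂ = ≈-sym (accept-block (block nothing))
    step-intro (just c) fits e .(bit qA) .(bit qA) .(just (table accB)) (here refl) h₁ h₂ =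
      case trans (sym h₁) (block-bit (just c) 0 qA) of λ ()
    step-intro s {s′} fits e b₁ b₂ body (there m) h₁ h₂ with ∈-concat⁻ (λ q → clausesAt q (halt q)) (allFin Q) m
    ... | q , m′ = go (halt q) refl m′
      where
        go : ∀ h → halt q ≡ h → (b₁ , b₂ , body) ∈ clausesAt q h → Fires (block s) (block s′) body
        go (just true) eh (here refl) with state-of s q h₁
        ... | ls , a , rs , refl with trans (sym e) (cong (λ h → nextAt h (conf q ls a rs)) eh)
        ... | refl = ≈-sym (accept-block (block s))
        go (just false) eh (here refl) with state-of s q h₁
        ... | ls , a , rs , refl with trans (sym e) (cong (λ h → nextAt h (conf q ls a rs)) eh)
        ... | ()
        go nothing eh m″ with ∈-map⁻ (λ a → bit (qb q) , bit (cb a) , just (actT q a)) m″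
        ... | a′ , _ , refl with state-of s q h₁
        ... | ls , a , rs , refl with eqb-true {x = a} {a′} (trans (sym (block-bit (just (conf q ls a rs)) 0 (cb a′))) h₂)
        ... | refl with trans (sym e) (cong (λ h → nextAt h (conf q ls a rs)) eh)
        ... | refl = ≈-trans (λ i _ b → cong (λ d → block (just d) i b) (step-move q ls a rs eh))
                (≈-sym (move-block q a ls rs _ _ _ (proj₁ fits) (proj₂ fits)))

    Good : Maybe (Config M) → Set
    Good s = ∀ n s′ → after n s ≡ just s′ → Fits s′

    good-after : ∀ {s s′} n → Good s → after n s ≡ just s′ → Good s′
    good-after {s} n gd e m s″ e′ = gd (n + m) s″ (trans (after-+ n m s) (trans (cong (_>>= after m) e) e′))

    after-2^ : ∀ n {s s′} → after (2 ^ n) s ≡ just s′ → after (2 ^ suc n) s ≡ after (2 ^ n) s′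
    after-2^ n {s} e = trans (after-+ (2 ^ n) (2 ^ n + 0) s) (trans (cong (_>>= after (2 ^ n + 0)) e) (cong (λ m → after m _) (+-identityʳ (2 ^ n))))

    -- The clauses determine the successor of a genuine configuration, so midpoints chosen among
    -- arbitrary blocks are forced to be genuine configurations too.
    reach-elim : ∀ n s {Y} → Good s → Reach n (block s) Y → ∃ λ s′ → after (2 ^ n) s ≡ just s′ × Y ≈ block s′
    reach-elim zero s gd r with step-elim s (gd 0 s refl) r
    ... | s′ , e , y = s′ , cong (_>>= after 0) e , y
    reach-elim (suc n) s gd (Z , r , r′) with reach-elim n s gd r
    ... | s₁ , e₁ , z with reach-elim n s₁ (good-after (2 ^ n) gd e₁) (reach-cong n z ≈-refl r′)
    ... | s₂ , e₂ , y = s₂ , trans (after-2^ n e₁) e₂ , y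

    reach-intro : ∀ n s {s′} → Good s → after (2 ^ n) s ≡ just s′ → Reach n (block s) (block s′)
    reach-intro zero s gd e with successor s in h
    reach-intro zero s gd refl | just s′ = step-intro s (gd 0 s refl) h
    reach-intro (suc n) s gd e with after (2 ^ n) s in h
    ... | just s₁ = block s₁ , reach-intro n s gd h , reach-intro n s₁ (good-after (2 ^ n) gd h) (trans (sym (after-2^ n h)) e)
    ... | nothing = case trans (sym e) (trans (after-+ (2 ^ n) (2 ^ n + 0) s) (cong (_>>= after (2 ^ n + 0)) h)) of λ ()

    module _ (w : List (Fin Σ₁)) (w<T : length w < T) (kinds : ∀ j → j < T → ∀ a → kindB j a ≡ eqb (cell (map inp w) j) a) where

      initial-block : ∀ X → apply (table initB) X ≈ block (just (init M w))
      initial-block X i i<T b = go w w<T (λ j h a → kinds j h a) (posOf T i) (posOf-is T i) (name b)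
        where
          short : ∀ w → length w < T → suc i ≡ T → length (map inp w) ≤ i
          short w h e = ≤-trans (≤-reflexive (length-map inp w)) (s≤s⁻¹ (≤-trans h (≤-reflexive (sym e))))
          go : ∀ w → length w < T → (∀ j → j < T → ∀ a → kindB j a ≡ eqb (cell (map inp w) j) a) → ∀ p → PosIs T i p → ∀ x → srcV X i (initB p x) ≡ bitOf (just (init M w)) i x
          go [] h k .pF (isF refl) (qb x) = refl
          go [] h k .pF (isF refl) qA = refl
          go [] h k .pF (isF refl) (cb x) = k 0 i<T x
          go [] h k .pF (isF refl) (lb x) = refl
          go [] h k .pF (isF refl) (rb x) = k 1 2≤T x
          go [] h k .pM (isM nz _) (qb x) = sym (off-zero _ nz)
          go [] h k .pM (isM nz _) qA = refl
          go [] h k .pM (isM nz _) (cb x) = sym (off-zero _ nz)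
          go [] h k .pM (isM nz _) (lb x) = refl
          go [] h k .pM (isM nz ne) (rb x) = k (suc i) (≤∧≢⇒< i<T ne) x
          go [] h k .pL (isL nz e) (qb x) = sym (off-zero _ nz)
          go [] h k .pL (isL nz e) qA = refl
          go [] h k .pL (isL nz e) (cb x) = sym (off-zero _ nz)
          go [] h k .pL (isL nz e) (lb x) = refl
          go [] h k .pL (isL nz e) (rb x) = refl
          go (a ∷ as) h k .pF (isF refl) (qb x) = refl
          go (a ∷ as) h k .pF (isF refl) qA = refl
          go (a ∷ as) h k .pF (isF refl) (cb x) = k 0 i<T x
          go (a ∷ as) h k .pF (isF refl) (lb x) = refl
          go (a ∷ as) h k .pF (isF refl) (rb x) = k 1 2≤T x
          go (a ∷ as) h k .pM (isM nz _) (qb x) = sym (off-zero _ nz)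
          go (a ∷ as) h k .pM (isM nz _) qA = refl
          go (a ∷ as) h k .pM (isM nz _) (cb x) = sym (off-zero _ nz)
          go (a ∷ as) h k .pM (isM nz _) (lb x) = refl
          go (a ∷ as) h k .pM (isM nz ne) (rb x) = k (suc i) (≤∧≢⇒< i<T ne) x
          go (a ∷ as) h k .pL (isL nz e) (qb x) = sym (off-zero _ nz)
          go (a ∷ as) h k .pL (isL nz e) qA = refl
          go (a ∷ as) h k .pL (isL nz e) (cb x) = sym (off-zero _ nz)
          go (a ∷ as) h k .pL (isL nz e) (lb x) = refl
          go (a ∷ as) h k .pL (isL nz e) (rb x) = cong (λ y → eqb y x) (sym (cell-beyond (map inp as) i
            (<⇒≤ (short (a ∷ as) h e))))

      eqB-copies : ∀ X → apply eqB X ≈ X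
      eqB-copies X i i<T b = refl

      accepting : Good (just (init M w)) →
        (GLP⊢ ι (Formula.formula (Fin Γ) g T kindB (table initB) (table accB) eqB clauses)) ⇔ (after (2 ^ pred T) (just (init M w)) ≡ just nothing)
      accepting gd = mk⇔ forward backward
        where
          correct = formula-correct eqB-copies
          forward : _ → after (2 ^ pred T) (just (init M w)) ≡ just nothing
          forward d with reach-elim (pred T) (just (init M w)) gd (Equivalence.to correct d (block (just (init M w))) (block nothing)
              (≈-sym (initial-block _)) (≈-sym (accept-block _)))
          ... | nothing , e , y = e
          ... | just c , e , y = case trans (sym (block-bit nothing 0 qA)) (trans (y 0 0<T (bit qA)) (block-bit (just c) 0 qA)) of λ ()
          backward : after (2 ^ pred T) (just (init M w)) ≡ just nothing → _
          backward e = Equivalence.from correct λ X Y x y →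
            reach-cong (pred T) (≈-sym (≈-trans x (initial-block X))) (≈-sym (≈-trans y (accept-block Y)))
              (reach-intro (pred T) (just (init M w)) gd e)

-- The reduction from a machine with polynomial space

concatMap-pick : ∀ {A B : Set} n (f : Fin n → A) (h : A → List B) i → (∀ j → j ≢ i → h (f j) ≡ []) → concatMap h (List.tabulate f) ≡ h (f i)
concatMap-pick (suc n) f h fz e = trans (cong (h (f fz) ++_) (vanish n (f ∘ fs) λ j → e (fs j) λ ())) (++-identityʳ _)
  where
    vanish : ∀ n (f : Fin n → _) → (∀ j → h (f j) ≡ []) → concatMap h (List.tabulate f) ≡ []
    vanish zero f e = refl
    vanish (suc n) f e = cong₂ _++_ (e fz) (vanish n (f ∘ fs) (λ j → e (fs j)))
concatMap-pick (suc n) f h (fs i) e = cong₂ _++_ (e fz λ ()) (concatMap-pick n (f ∘ fs) h i λ j ne → e (fs j) λ { refl → ne refl })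

cat-nth : ∀ {A B : Set} (F : Maybe A → List B) xs → cat 0 (length xs) (λ i → F (nth xs i)) ≡ concatMap (λ x → F (just x)) xs
cat-nth F [] = refl
cat-nth F (x ∷ xs) = cong (F (just x) ++_) (trans (sym (cat-shift 1 0 (length xs) (λ i → F (nth (x ∷ xs) i)))) (cat-nth F xs))

module Reduction {Σ₁ : ℕ} (M : TM Σ₁) (c k : ℕ) where
  open TM M
  open Blocks M
  open Halting M using (radix; halts-early; outcome-unique)

  -- Input cells, ticks and output cells. The number of ticks is the `T` of the formula; the first
  -- ticks carry the input symbols and the others stand for blanks.
  Kd : Set
  Kd = Fin Σ₁ ⊎ (Maybe (Fin Σ₁) ⊎ Sym)

  pattern inK a  = inj₁ a
  pattern tick m = inj₂ (inj₁ m)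
  pattern out s  = inj₂ (inj₂ s)

  finKd : Finite Kd
  finKd = fin-⊎ fin-Fin (fin-⊎ (fin-Maybe fin-Fin) fin-Fin)

  reg₁ reg₂ : Kd → Bool
  reg₁ (inK _) = true
  reg₁ _       = false
  reg₂ (tick _) = true
  reg₂ _        = false

  outK : Kd → Maybe Sym
  outK (out s) = just s
  outK _       = nothing

  isSym : Fin Γ → Kd → Bool
  isSym a (tick (just x)) = eqb (inp x) a
  isSym a (tick nothing)  = eqb blank a
  isSym a _               = false

  isIn : Fin Σ₁ → Kd → Bool
  isIn a (inK b) = eqb a b
  isIn a _       = false

  open TwoPhase Kd finKd (8 + k) reg₁ reg₂ (λ a → inK a) outK
  open Loops Kd finKd (8 + k) using (Env; upd-env; upd-same; kd)
  open P₁ using (G; skip; emit; _>>_; for; ifT; seqN; seqL; ⟦_⟧; ⟦seqN⟧; ⟦seqL⟧)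

  -- `radix * poly c k n` is the exponent in the bound on the halting time. The summand 2 makes
  -- `pred T` strictly greater than it, and ensures that a block has a first and a last cell.
  padding : ℕ → ℕ
  padding n = radix * poly c k n + 2

  blankTick : ∀ {m} → G m
  blankTick = emit (tick nothing) refl

  -- Prints `suc n ^ j` ticks by the rule that `suc n ^ suc j` is `suc n ^ j` plus `n` times
  -- `suc n ^ j`. The nesting depth is `j`, which is why the number of slots grows with the degree
  -- `k` of the space bound.
  power : ∀ {m} j → j ≤ m → j ≤ 8 + k → G m
  power zero    _ _ = blankTick
  power (suc j) l l′ = power j (<⇒≤ l) (<⇒≤ l′)
    >> for (fromℕ< l′) (subst (_< _) (sym (toℕ-fromℕ< l′)) l) (power j (≤-reflexive (sym (toℕ-fromℕ< l′))) (<⇒≤ l′))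

  ticksG : G (8 + k)
  ticksG = for fz (s≤s z≤n) (seqL (allFin Σ₁) (λ a → ifT (kd fz (isIn a)) (emit (tick (just a)) refl) skip))
    >> seqN 0 radix (λ _ → seqN 0 c (λ _ → power k (m≤n+m k 8) (m≤n+m k 8)) >> seqN 0 c (λ _ → blankTick))
    >> seqN 0 2 (λ _ → blankTick)

  module E = Emitters (Fin Γ) Kd finKd k reg₂ (λ s → out s) (λ _ → refl) isSym g

  formulaG : P₂.G 8
  formulaG = E.mainG (table initB) (table accB) eqB clauses

  ticks : List (Fin Σ₁) → List Kd
  ticks w = map (λ a → tick (just a)) w ++ replicate (padding (length w)) (tick nothing)

  power-ticks : ∀ {m} j l l′ rs ρ → ⟦ power {m} j l l′ ⟧ rs ρ ≡ replicate (suc (length rs) ^ j) (tick nothing)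
  power-ticks zero l l′ rs ρ = refl
  power-ticks (suc j) l l′ rs ρ = trans (cong₂ _++_ (power-ticks j _ _ rs ρ)
    (trans (cat-cong 0 (length rs) (λ _ _ _ → power-ticks j _ _ rs _)) (cat-replicate 0 (length rs) (suc (length rs) ^ j) _)))
    (replicate-++ (suc (length rs) ^ j) (length rs * suc (length rs) ^ j))

  repeat-ticks : ∀ {m} p n (h : G m) rs ρ a → ⟦ h ⟧ rs ρ ≡ replicate a (tick nothing) → ⟦ seqN p n (λ _ → h) ⟧ rs ρ ≡ replicate (n * a) (tick nothing)
  repeat-ticks p n h rs ρ a e = trans (⟦seqN⟧ p n (λ _ → h) rs ρ) (trans (cat-cong p n (λ _ _ _ → e)) (cat-replicate p n a (tick nothing)))

  ticks-correct : ∀ w ρ → ⟦ ticksG ⟧ (map (λ a → inK a) w) ρ ≡ ticks w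
  ticks-correct w ρ = cong₂ _++_ labelled (trans (cong₂ _++_
      (repeat-ticks 0 radix _ rs ρ (c * suc n ^ k + c) (trans (cong₂ _++_
        (repeat-ticks 0 c _ rs ρ (suc n ^ k) (trans (power-ticks k _ _ rs ρ) (cong (λ m → replicate (suc m ^ k) (tick nothing)) (length-map _ w))))
        (trans (repeat-ticks 0 c _ rs ρ 1 refl) (cong (λ m → replicate m (tick nothing)) (*-identityʳ c))))
        (replicate-++ (c * suc n ^ k) c)))
      refl) (replicate-++ (radix * poly c k n) 2))
    where
      n = length w
      rs = map (λ a → inK a) w
      labels : Maybe Kd → List Kd
      labels m = concatMap (λ a → if maybe′ (isIn a) false m then tick (just a) ∷ [] else []) (allFin Σ₁)
      chosen : ∀ a → labels (just (inK a)) ≡ tick (just a) ∷ []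
      chosen a = trans (concatMap-pick Σ₁ (λ b → b) (λ b → if eqb b a then tick (just b) ∷ [] else []) a others)
          (cong (λ b → if b then tick (just a) ∷ [] else []) (eqb-refl a))
        where
          others : ∀ b → b ≢ a → (if eqb b a then tick (just b) ∷ [] else []) ≡ []
          others b ne with b ≟ᶠ a
          ... | yes e = ⊥-elim (ne e)
          ... | no _  = refl
      all-chosen : ∀ w → concatMap (λ κ → labels (just κ)) (map (λ a → inK a) w) ≡ map (λ a → tick (just a)) w
      all-chosen [] = refl
      all-chosen (a ∷ w) = cong₂ _++_ (chosen a) (all-chosen w)
      labelled : cat 0 (length rs) (λ i → ⟦ seqL {m = 0} (allFin Σ₁) (λ a → ifT (kd fz (isIn a)) (emit (tick (just a)) refl) skip) ⟧ rs (upd-env ρ fz i)) ≡ map (λ a → tick (just a)) w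
      labelled = trans (cat-cong 0 (length rs) λ i _ _ → trans (⟦seqL⟧ {m = 0} (allFin Σ₁) _ rs (upd-env ρ fz i))
          (concatMap-cong (λ a → cong (λ j → if maybe′ (isIn a) false (nth rs j) then tick (just a) ∷ [] else []) (upd-same ρ fz i)) (allFin Σ₁)))
        (trans (cat-nth labels rs) (all-chosen w))

  region-input : ∀ w → O₁.region (map (λ a → inK a) w) ≡ map (λ a → inK a) w
  region-input [] = refl
  region-input (a ∷ w) = cong (inK a ∷_) (region-input w)

  first-correct : ∀ w → first ticksG formulaG w ≡ map (λ a → inK a) w ++ ticks w
  first-correct w = cong (map (λ a → inK a) w ++_) (trans (cong (λ rs → ⟦ ticksG ⟧ rs (off (O₁.size-of (map (λ a → inK a) w)))) (region-input w)) (ticks-correct w _))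

  region-ticks : ∀ w → O₂.region (first ticksG formulaG w) ≡ ticks w
  region-ticks w = trans (cong O₂.region (first-correct w)) (trans (O₂.region-++ (map (λ a → inK a) w) (ticks w)) (cong₂ _++_ (inputs w) (kept w)))
    where
      inputs : ∀ w → O₂.region (map (λ a → inK a) w) ≡ []
      inputs [] = refl
      inputs (a ∷ w) = inputs w
      blanks : ∀ n → O₂.region (replicate n (tick nothing)) ≡ replicate n (tick nothing)
      blanks zero = refl
      blanks (suc n) = cong (tick nothing ∷_) (blanks n)
      labelled : ∀ w → O₂.region (map (λ a → tick (just a)) w) ≡ map (λ a → tick (just a)) w
      labelled [] = refl
      labelled (a ∷ w) = cong (tick (just a) ∷_) (labelled w)
      kept : ∀ w → O₂.region (ticks w) ≡ ticks w
      kept w = trans (O₂.region-++ (map (λ a → tick (just a)) w) _) (cong₂ _++_ (labelled w) (blanks (padding (length w))))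

  tickCount : ℕ → ℕ
  tickCount n = n + padding n

  ticks-length : ∀ w → length (ticks w) ≡ tickCount (length w)
  ticks-length w = trans (length-++ (map (λ a → tick (just a)) w)) (cong₂ _+_ (length-map _ w) (blanks (padding (length w))))
    where
      blanks : ∀ n → length (replicate {A = Kd} n (tick nothing)) ≡ n
      blanks zero = refl
      blanks (suc n) = cong suc (blanks n)

  2≤ticks : ∀ w → 2 ≤ length (ticks w)
  2≤ticks w = ≤-trans (m≤n+m 2 (radix * poly c k (length w))) (≤-trans (m≤n+m (padding (length w)) (length w)) (≤-reflexive (sym (ticks-length w))))

  kindAt : List (Fin Σ₁) → ℕ → Fin Γ → Bool
  kindAt w j a = maybe′ (isSym a) false (nth (ticks w) j)

  φ : List (Fin Σ₁) → CFm
  φ w = Formula.formula (Fin Γ) g (length (ticks w)) (kindAt w) (table initB) (table accB) eqB clauses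

  reduce : List (Fin Σ₁) → List Sym
  reduce w = enc (φ w)

  second-correct : ∀ w → second ticksG formulaG w ≡ map (λ s → out s) (reduce w)
  second-correct w = trans (cong (λ rs → P₂.⟦ formulaG ⟧ rs (off (O₂.size-of (first ticksG formulaG w)))) (region-ticks w))
    (E.Emission.Emits.denotes (E.Emission.e-main (ticks w) (2≤ticks w) (table initB) (table accB) eqB clauses _))

  output-correct : ∀ w → mapMaybe outK (first ticksG formulaG w ++ second ticksG formulaG w) ≡ reduce w
  output-correct w = trans (cong₂ (λ a b → mapMaybe outK (a ++ b)) (first-correct w) (second-correct w))
    (trans (cong (mapMaybe outK) (++-assoc (map (λ a → inK a) w) (ticks w) (map (λ s → out s) (reduce w))))
      (trans (inputs w _) (trans (cong (mapMaybe outK) (++-assoc (map (λ a → tick (just a)) w) _ _)) (trans (labelled w _) (trans (blanks (padding (length w)) _) (outputs (reduce w)))))))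
    where
      inputs : ∀ w ks → mapMaybe outK (map (λ a → inK a) w ++ ks) ≡ mapMaybe outK ks
      inputs [] ks = refl
      inputs (a ∷ w) ks = inputs w ks
      labelled : ∀ (w : List (Fin Σ₁)) ks → mapMaybe outK (map (λ a → tick (just a)) w ++ ks) ≡ mapMaybe outK ks
      labelled [] ks = refl
      labelled (a ∷ w) ks = labelled w ks
      blanks : ∀ n ks → mapMaybe outK (replicate n (tick nothing) ++ ks) ≡ mapMaybe outK ks
      blanks zero ks = refl
      blanks (suc n) ks = blanks n ks
      outputs : ∀ s → mapMaybe outK (map (λ s → out s) s) ≡ s
      outputs [] = refl
      outputs (x ∷ s) = cong (x ∷_) (outputs s)

  reduce-polytime : PolyTimeComputable reduce
  reduce-polytime = two-phase-polytime ticksG formulaG reduce output-correct (λ n → n) tickCount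
    (λ w → trans (cong length (region-input w)) (length-map _ w))
    (λ w → trans (cong length (region-ticks w)) (ticks-length w))
    pb-id (pb-+ pb-id (pb-+ (pb-* (pb-const radix) (pb-poly c k)) (pb-const 2)))

  kinds-correct : ∀ w j → j < length (ticks w) → ∀ a → kindAt w j a ≡ eqb (cell (map inp w) j) a
  kinds-correct w j h a = go w (padding (length w)) j h
    where
      go : ∀ w n j → j < length (map {B = Kd} (λ a → tick (just a)) w ++ replicate n (tick nothing)) →
           maybe′ (isSym a) false (nth (map (λ a → tick (just a)) w ++ replicate n (tick nothing)) j) ≡ eqb (cell (map inp w) j) a
      go [] (suc n) zero h = refl
      go [] (suc n) (suc j) h = go [] n j (s≤s⁻¹ h)
      go (x ∷ w) n zero h = refl
      go (x ∷ w) n (suc j) h = go w n j (s≤s⁻¹ h)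

  module _ (L₁ : Language Σ₁)
           (decides : ∀ w → Σ ℕ λ t → Σ Bool λ b → outcome M (run M t (init M w)) ≡ just b × ((b ≡ true) ⇔ L₁ w))
           (bounded : ∀ w t → space M (run M t (init M w)) ≤ poly c k (length w)) where

    reduction-correct : ∀ w → L₁ w ⇔ GLPω₀ (reduce w)
    reduction-correct w = mk⇔ forward backward
      where
        len = length (ticks w)
        P = poly c k (length w)
        open Simulation len (2≤ticks w) (kindAt w)
        len-eq : len ≡ length w + (radix * P + 2)
        len-eq = ticks-length w
        w<len : length w < len
        w<len = ≤-trans (≤-trans (≤-reflexive (+-comm 1 (length w))) (+-monoʳ-≤ (length w) (≤-trans (s≤s z≤n) (m≤n+m 2 (radix * P))))) (≤-reflexive (sym len-eq))
        P≤len : P ≤ len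
        P≤len = ≤-trans (≤-trans (m≤m+n P _) (m≤m+n (radix * P) 2)) (≤-trans (m≤n+m _ (length w)) (≤-reflexive (sym len-eq)))
        good : Good (just (init M w))
        good n nothing e = _
        good n (just cf) e with after-run n (init M w) e
        ... | refl = ≤-trans (m≤m+n _ _) fits , ≤-trans (≤-trans (n≤1+n _) (m≤n+m _ (length (Config.lft cf)))) fits
          where
            fits : space M cf ≤ len
            fits = ≤-trans (bounded w n) P≤len
        correct = accepting w w<len (kinds-correct w) good
        enough : 2 ^ (radix * P) < 2 ^ pred len
        enough = ^-monoʳ-< 2 ≤-refl (≤-trans (≤-reflexive (+-comm 1 (radix * P))) (≤-trans (m≤n+m (radix * P + 1) (length w))
          (≤-reflexive (sym (trans (cong pred len-eq) (cong pred (trans (cong (length w +_) (+-suc (radix * P) 1)) (+-suc (length w) (radix * P + 1)))))))))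
        forward : L₁ w → GLPω₀ (reduce w)
        forward h with decides w
        ... | t , b , o , iff = φ w , refl , Equivalence.from correct (after-accept⁺ _ (2 ^ (radix * P)) (init M w) enough
              (halts-early P (init M w) (bounded w) t (trans o (cong just (Equivalence.from iff h)))))
        backward : GLPω₀ (reduce w) → L₁ w
        -- Membership provides some formula with this code; it is `φ w` because codes are uniquely
        -- readable.
        backward (A , e , d) with decides w | after-accept⁻ (2 ^ pred len) (init M w) (Equivalence.to correct (subst (λ A → GLP⊢ ι A) (enc-injective e) d))
        ... | t , b , o , iff | t′ , o′ = Equivalence.to iff (outcome-unique t t′ (init M w) o o′)

GLPω₀-hard : PSPACE-hard GLPω₀
GLPω₀-hard L₁ (M , c , k , decides , bounded) =
  Reduction.reduce M c k , Reduction.reduce-polytime M c k , Reduction.reduction-correct M c k L₁ decides bounded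

theorem1 : PSPACE-complete GLPω₀
theorem1 = GLPω₀∈PSPACE , GLPω₀-hard
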